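{- For every $\varepsilon>0$ there is $p_0(\varepsilon)$ such that for every prime $p\geq p_0$ and every divisor $t$ of $p-1$ with $t\geq p^{1/2}$, one has $H_p(t)\leq p^{\frac{437}{480}+\varepsilon}$.
   Context: For a prime $p$ and a divisor $t$ of $p-1$, let $\Gamma\subseteq\mathbb{F}_p^\times$ be the (unique) multiplicative subgroup of order $t$. $H_p(t)$ is the largest integer $H$ for which there exist $a\in\mathbb{F}_p^\times$ and $u\in\mathbb{F}_p$ such that $u+j\notin a\Gamma$ for all $j=1,\dots,H$ (the maximal gap between consecutive elements of a coset of $\Gamma$). -}

module Defs where

open import Data.Nat using (ℕ; _+_; _*_; _^_; _≤_; _<_; NonZero)
open import Data.Nat.DivMod using (_%_)
open import Data.Product using (Σ; _×_)
open import Relation.Nullary using (¬_)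
open import Relation.Binary.PropositionalEquality using (_≡_)

-- Elements of 𝔽_p are represented by residues 0 … p-1 (natural numbers < p),
-- equality in 𝔽_p is equality of remainders mod p.

-- Membership in Γ, the (unique) subgroup of 𝔽_p^× of order t (t ∣ p-1):
-- Γ = { g ∈ 𝔽_p^× : g^t = 1 }, the group of t-th roots of unity.
InΓ : (p t g : ℕ) → .{{_ : NonZero p}} → Set
InΓ p t g = (1 ≤ g) × (g < p) × ((g ^ t) % p ≡ 1)

InCoset : (p t a y : ℕ) → .{{_ : NonZero p}} → Set
InCoset p t a y = Σ ℕ (λ g → InΓ p t g × ((a * g) % p ≡ y % p))

IsGap : (p t a u H : ℕ) → .{{_ : NonZero p}} → Set
IsGap p t a u H = ∀ j → 1 ≤ j → j ≤ H → ¬ InCoset p t a (u + j)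

{-# OPTIONS --safe #-}
module Submission where


-- Let S(u) = Σ_{x ∈ Γ} e(ux/p) and suppose that a coset aΓ misses an interval of length 2h with h > p^(437/480)/2.
-- Integrating the m-th power of a Dirichlet kernel of length N, with N slightly larger than p/h, against the gap gives
-- t² ≤ 8L Σ_{j ≤ L} |S(ja)|² with L = mN + 1.
--
-- If U(u) counts the j ≤ L with u^(2t) = (ja)^(2t), then t Σ_j |S(ja)|² ≤ V = Σ_u U(u) |S(u)|², and the Hölder and Cauchy
-- inequalities together with Parseval's identity yield V⁶ ≤ t⁶ p² E₃(Γ) E₃(U), where E₃ is the third moment of the
-- number of representations of x as a difference.  Stepanov's method bounds E₃(U) by t³ W₂² up to logarithms, where W₂ is
-- the multiplicative energy of the classes of 1, …, L modulo t-th roots of unity (W₂ is bounded if only one j is kept).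
-- By the divisor bound W₂ is essentially the number w(L²) of pairs n, n' ≤ L² with n^(2t) = n'^(2t), and w is
-- essentially supermultiplicative, w(L²)³ ≤ p^o(1) w(L⁶).  Finally w(L⁶) is estimated by splitting off common divisors and
-- counting coprime solutions of x ≡ ρy for every root of unity ρ, either as lattice points or by squaring once more.
--
-- For t below about p^0.516 this contradicts the gap inequality.  Up to about p^0.6 it is enough to treat every j
-- separately, and beyond that |S(u)|² ≤ p suffices.  All exponents compare strictly, so the argument runs in powers of
-- ℓ ≈ p^(1/48000), which absorb constants, logarithms and divisor functions.
--
-- The exponential sums take values in bounded rational sequences modulo O(1/n): the powers of a rational rotation by a
-- small angle, stopped when they have turned by π, approximate the p-th roots of unity with that accuracy.

-- Stepanov's method requires t⁵ to stay below p³, hence the border near p^(3/5). A single j gives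
-- |S|² of size t p^(1/3), which is contradictory only when t exceeds L² p^(1/3), about p^0.513;
-- closer to p^(1/2) the mean over j is indispensable. The sixth-power inequality is in substance a
-- trace inequality. The matrix formed by the transform of U at the differences of elements of Γ is
-- positive semidefinite and has constant row sums, so the cube of the row sum is at most the trace
-- of the cube, and Cauchy's inequality separates that trace into the two third moments. The
-- exponent 2t in U makes U even and its transform real. The obstacle in bounding w(L⁶) is that
-- counting lattice points allows one solution for each of the 2t roots of unity, too many for
-- coprime x, y ≤ d with d < d₀. There the count is squared and compared with w(d²). If E denotes
-- the loss, the two estimates balance at 2t = d₀ E and d₀³ = E p, so E = ((2t)³/p)^(1/4), and W₂
-- exceeds L² essentially by E^(1/3).

module _ where
 open import Algebra.Bundles using (CommutativeRing)

 -- Normal forms over an arbitrary commutative ring, with integer coefficients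

 module IntegerSolver {c ℓ} (CR : CommutativeRing c ℓ) where
  open import Data.Nat as ℕ using (ℕ; zero; suc)
  import Data.Nat.Properties as ℕₚ
  open import Data.Integer as ℤ using (ℤ; +_; -[1+_]; _⊖_)
  import Data.Integer.Properties as ℤₚ
  open import Data.Maybe using (just; nothing)
  open import Relation.Nullary using (yes; no)
  open import Relation.Binary.Definitions using (WeaklyDecidable)
  import Relation.Binary.PropositionalEquality as ≡
  open import Algebra.Solver.Ring.AlmostCommutativeRing using (fromCommutativeRing; _-Raw-AlmostCommutative⟶_; Induced-equivalence)
  open CommutativeRing CR
  open import Algebra.Properties.Ring ring using (-‿distribˡ-*; -‿distribʳ-*; -0#≈0#)
  open import Algebra.Properties.AbelianGroup +-abelianGroup using (⁻¹-∙-comm; ⁻¹-involutive)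
  open import Relation.Binary.Reasoning.Setoid setoid

  -- The separate clause for 1 makes `ι 1` equal to `1#` by definition, and `ι 2` to `1# + 1#`.
  -- Solver expressions built from `:1` therefore match small numerals such as `ι 8` without any
  -- conversion.
  ι : ℕ → Carrier
  ι zero = 0#
  ι (suc zero) = 1#
  ι (suc (suc n)) = 1# + ι (suc n)

  ι-suc : ∀ n → ι (suc n) ≈ 1# + ι n
  ι-suc zero = sym (+-identityʳ 1#)
  ι-suc (suc n) = refl

  ι-+ : ∀ m n → ι (m ℕ.+ n) ≈ ι m + ι n
  ι-+ zero n = sym (+-identityˡ _)
  ι-+ (suc m) n = begin
    ι (suc (m ℕ.+ n))   ≈⟨ ι-suc (m ℕ.+ n) ⟩
    1# + ι (m ℕ.+ n)    ≈⟨ +-congˡ (ι-+ m n) ⟩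
    1# + (ι m + ι n)    ≈⟨ +-assoc _ _ _ ⟨
    1# + ι m + ι n      ≈⟨ +-congʳ (ι-suc m) ⟨
    ι (suc m) + ι n     ∎

  ι-* : ∀ m n → ι (m ℕ.* n) ≈ ι m * ι n
  ι-* zero n = sym (zeroˡ _)
  ι-* (suc m) n = begin
    ι (n ℕ.+ m ℕ.* n)     ≈⟨ ι-+ n (m ℕ.* n) ⟩
    ι n + ι (m ℕ.* n)     ≈⟨ +-cong (sym (*-identityˡ _)) (ι-* m n) ⟩
    1# * ι n + ι m * ι n  ≈⟨ distribʳ _ _ _ ⟨
    (1# + ι m) * ι n      ≈⟨ *-congʳ (ι-suc m) ⟨
    ι (suc m) * ι n       ∎

  private
    ⟦_⟧ : ℤ → Carrier
    ⟦ + n ⟧ = ι n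
    ⟦ -[1+ n ] ⟧ = - ι (suc n)

    cancel1 : ∀ a b → (1# + a) - (1# + b) ≈ a - b
    cancel1 a b = begin
      (1# + a) + - (1# + b)     ≈⟨ +-congˡ (⁻¹-∙-comm 1# b) ⟨
      (1# + a) + (- 1# + - b)   ≈⟨ +-congʳ (+-comm 1# a) ⟩
      (a + 1#) + (- 1# + - b)   ≈⟨ +-assoc a 1# _ ⟩
      a + (1# + (- 1# + - b))   ≈⟨ +-congˡ (+-assoc 1# (- 1#) (- b)) ⟨
      a + (1# + - 1# + - b)     ≈⟨ +-congˡ (+-congʳ (-‿inverseʳ 1#)) ⟩
      a + (0# + - b)            ≈⟨ +-congˡ (+-identityˡ _) ⟩
      a - b                     ∎

    neg-hom : ∀ n → ⟦ ℤ.- (+ n) ⟧ ≈ - ι n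
    neg-hom zero = sym -0#≈0#
    neg-hom (suc n) = refl

    ⊖-hom : ∀ m n → ⟦ m ⊖ n ⟧ ≈ ι m - ι n
    ⊖-hom m zero = sym (trans (+-congˡ -0#≈0#) (+-identityʳ _))
    ⊖-hom zero (suc n) = sym (+-identityˡ _)
    ⊖-hom (suc m) (suc n) = begin
      ⟦ suc m ⊖ suc n ⟧           ≡⟨ ≡.cong ⟦_⟧ (ℤₚ.[1+m]⊖[1+n]≡m⊖n m n) ⟩
      ⟦ m ⊖ n ⟧                   ≈⟨ ⊖-hom m n ⟩
      ι m - ι n                   ≈⟨ cancel1 _ _ ⟨
      (1# + ι m) - (1# + ι n)     ≈⟨ +-cong (ι-suc m) (-‿cong (ι-suc n)) ⟨
      ι (suc m) - ι (suc n)       ∎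

    +-hom : ∀ i j → ⟦ i ℤ.+ j ⟧ ≈ ⟦ i ⟧ + ⟦ j ⟧
    +-hom (+ m) (+ n) = ι-+ m n
    +-hom (+ m) -[1+ n ] = ⊖-hom m (suc n)
    +-hom -[1+ m ] (+ n) = trans (⊖-hom n (suc m)) (+-comm _ _)
    +-hom -[1+ m ] -[1+ n ] = begin
      - ι (suc (suc (m ℕ.+ n)))       ≡⟨ ≡.cong (λ z → - ι (suc z)) (≡.sym (ℕₚ.+-suc m n)) ⟩
      - ι (suc m ℕ.+ suc n)           ≈⟨ -‿cong (ι-+ (suc m) (suc n)) ⟩
      - (ι (suc m) + ι (suc n))       ≈⟨ ⁻¹-∙-comm _ _ ⟨
      - ι (suc m) + - ι (suc n)       ∎

    *-hom : ∀ i j → ⟦ i ℤ.* j ⟧ ≈ ⟦ i ⟧ * ⟦ j ⟧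
    *-hom (+ m) (+ n) = trans (reflexive (≡.cong ⟦_⟧ (≡.sym (ℤₚ.pos-* m n)))) (ι-* m n)
    *-hom (+ m) -[1+ n ] = begin
      ⟦ (+ m) ℤ.* -[1+ n ] ⟧     ≡⟨ ≡.cong ⟦_⟧ (≡.trans (≡.sym (ℤₚ.neg-distribʳ-* (+ m) (+ suc n))) (≡.cong ℤ.-_ (≡.sym (ℤₚ.pos-* m (suc n))))) ⟩
      ⟦ ℤ.- (+ (m ℕ.* suc n)) ⟧   ≈⟨ neg-hom (m ℕ.* suc n) ⟩
      - ι (m ℕ.* suc n)           ≈⟨ -‿cong (ι-* m (suc n)) ⟩
      - (ι m * ι (suc n))         ≈⟨ -‿distribʳ-* _ _ ⟩
      ι m * - ι (suc n)           ∎
    *-hom -[1+ m ] (+ n) = begin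
      ⟦ -[1+ m ] ℤ.* (+ n) ⟧     ≡⟨ ≡.cong ⟦_⟧ (≡.trans (≡.sym (ℤₚ.neg-distribˡ-* (+ suc m) (+ n))) (≡.cong ℤ.-_ (≡.sym (ℤₚ.pos-* (suc m) n)))) ⟩
      ⟦ ℤ.- (+ (suc m ℕ.* n)) ⟧   ≈⟨ neg-hom (suc m ℕ.* n) ⟩
      - ι (suc m ℕ.* n)           ≈⟨ -‿cong (ι-* (suc m) n) ⟩
      - (ι (suc m) * ι n)         ≈⟨ -‿distribˡ-* _ _ ⟩
      - ι (suc m) * ι n           ∎
    *-hom -[1+ m ] -[1+ n ] = begin
      ι (suc m ℕ.* suc n)              ≈⟨ ι-* (suc m) (suc n) ⟩
      ι (suc m) * ι (suc n)            ≈⟨ ⁻¹-involutive _ ⟨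
      - (- (ι (suc m) * ι (suc n)))    ≈⟨ -‿cong (-‿distribʳ-* _ _) ⟩
      - (ι (suc m) * - ι (suc n))      ≈⟨ -‿distribˡ-* _ _ ⟩
      - ι (suc m) * - ι (suc n)        ∎

    -hom : ∀ i → ⟦ ℤ.- i ⟧ ≈ - ⟦ i ⟧
    -hom (+ n) = neg-hom n
    -hom -[1+ n ] = sym (⁻¹-involutive _)

    ℤ⟶R : ℤ.+-*-rawRing -Raw-AlmostCommutative⟶ fromCommutativeRing CR
    ℤ⟶R = record { ⟦_⟧ = ⟦_⟧ ; +-homo = +-hom ; *-homo = *-hom ; -‿homo = -hom ; 0-homo = refl ; 1-homo = refl }

    coeff≟ : WeaklyDecidable (Induced-equivalence ℤ⟶R)
    coeff≟ i j with i ℤₚ.≟ j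
    ... | yes e = just (reflexive (≡.cong ⟦_⟧ e))
    ... | no _  = nothing

  open import Algebra.Solver.Ring ℤ.+-*-rawRing (fromCommutativeRing CR) ℤ⟶R coeff≟ public
    using (solve; _:=_; _:+_; _:*_; _:-_; :-_; con; Polynomial)

  :0 :1 : ∀ {n} → Polynomial n
  :0 = con (+ 0)
  :1 = con (+ 1)

-- Finite sums in a commutative semiring

module _ where
 open import Algebra.Bundles using (CommutativeSemiring)
 module Summation {c ℓ} (CS : CommutativeSemiring c ℓ) where
  open import Data.Nat using (zero; suc)
  open import Data.Fin as F using (Fin)
  import Data.Fin.Properties as Fₚ
  open import Data.Fin.Permutation using (permutation)
  open import Relation.Nullary using (¬_)
  open import Relation.Binary.PropositionalEquality using (_≡_)
  open CommutativeSemiring CS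
  import Algebra.Properties.Semiring.Sum semiring as S
  open import Relation.Binary.Reasoning.Setoid setoid

  -- Opaque, so that the summand can be inferred from a sum.
  abstract
    ∑ : ∀ {n} → (Fin n → Carrier) → Carrier
    ∑ f = S.sum f

    ∑-zero : ∀ (f : Fin 0 → Carrier) → ∑ f ≈ 0#
    ∑-zero f = refl

    ∑-suc : ∀ {n} (f : Fin (suc n) → Carrier) → ∑ f ≈ f F.zero + ∑ (λ i → f (F.suc i))
    ∑-suc f = refl

    ∑-cong : ∀ {n} {f g : Fin n → Carrier} → (∀ i → f i ≈ g i) → ∑ f ≈ ∑ g
    ∑-cong = S.sum-cong-≋

    ∑-+ : ∀ {n} (f g : Fin n → Carrier) → ∑ (λ i → f i + g i) ≈ ∑ f + ∑ g
    ∑-+ = S.∑-distrib-+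

    ∑-comm : ∀ {m n} (f : Fin m → Fin n → Carrier) → ∑ (λ i → ∑ (λ j → f i j)) ≈ ∑ (λ j → ∑ (λ i → f i j))
    ∑-comm = S.∑-comm

    *-∑ : ∀ {n} x (f : Fin n → Carrier) → x * ∑ f ≈ ∑ (λ i → x * f i)
    *-∑ = S.*-distribˡ-sum

    ∑-reindex : ∀ {n} (h : Fin n → Carrier) (f g : Fin n → Fin n) → (∀ x → f (g x) ≡ x) → (∀ x → g (f x) ≡ x) → ∑ h ≈ ∑ (λ x → h (f x))
    ∑-reindex h f g fg gf = S.sum-permute h (permutation f g (λ x → fg x) (λ x → gf x))

  ∑-* : ∀ {n} (f : Fin n → Carrier) x → ∑ f * x ≈ ∑ (λ i → f i * x)
  ∑-* f x = trans (*-comm _ _) (trans (*-∑ x f) (∑-cong (λ i → *-comm x (f i))))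

  ∑-0 : ∀ {n} {f : Fin n → Carrier} → (∀ i → f i ≈ 0#) → ∑ f ≈ 0#
  ∑-0 {zero} {f} h = ∑-zero f
  ∑-0 {suc n} {f} h = trans (∑-suc f) (trans (+-cong (h F.zero) (∑-0 (λ i → h (F.suc i)))) (+-identityˡ _))

  ∑-single : ∀ {n} (i : Fin n) (h : Fin n → Carrier) → (∀ j → ¬ i ≡ j → h j ≈ 0#) → ∑ h ≈ h i
  ∑-single {suc n} F.zero h z = trans (∑-suc h) (trans (+-congˡ (∑-0 (λ j → z (F.suc j) λ ()))) (+-identityʳ _))
  ∑-single {suc n} (F.suc i) h z = trans (∑-suc h) (trans (+-cong (z F.zero λ ()) (∑-single i (λ j → h (F.suc j)) (λ j ne → z (F.suc j) (λ e → ne (Fₚ.suc-injective e))))) (+-identityˡ _))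

  ∑-** : ∀ {m n} (f : Fin m → Carrier) (g : Fin n → Carrier) → ∑ f * ∑ g ≈ ∑ (λ i → ∑ (λ j → f i * g j))
  ∑-** f g = trans (∑-* f (∑ g)) (∑-cong (λ i → *-∑ (f i) g))

-- Sums of natural numbers, indicators and dyadic levels

module NatSums where
 open import Data.Nat
 open import Data.Nat.Properties
 open import Data.Fin as F using (Fin)
 import Data.Fin.Properties as Fₚ
 open import Data.Product using (Σ; _,_; _×_)
 open import Relation.Nullary using (Dec; yes; no; ¬_; contradiction)
 open import Relation.Binary.PropositionalEquality using (_≡_; refl; sym; trans; cong)
 open Summation +-*-commutativeSemiring public

 ∑-mono : ∀ {n} {f g : Fin n → ℕ} → (∀ i → f i ≤ g i) → ∑ f ≤ ∑ g
 ∑-mono {zero} {f} {g} h = ≤-reflexive (trans (∑-zero f) (sym (∑-zero g)))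
 ∑-mono {suc n} {f} {g} h = ≤-trans (≤-reflexive (∑-suc f)) (≤-trans (+-mono-≤ (h F.zero) (∑-mono (λ i → h (F.suc i)))) (≤-reflexive (sym (∑-suc g))))

 term≤∑ : ∀ {n} (f : Fin n → ℕ) i → f i ≤ ∑ f
 term≤∑ f F.zero = ≤-trans (m≤m+n _ _) (≤-reflexive (sym (∑-suc f)))
 term≤∑ f (F.suc i) = ≤-trans (term≤∑ (λ j → f (F.suc j)) i) (≤-trans (m≤n+m _ _) (≤-reflexive (sym (∑-suc f))))

 ∑-const : ∀ n c → ∑ {n} (λ _ → c) ≡ n * c
 ∑-const zero c = ∑-zero _
 ∑-const (suc n) c = trans (∑-suc _) (cong (c +_) (∑-const n c))

 ∑-≤-const : ∀ {n} {f : Fin n → ℕ} c → (∀ i → f i ≤ c) → ∑ f ≤ n * c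
 ∑-≤-const {n} c h = ≤-trans (∑-mono h) (≤-reflexive (∑-const n c))

 𝟙 : ∀ {P : Set} → Dec P → ℕ
 𝟙 (yes _) = 1
 𝟙 (no _) = 0

 𝟙≤1 : ∀ {P : Set} (d : Dec P) → 𝟙 d ≤ 1
 𝟙≤1 (yes _) = ≤-refl
 𝟙≤1 (no _) = z≤n

 𝟙-yes : ∀ {P : Set} (d : Dec P) → P → 𝟙 d ≡ 1
 𝟙-yes (yes _) _ = refl
 𝟙-yes (no np) q = contradiction q np

 𝟙-no : ∀ {P : Set} (d : Dec P) → ¬ P → 𝟙 d ≡ 0
 𝟙-no (yes q) np = contradiction q np
 𝟙-no (no _) _ = refl

 𝟙-mono : ∀ {P Q : Set} (d : Dec P) (e : Dec Q) → (P → Q) → 𝟙 d ≤ 𝟙 e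
 𝟙-mono (yes q) e h = ≤-reflexive (sym (𝟙-yes e (h q)))
 𝟙-mono (no _) e h = z≤n

 𝟙*-≤ : ∀ {P : Set} (d : Dec P) a → 𝟙 d * a ≤ a
 𝟙*-≤ d a = ≤-trans (*-monoˡ-≤ a (𝟙≤1 d)) (≤-reflexive (*-identityˡ a))

 ∑-𝟙 : ∀ {n} (i : Fin n) (h : Fin n → ℕ) → ∑ (λ j → 𝟙 (i Fₚ.≟ j) * h j) ≡ h i
 ∑-𝟙 i h = trans (∑-single i (λ j → 𝟙 (i Fₚ.≟ j) * h j) (λ j ne → cong (_* h j) (𝟙-no (i Fₚ.≟ j) ne))) (trans (cong (_* h i) (𝟙-yes (i Fₚ.≟ i) refl)) (*-identityˡ _))

 sumTo : ℕ → (ℕ → ℕ) → ℕ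
 sumTo zero h = 0
 sumTo (suc J) h = h J + sumTo J h

 sumTo-≤ : ∀ J h m → (∀ j → j < J → h j ≤ m) → sumTo J h ≤ J * m
 sumTo-≤ zero h m _ = z≤n
 sumTo-≤ (suc J) h m b = +-mono-≤ (b J ≤-refl) (sumTo-≤ J h m (λ j l → b j (m<n⇒m<1+n l)))

 -- The maximum is specified by its two uses: it bounds all values, and every common bound of the
 -- cubes bounds its cube. An index attaining it could not be promised for `J = 0`.
 max-below : ∀ J (h : ℕ → ℕ) → Σ ℕ λ m → (∀ j → j < J → h j ≤ m) × (∀ A → (∀ j → j < J → h j * h j * h j ≤ A) → m * m * m ≤ A)
 max-below zero h = 0 , (λ _ ()) , λ _ _ → z≤n
 max-below (suc J) h with max-below J h
 ... | m , b , c = go (≤-total (h J) m)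
   where
   open import Data.Sum using (_⊎_; inj₁; inj₂)
   go : h J ≤ m ⊎ m ≤ h J → Σ ℕ λ m → (∀ j → j < suc J → h j ≤ m) × (∀ A → (∀ j → j < suc J → h j * h j * h j ≤ A) → m * m * m ≤ A)
   ext : ∀ x → h J ≤ x → m ≤ x → ∀ j → j < suc J → h j ≤ x
   ext x l l' j (s≤s j≤J) with m≤n⇒m<n∨m≡n j≤J
   ... | inj₁ j<J = ≤-trans (b j j<J) l'
   ... | inj₂ refl = l
   go (inj₁ l) = m , ext m l ≤-refl , λ A H → c A (λ j j<J → H j (m<n⇒m<1+n j<J))
   go (inj₂ l) = h J , ext (h J) ≤-refl l , λ A H → H J ≤-refl

 -- A crude substitute for Hölder's inequality: the sum is at most J times the maximum. In the
 -- applications `J` is the number of dyadic levels, so the loss J³ is harmless.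
 sumTo-cube : ∀ J h A → (∀ j → j < J → h j * h j * h j ≤ A) → sumTo J h * sumTo J h * sumTo J h ≤ (J * J * J) * A
 sumTo-cube J h A H with max-below J h
 ... | m , b , c = ≤-trans (*-mono-≤ (*-mono-≤ s s) s) (≤-trans (≤-reflexive (lem J m)) (*-monoʳ-≤ (J * J * J) (c A H)))
   where
   open import Data.Nat.Solver using (module +-*-Solver)
   open +-*-Solver using (solve; _:=_; _:*_)
   s = sumTo-≤ J h m b
   lem : ∀ J m → J * m * (J * m) * (J * m) ≡ (J * J * J) * (m * m * m)
   lem = solve 2 (λ J m → J :* m :* (J :* m) :* (J :* m) := (J :* J :* J) :* (m :* m :* m)) refl

 ∑-sumTo : ∀ {n} J (h : ℕ → Fin n → ℕ) → ∑ (λ i → sumTo J (λ j → h j i)) ≡ sumTo J (λ j → ∑ (h j))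
 ∑-sumTo zero h = ∑-0 (λ _ → refl)
 ∑-sumTo (suc J) h = trans (∑-+ (h J) (λ i → sumTo J (λ j → h j i))) (cong (∑ (h J) +_) (∑-sumTo J h))

 -- The highest level j with 2^j ≤ a already suffices, since a < 2^(j+1) and g is monotone; the
 -- recursion looks for it from above. For a = 0 no level is active, hence the condition g 0 = 0.
 dyadic : ∀ (g : ℕ → ℕ) → g 0 ≡ 0 → (∀ {x y} → x ≤ y → g x ≤ g y) → ∀ J a → a < 2 ^ J → g a ≤ sumTo J (λ j → g (2 ^ suc j) * 𝟙 (2 ^ j ≤? a))
 dyadic g g0 mono zero zero (s≤s z≤n) = ≤-reflexive g0
 dyadic g g0 mono (suc J) a a< with 2 ^ J ≤? a
 ... | yes l = ≤-trans (mono (<⇒≤ a<)) (≤-trans (≤-reflexive (sym (*-identityʳ _))) (m≤m+n _ _))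
 ... | no nl = ≤-trans (dyadic g g0 mono J a (≰⇒> nl)) (m≤n+m _ _)

-- Integer roots, cancellation and the parameters of Stepanov's method

module Arithmetic where
 open import Data.Nat
 open import Data.Nat.Properties
 open import Data.Product using (Σ; _,_; _×_)
 open import Relation.Nullary using (yes; no)
 open import Relation.Binary.PropositionalEquality using (_≡_; refl; sym; trans; cong; subst)
 open import Data.Nat.DivMod using (m/n*n≤m; m≡m%n+[m/n]*n; m%n<n; m≥n⇒m/n>0)
 open import Data.Nat.Solver using (module +-*-Solver)
 open +-*-Solver using (solve; _:=_; _:+_; _:*_; con)

 -- Induction on N: from N to N + 1 the root grows by at most one, because the power of `suc r`
 -- already exceeds N and the next power is strictly larger.
 integer-root : ∀ k .{{_ : NonZero k}} N → Σ ℕ λ r → (r ^ k ≤ N) × (N < suc r ^ k)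
 integer-root (suc k) zero = 0 , z≤n , >-nonZero⁻¹ (1 ^ suc k) {{m^n≢0 1 (suc k)}}
 integer-root k@(suc _) (suc N) with integer-root k N
 ... | r , l , u with suc r ^ k ≤? suc N
 ...   | yes l' = suc r , l' , ≤-<-trans u (^-monoˡ-< k ≤-refl)
 ...   | no nl = r , m≤n⇒m≤1+n l , ≰⇒> nl

 cube-mono : ∀ {a b} → a ≤ b → a * a * a ≤ b * b * b
 cube-mono h = *-mono-≤ (*-mono-≤ h h) h

 cube-cancel : ∀ {a b} → a * a * a ≤ b * b * b → a ≤ b
 cube-cancel {a} {b} h with a ≤? b
 ... | yes l = l
 ... | no nl with () ← <-irrefl refl (≤-<-trans h (*-mono-< (*-mono-< (≰⇒> nl) (≰⇒> nl)) (≰⇒> nl)))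

 sq-cancel : ∀ {a b} → a * a ≤ b * b → a ≤ b
 sq-cancel {a} {b} h with a ≤? b
 ... | yes l = l
 ... | no nl with () ← <-irrefl refl (≤-<-trans h (*-mono-< (≰⇒> nl) (≰⇒> nl)))

 -- Opaque numerals: unfolding _*_ on a literal of this size is expensive.
 abstract
   c₁₂₈ c₆₉₁₂ : ℕ
   c₁₂₈ = 128
   c₆₉₁₂ = 6912

   c₁₂₈-def : 16 * (2 * 2 * 2) ≡ c₁₂₈
   c₁₂₈-def = refl

   c₆₉₁₂-def : 4 * (12 * 12 * 12) ≡ c₆₉₁₂
   c₆₉₁₂-def = refl

 -- B = ⌊(2nt)^(1/3)⌋ and D ≈ B²/2n: then the D B² coefficients outnumber the 2nD² vanishing conditions.
 stepanov-parameters : ∀ n t p → 1 ≤ n → c₁₂₈ * n ≤ t * t → 16 * n * (t * t * t * t) ≤ p * p * p →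
   Σ ℕ λ D → Σ ℕ λ B → (1 ≤ D) × (1 ≤ B) × (n * (D * (D + D)) < B * B * D) × (B * D ≤ t) × (B * t + D ≤ p) ×
     (∀ P → D * P ≤ B * t + (B * t + D) → P * P * P ≤ c₆₉₁₂ * ((n * t) * (n * t)))
 stepanov-parameters n t p 1≤n hyp₁ hyp₂ with integer-root 3 (2 * n * t)
 ... | B , l₀ , u₀ = D , B , 1≤D , 1≤B , cnt , BD≤t , fits , final
   where
   open ≤-Reasoning
   instance
     n≢0 : NonZero n
     n≢0 = >-nonZero 1≤n
     2n≢0 : NonZero (2 * n)
     2n≢0 = m*n≢0 2 n
   l : B * B * B ≤ 2 * n * t
   l = ≤-trans (≤-reflexive (lem B)) l₀
     where
     lem : ∀ B → B * B * B ≡ B * (B * (B * 1))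
     lem = solve 1 (λ B → B :* B :* B := B :* (B :* (B :* con 1))) refl
   u : 2 * n * t < suc B * suc B * suc B
   u = <-≤-trans u₀ (≤-reflexive (lem (suc B)))
     where
     lem : ∀ B → B * (B * (B * 1)) ≡ B * B * B
     lem = solve 1 (λ B → B :* (B :* (B :* con 1)) := B :* B :* B) refl
   1≤t : 1 ≤ t
   1≤t = n≢0⇒n>0 λ { refl → <⇒≱ (*-mono-≤ (subst (1 ≤_) c₁₂₈-def (s≤s z≤n)) 1≤n) hyp₁ }
   1≤B : 1 ≤ B
   1≤B = n≢0⇒n>0 λ { refl → <⇒≱ u (*-mono-≤ {1} {2 * n} {1} (≤-trans 1≤n (m≤m+n n _)) 1≤t) }
   u' : n * t < 4 * (B * B * B)
   u' = *-cancelˡ-< 2 _ _ (begin-strict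
     2 * (n * t)               ≡⟨ *-assoc 2 n t ⟨
     2 * n * t                 <⟨ u ⟩
     suc B * suc B * suc B     ≤⟨ cube-mono (≤-trans (+-monoˡ-≤ B 1≤B) (≤-reflexive (cong (B +_) (sym (+-identityʳ B))))) ⟩
     (2 * B) * (2 * B) * (2 * B)  ≡⟨ lem B ⟩
     2 * (4 * (B * B * B))     ∎)
     where
     lem : ∀ B → (2 * B) * (2 * B) * (2 * B) ≡ 2 * (4 * (B * B * B))
     lem = solve 1 (λ B → (con 2 :* B) :* (con 2 :* B) :* (con 2 :* B) := con 2 :* (con 4 :* (B :* B :* B))) refl
   lem₁ : ∀ n t → (n * n) * (t * t) ≡ (n * t) * (n * t)
   lem₁ = solve 2 (λ n t → (n :* n) :* (t :* t) := (n :* t) :* (n :* t)) refl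
   lem₂ : ∀ B → (4 * (B * B * B)) * (4 * (B * B * B)) ≡ 16 * ((B * B) * (B * B) * (B * B))
   lem₂ = solve 1 (λ B → (con 4 :* (B :* B :* B)) :* (con 4 :* (B :* B :* B)) := con 16 :* ((B :* B) :* (B :* B) :* (B :* B))) refl
   lem₃ : ∀ c k n → c * ((k * n) * (k * n) * (k * n)) ≡ (n * n) * (c * (k * k * k) * n)
   lem₃ = solve 3 (λ c k n → c :* ((k :* n) :* (k :* n) :* (k :* n)) := (n :* n) :* (c :* (k :* k :* k) :* n)) refl
   -- This ensures D ≥ 1. Otherwise (nt)² < 16 B⁶ ≤ 128 n³ would give t² < 128 n, which is the
   -- origin of `c₁₂₈`.
   B²>2n : 2 * n < B * B
   B²>2n = ≰⇒> λ nh → <-irrefl refl (begin-strict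
       (n * n) * (t * t)     ≡⟨ lem₁ n t ⟩
       (n * t) * (n * t)     <⟨ *-mono-< u' u' ⟩
       (4 * (B * B * B)) * (4 * (B * B * B))  ≡⟨ lem₂ B ⟩
       16 * ((B * B) * (B * B) * (B * B))     ≤⟨ *-monoʳ-≤ 16 (cube-mono nh) ⟩
       16 * ((2 * n) * (2 * n) * (2 * n))     ≡⟨ trans (lem₃ 16 2 n) (cong (λ z → (n * n) * (z * n)) c₁₂₈-def) ⟩
       (n * n) * (c₁₂₈ * n)   ≤⟨ *-monoʳ-≤ (n * n) hyp₁ ⟩
       (n * n) * (t * t)     ∎)
   -- Subtracting 1 makes 2nD < B² strict, so that the unknowns really outnumber the conditions.
   D = (B * B ∸ 1) / (2 * n)
   1≤B² : 1 ≤ B * B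
   1≤B² = *-mono-≤ 1≤B 1≤B
   D-lower : D * (2 * n) < B * B
   D-lower = ≤-<-trans (m/n*n≤m (B * B ∸ 1) (2 * n)) (≤-reflexive (m+[n∸m]≡n 1≤B²))
   1≤D : 1 ≤ D
   1≤D = m≥n⇒m/n>0 (≤-pred (≤-trans B²>2n (≤-reflexive (sym (m+[n∸m]≡n 1≤B²)))))
   D-upper : B * B ≤ 4 * n * D
   D-upper = begin
     B * B                    ≡⟨ m+[n∸m]≡n 1≤B² ⟨
     suc (B * B ∸ 1)          ≤⟨ s≤s (≤-reflexive (m≡m%n+[m/n]*n (B * B ∸ 1) (2 * n))) ⟩
     suc ((B * B ∸ 1) % (2 * n)) + D * (2 * n)  ≤⟨ +-monoˡ-≤ (D * (2 * n)) (m%n<n (B * B ∸ 1) (2 * n)) ⟩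
     2 * n + D * (2 * n)      ≤⟨ +-monoˡ-≤ (D * (2 * n)) (≤-trans (≤-reflexive (sym (*-identityˡ (2 * n)))) (*-monoˡ-≤ (2 * n) 1≤D)) ⟩
     D * (2 * n) + D * (2 * n) ≡⟨ lem D n ⟩
     4 * n * D                ∎
     where
     lem : ∀ D n → D * (2 * n) + D * (2 * n) ≡ 4 * n * D
     lem = solve 2 (λ D n → D :* (con 2 :* n) :+ D :* (con 2 :* n) := con 4 :* n :* D) refl
   cnt : n * (D * (D + D)) < B * B * D
   cnt = begin-strict
     n * (D * (D + D))   ≡⟨ lem n D ⟩
     D * (2 * n) * D     <⟨ *-monoˡ-< D {{>-nonZero 1≤D}} D-lower ⟩
     B * B * D           ∎
     where
     lem : ∀ n D → n * (D * (D + D)) ≡ D * (2 * n) * D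
     lem = solve 2 (λ n D → n :* (D :* (D :+ D)) := D :* (con 2 :* n) :* D) refl
   BD≤t : B * D ≤ t
   BD≤t = *-cancelˡ-≤ (2 * n) (begin
     2 * n * (B * D)    ≡⟨ lem n B D ⟩
     B * (D * (2 * n))  ≤⟨ *-monoʳ-≤ B (<⇒≤ D-lower) ⟩
     B * (B * B)        ≡⟨ *-assoc B B B ⟨
     B * B * B          ≤⟨ l ⟩
     2 * n * t          ∎)
     where
     lem : ∀ n B D → 2 * n * (B * D) ≡ B * (D * (2 * n))
     lem = solve 3 (λ n B D → con 2 :* n :* (B :* D) := B :* (D :* (con 2 :* n))) refl
   D≤Bt : D ≤ B * t
   D≤Bt = ≤-trans (m≤n*m D B {{>-nonZero 1≤B}}) (≤-trans BD≤t (m≤n*m t B {{>-nonZero 1≤B}}))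
   -- Since D ≤ Bt, it is enough that 2Bt ≤ p; cubing and B³ ≤ 2nt turn this into 16 n t⁴ ≤ p³.
   fits : B * t + D ≤ p
   fits = ≤-trans (+-monoʳ-≤ (B * t) D≤Bt) (cube-cancel (begin
     (B * t + B * t) * (B * t + B * t) * (B * t + B * t)  ≡⟨ lem B t ⟩
     8 * (B * B * B) * (t * t * t)       ≤⟨ *-monoˡ-≤ (t * t * t) (*-monoʳ-≤ 8 l) ⟩
     8 * (2 * n * t) * (t * t * t)       ≡⟨ lem' n t ⟩
     16 * n * (t * t * t * t)            ≤⟨ hyp₂ ⟩
     p * p * p                           ∎))
     where
     lem : ∀ B t → (B * t + B * t) * (B * t + B * t) * (B * t + B * t) ≡ 8 * (B * B * B) * (t * t * t)
     lem = solve 2 (λ B t → (B :* t :+ B :* t) :* (B :* t :+ B :* t) :* (B :* t :+ B :* t) := con 8 :* (B :* B :* B) :* (t :* t :* t)) refl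
     lem' : ∀ n t → 8 * (2 * n * t) * (t * t * t) ≡ 16 * n * (t * t * t * t)
     lem' = solve 2 (λ n t → con 8 :* (con 2 :* n :* t) :* (t :* t :* t) := con 16 :* n :* (t :* t :* t :* t)) refl
   -- From B² ≤ 4nD and DP ≤ 3Bt one gets BP ≤ 12nt, and nt < 4B³ converts this into a bound for P³;
   -- the constant is 4 times 12³.
   final : ∀ P → D * P ≤ B * t + (B * t + D) → P * P * P ≤ c₆₉₁₂ * ((n * t) * (n * t))
   final P h = *-cancelˡ-≤ (n * t) {{>-nonZero (*-mono-≤ 1≤n 1≤t)}} (begin
     n * t * (P * P * P)               ≤⟨ *-monoˡ-≤ (P * P * P) (<⇒≤ u') ⟩
     4 * (B * B * B) * (P * P * P)     ≡⟨ lem B P ⟩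
     4 * ((B * P) * (B * P) * (B * P)) ≤⟨ *-monoʳ-≤ 4 (cube-mono BP) ⟩
     4 * ((12 * (n * t)) * (12 * (n * t)) * (12 * (n * t))) ≡⟨ trans (lem' 4 12 (n * t)) (cong (λ z → n * t * (z * ((n * t) * (n * t)))) c₆₉₁₂-def) ⟩
     n * t * (c₆₉₁₂ * ((n * t) * (n * t))) ∎)
     where
     lem : ∀ B P → 4 * (B * B * B) * (P * P * P) ≡ 4 * ((B * P) * (B * P) * (B * P))
     lem = solve 2 (λ B P → con 4 :* (B :* B :* B) :* (P :* P :* P) := con 4 :* ((B :* P) :* (B :* P) :* (B :* P))) refl
     lem' : ∀ c k x → c * ((k * x) * (k * x) * (k * x)) ≡ x * (c * (k * k * k) * (x * x))
     lem' = solve 3 (λ c k x → c :* ((k :* x) :* (k :* x) :* (k :* x)) := x :* (c :* (k :* k :* k) :* (x :* x))) refl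
     lem₄ : ∀ n D P → 4 * n * D * P ≡ 4 * n * (D * P)
     lem₄ = solve 3 (λ n D P → con 4 :* n :* D :* P := con 4 :* n :* (D :* P)) refl
     lem₅ : ∀ n B t → 4 * n * (B * t + (B * t + B * t)) ≡ B * (12 * (n * t))
     lem₅ = solve 3 (λ n B t → con 4 :* n :* (B :* t :+ (B :* t :+ B :* t)) := B :* (con 12 :* (n :* t))) refl
     BP : B * P ≤ 12 * (n * t)
     BP = *-cancelˡ-≤ B {{>-nonZero 1≤B}} (begin
       B * (B * P)           ≡⟨ *-assoc B B P ⟨
       B * B * P             ≤⟨ *-monoˡ-≤ P D-upper ⟩
       4 * n * D * P         ≡⟨ lem₄ n D P ⟩
       4 * n * (D * P)       ≤⟨ *-monoʳ-≤ (4 * n) h ⟩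
       4 * n * (B * t + (B * t + D)) ≤⟨ *-monoʳ-≤ (4 * n) (+-monoʳ-≤ (B * t) (+-monoʳ-≤ (B * t) D≤Bt)) ⟩
       4 * n * (B * t + (B * t + B * t)) ≡⟨ lem₅ n B t ⟩
       B * (12 * (n * t))    ∎)

-- The field with p elements

module _ where
 open import Data.Nat using (ℕ)
 open import Data.Nat.Primality using (Prime)
 module PrimeField (p : ℕ) (pr : Prime p) where
  open import Level using (0ℓ)
  open import Algebra.Bundles using (CommutativeRing)
  open import Data.Nat as ℕ using (zero; suc; NonZero; _%_)
  import Data.Nat.Properties as ℕₚ
  import Data.Nat.DivMod as DM
  open import Data.Nat.Divisibility using (_∣_; m%n≡0⇒n∣m; n∣m⇒m%n≡0; ∣⇒≤)
  open import Data.Nat.Primality using (prime⇒nonZero; prime⇒nonTrivial)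
  open import Data.Nat.Coprimality using (prime⇒coprime; coprime-Bézout)
  open import Data.Nat.GCD using (module Bézout)
  open import Data.Fin using (Fin; toℕ; fromℕ<)
  import Data.Fin.Properties as Fₚ
  open import Data.Product using (Σ; _,_; proj₁; proj₂)
  open import Relation.Nullary using (¬_; Dec; yes; no; contradiction)
  open import Relation.Binary.PropositionalEquality as ≡ using (_≡_; refl; cong; cong₂; trans; isEquivalence; module ≡-Reasoning)

  instance
    p-nonZero : NonZero p
    p-nonZero = prime⇒nonZero pr

  0%p : 0 % p ≡ 0
  0%p = DM.m<n⇒m%n≡m (ℕ.>-nonZero⁻¹ p)

  K : Set
  K = Fin p

  infix 4 _≟K_
  _≟K_ : (x y : K) → Dec (x ≡ y)
  _≟K_ = Fₚ._≟_

  1<p : 1 ℕ.< p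
  1<p = ℕ.nonTrivial⇒n>1 p {{prime⇒nonTrivial pr}}

  abstract
    [_] : ℕ → K
    [ n ] = fromℕ< (DM.m%n<n n p)

    toℕ-[] : ∀ n → toℕ [ n ] ≡ n % p
    toℕ-[] n = Fₚ.toℕ-fromℕ< (DM.m%n<n n p)

  []-cong : ∀ {m n} → m % p ≡ n % p → [ m ] ≡ [ n ]
  []-cong {m} {n} e = Fₚ.toℕ-injective (trans (toℕ-[] m) (trans e (≡.sym (toℕ-[] n))))

  []-inj : ∀ {m n} → [ m ] ≡ [ n ] → m % p ≡ n % p
  []-inj {m} {n} e = trans (≡.sym (toℕ-[] m)) (trans (cong toℕ e) (toℕ-[] n))

  []-toℕ : ∀ x → [ toℕ x ] ≡ x
  []-toℕ x = Fₚ.toℕ-injective (trans (toℕ-[] (toℕ x)) (DM.m<n⇒m%n≡m (Fₚ.toℕ<n x)))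

  toℕ-[]-< : ∀ {n} → n ℕ.< p → toℕ [ n ] ≡ n
  toℕ-[]-< {n} n<p = trans (toℕ-[] n) (DM.m<n⇒m%n≡m n<p)

  []-inj-< : ∀ {m n} → m ℕ.< p → n ℕ.< p → [ m ] ≡ [ n ] → m ≡ n
  []-inj-< m< n< e = trans (≡.sym (toℕ-[]-< m<)) (trans (cong toℕ e) (toℕ-[]-< n<))

  abstract
    0K 1K : K
    0K = [ 0 ]
    1K = [ 1 ]

    _+K_ _*K_ : K → K → K
    x +K y = [ toℕ x ℕ.+ toℕ y ]
    x *K y = [ toℕ x ℕ.* toℕ y ]

    -K_ : K → K
    -K x = [ p ℕ.∸ toℕ x ]

    []-0 : [ 0 ] ≡ 0K
    []-0 = refl

    []-1 : [ 1 ] ≡ 1K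
    []-1 = refl

    []-+ : ∀ m n → [ m ℕ.+ n ] ≡ [ m ] +K [ n ]
    []-+ m n = []-cong (trans (DM.%-distribˡ-+ m n p) (cong (_% p) (≡.sym (cong₂ ℕ._+_ (toℕ-[] m) (toℕ-[] n)))))

    []-* : ∀ m n → [ m ℕ.* n ] ≡ [ m ] *K [ n ]
    []-* m n = []-cong (trans (DM.%-distribˡ-* m n p) (cong (_% p) (≡.sym (cong₂ ℕ._*_ (toℕ-[] m) (toℕ-[] n)))))

    neg-inv : ∀ x → (-K x) +K x ≡ 0K
    neg-inv x = trans (cong ((-K x) +K_) (≡.sym ([]-toℕ x)))
      (trans (≡.sym ([]-+ (p ℕ.∸ toℕ x) (toℕ x)))
      (trans (cong [_] (ℕₚ.m∸n+n≡m (ℕₚ.<⇒≤ (Fₚ.toℕ<n x))))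
      ([]-cong (trans (DM.n%n≡0 p) (≡.sym 0%p)))))

  private
    -- Every element is the residue of a natural number, so the ring laws are inherited from ℕ
    -- through `[]-+` and `[]-*`.
    elim : (P : K → Set) → (∀ n → P [ n ]) → ∀ x → P x
    elim P h x = ≡.subst P ([]-toℕ x) (h (toℕ x))

    elim₂ : (P : K → K → Set) → (∀ m n → P [ m ] [ n ]) → ∀ x y → P x y
    elim₂ P h = elim (λ x → ∀ y → P x y) (λ m → elim (P [ m ]) (h m))

    elim₃ : (P : K → K → K → Set) → (∀ m n o → P [ m ] [ n ] [ o ]) → ∀ x y z → P x y z
    elim₃ P h = elim (λ x → ∀ y z → P x y z) (λ m → elim₂ (P [ m ]) (h m))

    open ≡-Reasoning

    +a : ∀ x y z → (x +K y) +K z ≡ x +K (y +K z)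
    +a = elim₃ _ λ m n o → begin
      ([ m ] +K [ n ]) +K [ o ]   ≡⟨ cong (_+K [ o ]) ([]-+ m n) ⟨
      [ m ℕ.+ n ] +K [ o ]        ≡⟨ []-+ (m ℕ.+ n) o ⟨
      [ m ℕ.+ n ℕ.+ o ]           ≡⟨ cong [_] (ℕₚ.+-assoc m n o) ⟩
      [ m ℕ.+ (n ℕ.+ o) ]         ≡⟨ []-+ m (n ℕ.+ o) ⟩
      [ m ] +K [ n ℕ.+ o ]        ≡⟨ cong ([ m ] +K_) ([]-+ n o) ⟩
      [ m ] +K ([ n ] +K [ o ])   ∎

    *a : ∀ x y z → (x *K y) *K z ≡ x *K (y *K z)
    *a = elim₃ _ λ m n o → begin
      ([ m ] *K [ n ]) *K [ o ]   ≡⟨ cong (_*K [ o ]) ([]-* m n) ⟨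
      [ m ℕ.* n ] *K [ o ]        ≡⟨ []-* (m ℕ.* n) o ⟨
      [ m ℕ.* n ℕ.* o ]           ≡⟨ cong [_] (ℕₚ.*-assoc m n o) ⟩
      [ m ℕ.* (n ℕ.* o) ]         ≡⟨ []-* m (n ℕ.* o) ⟩
      [ m ] *K [ n ℕ.* o ]        ≡⟨ cong ([ m ] *K_) ([]-* n o) ⟩
      [ m ] *K ([ n ] *K [ o ])   ∎

    +c : ∀ x y → x +K y ≡ y +K x
    +c = elim₂ _ λ m n → trans (≡.sym ([]-+ m n)) (trans (cong [_] (ℕₚ.+-comm m n)) ([]-+ n m))

    *c : ∀ x y → x *K y ≡ y *K x
    *c = elim₂ _ λ m n → trans (≡.sym ([]-* m n)) (trans (cong [_] (ℕₚ.*-comm m n)) ([]-* n m))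

    +i : ∀ x → 0K +K x ≡ x
    +i = elim _ λ m → trans (cong (_+K [ m ]) (≡.sym []-0)) (≡.sym ([]-+ 0 m))

    *i : ∀ x → 1K *K x ≡ x
    *i = elim _ λ m → trans (cong (_*K [ m ]) (≡.sym []-1)) (trans (≡.sym ([]-* 1 m)) (cong [_] (ℕₚ.*-identityˡ m)))

    dˡ : ∀ x y z → x *K (y +K z) ≡ (x *K y) +K (x *K z)
    dˡ = elim₃ _ λ m n o → begin
      [ m ] *K ([ n ] +K [ o ])            ≡⟨ cong ([ m ] *K_) ([]-+ n o) ⟨
      [ m ] *K [ n ℕ.+ o ]                 ≡⟨ []-* m (n ℕ.+ o) ⟨
      [ m ℕ.* (n ℕ.+ o) ]                  ≡⟨ cong [_] (ℕₚ.*-distribˡ-+ m n o) ⟩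
      [ m ℕ.* n ℕ.+ m ℕ.* o ]              ≡⟨ []-+ (m ℕ.* n) (m ℕ.* o) ⟩
      [ m ℕ.* n ] +K [ m ℕ.* o ]           ≡⟨ cong₂ _+K_ ([]-* m n) ([]-* m o) ⟩
      ([ m ] *K [ n ]) +K ([ m ] *K [ o ]) ∎

  KR : CommutativeRing 0ℓ 0ℓ
  KR = record
    { Carrier = K ; _≈_ = _≡_ ; _+_ = _+K_ ; _*_ = _*K_ ; -_ = -K_ ; 0# = 0K ; 1# = 1K
    ; isCommutativeRing = record
      { isRing = record
        { +-isAbelianGroup = record
          { isGroup = record
            { isMonoid = record
              { isSemigroup = record
                { isMagma = record { isEquivalence = isEquivalence ; ∙-cong = cong₂ _+K_ }
                ; assoc = +a }
              ; identity = +i , λ x → trans (+c x 0K) (+i x) }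
            ; inverse = neg-inv , λ x → trans (+c x _) (neg-inv x)
            ; ⁻¹-cong = cong -K_ }
          ; comm = +c }
        ; *-cong = cong₂ _*K_
        ; *-assoc = *a
        ; *-identity = *i , λ x → trans (*c x 1K) (*i x)
        ; distrib = dˡ , λ x y z → trans (*c (y +K z) x) (trans (dˡ x y z) (cong₂ _+K_ (*c x y) (*c x z)))
        }
      ; *-comm = *c } }

  open CommutativeRing KR public
    using (_+_; _*_; -_; _-_; 0#; 1#; +-assoc; +-comm; +-identityˡ; +-identityʳ; *-assoc; *-comm; *-identityˡ; *-identityʳ;
           zeroˡ; zeroʳ; distribˡ; distribʳ; -‿inverseˡ; -‿inverseʳ; semiring; commutativeSemiring; ring; +-abelianGroup; *-commutativeMonoid)
  open IntegerSolver KR public using () renaming (ι to ιK; ι-+ to ιK-+; ι-* to ιK-*; ι-suc to ιK-suc; solve to solveK; _:=_ to _:=_; _:+_ to _:+_; _:*_ to _:*_; _:-_ to _:-_; :-_ to :-_; :0 to :0; :1 to :1)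
  open import Algebra.Properties.CommutativeSemiring.Exp commutativeSemiring public
    using (_^_; ^-homo-*; ^-assocʳ; ^-distrib-*)

  ιK-[] : ∀ n → ιK n ≡ [ n ]
  ιK-[] zero = ≡.sym []-0
  ιK-[] (suc n) = trans (ιK-suc n) (trans (cong₂ _+_ (≡.sym []-1) (ιK-[] n)) (≡.sym ([]-+ 1 n)))

  []≡0⇒∣ : ∀ n → [ n ] ≡ 0# → p ∣ n
  []≡0⇒∣ n e = m%n≡0⇒n∣m n p (trans ([]-inj (trans e (≡.sym []-0))) 0%p)

  ∣⇒[]≡0 : ∀ n → p ∣ n → [ n ] ≡ 0#
  ∣⇒[]≡0 n d = trans ([]-cong (trans (n∣m⇒m%n≡0 n p d) (≡.sym 0%p))) []-0

  []≢0 : ∀ n → 1 ℕ.≤ n → n ℕ.< p → ¬ [ n ] ≡ 0#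
  []≢0 (suc n) _ n<p e = ℕₚ.<⇒≱ n<p (∣⇒≤ ([]≡0⇒∣ (suc n) e))

  1≢0 : ¬ 1# ≡ 0#
  1≢0 e = []≢0 1 ℕₚ.≤-refl 1<p (trans []-1 e)

  toℕ≢0 : ∀ x → ¬ x ≡ 0# → 1 ℕ.≤ toℕ x
  toℕ≢0 x x≢0 = ℕₚ.n≢0⇒n>0 (λ e → x≢0 (trans (≡.sym ([]-toℕ x)) (trans (cong [_] e) []-0)))

  -- Bézout's identity for x and p comes in two forms over ℕ: either bx = 1 + ap, and b is the
  -- inverse, or 1 + bx = ap, and -b is.
  inverse : ∀ x → ¬ x ≡ 0# → Σ K λ y → x * y ≡ 1#
  inverse x x≢0 with coprime-Bézout (prime⇒coprime pr {{ℕ.>-nonZero (toℕ≢0 x x≢0)}} (Fₚ.toℕ<n x))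
  ... | Bézout.-+ a b e = [ b ] , (begin
    x * [ b ]                ≡⟨ cong (_* [ b ]) ([]-toℕ x) ⟨
    [ toℕ x ] * [ b ]        ≡⟨ *-comm _ _ ⟩
    [ b ] * [ toℕ x ]        ≡⟨ []-* b (toℕ x) ⟨
    [ b ℕ.* toℕ x ]          ≡⟨ cong [_] (≡.sym e) ⟩
    [ 1 ℕ.+ a ℕ.* p ]        ≡⟨ []-cong (DM.[m+kn]%n≡m%n 1 a p) ⟩
    [ 1 ]                    ≡⟨ []-1 ⟩
    1#                       ∎)
  ... | Bézout.+- a b e = - [ b ] , (begin
    x * (- [ b ])                    ≡⟨ lem x [ b ] ⟩
    (1# + x * [ b ]) * (- 1#) + 1#   ≡⟨ cong (λ z → z * (- 1#) + 1#) eq ⟩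
    0# * (- 1#) + 1#                 ≡⟨ lem' (- 1#) ⟩
    1#                               ∎)
    where
    lem : ∀ x b → x * (- b) ≡ (1# + x * b) * (- 1#) + 1#
    lem = solveK 2 (λ x b → x :* (:- b) := (:1 :+ x :* b) :* (:- :1) :+ :1) refl
    lem' : ∀ x → 0# * x + 1# ≡ 1#
    lem' x = trans (cong (_+ 1#) (zeroˡ x)) (+-identityˡ 1#)
    eq : 1# + x * [ b ] ≡ 0#
    eq = begin
      1# + x * [ b ]             ≡⟨ cong₂ (λ u v → u + v * [ b ]) (≡.sym []-1) (≡.sym ([]-toℕ x)) ⟩
      [ 1 ] + [ toℕ x ] * [ b ]  ≡⟨ cong ([ 1 ] +_) (trans (*-comm _ _) (≡.sym ([]-* b (toℕ x)))) ⟩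
      [ 1 ] + [ b ℕ.* toℕ x ]    ≡⟨ []-+ 1 _ ⟨
      [ 1 ℕ.+ b ℕ.* toℕ x ]      ≡⟨ cong [_] e ⟩
      [ a ℕ.* p ]                ≡⟨ ∣⇒[]≡0 _ (Data.Nat.Divisibility.n∣m*n a) ⟩
      0#                         ∎
      where import Data.Nat.Divisibility

  abstract
    -- The value 0 at 0 makes inversion an involution of the whole field, so that it can serve as a
    -- change of variable in sums over `K`.
    _⁻¹ : K → K
    x ⁻¹ with x ≟K 0#
    ... | yes _ = 0#
    ... | no x≢0 = proj₁ (inverse x x≢0)

    inv-r : ∀ {x} → ¬ x ≡ 0# → x * (x ⁻¹) ≡ 1#
    inv-r {x} x≢0 with x ≟K 0#
    ... | yes e = contradiction e x≢0
    ... | no ne = proj₂ (inverse x ne)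

    inv-0 : 0# ⁻¹ ≡ 0#
    inv-0 with 0# ≟K 0#
    ... | yes _ = refl
    ... | no ne = contradiction refl ne

  inv-l : ∀ {x} → ¬ x ≡ 0# → (x ⁻¹) * x ≡ 1#
  inv-l {x} x≢0 = trans (*-comm _ x) (inv-r x≢0)

  *-cancelˡ : ∀ {x y z} → ¬ x ≡ 0# → x * y ≡ x * z → y ≡ z
  *-cancelˡ {x} {y} {z} x≢0 e = trans (≡.sym (h y)) (trans (cong ((x ⁻¹) *_) e) (h z))
    where
    h : ∀ w → (x ⁻¹) * (x * w) ≡ w
    h w = trans (≡.sym (*-assoc _ x w)) (trans (cong (_* w) (inv-l x≢0)) (*-identityˡ w))

  zero-div : ∀ {x y} → x * y ≡ 0# → ¬ x ≡ 0# → y ≡ 0#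
  zero-div {x} {y} e x≢0 = *-cancelˡ x≢0 (trans e (≡.sym (zeroʳ x)))

  *-≢0 : ∀ {x y} → ¬ x ≡ 0# → ¬ y ≡ 0# → ¬ x * y ≡ 0#
  *-≢0 x≢0 y≢0 e = y≢0 (zero-div e x≢0)

  ^-≢0 : ∀ {x} n → ¬ x ≡ 0# → ¬ x ^ n ≡ 0#
  ^-≢0 zero _ = 1≢0
  ^-≢0 {x} (suc n) x≢0 = *-≢0 x≢0 (^-≢0 n x≢0)

  inv-≢0 : ∀ {x} → ¬ x ≡ 0# → ¬ x ⁻¹ ≡ 0#
  inv-≢0 {x} x≢0 e = 1≢0 (trans (≡.sym (inv-r x≢0)) (trans (cong (x *_) e) (zeroʳ x)))

  x-y≡0⇒x≡y : ∀ {x y} → x - y ≡ 0# → x ≡ y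
  x-y≡0⇒x≡y {x} {y} e = trans (lem x y) (trans (cong (_+ y) e) (+-identityˡ y))
    where
    lem : ∀ x y → x ≡ (x - y) + y
    lem = solveK 2 (λ x y → x := (x :- y) :+ y) refl

  1^ : ∀ n → 1# ^ n ≡ 1#
  1^ zero = refl
  1^ (suc n) = trans (*-identityˡ _) (1^ n)

  0^ : ∀ n → 1 ℕ.≤ n → 0# ^ n ≡ 0#
  0^ (suc n) _ = zeroˡ _

  []-^ : ∀ m n → [ m ℕ.^ n ] ≡ [ m ] ^ n
  []-^ m zero = []-1
  []-^ m (suc n) = trans ([]-* m (m ℕ.^ n)) (cong ([ m ] *_) ([]-^ m n))

-- Polynomials: multiplicities of roots and sparse polynomials

module _ where
 open import Data.Nat using (ℕ)
 open import Data.Nat.Primality using (Prime)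
 module Polynomials (p : ℕ) (pr : Prime p) where
  open PrimeField p pr
  open import Data.Nat as ℕ using (zero; suc; z≤n; s≤s)
  import Data.Nat.Properties as ℕₚ
  open import Data.List using (List; []; _∷_; map; length)
  open import Data.List.Membership.Propositional using (_∉_)
  open import Data.List.Relation.Unary.Any using (here; there)
  open import Data.List.Relation.Unary.All as All using (All; []; _∷_)
  open import Data.List.Relation.Unary.AllPairs using ([]; _∷_)
  open import Data.List.Relation.Unary.Unique.Propositional using (Unique)
  open import Data.Product using (Σ; _,_)
  open import Relation.Nullary using (¬_; yes; no)
  open import Relation.Binary.PropositionalEquality as ≡ using (_≡_; refl; cong; cong₂; trans; module ≡-Reasoning)
  open ≡-Reasoning

  Poly : Set
  Poly = List K

  coef : Poly → ℕ → K
  coef [] n = 0#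
  coef (a ∷ f) zero = a
  coef (a ∷ f) (suc n) = coef f n

  infix 4 _≗_
  -- Lists may end in zeros, so equality is coefficientwise. Wrapping it in a record lets both
  -- polynomials be recovered from the type of a proof.
  record _≗_ (f g : Poly) : Set where
    constructor ⟪_⟫
    field at : ∀ n → coef f n ≡ coef g n
  open _≗_ public

  ≗-sym : ∀ {f g} → f ≗ g → g ≗ f
  ≗-sym e .at n = ≡.sym (at e n)

  ≗-trans : ∀ {f g h} → f ≗ g → g ≗ h → f ≗ h
  ≗-trans e e' .at n = trans (at e n) (at e' n)

  eval : Poly → K → K
  eval [] x = 0#
  eval (a ∷ f) x = a + x * eval f x

  infixl 6 _⊞_
  _⊞_ : Poly → Poly → Poly
  [] ⊞ g = g
  (a ∷ f) ⊞ [] = a ∷ f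
  (a ∷ f) ⊞ (b ∷ g) = (a + b) ∷ (f ⊞ g)

  scale : K → Poly → Poly
  scale c = map (c *_)

  -- The product (X - x) f.
  lin : K → Poly → Poly
  lin x f = (0# ∷ f) ⊞ scale (- x) f

  -- Multiplies the n-th coefficient by n + k; thus `ϑ` is Euler's derivation X d/dX. Unlike d/dX it
  -- maps every monomial to a multiple of itself.
  wt : ℕ → Poly → Poly
  wt k [] = []
  wt k (a ∷ f) = ιK k * a ∷ wt (suc k) f

  ϑ : Poly → Poly
  ϑ = wt 0

  coef-⊞ : ∀ f g n → coef (f ⊞ g) n ≡ coef f n + coef g n
  coef-⊞ [] g n = ≡.sym (+-identityˡ _)
  coef-⊞ (a ∷ f) [] n = ≡.sym (+-identityʳ _)
  coef-⊞ (a ∷ f) (b ∷ g) zero = refl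
  coef-⊞ (a ∷ f) (b ∷ g) (suc n) = coef-⊞ f g n

  coef-scale : ∀ c f n → coef (scale c f) n ≡ c * coef f n
  coef-scale c [] n = ≡.sym (zeroʳ c)
  coef-scale c (a ∷ f) zero = refl
  coef-scale c (a ∷ f) (suc n) = coef-scale c f n

  coef-wt : ∀ k f n → coef (wt k f) n ≡ ιK (n ℕ.+ k) * coef f n
  coef-wt k [] n = ≡.sym (zeroʳ _)
  coef-wt k (a ∷ f) zero = refl
  coef-wt k (a ∷ f) (suc n) = trans (coef-wt (suc k) f n) (cong (λ z → ιK z * coef f n) (ℕₚ.+-suc n k))

  coef-ϑ : ∀ f n → coef (ϑ f) n ≡ ιK n * coef f n
  coef-ϑ f n = trans (coef-wt 0 f n) (cong (λ z → ιK z * coef f n) (ℕₚ.+-identityʳ n))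

  coef-lin-0 : ∀ x f → coef (lin x f) 0 ≡ - x * coef f 0
  coef-lin-0 x f = trans (coef-⊞ (0# ∷ f) (scale (- x) f) 0) (trans (+-identityˡ _) (coef-scale (- x) f 0))

  coef-lin-s : ∀ x f n → coef (lin x f) (suc n) ≡ coef f n + - x * coef f (suc n)
  coef-lin-s x f n = trans (coef-⊞ (0# ∷ f) (scale (- x) f) (suc n)) (cong (coef f n +_) (coef-scale (- x) f (suc n)))

  ⊞-cong : ∀ {f f' g g'} → f ≗ f' → g ≗ g' → f ⊞ g ≗ f' ⊞ g'
  ⊞-cong {f} {f'} {g} {g'} e e' .at n = trans (coef-⊞ f g n) (trans (cong₂ _+_ (at e n) (at e' n)) (≡.sym (coef-⊞ f' g' n)))

  scale-cong : ∀ c {f f'} → f ≗ f' → scale c f ≗ scale c f'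
  scale-cong c {f} {f'} e .at n = trans (coef-scale c f n) (trans (cong (c *_) (at e n)) (≡.sym (coef-scale c f' n)))

  X-cong : ∀ {f f'} → f ≗ f' → 0# ∷ f ≗ 0# ∷ f'
  X-cong e .at zero = refl
  X-cong e .at (suc n) = at e n

  lin-cong : ∀ x {f f'} → f ≗ f' → lin x f ≗ lin x f'
  lin-cong x {f} {f'} e = ⊞-cong {0# ∷ f} {0# ∷ f'} (X-cong e) (scale-cong (- x) e)

  ϑ-cong : ∀ {f f'} → f ≗ f' → ϑ f ≗ ϑ f'
  ϑ-cong {f} {f'} e .at n = trans (coef-ϑ f n) (trans (cong (ιK n *_) (at e n)) (≡.sym (coef-ϑ f' n)))

  eval-0 : ∀ f x → (∀ n → coef f n ≡ 0#) → eval f x ≡ 0#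
  eval-0 [] x e = refl
  eval-0 (a ∷ f) x e = trans (cong₂ (λ u v → u + x * v) (e 0) (eval-0 f x (λ n → e (suc n)))) (trans (+-identityˡ _) (zeroʳ x))

  eval-cong : ∀ {f g} x → f ≗ g → eval f x ≡ eval g x
  eval-cong {[]} {g} x e = ≡.sym (eval-0 g x (λ n → ≡.sym (at e n)))
  eval-cong {a ∷ f} {[]} x e = eval-0 (a ∷ f) x (at e)
  eval-cong {a ∷ f} {b ∷ g} x e = cong₂ (λ u v → u + x * v) (at e 0) (eval-cong {f} {g} x ⟪ (λ n → at e (suc n)) ⟫)

  eval-⊞ : ∀ f g x → eval (f ⊞ g) x ≡ eval f x + eval g x
  eval-⊞ [] g x = ≡.sym (+-identityˡ _)
  eval-⊞ (a ∷ f) [] x = ≡.sym (+-identityʳ _)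
  eval-⊞ (a ∷ f) (b ∷ g) x = trans (cong (λ z → a + b + x * z) (eval-⊞ f g x)) (lem a b x (eval f x) (eval g x))
    where
    lem : ∀ a b x u v → a + b + x * (u + v) ≡ (a + x * u) + (b + x * v)
    lem = solveK 5 (λ a b x u v → a :+ b :+ x :* (u :+ v) := (a :+ x :* u) :+ (b :+ x :* v)) refl

  eval-scale : ∀ c f x → eval (scale c f) x ≡ c * eval f x
  eval-scale c [] x = ≡.sym (zeroʳ c)
  eval-scale c (a ∷ f) x = trans (cong (λ z → c * a + x * z) (eval-scale c f x)) (lem a c x (eval f x))
    where
    lem : ∀ a c x u → c * a + x * (c * u) ≡ c * (a + x * u)
    lem = solveK 4 (λ a c x u → c :* a :+ x :* (c :* u) := c :* (a :+ x :* u)) refl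

  eval-X : ∀ f x → eval (0# ∷ f) x ≡ x * eval f x
  eval-X f x = +-identityˡ _

  eval-lin : ∀ y f x → eval (lin y f) x ≡ (x - y) * eval f x
  eval-lin y f x = trans (eval-⊞ (0# ∷ f) (scale (- y) f) x) (trans (cong₂ _+_ (eval-X f x) (eval-scale (- y) f x)) (≡.sym (distribʳ _ x (- y))))

  -- Horner's scheme
  quo : K → Poly → Poly
  quo x [] = []
  quo x (a ∷ f) = eval f x ∷ quo x f

  quo-correct : ∀ x f → eval f x ≡ 0# → f ≗ lin x (quo x f)
  quo-correct x f e .at n = trans (≡.sym (h f n e)) refl
    where
    h' : ∀ f n → coef f (suc n) ≡ coef (quo x f) n + - x * coef (quo x f) (suc n)
    h' [] n = ≡.sym (trans (+-identityˡ _) (zeroʳ _))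
    h' (a ∷ []) n = ≡.sym (lem n)
      where
      lem : ∀ n → coef (0# ∷ []) n + - x * 0# ≡ 0#
      lem zero = trans (+-identityˡ _) (zeroʳ _)
      lem (suc n) = trans (+-identityˡ _) (zeroʳ _)
    h' (a ∷ b ∷ f) zero = lem b x (eval f x)
      where
      lem : ∀ b x u → b ≡ (b + x * u) + - x * u
      lem = solveK 3 (λ b x u → b := (b :+ x :* u) :+ (:- x) :* u) refl
    h' (a ∷ b ∷ f) (suc n) = h' (b ∷ f) n
    h : ∀ f n → eval f x ≡ 0# → coef (lin x (quo x f)) n ≡ coef f n
    h f (suc n) e = trans (coef-lin-s x (quo x f) n) (≡.sym (h' f n))
    h [] zero e = refl
    h (a ∷ f) zero e = trans (coef-lin-0 x (quo x (a ∷ f))) (trans (lem a x (eval f x)) (trans (cong (λ z → a - z) e) (lem2 a)))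
      where
      lem : ∀ a x u → - x * u ≡ a - (a + x * u)
      lem = solveK 3 (λ a x u → (:- x) :* u := a :- (a :+ x :* u)) refl
      lem2 : ∀ a → a - 0# ≡ a
      lem2 = solveK 1 (λ a → a :- :0 := a) refl

  lin-⊞ : ∀ x f g → lin x (f ⊞ g) ≗ lin x f ⊞ lin x g
  lin-⊞ x f g .at zero = begin
    coef (lin x (f ⊞ g)) 0                   ≡⟨ coef-lin-0 x (f ⊞ g) ⟩
    - x * coef (f ⊞ g) 0                     ≡⟨ cong (- x *_) (coef-⊞ f g 0) ⟩
    - x * (coef f 0 + coef g 0)              ≡⟨ distribˡ _ _ _ ⟩
    - x * coef f 0 + - x * coef g 0          ≡⟨ cong₂ _+_ (coef-lin-0 x f) (coef-lin-0 x g) ⟨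
    coef (lin x f) 0 + coef (lin x g) 0      ≡⟨ coef-⊞ (lin x f) (lin x g) 0 ⟨
    coef (lin x f ⊞ lin x g) 0               ∎
  lin-⊞ x f g .at (suc n) = begin
    coef (lin x (f ⊞ g)) (suc n)                                  ≡⟨ coef-lin-s x (f ⊞ g) n ⟩
    coef (f ⊞ g) n + - x * coef (f ⊞ g) (suc n)                   ≡⟨ cong₂ (λ u v → u + - x * v) (coef-⊞ f g n) (coef-⊞ f g (suc n)) ⟩
    (coef f n + coef g n) + - x * (coef f (suc n) + coef g (suc n)) ≡⟨ lem (coef f n) (coef g n) (coef f (suc n)) (coef g (suc n)) x ⟩
    (coef f n + - x * coef f (suc n)) + (coef g n + - x * coef g (suc n))  ≡⟨ cong₂ _+_ (coef-lin-s x f n) (coef-lin-s x g n) ⟨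
    coef (lin x f) (suc n) + coef (lin x g) (suc n)               ≡⟨ coef-⊞ (lin x f) (lin x g) (suc n) ⟨
    coef (lin x f ⊞ lin x g) (suc n)               ∎
    where
    lem : ∀ a b c d x → (a + b) + - x * (c + d) ≡ (a + - x * c) + (b + - x * d)
    lem = solveK 5 (λ a b c d x → (a :+ b) :+ (:- x) :* (c :+ d) := (a :+ (:- x) :* c) :+ (b :+ (:- x) :* d)) refl

  lin-X : ∀ x f → lin x (0# ∷ f) ≗ 0# ∷ lin x f
  lin-X x f .at zero = trans (coef-lin-0 x (0# ∷ f)) (zeroʳ _)
  lin-X x f .at (suc zero) = trans (coef-lin-s x (0# ∷ f) 0) (trans (+-identityˡ _) (≡.sym (coef-lin-0 x f)))
  lin-X x f .at (suc (suc n)) = trans (coef-lin-s x (0# ∷ f) (suc n)) (≡.sym (coef-lin-s x f n))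

  lin-scale : ∀ x c f → lin x (scale c f) ≗ scale c (lin x f)
  lin-scale x c f .at zero = begin
    coef (lin x (scale c f)) 0   ≡⟨ coef-lin-0 x (scale c f) ⟩
    - x * coef (scale c f) 0     ≡⟨ cong (- x *_) (coef-scale c f 0) ⟩
    - x * (c * coef f 0)         ≡⟨ solveK 3 (λ x c u → (:- x) :* (c :* u) := c :* ((:- x) :* u)) refl x c _ ⟩
    c * (- x * coef f 0)         ≡⟨ cong (c *_) (coef-lin-0 x f) ⟨
    c * coef (lin x f) 0         ≡⟨ coef-scale c (lin x f) 0 ⟨
    coef (scale c (lin x f)) 0   ∎
  lin-scale x c f .at (suc n) = begin
    coef (lin x (scale c f)) (suc n)   ≡⟨ coef-lin-s x (scale c f) n ⟩
    coef (scale c f) n + - x * coef (scale c f) (suc n)     ≡⟨ cong₂ (λ u v → u + - x * v) (coef-scale c f n) (coef-scale c f (suc n)) ⟩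
    c * coef f n + - x * (c * coef f (suc n))         ≡⟨ solveK 4 (λ x c u v → c :* u :+ (:- x) :* (c :* v) := c :* (u :+ (:- x) :* v)) refl x c _ _ ⟩
    c * (coef f n + - x * coef f (suc n))         ≡⟨ cong (c *_) (coef-lin-s x f n) ⟨
    c * coef (lin x f) (suc n)         ≡⟨ coef-scale c (lin x f) (suc n) ⟨
    coef (scale c (lin x f)) (suc n)   ∎

  lin-comm : ∀ x y f → lin x (lin y f) ≗ lin y (lin x f)
  lin-comm x y f = ≗-trans (lin-⊞ x (0# ∷ f) (scale (- y) f))
    (⊞-cong {lin x (0# ∷ f)} {0# ∷ lin x f} (lin-X x f) (lin-scale x (- y) f))

  ϑ-lin : ∀ x f → ϑ (lin x f) ≗ (0# ∷ f) ⊞ lin x (ϑ f)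
  ϑ-lin x f .at zero = begin
    coef (ϑ (lin x f)) 0                ≡⟨ coef-ϑ (lin x f) 0 ⟩
    0# * coef (lin x f) 0               ≡⟨ zeroˡ _ ⟩
    0#                                  ≡⟨ solveK 2 (λ x u → :0 := :0 :+ (:- x) :* (:0 :* u)) refl x (coef f 0) ⟩
    0# + - x * (0# * coef f 0)          ≡⟨ cong (λ z → 0# + - x * z) (coef-ϑ f 0) ⟨
    0# + - x * coef (ϑ f) 0             ≡⟨ cong (λ z → 0# + z) (coef-lin-0 x (ϑ f)) ⟨
    0# + coef (lin x (ϑ f)) 0           ≡⟨ coef-⊞ (0# ∷ f) (lin x (ϑ f)) 0 ⟨
    coef ((0# ∷ f) ⊞ lin x (ϑ f)) 0     ∎
  ϑ-lin x f .at (suc n) = begin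
    coef (ϑ (lin x f)) (suc n)                 ≡⟨ coef-ϑ (lin x f) (suc n) ⟩
    ιK (suc n) * coef (lin x f) (suc n)        ≡⟨ cong₂ _*_ (ιK-suc n) (coef-lin-s x f n) ⟩
    (1# + ιK n) * (coef f n + - x * coef f (suc n))   ≡⟨ solveK 4 (λ i x u v → (:1 :+ i) :* (u :+ (:- x) :* v) := u :+ (i :* u :+ (:- x) :* ((:1 :+ i) :* v))) refl (ιK n) x (coef f n) (coef f (suc n)) ⟩
    coef f n + (ιK n * coef f n + - x * ((1# + ιK n) * coef f (suc n)))   ≡⟨ cong (λ z → coef f n + (ιK n * coef f n + - x * (z * coef f (suc n)))) (ιK-suc n) ⟨
    coef f n + (ιK n * coef f n + - x * (ιK (suc n) * coef f (suc n)))   ≡⟨ cong₂ (λ u v → coef f n + (u + - x * v)) (coef-ϑ f n) (coef-ϑ f (suc n)) ⟨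
    coef f n + (coef (ϑ f) n + - x * coef (ϑ f) (suc n))   ≡⟨ cong (coef f n +_) (coef-lin-s x (ϑ f) n) ⟨
    coef f n + coef (lin x (ϑ f)) (suc n)      ≡⟨ coef-⊞ (0# ∷ f) (lin x (ϑ f)) (suc n) ⟨
    coef ((0# ∷ f) ⊞ lin x (ϑ f)) (suc n)      ∎

  linᵏ : K → ℕ → Poly → Poly
  linᵏ x zero f = f
  linᵏ x (suc k) f = lin x (linᵏ x k f)

  linᵏ-cong : ∀ x k {f f'} → f ≗ f' → linᵏ x k f ≗ linᵏ x k f'
  linᵏ-cong x zero e = e
  linᵏ-cong x (suc k) e = lin-cong x (linᵏ-cong x k e)

  lin-linᵏ : ∀ x y k f → lin x (linᵏ y k f) ≗ linᵏ y k (lin x f)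
  lin-linᵏ x y zero f .at n = refl
  lin-linᵏ x y (suc k) f = ≗-trans (lin-comm x y (linᵏ y k f)) (lin-cong y (lin-linᵏ x y k f))

  linᵏ-⊞ : ∀ x k f g → linᵏ x k (f ⊞ g) ≗ linᵏ x k f ⊞ linᵏ x k g
  linᵏ-⊞ x zero f g .at n = refl
  linᵏ-⊞ x (suc k) f g = ≗-trans (lin-cong x (linᵏ-⊞ x k f g)) (lin-⊞ x (linᵏ x k f) (linᵏ x k g))

  linᵏ-X : ∀ x k f → linᵏ x k (0# ∷ f) ≗ 0# ∷ linᵏ x k f
  linᵏ-X x zero f .at n = refl
  linᵏ-X x (suc k) f = ≗-trans (lin-cong x (linᵏ-X x k f)) (lin-X x (linᵏ x k f))

  linᵏ-scale : ∀ x k c f → linᵏ x k (scale c f) ≗ scale c (linᵏ x k f)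
  linᵏ-scale x zero c f .at n = refl
  linᵏ-scale x (suc k) c f = ≗-trans (lin-cong x (linᵏ-scale x k c f)) (lin-scale x c (linᵏ x k f))

  eval-linᵏ : ∀ y k f x → eval (linᵏ y k f) x ≡ (x - y) ^ k * eval f x
  eval-linᵏ y zero f x = ≡.sym (*-identityˡ _)
  eval-linᵏ y (suc k) f x = trans (eval-lin y (linᵏ y k f) x) (trans (cong ((x - y) *_) (eval-linᵏ y k f x)) (≡.sym (*-assoc _ _ _)))

  -- Leibniz' rule, using ϑ(X - x) = X: one application of `ϑ` lowers the order of vanishing at x by
  -- at most one.
  ϑ-linᵏ : ∀ x k f → ϑ (linᵏ x (suc k) f) ≗ linᵏ x k (scale (ιK (suc k)) (0# ∷ f) ⊞ lin x (ϑ f))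
  ϑ-linᵏ x zero f = ≗-trans (ϑ-lin x f) (⊞-cong {0# ∷ f} {scale 1# (0# ∷ f)} {lin x (ϑ f)} {lin x (ϑ f)} ⟪ (λ n → ≡.sym (trans (coef-scale 1# (0# ∷ f) n) (*-identityˡ _))) ⟫ ⟪ (λ _ → refl) ⟫)
  ϑ-linᵏ x (suc k) f .at n = begin
    coef (ϑ (lin x h)) n                           ≡⟨ at (ϑ-lin x h) n ⟩
    coef ((0# ∷ h) ⊞ lin x (ϑ h)) n                ≡⟨ coef-⊞ (0# ∷ h) (lin x (ϑ h)) n ⟩
    coef (0# ∷ h) n + coef (lin x (ϑ h)) n         ≡⟨ cong₂ _+_ (≡.sym (at (linᵏ-X x (suc k) f) n)) (at (lin-cong x (ϑ-linᵏ x k f)) n) ⟩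
    coef (linᵏ x (suc k) (0# ∷ f)) n + coef (linᵏ x (suc k) u) n   ≡⟨ coef-⊞ (linᵏ x (suc k) (0# ∷ f)) (linᵏ x (suc k) u) n ⟨
    coef (linᵏ x (suc k) (0# ∷ f) ⊞ linᵏ x (suc k) u) n   ≡⟨ at (linᵏ-⊞ x (suc k) (0# ∷ f) u) n ⟨
    coef (linᵏ x (suc k) ((0# ∷ f) ⊞ u)) n   ≡⟨ at (linᵏ-cong x (suc k) eq) n ⟩
    coef (linᵏ x (suc k) (scale (ιK (suc (suc k))) (0# ∷ f) ⊞ lin x (ϑ f))) n ∎
    where
    h = linᵏ x (suc k) f
    u = scale (ιK (suc k)) (0# ∷ f) ⊞ lin x (ϑ f)
    eq : (0# ∷ f) ⊞ u ≗ scale (ιK (suc (suc k))) (0# ∷ f) ⊞ lin x (ϑ f)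
    eq .at n = begin
      coef ((0# ∷ f) ⊞ u) n    ≡⟨ coef-⊞ (0# ∷ f) u n ⟩
      a + coef u n             ≡⟨ cong (a +_) (coef-⊞ (scale (ιK (suc k)) (0# ∷ f)) (lin x (ϑ f)) n) ⟩
      a + (coef (scale (ιK (suc k)) (0# ∷ f)) n + b)     ≡⟨ cong (λ z → a + (z + b)) (coef-scale (ιK (suc k)) (0# ∷ f) n) ⟩
      a + (ιK (suc k) * a + b)     ≡⟨ solveK 3 (λ a i b → a :+ (i :* a :+ b) := (:1 :+ i) :* a :+ b) refl a (ιK (suc k)) b ⟩
      ιK (suc (suc k)) * a + b     ≡⟨ cong (_+ b) (coef-scale (ιK (suc (suc k))) (0# ∷ f) n) ⟨
      coef (scale (ιK (suc (suc k))) (0# ∷ f)) n + b     ≡⟨ coef-⊞ (scale (ιK (suc (suc k))) (0# ∷ f)) (lin x (ϑ f)) n ⟨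
      coef (scale (ιK (suc (suc k))) (0# ∷ f) ⊞ lin x (ϑ f)) n ∎
      where
      a = coef (0# ∷ f) n
      b = coef (lin x (ϑ f)) n

  -- Degree less than n, expressed by coefficients because the length of the list is only an upper
  -- bound.
  Bd : ℕ → Poly → Set
  Bd n f = ∀ k → n ℕ.≤ k → coef f k ≡ 0#

  Bd-length : ∀ f → Bd (length f) f
  Bd-length [] k _ = refl
  Bd-length (a ∷ f) (suc k) (s≤s h) = Bd-length f k h

  Bd-cong : ∀ {n f g} → f ≗ g → Bd n f → Bd n g
  Bd-cong e b k h = trans (≡.sym (at e k)) (b k h)

  Bd-mono : ∀ {m n f} → m ℕ.≤ n → Bd m f → Bd n f
  Bd-mono m≤n b k h = b k (ℕₚ.≤-trans m≤n h)

  Bd-⊞ : ∀ {n} f g → Bd n f → Bd n g → Bd n (f ⊞ g)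
  Bd-⊞ f g b b' k h = trans (coef-⊞ f g k) (trans (cong₂ _+_ (b k h) (b' k h)) (+-identityˡ _))

  Bd-scale : ∀ {n} c f → Bd n f → Bd n (scale c f)
  Bd-scale c f b k h = trans (coef-scale c f k) (trans (cong (c *_) (b k h)) (zeroʳ c))

  Bd-X : ∀ {n} f → Bd n f → Bd (suc n) (0# ∷ f)
  Bd-X f b (suc k) (s≤s h) = b k h

  Bd-lin : ∀ {n} x f → Bd n f → Bd (suc n) (lin x f)
  Bd-lin {n} x f b = Bd-⊞ (0# ∷ f) (scale (- x) f) (Bd-X f b) (Bd-mono {n} {suc n} {scale (- x) f} (ℕₚ.n≤1+n n) (Bd-scale (- x) f b))

  Bd-linᵏ : ∀ {n} x k f → Bd n f → Bd (k ℕ.+ n) (linᵏ x k f)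
  Bd-linᵏ x zero f b = b
  Bd-linᵏ x (suc k) f b = Bd-lin x (linᵏ x k f) (Bd-linᵏ x k f b)

  Bd-ϑ : ∀ {n} f → Bd n f → Bd n (ϑ f)
  Bd-ϑ f b k h = trans (coef-ϑ f k) (trans (cong (ιK k *_) (b k h)) (zeroʳ _))

  -- Downward induction from the length of g: the coefficient g_k equals the coefficient of X^(k+1)
  -- in (X - x) g plus x g_(k+1), and both vanish.
  Bd-down : ∀ {n} x g → Bd (suc n) (lin x g) → Bd n g
  Bd-down {n} x g b k n≤k = go (length g) k n≤k (ℕₚ.m≤n+m (length g) k)
    where
    go : ∀ j k → n ℕ.≤ k → length g ℕ.≤ k ℕ.+ j → coef g k ≡ 0#
    go zero k h l = Bd-length g k (≡.subst (length g ℕ.≤_) (ℕₚ.+-identityʳ k) l)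
    go (suc j) k h l = begin
      coef g k                                   ≡⟨ solveK 2 (λ a x → a := a :+ (:- x) :* :0) refl (coef g k) x ⟩
      coef g k + - x * 0#                        ≡⟨ cong (λ z → coef g k + - x * z) (go j (suc k) (ℕₚ.m≤n⇒m≤1+n h) (≡.subst (length g ℕ.≤_) (ℕₚ.+-suc k j) l)) ⟨
      coef g k + - x * coef g (suc k)            ≡⟨ coef-lin-s x g k ⟨
      coef (lin x g) (suc k)                     ≡⟨ b (suc k) (s≤s h) ⟩
      0#                                         ∎

  Bd-downᵏ : ∀ {n} x k g → Bd (k ℕ.+ n) (linᵏ x k g) → Bd n g
  Bd-downᵏ x zero g b = b
  Bd-downᵏ x (suc k) g b = Bd-downᵏ x k g (Bd-down x (linᵏ x k g) b)

  Zero : Poly → Set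
  Zero f = ∀ n → coef f n ≡ 0#

  Bd⇒Zero : ∀ {f} → Bd 0 f → Zero f
  Bd⇒Zero b n = b n z≤n

  Zero-linᵏ : ∀ x k g → Zero g → Zero (linᵏ x k g)
  Zero-linᵏ x zero g z = z
  Zero-linᵏ x (suc k) g z zero = trans (coef-lin-0 x (linᵏ x k g)) (trans (cong (- x *_) (Zero-linᵏ x k g z 0)) (zeroʳ _))
  Zero-linᵏ x (suc k) g z (suc n) = trans (coef-lin-s x (linᵏ x k g) n) (trans (cong₂ (λ u v → u + - x * v) (Zero-linᵏ x k g z n) (Zero-linᵏ x k g z (suc n))) (trans (+-identityˡ _) (zeroʳ _)))

  Zero-linᵏ⁻ : ∀ x k g → Zero (linᵏ x k g) → Zero g
  Zero-linᵏ⁻ x k g z = Bd⇒Zero {g} (Bd-downᵏ {0} x k g (λ n _ → z n))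

  lin-cancel : ∀ x f g → lin x f ≗ lin x g → f ≗ g
  lin-cancel x f g e .at n = x-y≡0⇒x≡y (begin
    coef f n - coef g n               ≡⟨ solveK 2 (λ a b → a :- b := a :+ (:- :1) :* b) refl (coef f n) (coef g n) ⟩
    coef f n + - 1# * coef g n        ≡⟨ cong (coef f n +_) (coef-scale (- 1#) g n) ⟨
    coef f n + coef (scale (- 1#) g) n        ≡⟨ coef-⊞ f (scale (- 1#) g) n ⟨
    coef (f ⊞ scale (- 1#) g) n       ≡⟨ Zero-linᵏ⁻ x 1 (f ⊞ scale (- 1#) g) z n ⟩
    0#                                ∎)
    where
    z : Zero (lin x (f ⊞ scale (- 1#) g))
    z m = begin
      coef (lin x (f ⊞ scale (- 1#) g)) m          ≡⟨ at (lin-⊞ x f (scale (- 1#) g)) m ⟩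
      coef (lin x f ⊞ lin x (scale (- 1#) g)) m    ≡⟨ coef-⊞ (lin x f) (lin x (scale (- 1#) g)) m ⟩
      coef (lin x f) m + coef (lin x (scale (- 1#) g)) m ≡⟨ cong₂ _+_ (at e m) (trans (at (lin-scale x (- 1#) g) m) (coef-scale (- 1#) (lin x g) m)) ⟩
      coef (lin x g) m + - 1# * coef (lin x g) m ≡⟨ solveK 1 (λ a → a :+ (:- :1) :* a := :0) refl (coef (lin x g) m) ⟩
      0# ∎

  Div : K → ℕ → Poly → Set
  Div x k f = Σ Poly λ g → f ≗ linᵏ x k g

  x≢y⇒x-y≢0 : ∀ {x y : K} → ¬ x ≡ y → ¬ x - y ≡ 0#
  x≢y⇒x-y≢0 ne e = ne (x-y≡0⇒x≡y e)

  -- If (X - x) g = (X - y)^k h, evaluation at x shows h(x) = 0, since x - y is invertible. Hence X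
  -- - x splits off h and can be cancelled on both sides.
  div-lin : ∀ {x y} k g → ¬ x ≡ y → Div y k (lin x g) → Div y k g
  div-lin {x} {y} k g ne (h , e) = quo x h , lin-cancel x g (linᵏ y k (quo x h))
    (≗-trans e
     (≗-trans (linᵏ-cong y k (quo-correct x h hx)) (≗-sym {lin x (linᵏ y k (quo x h))} (lin-linᵏ x y k (quo x h)))))
    where
    hx : eval h x ≡ 0#
    hx = zero-div {(x - y) ^ k} (begin
      (x - y) ^ k * eval h x   ≡⟨ eval-linᵏ y k h x ⟨
      eval (linᵏ y k h) x      ≡⟨ eval-cong {lin x g} {linᵏ y k h} x e ⟨
      eval (lin x g) x         ≡⟨ eval-lin x g x ⟩
      (x - x) * eval g x       ≡⟨ cong (_* eval g x) (-‿inverseʳ x) ⟩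
      0# * eval g x            ≡⟨ zeroˡ _ ⟩
      0#                       ∎) (^-≢0 k (x≢y⇒x-y≢0 ne))

  div-linᵏ : ∀ {x y} j k g → ¬ x ≡ y → Div y k (linᵏ x j g) → Div y k g
  div-linᵏ zero k g ne d = d
  div-linᵏ {x} (suc j) k g ne d = div-linᵏ j k g ne (div-lin k (linᵏ x j g) ne d)

  -- After division by (X - x)^D the other points remain D-fold roots of the quotient, and the
  -- degree has dropped by D; induction leaves a polynomial of degree less than 0.
  root-bound : ∀ D xs → Unique xs → ∀ f n → All (λ x → Div x D f) xs → Bd n f → n ℕ.≤ D ℕ.* length xs → Zero f
  root-bound D [] _ f n _ b n≤ = Bd⇒Zero {f} (Bd-mono {n} {0} {f} (ℕₚ.≤-trans n≤ (ℕₚ.≤-reflexive (ℕₚ.*-zeroʳ D))) b)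
  root-bound D (x ∷ xs) (x∉ ∷ u) f n ((g , e) ∷ ds) b n≤ k = trans (at e k) (Zero-linᵏ x D g zg k)
    where
    n' = D ℕ.* length xs
    bg : Bd n' g
    bg = Bd-downᵏ x D g (Bd-cong {f = f} {linᵏ x D g} e (Bd-mono {n} {D ℕ.+ n'} {f} (ℕₚ.≤-trans n≤ (ℕₚ.≤-reflexive (ℕₚ.*-suc D (length xs)))) b))
    go : ∀ ys → All (λ y → ¬ x ≡ y) ys → All (λ y → Div y D f) ys → All (λ y → Div y D g) ys
    go [] [] [] = []
    go (y ∷ ys) (ne ∷ nes) ((h , eh) ∷ ds) = div-linᵏ D D g ne (h , ≗-trans (≗-sym e) eh) ∷ go ys nes ds
    zg : Zero g
    zg = root-bound D xs u g n' (go xs x∉ ds) bg ℕₚ.≤-refl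

  eval-single : ∀ f e → (∀ n → ¬ n ≡ e → coef f n ≡ 0#) → eval f 1# ≡ coef f e
  eval-single [] e h = refl
  eval-single (a ∷ f) zero h = trans (cong (λ z → a + 1# * z) (eval-0 f 1# (λ n → h (suc n) λ ()))) (solveK 1 (λ a → a :+ :1 :* :0 := a) refl a)
  eval-single (a ∷ f) (suc e) h = trans (cong₂ (λ u v → u + 1# * v) (h 0 λ ()) (eval-single f e (λ n ne → h (suc n) (λ q → ne (ℕₚ.suc-injective q))))) (trans (+-identityˡ _) (*-identityˡ _))

  ιK-inj : ∀ {m n} → m ℕ.< p → n ℕ.< p → ιK m ≡ ιK n → m ≡ n
  ιK-inj {m} {n} m< n< e = []-inj-< m< n< (trans (≡.sym (ιK-[] m)) (trans e (ιK-[] n)))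

  -- Each factor ϑ - e of the operator Π (ϑ - e) kills one monomial and lowers the order of vanishing at 1 by at most one.
  few-terms : ∀ es → All (ℕ._< p) es → ∀ f k → length es ℕ.≤ k → Div 1# k f → (∀ n → n ∉ es → coef f n ≡ 0#) → Zero f
  few-terms [] _ f k _ _ supp n = supp n λ ()
  few-terms (e ∷ es) (e<p ∷ es<p) f (suc k) (s≤s l) (g , eq) supp n = res n
    where
    f' = ϑ f ⊞ scale (- ιK e) f
    cf' : ∀ m → coef f' m ≡ (ιK m - ιK e) * coef f m
    cf' m = trans (coef-⊞ (ϑ f) _ m) (trans (cong₂ _+_ (coef-ϑ f m) (coef-scale (- ιK e) f m)) (≡.sym (distribʳ _ _ _)))
    d' : Div 1# k f'
    d' = (u ⊞ scale (- ιK e) (lin 1# g)) , ⟪ (λ m → begin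
      coef f' m  ≡⟨ coef-⊞ (ϑ f) _ m ⟩
      coef (ϑ f) m + coef (scale (- ιK e) f) m  ≡⟨ cong₂ _+_ (trans (at (ϑ-cong eq) m) (at (ϑ-linᵏ 1# k g) m)) (at (scale-cong (- ιK e) eq) m) ⟩
      coef (linᵏ 1# k u) m + coef (scale (- ιK e) (lin 1# (linᵏ 1# k g))) m  ≡⟨ cong (coef (linᵏ 1# k u) m +_) (trans (at (scale-cong (- ιK e) (lin-linᵏ 1# 1# k g)) m) (≡.sym (at (linᵏ-scale 1# k (- ιK e) (lin 1# g)) m))) ⟩
      coef (linᵏ 1# k u) m + coef (linᵏ 1# k (scale (- ιK e) (lin 1# g))) m  ≡⟨ coef-⊞ (linᵏ 1# k u) _ m ⟨
      coef (linᵏ 1# k u ⊞ linᵏ 1# k (scale (- ιK e) (lin 1# g))) m  ≡⟨ at (linᵏ-⊞ 1# k u (scale (- ιK e) (lin 1# g))) m ⟨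
      coef (linᵏ 1# k (u ⊞ scale (- ιK e) (lin 1# g))) m ∎) ⟫
      where u = scale (ιK (suc k)) (0# ∷ g) ⊞ lin 1# (ϑ g)
    supp' : ∀ m → m ∉ es → coef f' m ≡ 0#
    supp' m m∉ with m ℕₚ.≟ e
    ... | yes refl = trans (cf' m) (trans (cong (_* coef f m) (-‿inverseʳ (ιK m))) (zeroˡ _))
    ... | no m≢e = trans (cf' m) (trans (cong ((ιK m - ιK e) *_) (supp m λ { (here q) → m≢e q ; (there q) → m∉ q })) (zeroʳ _))
    z' : Zero f'
    z' = few-terms es es<p f' k l d' supp'
    offe : ∀ m → ¬ m ≡ e → coef f m ≡ 0#
    offe m m≢e with Data.List.Membership.DecPropositional._∈?_ ℕₚ._≟_ m es
      where import Data.List.Membership.DecPropositional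
    -- Distinct exponents below p stay distinct in the field, so the factor by which the operator
    -- multiplied this coefficient is invertible.
    ... | yes m∈ = zero-div (trans (≡.sym (cf' m)) (z' m)) (x≢y⇒x-y≢0 (λ q → m≢e (ιK-inj (All.lookup es<p m∈) e<p q)))
    ... | no m∉ = supp m λ { (here q) → m≢e q ; (there q) → m∉ q }
    -- Only the monomial with exponent e can be left, and its coefficient is the value of f at 1,
    -- which is 0.
    res : ∀ m → coef f m ≡ 0#
    res m with m ℕₚ.≟ e
    ... | no ne = offe m ne
    ... | yes refl = trans (≡.sym (eval-single f m offe)) (begin
      eval f 1#                         ≡⟨ eval-cong {f} {linᵏ 1# (suc k) g} 1# eq ⟩
      eval (lin 1# (linᵏ 1# k g)) 1#    ≡⟨ eval-lin 1# (linᵏ 1# k g) 1# ⟩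
      (1# - 1#) * eval (linᵏ 1# k g) 1# ≡⟨ cong (_* eval (linᵏ 1# k g) 1#) (-‿inverseʳ 1#) ⟩
      0# * eval (linᵏ 1# k g) 1#        ≡⟨ zeroˡ _ ⟩
      0#                                ∎)

-- Stepanov's method

module _ where
 open import Data.Nat using (ℕ)
 open import Data.Nat.Primality using (Prime)
 module Stepanov (p : ℕ) (pr : Prime p) where
  open PrimeField p pr
  open Polynomials p pr
  open import Data.Nat as ℕ using (zero; suc; z≤n; s≤s; _/_; _%_; NonZero)
  import Data.Nat.Properties as ℕₚ
  import Data.Nat.DivMod as DM
  open import Data.Fin as F using (Fin; toℕ; fromℕ<; combine; remQuot; finToFun; funToFin)
  import Data.Fin.Properties as Fₚ
  open import Data.List using (List; []; _∷_; map; length; applyUpTo; upTo; _++_)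
  import Data.List.Properties as Lₚ
  open import Data.List.Membership.Propositional using (_∈_; _∉_)
  open import Data.List.Membership.Propositional.Properties using (∈-++⁺ˡ; ∈-++⁺ʳ; ∈-map⁺; ∈-upTo⁺; ∈-upTo⁻)
  open import Data.List.Relation.Unary.All as All using (All; []; _∷_)
  import Data.List.Relation.Unary.All.Properties as Allₚ
  open import Data.List.Relation.Unary.Unique.Propositional using (Unique)
  open import Data.Product using (Σ; _,_; proj₁; proj₂; _×_)
  open import Relation.Nullary using (¬_; yes; no; contradiction)
  open import Relation.Binary.PropositionalEquality as ≡ using (_≡_; refl; cong; cong₂; trans; module ≡-Reasoning)
  open ≡-Reasoning

  it : (Poly → Poly) → ℕ → Poly → Poly
  it O zero f = f
  it O (suc m) f = it O m (O f)

  it-cong : ∀ {O} → (∀ {f g} → f ≗ g → O f ≗ O g) → ∀ m {f g} → f ≗ g → it O m f ≗ it O m g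
  it-cong c zero e = e
  it-cong c (suc m) e = it-cong c m (c e)

  it-⊞ : ∀ {O} → (∀ {f g} → f ≗ g → O f ≗ O g) → (∀ f g → O (f ⊞ g) ≗ O f ⊞ O g) → ∀ m f g → it O m (f ⊞ g) ≗ it O m f ⊞ it O m g
  it-⊞ c a zero f g = ⟪ (λ _ → refl) ⟫
  it-⊞ {O} c a (suc m) f g = ≗-trans (it-cong c m (a f g)) (it-⊞ c a m (O f) (O g))

  -- The derivation X (X - 1) d/dX. It multiplies X^a (X - 1)^b by the polynomial a (X - 1) + b X,
  -- so no denominators arise.
  δ : Poly → Poly
  δ f = lin 1# (ϑ f)

  δ-cong : ∀ {f g} → f ≗ g → δ f ≗ δ g
  δ-cong e = lin-cong 1# (ϑ-cong e)

  module Multiplicity (x : K) where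

    -- Explicitly k! (x (x - 1))^k: the factor with which k applications of `δ` turn (X - x)^k g
    -- into a value at x.
    lead : ℕ → K
    lead zero = 1#
    lead (suc k) = lead k * ((x - 1#) * (ιK (suc k) * x))

    eval-δᵏ : ∀ k g → eval (it δ k (linᵏ x k g)) x ≡ lead k * eval g x
    eval-δᵏ zero g = ≡.sym (*-identityˡ _)
    eval-δᵏ (suc k) g = begin
      eval (it δ k (δ (linᵏ x (suc k) g))) x      ≡⟨ eval-cong x (it-cong δ-cong k (≗-trans (lin-cong 1# (ϑ-linᵏ x k g)) (lin-linᵏ 1# x k h))) ⟩
      eval (it δ k (linᵏ x k (lin 1# h))) x       ≡⟨ eval-δᵏ k (lin 1# h) ⟩
      lead k * eval (lin 1# h) x                  ≡⟨ cong (lead k *_) (eval-lin 1# h x) ⟩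
      lead k * ((x - 1#) * eval h x)              ≡⟨ cong (λ z → lead k * ((x - 1#) * z)) eh ⟩
      lead k * ((x - 1#) * (ιK (suc k) * (x * eval g x)))  ≡⟨ solveK 5 (λ l y i x e → l :* (y :* (i :* (x :* e))) := l :* (y :* (i :* x)) :* e) refl (lead k) (x - 1#) (ιK (suc k)) x (eval g x) ⟩
      lead (suc k) * eval g x                     ∎
      where
      h = scale (ιK (suc k)) (0# ∷ g) ⊞ lin x (ϑ g)
      eh : eval h x ≡ ιK (suc k) * (x * eval g x)
      eh = begin
        eval h x    ≡⟨ eval-⊞ (scale (ιK (suc k)) (0# ∷ g)) (lin x (ϑ g)) x ⟩
        eval (scale (ιK (suc k)) (0# ∷ g)) x + eval (lin x (ϑ g)) x ≡⟨ cong₂ _+_ (trans (eval-scale (ιK (suc k)) (0# ∷ g) x) (cong (ιK (suc k) *_) (eval-X g x))) (eval-lin x (ϑ g) x) ⟩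
        ιK (suc k) * (x * eval g x) + (x - x) * eval (ϑ g) x ≡⟨ solveK 3 (λ a x b → a :+ (x :- x) :* b := a) refl _ x _ ⟩
        ιK (suc k) * (x * eval g x) ∎

    module _ (x≢0 : ¬ x ≡ 0#) (x≢1 : ¬ x ≡ 1#) where

      lead≢0 : ∀ k → k ℕ.< p → ¬ lead k ≡ 0#
      lead≢0 zero _ = 1≢0
      lead≢0 (suc k) k<p = *-≢0 (lead≢0 k (ℕₚ.<-trans (ℕₚ.n<1+n k) k<p)) (*-≢0 (x≢y⇒x-y≢0 x≢1) (*-≢0 (λ e → []≢0 (suc k) (s≤s z≤n) k<p (trans (≡.sym (ιK-[] (suc k))) e)) x≢0))

      -- If (X - x)^D already divides f with quotient g, the D-th derivative at x equals `lead D`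
      -- times g(x). For x different from 0 and 1 and orders below p this factor is invertible, so
      -- g(x) = 0 and one more factor splits off.
      δ-vanish : ∀ D → D ℕ.≤ p → ∀ f → (∀ m → m ℕ.< D → eval (it δ m f) x ≡ 0#) → Div x D f
      δ-vanish zero _ f _ = f , ⟪ (λ _ → refl) ⟫
      δ-vanish (suc D) D<p f h with δ-vanish D (ℕₚ.<⇒≤ D<p) f (λ m l → h m (ℕₚ.<-trans l (ℕₚ.n<1+n D)))
      ... | g , e = quo x g , ≗-trans e (≗-trans (linᵏ-cong x D (quo-correct x g gx)) (≗-sym (lin-linᵏ x x D (quo x g))))
        where
        gx : eval g x ≡ 0#
        gx = zero-div {lead D} (trans (≡.sym (eval-δᵏ D g)) (trans (eval-cong x (it-cong δ-cong D (≗-sym e))) (h D ℕₚ.≤-refl))) (lead≢0 D D<p)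

  -- The conjugate of `δ` by X^u (X - 1)^v: applying `δ` to X^u (X - 1)^v f gives X^u (X - 1)^v
  -- times `Dᵤ u v f`. Here u and v are field elements, only their residues matter.
  Dᵤ : K → K → Poly → Poly
  Dᵤ u v f = δ f ⊞ (scale u (lin 1# f) ⊞ scale v (0# ∷ f))

  Dᵤ-cong : ∀ u v {f g} → f ≗ g → Dᵤ u v f ≗ Dᵤ u v g
  Dᵤ-cong u v e = ⊞-cong (δ-cong e) (⊞-cong (scale-cong u (lin-cong 1# e)) (scale-cong v (X-cong e)))

  ϑ-⊞ : ∀ f g → ϑ (f ⊞ g) ≗ ϑ f ⊞ ϑ g
  ϑ-⊞ f g .at n = begin
    coef (ϑ (f ⊞ g)) n                 ≡⟨ coef-ϑ (f ⊞ g) n ⟩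
    ιK n * coef (f ⊞ g) n              ≡⟨ cong (ιK n *_) (coef-⊞ f g n) ⟩
    ιK n * (coef f n + coef g n)       ≡⟨ distribˡ _ _ _ ⟩
    ιK n * coef f n + ιK n * coef g n  ≡⟨ cong₂ _+_ (coef-ϑ f n) (coef-ϑ g n) ⟨
    coef (ϑ f) n + coef (ϑ g) n        ≡⟨ coef-⊞ (ϑ f) (ϑ g) n ⟨
    coef (ϑ f ⊞ ϑ g) n                 ∎

  scale-⊞ : ∀ c f g → scale c (f ⊞ g) ≗ scale c f ⊞ scale c g
  scale-⊞ c f g .at n = begin
    coef (scale c (f ⊞ g)) n                 ≡⟨ coef-scale c (f ⊞ g) n ⟩
    c * coef (f ⊞ g) n              ≡⟨ cong (c *_) (coef-⊞ f g n) ⟩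
    c * (coef f n + coef g n)       ≡⟨ distribˡ _ _ _ ⟩
    c * coef f n + c * coef g n  ≡⟨ cong₂ _+_ (coef-scale c f n) (coef-scale c g n) ⟨
    coef (scale c f) n + coef (scale c g) n        ≡⟨ coef-⊞ (scale c f) (scale c g) n ⟨
    coef (scale c f ⊞ scale c g) n                 ∎

  X-⊞ : ∀ f g → 0# ∷ (f ⊞ g) ≗ (0# ∷ f) ⊞ (0# ∷ g)
  X-⊞ f g .at zero = ≡.sym (+-identityˡ _)
  X-⊞ f g .at (suc n) = refl

  ⊞-swap : ∀ a b c d → (a ⊞ b) ⊞ (c ⊞ d) ≗ (a ⊞ c) ⊞ (b ⊞ d)
  ⊞-swap a b c d .at n = begin
    coef ((a ⊞ b) ⊞ (c ⊞ d)) n   ≡⟨ e a b c d ⟩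
    (coef a n + coef b n) + (coef c n + coef d n)  ≡⟨ solveK 4 (λ a b c d → (a :+ b) :+ (c :+ d) := (a :+ c) :+ (b :+ d)) refl (coef a n) (coef b n) (coef c n) (coef d n) ⟩
    (coef a n + coef c n) + (coef b n + coef d n)  ≡⟨ e a c b d ⟨
    coef ((a ⊞ c) ⊞ (b ⊞ d)) n   ∎
    where
    e : ∀ a b c d → coef ((a ⊞ b) ⊞ (c ⊞ d)) n ≡ (coef a n + coef b n) + (coef c n + coef d n)
    e a b c d = trans (coef-⊞ (a ⊞ b) (c ⊞ d) n) (cong₂ _+_ (coef-⊞ a b n) (coef-⊞ c d n))

  Dᵤ-⊞ : ∀ u v f g → Dᵤ u v (f ⊞ g) ≗ Dᵤ u v f ⊞ Dᵤ u v g
  Dᵤ-⊞ u v f g = ≗-trans (⊞-cong (≗-trans (lin-cong 1# (ϑ-⊞ f g)) (lin-⊞ 1# (ϑ f) (ϑ g)))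
      (≗-trans (⊞-cong (≗-trans (scale-cong u (lin-⊞ 1# f g)) (scale-⊞ u (lin 1# f) (lin 1# g))) (≗-trans (scale-cong v (X-⊞ f g)) (scale-⊞ v (0# ∷ f) (0# ∷ g))))
        (⊞-swap (scale u (lin 1# f)) (scale u (lin 1# g)) (scale v (0# ∷ f)) (scale v (0# ∷ g)))))
    (⊞-swap (δ f) (δ g) (scale u (lin 1# f) ⊞ scale v (0# ∷ f)) (scale u (lin 1# g) ⊞ scale v (0# ∷ g)))

  coef-Dᵤ : ∀ u v f n → coef (Dᵤ u v f) n ≡ coef (δ f) n + (u * coef (lin 1# f) n + v * coef (0# ∷ f) n)
  coef-Dᵤ u v f n = trans (coef-⊞ (δ f) _ n) (cong (coef (δ f) n +_) (trans (coef-⊞ (scale u (lin 1# f)) (scale v (0# ∷ f)) n) (cong₂ _+_ (coef-scale u (lin 1# f) n) (coef-scale v (0# ∷ f) n))))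

  ϑ-X : ∀ f → ϑ (0# ∷ f) ≗ 0# ∷ (f ⊞ ϑ f)
  ϑ-X f .at zero = zeroʳ _
  ϑ-X f .at (suc n) = begin
    coef (ϑ (0# ∷ f)) (suc n)  ≡⟨ coef-ϑ (0# ∷ f) (suc n) ⟩
    ιK (suc n) * coef f n      ≡⟨ cong (_* coef f n) (ιK-suc n) ⟩
    (1# + ιK n) * coef f n     ≡⟨ solveK 2 (λ i u → (:1 :+ i) :* u := u :+ i :* u) refl (ιK n) (coef f n) ⟩
    coef f n + ιK n * coef f n ≡⟨ cong (coef f n +_) (coef-ϑ f n) ⟨
    coef f n + coef (ϑ f) n    ≡⟨ coef-⊞ f (ϑ f) n ⟨
    coef (f ⊞ ϑ f) n           ∎

  Dᵤ-X : ∀ u v f → Dᵤ u v (0# ∷ f) ≗ 0# ∷ Dᵤ (1# + u) v f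
  Dᵤ-X u v f = ≗-trans (⊞-cong (≗-trans (lin-cong 1# (ϑ-X f)) (lin-X 1# (f ⊞ ϑ f))) (⊞-cong {g = scale v (0# ∷ 0# ∷ f)} {scale v (0# ∷ 0# ∷ f)} (scale-cong u (lin-X 1# f)) ⟪ (λ _ → refl) ⟫)) ⟪ go ⟫
    where
    go : ∀ n → coef ((0# ∷ lin 1# (f ⊞ ϑ f)) ⊞ (scale u (0# ∷ lin 1# f) ⊞ scale v (0# ∷ (0# ∷ f)))) n ≡ coef (0# ∷ Dᵤ (1# + u) v f) n
    go zero = solveK 2 (λ u v → :0 :+ (u :* :0 :+ v :* :0) := :0) refl u v
    go (suc n) = begin
      coef (lin 1# (f ⊞ ϑ f) ⊞ (scale u (lin 1# f) ⊞ scale v (0# ∷ f))) n  ≡⟨ trans (coef-⊞ (lin 1# (f ⊞ ϑ f)) _ n) (cong (coef (lin 1# (f ⊞ ϑ f)) n +_) (trans (coef-⊞ (scale u (lin 1# f)) (scale v (0# ∷ f)) n) (cong₂ _+_ (coef-scale u (lin 1# f) n) (coef-scale v (0# ∷ f) n)))) ⟩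
      coef (lin 1# (f ⊞ ϑ f)) n + (u * coef (lin 1# f) n + v * coef (0# ∷ f) n)  ≡⟨ cong (_+ (u * coef (lin 1# f) n + v * coef (0# ∷ f) n)) (trans (at (lin-⊞ 1# f (ϑ f)) n) (coef-⊞ (lin 1# f) (δ f) n)) ⟩
      coef (lin 1# f) n + coef (δ f) n + (u * coef (lin 1# f) n + v * coef (0# ∷ f) n) ≡⟨ solveK 4 (λ l d u w → l :+ d :+ (u :* l :+ w) := d :+ ((:1 :+ u) :* l :+ w)) refl (coef (lin 1# f) n) (coef (δ f) n) u _ ⟩
      coef (δ f) n + ((1# + u) * coef (lin 1# f) n + v * coef (0# ∷ f) n) ≡⟨ coef-Dᵤ (1# + u) v f n ⟨
      coef (Dᵤ (1# + u) v f) n ∎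

  Dᵤ-lin : ∀ u v f → Dᵤ u v (lin 1# f) ≗ lin 1# (Dᵤ u (1# + v) f)
  Dᵤ-lin u v f = ≗-sym (≗-trans (≗-trans (lin-⊞ 1# (δ f) _) (⊞-cong {lin 1# (δ f)} {lin 1# (δ f)} ⟪ (λ _ → refl) ⟫ (≗-trans (lin-⊞ 1# (scale u (lin 1# f)) (scale (1# + v) (0# ∷ f)))
       (⊞-cong (lin-scale 1# u (lin 1# f)) (≗-trans (lin-scale 1# (1# + v) (0# ∷ f)) (scale-cong (1# + v) (lin-X 1# f))))))) ⟪ go ⟫)
    where
    go : ∀ n → coef (lin 1# (δ f) ⊞ (scale u (lin 1# (lin 1# f)) ⊞ scale (1# + v) (0# ∷ lin 1# f))) n ≡ coef (Dᵤ u v (lin 1# f)) n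
    go n = begin
      _  ≡⟨ trans (coef-⊞ (lin 1# (δ f)) _ n) (cong (coef (lin 1# (δ f)) n +_) (trans (coef-⊞ (scale u (lin 1# (lin 1# f))) (scale (1# + v) (0# ∷ lin 1# f)) n) (cong₂ _+_ (coef-scale u (lin 1# (lin 1# f)) n) (coef-scale (1# + v) (0# ∷ lin 1# f) n)))) ⟩
      coef (lin 1# (δ f)) n + (u * l + (1# + v) * w) ≡⟨ solveK 5 (λ d u l v w → d :+ (u :* l :+ (:1 :+ v) :* w) := w :+ d :+ (u :* l :+ v :* w)) refl (coef (lin 1# (δ f)) n) u l v w ⟩
      w + coef (lin 1# (δ f)) n + (u * l + v * w)  ≡⟨ cong (_+ (u * l + v * w)) (begin
          w + coef (lin 1# (δ f)) n  ≡⟨ cong (_+ coef (lin 1# (δ f)) n) (at (lin-X 1# f) n) ⟨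
          coef (lin 1# (0# ∷ f)) n + coef (lin 1# (δ f)) n ≡⟨ coef-⊞ (lin 1# (0# ∷ f)) (lin 1# (δ f)) n ⟨
          coef (lin 1# (0# ∷ f) ⊞ lin 1# (δ f)) n ≡⟨ at (lin-⊞ 1# (0# ∷ f) (δ f)) n ⟨
          coef (lin 1# ((0# ∷ f) ⊞ δ f)) n ≡⟨ at (lin-cong 1# (ϑ-lin 1# f)) n ⟨
          coef (δ (lin 1# f)) n ∎) ⟩
      coef (δ (lin 1# f)) n + (u * l + v * w)    ≡⟨ coef-Dᵤ u v (lin 1# f) n ⟨
      coef (Dᵤ u v (lin 1# f)) n ∎
      where
      l = coef (lin 1# (lin 1# f)) n
      w = coef (0# ∷ lin 1# f) n

  -- The sum u + k, in the form that arises when k factors X or X - 1 are moved out of `Dᵤ` one at a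
  -- time.
  sh : ℕ → K → K
  sh zero u = u
  sh (suc k) u = sh k (1# + u)

  Xᵏ : ℕ → Poly → Poly
  Xᵏ zero f = f
  Xᵏ (suc k) f = 0# ∷ Xᵏ k f

  eval-Xᵏ : ∀ k f x → eval (Xᵏ k f) x ≡ x ^ k * eval f x
  eval-Xᵏ zero f x = ≡.sym (*-identityˡ _)
  eval-Xᵏ (suc k) f x = trans (eval-X (Xᵏ k f) x) (trans (cong (x *_) (eval-Xᵏ k f x)) (≡.sym (*-assoc _ _ _)))

  Dᵤ-Xᵏ : ∀ k u v f → Dᵤ u v (Xᵏ k f) ≗ Xᵏ k (Dᵤ (sh k u) v f)
  Dᵤ-Xᵏ zero u v f = ⟪ (λ _ → refl) ⟫
  Dᵤ-Xᵏ (suc k) u v f = ≗-trans (Dᵤ-X u v (Xᵏ k f)) (X-cong (Dᵤ-Xᵏ k (1# + u) v f))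

  Dᵤ-linᵏ : ∀ k u v f → Dᵤ u v (linᵏ 1# k f) ≗ linᵏ 1# k (Dᵤ u (sh k v) f)
  Dᵤ-linᵏ zero u v f = ⟪ (λ _ → refl) ⟫
  Dᵤ-linᵏ (suc k) u v f = ≗-trans (Dᵤ-lin u v (linᵏ 1# k f)) (lin-cong 1# (Dᵤ-linᵏ k u (1# + v) f))

  itD-Xᵏ : ∀ m k u v f → it (Dᵤ u v) m (Xᵏ k f) ≗ Xᵏ k (it (Dᵤ (sh k u) v) m f)
  itD-Xᵏ zero k u v f = ⟪ (λ _ → refl) ⟫
  itD-Xᵏ (suc m) k u v f = ≗-trans (it-cong (Dᵤ-cong u v) m (Dᵤ-Xᵏ k u v f)) (itD-Xᵏ m k u v _)

  itD-linᵏ : ∀ m k u v f → it (Dᵤ u v) m (linᵏ 1# k f) ≗ linᵏ 1# k (it (Dᵤ u (sh k v)) m f)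
  itD-linᵏ zero k u v f = ⟪ (λ _ → refl) ⟫
  itD-linᵏ (suc m) k u v f = ≗-trans (it-cong (Dᵤ-cong u v) m (Dᵤ-linᵏ k u v f)) (itD-linᵏ m k u v _)

  itD-[] : ∀ m u v → Zero (it (Dᵤ u v) m [])
  itD-[] zero u v n = refl
  itD-[] (suc m) u v n = trans (at (it-cong (Dᵤ-cong u v) m {Dᵤ u v []} {[]} ⟪ z ⟫) n) (itD-[] m u v n)
    where
    z : Zero (Dᵤ u v [])
    z zero = solveK 2 (λ u v → :0 :+ (u :* :0 :+ v :* :0) := :0) refl u v
    z (suc n) = refl

  itDᵤ-⊞ : ∀ m u v f g → it (Dᵤ u v) m (f ⊞ g) ≗ it (Dᵤ u v) m f ⊞ it (Dᵤ u v) m g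
  itDᵤ-⊞ m u v = it-⊞ (Dᵤ-cong u v) (Dᵤ-⊞ u v) m

  -- Linearity as a relation f = g - h. It passes through every operator of the construction, and
  -- additivity in this form is all that the pigeonhole argument of `linear-system` asks for.
  record Diff (f g h : Poly) : Set where
    constructor mkDiff
    field diff : ∀ n → coef f n ≡ coef g n - coef h n
  open Diff

  Diff-⊞ : ∀ {f g h f' g' h'} → Diff f g h → Diff f' g' h' → Diff (f ⊞ f') (g ⊞ g') (h ⊞ h')
  Diff-⊞ {f} {g} {h} {f'} {g'} {h'} d d' .diff n = begin
    coef (f ⊞ f') n       ≡⟨ coef-⊞ f f' n ⟩
    coef f n + coef f' n  ≡⟨ cong₂ _+_ (diff d n) (diff d' n) ⟩
    (coef g n - coef h n) + (coef g' n - coef h' n)  ≡⟨ solveK 4 (λ a b c d → (a :- b) :+ (c :- d) := (a :+ c) :- (b :+ d)) refl (coef g n) (coef h n) (coef g' n) (coef h' n) ⟩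
    (coef g n + coef g' n) - (coef h n + coef h' n)  ≡⟨ cong₂ _-_ (coef-⊞ g g' n) (coef-⊞ h h' n) ⟨
    coef (g ⊞ g') n - coef (h ⊞ h') n ∎

  Diff-scale : ∀ c {f g h} → Diff f g h → Diff (scale c f) (scale c g) (scale c h)
  Diff-scale c {f} {g} {h} d .diff n = begin
    coef (scale c f) n    ≡⟨ coef-scale c f n ⟩
    c * coef f n          ≡⟨ cong (c *_) (diff d n) ⟩
    c * (coef g n - coef h n)  ≡⟨ solveK 3 (λ c a b → c :* (a :- b) := c :* a :- c :* b) refl c (coef g n) (coef h n) ⟩
    c * coef g n - c * coef h n  ≡⟨ cong₂ _-_ (coef-scale c g n) (coef-scale c h n) ⟨
    coef (scale c g) n - coef (scale c h) n ∎

  Diff-ϑ : ∀ {f g h} → Diff f g h → Diff (ϑ f) (ϑ g) (ϑ h)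
  Diff-ϑ {f} {g} {h} d .diff n = begin
    coef (ϑ f) n    ≡⟨ coef-ϑ f n ⟩
    ιK n * coef f n          ≡⟨ cong (ιK n *_) (diff d n) ⟩
    ιK n * (coef g n - coef h n)  ≡⟨ solveK 3 (λ c a b → c :* (a :- b) := c :* a :- c :* b) refl (ιK n) (coef g n) (coef h n) ⟩
    ιK n * coef g n - ιK n * coef h n  ≡⟨ cong₂ _-_ (coef-ϑ g n) (coef-ϑ h n) ⟨
    coef (ϑ g) n - coef (ϑ h) n ∎

  Diff-X : ∀ {f g h} → Diff f g h → Diff (0# ∷ f) (0# ∷ g) (0# ∷ h)
  Diff-X d .diff zero = ≡.sym (-‿inverseʳ 0#)
  Diff-X d .diff (suc n) = diff d n

  Diff-lin : ∀ x {f g h} → Diff f g h → Diff (lin x f) (lin x g) (lin x h)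
  Diff-lin x d = Diff-⊞ (Diff-X d) (Diff-scale (- x) d)

  Diff-Dᵤ : ∀ u v {f g h} → Diff f g h → Diff (Dᵤ u v f) (Dᵤ u v g) (Dᵤ u v h)
  Diff-Dᵤ u v d = Diff-⊞ (Diff-lin 1# (Diff-ϑ d)) (Diff-⊞ (Diff-scale u (Diff-lin 1# d)) (Diff-scale v (Diff-X d)))

  Diff-it : ∀ m u v {f g h} → Diff f g h → Diff (it (Dᵤ u v) m f) (it (Dᵤ u v) m g) (it (Dᵤ u v) m h)
  Diff-it zero u v d = d
  Diff-it (suc m) u v d = Diff-it m u v (Diff-Dᵤ u v d)

  Bd-it : ∀ m u v {n f} → Bd n f → Bd (m ℕ.+ n) (it (Dᵤ u v) m f)
  Bd-it zero u v b = b
  Bd-it (suc m) u v {n} {f} b = ≡.subst (λ k → Bd k (it (Dᵤ u v) m (Dᵤ u v f))) (ℕₚ.+-suc m n) (Bd-it m u v {suc n} {Dᵤ u v f} b')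
    where
    b' : Bd (suc n) (Dᵤ u v f)
    b' = Bd-⊞ (δ f) _ (Bd-lin 1# (ϑ f) (Bd-ϑ f b)) (Bd-⊞ (scale u (lin 1# f)) _ (Bd-scale u (lin 1# f) (Bd-lin 1# f b)) (Bd-scale v (0# ∷ f) (Bd-X f b)))

  -- For families of polynomials q_b and Q_c,b:
  -- hx = Σ_b X^(tb) q_b  and  hy = Σ_c (X-1)^(tc) Σ_b X^(tb) Q_c,b;
  -- at a point with X^t = α and (X-1)^t = β the m-th δ-derivative of hy agrees with the polynomial hyD of small degree.
  module Auxiliary (t : ℕ) (B₀ : ℕ) where

    hx : ℕ → (ℕ → Poly) → Poly
    hx zero q = []
    hx (suc B) q = q 0 ⊞ Xᵏ t (hx B (λ b → q (suc b)))

    hy : ℕ → (ℕ → ℕ → Poly) → Poly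
    hy zero Q = []
    hy (suc B) Q = hx B₀ (Q 0) ⊞ linᵏ 1# t (hy B (λ c → Q (suc c)))

    module _ (m : ℕ) (α β : K) where

      -- The factor X^t is replaced by its value α, while the derivation under it is shifted from u
      -- to u + t. The result has degree less than m + A although `hx` has degree about Bt.
      hxD : ℕ → (ℕ → Poly) → K → K → Poly
      hxD zero q u v = []
      hxD (suc B) q u v = it (Dᵤ u v) m (q 0) ⊞ scale α (hxD B (λ b → q (suc b)) (sh t u) v)

      hyD : ℕ → (ℕ → ℕ → Poly) → K → Poly
      hyD zero Q v = []
      hyD (suc B) Q v = hxD B₀ (Q 0) 0# v ⊞ scale β (hyD B (λ c → Q (suc c)) (sh t v))

      Diff-hxD : ∀ B {q q' q''} → (∀ b → Diff (q b) (q' b) (q'' b)) → ∀ u v → Diff (hxD B q u v) (hxD B q' u v) (hxD B q'' u v)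
      Diff-hxD zero d u v .diff n = ≡.sym (-‿inverseʳ 0#)
      Diff-hxD (suc B) d u v = Diff-⊞ (Diff-it m u v (d 0)) (Diff-scale α (Diff-hxD B (λ b → d (suc b)) (sh t u) v))

      Diff-hyD : ∀ B {Q Q' Q''} → (∀ c b → Diff (Q c b) (Q' c b) (Q'' c b)) → ∀ v → Diff (hyD B Q v) (hyD B Q' v) (hyD B Q'' v)
      Diff-hyD zero d v .diff n = ≡.sym (-‿inverseʳ 0#)
      Diff-hyD (suc B) d v = Diff-⊞ (Diff-hxD B₀ (d 0) 0# v) (Diff-scale β (Diff-hyD B (λ c → d (suc c)) (sh t v)))

      Bd-hxD : ∀ B {A q} → (∀ b → Bd A (q b)) → ∀ u v → Bd (m ℕ.+ A) (hxD B q u v)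
      Bd-hxD zero b u v _ _ = refl
      Bd-hxD (suc B) {q = q} b u v = Bd-⊞ (it (Dᵤ u v) m (q 0)) _ (Bd-it m u v (b 0)) (Bd-scale α (hxD B _ (sh t u) v) (Bd-hxD B (λ c → b (suc c)) (sh t u) v))

      Bd-hyD : ∀ B {A Q} → (∀ c b → Bd A (Q c b)) → ∀ v → Bd (m ℕ.+ A) (hyD B Q v)
      Bd-hyD zero b v _ _ = refl
      Bd-hyD (suc B) {Q = Q} b v = Bd-⊞ (hxD B₀ (Q 0) 0# v) _ (Bd-hxD B₀ (b 0) 0# v) (Bd-scale β (hyD B _ (sh t v)) (Bd-hyD B (λ c → b (suc c)) (sh t v)))

      module _ (x : K) (eα : x ^ t ≡ α) (eβ : (x - 1#) ^ t ≡ β) where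

        eval-hxD : ∀ B q u v → eval (it (Dᵤ u v) m (hx B q)) x ≡ eval (hxD B q u v) x
        eval-hxD zero q u v = eval-0 (it (Dᵤ u v) m []) x (itD-[] m u v)
        eval-hxD (suc B) q u v = begin
          eval (it (Dᵤ u v) m (q 0 ⊞ Xᵏ t r)) x   ≡⟨ eval-cong x (itDᵤ-⊞ m u v (q 0) (Xᵏ t r)) ⟩
          eval (it (Dᵤ u v) m (q 0) ⊞ it (Dᵤ u v) m (Xᵏ t r)) x   ≡⟨ eval-⊞ (it (Dᵤ u v) m (q 0)) _ x ⟩
          e₀ + eval (it (Dᵤ u v) m (Xᵏ t r)) x   ≡⟨ cong (e₀ +_) (eval-cong x (itD-Xᵏ m t u v r)) ⟩
          e₀ + eval (Xᵏ t (it (Dᵤ (sh t u) v) m r)) x   ≡⟨ cong (e₀ +_) (eval-Xᵏ t _ x) ⟩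
          e₀ + x ^ t * eval (it (Dᵤ (sh t u) v) m r) x   ≡⟨ cong₂ (λ z w → e₀ + z * w) eα (eval-hxD B _ (sh t u) v) ⟩
          e₀ + α * eval (hxD B _ (sh t u) v) x   ≡⟨ cong (e₀ +_) (eval-scale α (hxD B _ (sh t u) v) x) ⟨
          e₀ + eval (scale α (hxD B _ (sh t u) v)) x   ≡⟨ eval-⊞ (it (Dᵤ u v) m (q 0)) _ x ⟨
          eval (hxD (suc B) q u v) x    ∎
          where
          r = hx B (λ b → q (suc b))
          e₀ = eval (it (Dᵤ u v) m (q 0)) x

        eval-hyD : ∀ B Q v → eval (it (Dᵤ 0# v) m (hy B Q)) x ≡ eval (hyD B Q v) x
        eval-hyD zero Q v = eval-0 (it (Dᵤ 0# v) m []) x (itD-[] m 0# v)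
        eval-hyD (suc B) Q v = begin
          eval (it (Dᵤ 0# v) m (hx B₀ (Q 0) ⊞ linᵏ 1# t r)) x   ≡⟨ eval-cong x (itDᵤ-⊞ m 0# v (hx B₀ (Q 0)) (linᵏ 1# t r)) ⟩
          eval (it (Dᵤ 0# v) m (hx B₀ (Q 0)) ⊞ it (Dᵤ 0# v) m (linᵏ 1# t r)) x   ≡⟨ eval-⊞ (it (Dᵤ 0# v) m (hx B₀ (Q 0))) _ x ⟩
          eval (it (Dᵤ 0# v) m (hx B₀ (Q 0))) x + eval (it (Dᵤ 0# v) m (linᵏ 1# t r)) x   ≡⟨ cong₂ _+_ (eval-hxD B₀ (Q 0) 0# v) (eval-cong x (itD-linᵏ m t 0# v r)) ⟩
          e₀ + eval (linᵏ 1# t (it (Dᵤ 0# (sh t v)) m r)) x   ≡⟨ cong (e₀ +_) (eval-linᵏ 1# t _ x) ⟩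
          e₀ + (x - 1#) ^ t * eval (it (Dᵤ 0# (sh t v)) m r) x   ≡⟨ cong₂ (λ z w → e₀ + z * w) eβ (eval-hyD B _ (sh t v)) ⟩
          e₀ + β * eval (hyD B _ (sh t v)) x   ≡⟨ cong (e₀ +_) (eval-scale β (hyD B _ (sh t v)) x) ⟨
          e₀ + eval (scale β (hyD B _ (sh t v))) x   ≡⟨ eval-⊞ (hxD B₀ (Q 0) 0# v) _ x ⟨
          eval (hyD (suc B) Q v) x    ∎
          where
          r = hy B (λ c → Q (suc c))
          e₀ = eval (hxD B₀ (Q 0) 0# v) x

    Bd-Xᵏ : ∀ {n} k f → Bd n f → Bd (k ℕ.+ n) (Xᵏ k f)
    Bd-Xᵏ zero f b = b
    Bd-Xᵏ (suc k) f b = Bd-X (Xᵏ k f) (Bd-Xᵏ k f b)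

    Bd-hx : ∀ B {A q} → (∀ b → Bd A (q b)) → Bd (B ℕ.* t ℕ.+ A) (hx B q)
    Bd-hx zero b _ _ = refl
    Bd-hx (suc B) {A} {q} b = Bd-⊞ (q 0) _ (Bd-mono {f = q 0} (ℕₚ.m≤n+m A (suc B ℕ.* t)) (b 0))
      (≡.subst (λ k → Bd k (Xᵏ t r)) (≡.sym (ℕₚ.+-assoc t (B ℕ.* t) A)) (Bd-Xᵏ t r (Bd-hx B (λ c → b (suc c)))))
      where r = hx B (λ b → q (suc b))

    Bd-hy : ∀ B {A Q} → (∀ c b → Bd A (Q c b)) → Bd (B ℕ.* t ℕ.+ (B₀ ℕ.* t ℕ.+ A)) (hy B Q)
    Bd-hy zero b _ _ = refl
    Bd-hy (suc B) {A} {Q} b = Bd-⊞ (hx B₀ (Q 0)) _ (Bd-mono {f = hx B₀ (Q 0)} (ℕₚ.m≤n+m _ (suc B ℕ.* t)) (Bd-hx B₀ (b 0)))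
      (≡.subst (λ k → Bd k (linᵏ 1# t r)) (≡.sym (ℕₚ.+-assoc t (B ℕ.* t) _)) (Bd-linᵏ 1# t r (Bd-hy B (λ c → b (suc c)))))
      where r = hy B (λ c → Q (suc c))

    -- The exponents tb + a with a < A and b < B. There are only AB of them, which is what makes
    -- `hx` sparse.
    exps : ℕ → ℕ → List ℕ
    exps A zero = []
    exps A (suc B) = upTo A ++ map (t ℕ.+_) (exps A B)

    length-exps : ∀ A B → length (exps A B) ≡ B ℕ.* A
    length-exps A zero = refl
    length-exps A (suc B) = trans (Lₚ.length-++ (upTo A)) (cong₂ ℕ._+_ (Lₚ.length-upTo A) (trans (Lₚ.length-map _ (exps A B)) (length-exps A B)))

    exps-< : ∀ A B → All (ℕ._< B ℕ.* t ℕ.+ A) (exps A B)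
    exps-< A zero = []
    exps-< A (suc B) = Allₚ.++⁺ (All.tabulate (λ {x} x∈ → ℕₚ.<-≤-trans (∈-upTo⁻ x∈) (ℕₚ.m≤n+m A (suc B ℕ.* t))))
      (Allₚ.map⁺ (All.map (λ {x} l → ℕₚ.<-≤-trans (ℕₚ.+-monoʳ-< t l) (ℕₚ.≤-reflexive (≡.sym (ℕₚ.+-assoc t (B ℕ.* t) A)))) (exps-< A B)))

    coef-Xᵏ-+ : ∀ k f n → coef (Xᵏ k f) (k ℕ.+ n) ≡ coef f n
    coef-Xᵏ-+ zero f n = refl
    coef-Xᵏ-+ (suc k) f n = coef-Xᵏ-+ k f n

    coef-Xᵏ-< : ∀ k f n → n ℕ.< k → coef (Xᵏ k f) n ≡ 0#
    coef-Xᵏ-< (suc k) f zero l = refl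
    coef-Xᵏ-< (suc k) f (suc n) (s≤s l) = coef-Xᵏ-< k f n l

    hx-supp : ∀ B {A q} → (∀ b → Bd A (q b)) → ∀ n → n ∉ exps A B → coef (hx B q) n ≡ 0#
    hx-supp zero b n _ = refl
    hx-supp (suc B) {A} {q} b n n∉ = trans (coef-⊞ (q 0) (Xᵏ t r) n) (trans (cong₂ _+_ (b 0 n (ℕₚ.≮⇒≥ λ l → n∉ (∈-++⁺ˡ (∈-upTo⁺ l)))) (h n n∉)) (+-identityˡ _))
      where
      r = hx B (λ b → q (suc b))
      h : ∀ n → n ∉ exps A (suc B) → coef (Xᵏ t r) n ≡ 0#
      h n n∉ with n ℕₚ.<? t
      ... | yes l = coef-Xᵏ-< t r n l
      ... | no nl = trans (cong (coef (Xᵏ t r)) (≡.sym e)) (trans (coef-Xᵏ-+ t r (n ℕ.∸ t)) (hx-supp B (λ c → b (suc c)) (n ℕ.∸ t) (λ m → n∉ (≡.subst (_∈ exps A (suc B)) e (∈-++⁺ʳ (upTo A) (∈-map⁺ (t ℕ.+_) m))))))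
        where
        e : t ℕ.+ (n ℕ.∸ t) ≡ n
        e = ℕₚ.m+[n∸m]≡n (ℕₚ.≮⇒≥ nl)

    -- Because A ≤ t, the blocks X^(tb) q_b occupy disjoint ranges of exponents and cannot cancel
    -- each other.
    hx-zero : ∀ B {A q} → A ℕ.≤ t → (∀ b → Bd A (q b)) → Zero (hx B q) → ∀ b → b ℕ.< B → Zero (q b)
    hx-zero (suc B) {A} {q} A≤t bd z = go
      where
      r = hx B (λ b → q (suc b))
      z0 : Zero (q 0)
      z0 n with n ℕₚ.<? A
      ... | no nl = bd 0 n (ℕₚ.≮⇒≥ nl)
      ... | yes l = begin
        coef (q 0) n                     ≡⟨ +-identityʳ _ ⟨
        coef (q 0) n + 0#                ≡⟨ cong (coef (q 0) n +_) (coef-Xᵏ-< t r n (ℕₚ.<-≤-trans l A≤t)) ⟨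
        coef (q 0) n + coef (Xᵏ t r) n   ≡⟨ coef-⊞ (q 0) (Xᵏ t r) n ⟨
        coef (hx (suc B) q) n            ≡⟨ z n ⟩
        0#                               ∎
      zr : Zero r
      zr n = begin
        coef r n                         ≡⟨ coef-Xᵏ-+ t r n ⟨
        coef (Xᵏ t r) (t ℕ.+ n)          ≡⟨ +-identityˡ _ ⟨
        0# + coef (Xᵏ t r) (t ℕ.+ n)     ≡⟨ cong (_+ coef (Xᵏ t r) (t ℕ.+ n)) (z0 (t ℕ.+ n)) ⟨
        coef (q 0) (t ℕ.+ n) + coef (Xᵏ t r) (t ℕ.+ n)   ≡⟨ coef-⊞ (q 0) (Xᵏ t r) _ ⟨
        coef (hx (suc B) q) (t ℕ.+ n)            ≡⟨ z _ ⟩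
        0#                               ∎
      go : ∀ b → b ℕ.< suc B → Zero (q b)
      go zero _ = z0
      go (suc b) (s≤s l) = hx-zero B A≤t (λ c → bd (suc c)) zr b l

    -- If the whole sum vanishes, its term with c = 0 is divisible by (X - 1)^t. This term has at
    -- most t monomials, all of degree below p, so `few-terms` forces it to be zero. Then (X - 1)^t
    -- is cancelled and the induction continues with c + 1.
    hy-zero : ∀ B {A Q} → A ℕ.≤ t → B₀ ℕ.* A ℕ.≤ t → B₀ ℕ.* t ℕ.+ A ℕ.≤ p → (∀ c b → Bd A (Q c b)) → Zero (hy B Q) → ∀ c b → c ℕ.< B → b ℕ.< B₀ → Zero (Q c b)
    hy-zero (suc B) {A} {Q} A≤t BA≤t ≤p bd z = go
      where
      r = hy B (λ c → Q (suc c))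
      f = hx B₀ (Q 0)
      zz : ∀ n → coef f n + coef (linᵏ 1# t r) n ≡ 0#
      zz n = trans (≡.sym (coef-⊞ f _ n)) (z n)
      dv : Div 1# t f
      dv = scale (- 1#) r , ⟪ (λ n → begin
        coef f n    ≡⟨ solveK 2 (λ a b → a := (a :+ b) :+ (:- :1) :* b) refl (coef f n) (coef (linᵏ 1# t r) n) ⟩
        (coef f n + coef (linᵏ 1# t r) n) + - 1# * coef (linᵏ 1# t r) n   ≡⟨ cong (_+ - 1# * coef (linᵏ 1# t r) n) (zz n) ⟩
        0# + - 1# * coef (linᵏ 1# t r) n   ≡⟨ +-identityˡ _ ⟩
        - 1# * coef (linᵏ 1# t r) n   ≡⟨ coef-scale (- 1#) (linᵏ 1# t r) n ⟨
        coef (scale (- 1#) (linᵏ 1# t r)) n   ≡⟨ at (linᵏ-scale 1# t (- 1#) r) n ⟨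
        coef (linᵏ 1# t (scale (- 1#) r)) n ∎) ⟫
      zf : Zero f
      zf = few-terms (exps A B₀) (All.map (λ l → ℕₚ.<-≤-trans l ≤p) (exps-< A B₀)) f t (ℕₚ.≤-trans (ℕₚ.≤-reflexive (length-exps A B₀)) BA≤t) dv (hx-supp B₀ (bd 0))
      zr : Zero r
      zr = Zero-linᵏ⁻ 1# t r (λ n → trans (≡.sym (+-identityˡ _)) (trans (cong (_+ coef (linᵏ 1# t r) n) (≡.sym (zf n))) (zz n)))
      go : ∀ c b → c ℕ.< suc B → b ℕ.< B₀ → Zero (Q c b)
      go zero b _ l = hx-zero B₀ A≤t (bd 0) zf b l
      go (suc c) b (s≤s l) l' = hy-zero B A≤t BA≤t ≤p (λ c → bd (suc c)) zr c b l l'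

  -- Two of the p^U vectors must have the same image among the p^E possible ones; their difference
  -- is a nonzero solution.
  linear-system : ∀ {U E} → E ℕ.< U → (Φ : (Fin U → K) → Fin E → K) → (∀ v w e → Φ (λ i → v i - w i) e ≡ Φ v e - Φ w e) →
    Σ (Fin U → K) λ v → (Σ (Fin U) λ i → ¬ v i ≡ 0#) × (∀ e → Φ v e ≡ 0#)
  linear-system {U} {E} E<U Φ add with Fₚ.pigeonhole (ℕₚ.^-monoʳ-< p 1<p E<U) (λ k → funToFin (Φ (finToFun k)))
  ... | i , j , i<j , eq = (λ k → finToFun i k - finToFun j k) , (proj₁ nz , λ e → proj₂ nz (x-y≡0⇒x≡y e)) , (λ e → trans (add (finToFun i) (finToFun j) e) (trans (cong (_- Φ (finToFun j) e) (same e)) (-‿inverseʳ _)))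
    where
    same : ∀ e → Φ (finToFun i) e ≡ Φ (finToFun j) e
    same e = trans (≡.sym (Fₚ.finToFun-funToFin (Φ (finToFun i)) e)) (trans (cong (λ z → finToFun z e) eq) (Fₚ.finToFun-funToFin (Φ (finToFun j)) e))
    funToFin-cong : ∀ {m n} {f g : Fin m → Fin n} → (∀ k → f k ≡ g k) → funToFin f ≡ funToFin g
    funToFin-cong {zero} h = refl
    funToFin-cong {suc m} h = cong₂ combine (h F.zero) (funToFin-cong (λ k → h (F.suc k)))
    nz : Σ (Fin U) λ k → ¬ finToFun i k ≡ finToFun j k
    nz = Fₚ.¬∀⟶∃¬ U (λ k → finToFun {p} {U} i k ≡ finToFun j k) (λ k → finToFun i k ≟K finToFun j k) (λ h → Fₚ.<⇒≢ i<j (trans (≡.sym (Fₚ.funToFin-finToFin {U} {p} i)) (trans (funToFin-cong h) (Fₚ.funToFin-finToFin {U} {p} j))))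

  coef-applyUpTo : ∀ (g : ℕ → K) A n → n ℕ.< A → coef (applyUpTo g A) n ≡ g n
  coef-applyUpTo g (suc A) zero _ = refl
  coef-applyUpTo g (suc A) (suc n) (s≤s l) = coef-applyUpTo (λ k → g (suc k)) A n l

  Diff-applyUpTo : ∀ {g h k : ℕ → K} A → (∀ n → g n ≡ h n - k n) → Diff (applyUpTo g A) (applyUpTo h A) (applyUpTo k A)
  Diff-applyUpTo zero e .diff n = ≡.sym (-‿inverseʳ 0#)
  Diff-applyUpTo (suc A) e .diff zero = e 0
  Diff-applyUpTo (suc A) e .diff (suc n) = diff (Diff-applyUpTo A (λ m → e (suc m))) n

  -- D·|P| is at most the degree of the auxiliary polynomial.
  stepanov-core : (t n D B : ℕ) .{{_ : NonZero D}} .{{_ : NonZero B}} (α β : Fin n → K) (xs : List K) → Unique xs →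
    All (λ x → (¬ x ≡ 0#) × (¬ x ≡ 1#) × Σ (Fin n) λ l → (x ^ t ≡ α l) × ((x - 1#) ^ t ≡ β l)) xs →
    n ℕ.* (D ℕ.* (D ℕ.+ D)) ℕ.< B ℕ.* B ℕ.* D → B ℕ.* D ℕ.≤ t → B ℕ.* t ℕ.+ D ℕ.≤ p →
    D ℕ.* length xs ℕ.≤ B ℕ.* t ℕ.+ (B ℕ.* t ℕ.+ D)
  stepanov-core t n D B α β xs u hyp cnt BD≤t ≤p with D ℕ.* length xs ℕₚ.≤? B ℕ.* t ℕ.+ (B ℕ.* t ℕ.+ D)
  ... | yes l = l
  ... | no nl = contradiction vi≡0 (proj₂ (proj₁ (proj₂ sys)))
    where
    open Auxiliary t B
    U = B ℕ.* B ℕ.* D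
    -- For each of the n pairs and each order m < D the polynomial `hyD` has degree less than m + D
    -- ≤ 2D, which makes 2D conditions.
    E = n ℕ.* (D ℕ.* (D ℕ.+ D))
    ext : (Fin U → K) → ℕ → K
    ext v k with k ℕₚ.<? U
    ... | yes l = v (fromℕ< l)
    ... | no _ = 0#
    Q : (Fin U → K) → ℕ → ℕ → Poly
    Q v c b = applyUpTo (λ a → ext v ((c ℕ.* B ℕ.+ b) ℕ.* D ℕ.+ a)) D
    ext-sub : ∀ v w k → ext (λ i → v i - w i) k ≡ ext v k - ext w k
    ext-sub v w k with k ℕₚ.<? U
    ... | yes l = refl
    ... | no _ = ≡.sym (-‿inverseʳ 0#)
    cond : (Fin U → K) → Fin n → Fin D → Fin (D ℕ.+ D) → K
    cond v l m k = coef (hyD (toℕ m) (α l) (β l) B (Q v) 0#) (toℕ k)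
    Φ₁ : (Fin U → K) → Fin n → Fin D × Fin (D ℕ.+ D) → K
    Φ₁ v l (m , k) = cond v l m k
    Φ₂ : (Fin U → K) → Fin n × Fin (D ℕ.* (D ℕ.+ D)) → K
    Φ₂ v (l , mk) = Φ₁ v l (remQuot {D} (D ℕ.+ D) mk)
    Φ : (Fin U → K) → Fin E → K
    Φ v e = Φ₂ v (remQuot {n} (D ℕ.* (D ℕ.+ D)) e)
    cond-sub : ∀ v w l m k → cond (λ i → v i - w i) l m k ≡ cond v l m k - cond w l m k
    cond-sub v w l m k = diff (Diff-hyD (toℕ m) (α l) (β l) B (λ c b → Diff-applyUpTo D (λ a → ext-sub v w _)) 0#) (toℕ k)
    sys = linear-system cnt Φ (λ v w e → cond-sub v w _ _ _)
    v = proj₁ sys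
    i = proj₁ (proj₁ (proj₂ sys))
    cond-0 : ∀ l m k → cond v l m k ≡ 0#
    cond-0 l m k = trans (≡.sym eq) (proj₂ (proj₂ sys) (combine l (combine m k)))
      where
      eq : Φ v (combine l (combine m k)) ≡ cond v l m k
      eq = trans (cong (Φ₂ v) (Fₚ.remQuot-combine {n} {D ℕ.* (D ℕ.+ D)} l (combine m k))) (cong (Φ₁ v l) (Fₚ.remQuot-combine {D} {D ℕ.+ D} m k))
    bdQ : ∀ c b → Bd D (Q v c b)
    bdQ c b = ≡.subst (λ k → Bd k (Q v c b)) (Lₚ.length-applyUpTo _ D) (Bd-length (Q v c b))
    Ψ = hy B (Q v)
    D≤p : D ℕ.≤ p
    D≤p = ℕₚ.≤-trans (ℕₚ.m≤n+m D (B ℕ.* t)) ≤p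
    hyD-zero : ∀ l m → m ℕ.< D → Zero (hyD m (α l) (β l) B (Q v) 0#)
    hyD-zero l m m<D k with k ℕₚ.<? D ℕ.+ D
    ... | yes k< = ≡.subst₂ (λ m k → coef (hyD m (α l) (β l) B (Q v) 0#) k ≡ 0#) (Fₚ.toℕ-fromℕ< m<D) (Fₚ.toℕ-fromℕ< k<) (cond-0 l (fromℕ< m<D) (fromℕ< k<))
    ... | no k≮ = Bd-hyD m (α l) (β l) B bdQ 0# k (ℕₚ.≤-trans (ℕₚ.+-monoˡ-≤ D (ℕₚ.<⇒≤ m<D)) (ℕₚ.≮⇒≥ k≮))
    D00 : ∀ f → δ f ≗ Dᵤ 0# 0# f
    D00 f .at k = trans (≡.sym (solveK 3 (λ d a b → d :+ (:0 :* a :+ :0 :* b) := d) refl _ _ _)) (≡.sym (coef-Dᵤ 0# 0# f k))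
    it-D00 : ∀ m f → it δ m f ≗ it (Dᵤ 0# 0#) m f
    it-D00 zero f = ⟪ (λ _ → refl) ⟫
    it-D00 (suc m) f = ≗-trans (it-cong δ-cong m (D00 f)) (it-D00 m (Dᵤ 0# 0# f))
    divs : All (λ x → Div x D Ψ) xs
    divs = All.map (λ { {x} (x≢0 , x≢1 , l , eα , eβ) → Multiplicity.δ-vanish x x≢0 x≢1 D D≤p Ψ (λ m m<D →
      trans (eval-cong x (it-D00 m Ψ)) (trans (eval-hyD m (α l) (β l) x eα eβ B (Q v) 0#) (eval-0 (hyD m (α l) (β l) B (Q v) 0#) x (hyD-zero l m m<D)))) }) hyp
    -- The assumed failure of the bound enters here: counted with multiplicity, Ψ has more zeros
    -- than its degree permits. Independence then contradicts the nonzero coefficient `v i`.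
    Ψ-zero : Zero Ψ
    Ψ-zero = root-bound D xs u Ψ (B ℕ.* t ℕ.+ (B ℕ.* t ℕ.+ D)) divs (Bd-hy B bdQ) (ℕₚ.<⇒≤ (ℕₚ.≰⇒> nl))
    -- The index of the nonzero coefficient is decoded into the degree a and the block numbers b and
    -- c.
    a = toℕ i % D
    s = toℕ i / D
    b = s % B
    c = s / B
    s< : s ℕ.< B ℕ.* B
    s< = DM.m<n*o⇒m/o<n (Fₚ.toℕ<n i)
    idx : (c ℕ.* B ℕ.+ b) ℕ.* D ℕ.+ a ≡ toℕ i
    idx = begin
      (c ℕ.* B ℕ.+ b) ℕ.* D ℕ.+ a   ≡⟨ cong (λ z → z ℕ.* D ℕ.+ a) (trans (ℕₚ.+-comm (c ℕ.* B) b) (≡.sym (DM.m≡m%n+[m/n]*n s B))) ⟩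
      s ℕ.* D ℕ.+ a                 ≡⟨ trans (ℕₚ.+-comm (s ℕ.* D) a) (≡.sym (DM.m≡m%n+[m/n]*n (toℕ i) D)) ⟩
      toℕ i                         ∎
    ext-i : ext v (toℕ i) ≡ v i
    ext-i with toℕ i ℕₚ.<? U
    ... | yes l = cong v (Fₚ.fromℕ<-toℕ i l)
    ... | no nl = contradiction (Fₚ.toℕ<n i) nl
    A≤t : D ℕ.≤ t
    A≤t = ℕₚ.≤-trans (ℕₚ.m≤n*m D B) BD≤t
    vi≡0 : v i ≡ 0#
    vi≡0 = begin
      v i                        ≡⟨ ext-i ⟨
      ext v (toℕ i)              ≡⟨ cong (ext v) idx ⟨
      ext v ((c ℕ.* B ℕ.+ b) ℕ.* D ℕ.+ a)   ≡⟨ coef-applyUpTo (λ a → ext v ((c ℕ.* B ℕ.+ b) ℕ.* D ℕ.+ a)) D a (DM.m%n<n (toℕ i) D) ⟨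
      coef (Q v c b) a           ≡⟨ hy-zero B A≤t BD≤t ≤p bdQ Ψ-zero c b (DM.m<n*o⇒m/o<n s<) (DM.m%n<n s B) a ⟩
      0#                         ∎

-- Lists of the elements of decidable sets

module Enumeration where
 open import Data.Nat
 open import Data.Nat.Properties
 open import Data.Fin as F using (Fin)
 import Data.Fin.Properties as Fₚ
 open import Data.List using (List; []; _∷_; map; length; _++_; lookup)
 import Data.List.Properties as Lₚ
 open import Data.List.Membership.Propositional using (_∈_)
 open import Data.List.Membership.Propositional.Properties using (∈-map⁺; ∈-++⁺ˡ; ∈-++⁺ʳ)
 open import Data.List.Relation.Unary.Any as Any using (here; there)
 open import Data.List.Relation.Unary.Any.Properties using (lookup-index)
 open import Data.List.Relation.Unary.All as All using (All; []; _∷_)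
 import Data.List.Relation.Unary.All.Properties as Allₚ
 open import Data.List.Relation.Unary.AllPairs using ([]; _∷_)
 open import Data.List.Relation.Unary.Unique.Propositional using (Unique)
 import Data.List.Relation.Unary.Unique.Propositional.Properties as Uₚ
 open import Data.Product using (Σ; _,_; _×_)
 open import Relation.Nullary using (Dec; yes; no)
 open import Relation.Binary.PropositionalEquality using (_≡_; refl; sym; trans; cong; cong₂)
 open NatSums

 enumerate : ∀ {n} {P : Fin n → Set} (P? : ∀ i → Dec (P i)) →
   Σ (List (Fin n)) λ xs → Unique xs × All P xs × (length xs ≡ ∑ (λ i → 𝟙 (P? i))) × (∀ i → P i → i ∈ xs)
 enumerate {zero} P? = [] , [] , [] , sym (∑-zero _) , λ ()
 enumerate {suc n} {P} P? = go (P? F.zero) refl (enumerate (λ i → P? (F.suc i)))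
   where
   go : (d : Dec (P F.zero)) → d ≡ P? F.zero →
     (Σ (List (Fin n)) λ xs → Unique xs × All (λ i → P (F.suc i)) xs × (length xs ≡ ∑ (λ i → 𝟙 (P? (F.suc i)))) × (∀ i → P (F.suc i) → i ∈ xs)) →
     Σ (List (Fin (suc n))) λ xs → Unique xs × All P xs × (length xs ≡ ∑ (λ i → 𝟙 (P? i))) × (∀ i → P i → i ∈ xs)
   go (yes q) e (xs , u , a , l , c) = F.zero ∷ map F.suc xs ,
     (Allₚ.map⁺ (All.tabulate (λ _ ())) ∷ Uₚ.map⁺ Fₚ.suc-injective u) , (q ∷ Allₚ.map⁺ a) ,
     trans (cong suc (trans (Lₚ.length-map F.suc xs) l)) (sym (trans (∑-suc _) (cong (λ d → 𝟙 d + ∑ (λ i → 𝟙 (P? (F.suc i)))) (sym e)))) ,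
     λ { F.zero _ → here refl ; (F.suc i) h → there (∈-map⁺ F.suc (c i h)) }
   go (no nq) e (xs , u , a , l , c) = map F.suc xs , Uₚ.map⁺ Fₚ.suc-injective u , Allₚ.map⁺ a ,
     trans (trans (Lₚ.length-map F.suc xs) l) (sym (trans (∑-suc _) (cong (λ d → 𝟙 d + ∑ (λ i → 𝟙 (P? (F.suc i)))) (sym e)))) ,
     λ { F.zero h → ⊥-elim (nq h) ; (F.suc i) h → ∈-map⁺ F.suc (c i h) }
     where open import Data.Empty using (⊥-elim)

 enumerate₂ : ∀ {m n} {P : Fin m → Fin n → Set} (P? : ∀ i j → Dec (P i j)) →
   Σ (List (Fin m × Fin n)) λ xs → (length xs ≡ ∑ (λ i → ∑ (λ j → 𝟙 (P? i j)))) × (∀ i j → P i j → (i , j) ∈ xs)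
 enumerate₂ {zero} P? = [] , sym (∑-zero _) , λ ()
 enumerate₂ {suc m} {n} P? with enumerate (P? F.zero) | enumerate₂ (λ i → P? (F.suc i))
 ... | ys , _ , _ , ly , cy | zs , lz , cz = map f ys ++ map g zs ,
   trans (Lₚ.length-++ (map f ys) {map g zs}) (trans (cong₂ _+_ (trans (Lₚ.length-map f ys) ly) (trans (Lₚ.length-map g zs) lz)) (sym (∑-suc _))) ,
   λ { F.zero j h → ∈-++⁺ˡ (∈-map⁺ f (cy j h)) ; (F.suc i) j h → ∈-++⁺ʳ (map f ys) (∈-map⁺ g (cz i j h)) }
   where
   f : Fin n → Fin (suc m) × Fin n
   f j = F.zero , j
   g : Fin m × Fin n → Fin (suc m) × Fin n
   g (i , j) = F.suc i , j

 ∈-lookup : ∀ {A : Set} {x : A} {xs : List A} → x ∈ xs → Σ (Fin (length xs)) λ l → lookup xs l ≡ x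
 ∈-lookup h = Any.index h , sym (lookup-index h)

-- Fibres of power maps and the counting form of Stepanov's bound

module _ where
 open import Data.Nat using (ℕ)
 open import Data.Nat.Primality using (Prime)
 module Fibres (p : ℕ) (pr : Prime p) where
  open PrimeField p pr
  open Polynomials p pr
  open Stepanov p pr using (Xᵏ; eval-Xᵏ; module Auxiliary; stepanov-core)
  open NatSums
  open Enumeration
  open Arithmetic
  open import Data.Nat as ℕ using (suc; z≤n; s≤s; NonZero)
  import Data.Nat.Properties as ℕₚ
  open import Data.Fin using (Fin)
  import Data.Fin.Properties as Fₚ
  open import Data.List using (List; []; _∷_; length; lookup)
  open import Data.List.Relation.Unary.All as All using (All; []; _∷_)
  open import Data.List.Relation.Unary.Unique.Propositional using (Unique)
  open import Data.Product using (Σ; _,_; proj₁; proj₂; _×_)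
  open import Relation.Nullary using (¬_; Dec; yes; no; contradiction)
  open import Relation.Binary.PropositionalEquality as ≡ using (_≡_; refl; cong; trans)

  -- The elements of the fibre are roots of X^t - κ, which has degree t and leading coefficient 1.
  power-fibre : ∀ t .{{_ : NonZero t}} κ → ∑ (λ x → 𝟙 (x ^ t ≟K κ)) ℕ.≤ t
  power-fibre t@(suc t') κ with enumerate (λ x → x ^ t ≟K κ)
  ... | xs , u , a , l , _ = ≡.subst (ℕ._≤ t) l (ℕₚ.≮⇒≥ λ t<l → 1≢0 (trans (≡.sym lead) (root-bound 1 xs u f (suc t) divs bd (ℕₚ.≤-trans t<l (ℕₚ.≤-reflexive (≡.sym (ℕₚ.*-identityˡ _)))) t)))
    where
    open Auxiliary 0 0 using (Bd-Xᵏ; coef-Xᵏ-+)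
    f = Xᵏ t (1# ∷ []) ⊞ (- κ ∷ [])
    ev : ∀ x → eval f x ≡ x ^ t - κ
    ev x = trans (eval-⊞ (Xᵏ t (1# ∷ [])) (- κ ∷ []) x) (trans (cong (_+ (- κ + x * 0#)) (eval-Xᵏ t (1# ∷ []) x)) (solveK 3 (λ y x k → y :* (:1 :+ x :* :0) :+ ((:- k) :+ x :* :0) := y :- k) refl (x ^ t) x κ))
    divs : All (λ x → Div x 1 f) xs
    divs = All.map (λ {x} e → quo x f , quo-correct x f (trans (ev x) (trans (cong (_- κ) e) (-‿inverseʳ κ)))) a
    bd : Bd (suc t) f
    bd = Bd-⊞ (Xᵏ t (1# ∷ [])) (- κ ∷ []) (≡.subst (λ k → Bd k (Xᵏ t (1# ∷ []))) (ℕₚ.+-comm t 1) (Bd-Xᵏ t (1# ∷ []) (λ { (suc k) (s≤s _) → refl }))) (λ { (suc k) _ → refl })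
    lead : coef f t ≡ 1#
    lead = trans (coef-⊞ (Xᵏ t (1# ∷ [])) (- κ ∷ []) t) (trans (cong (_+ 0#) (trans (cong (coef (Xᵏ t (1# ∷ []))) (≡.sym (ℕₚ.+-identityʳ t))) (coef-Xᵏ-+ t (1# ∷ []) 0))) (+-identityʳ 1#))

  ∑-power : ∀ t .{{_ : NonZero t}} (h : K → ℕ) → ∑ (λ x → h (x ^ t)) ℕ.≤ t ℕ.* ∑ h
  ∑-power t h = begin
    ∑ (λ x → h (x ^ t))                              ≡⟨ ∑-cong (λ x → ≡.sym (∑-𝟙 (x ^ t) h)) ⟩
    ∑ (λ x → ∑ (λ κ → 𝟙 (x ^ t ≟K κ) ℕ.* h κ))       ≡⟨ ∑-comm (λ x κ → 𝟙 (x ^ t ≟K κ) ℕ.* h κ) ⟩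
    ∑ (λ κ → ∑ (λ x → 𝟙 (x ^ t ≟K κ) ℕ.* h κ))       ≡⟨ ∑-cong (λ κ → ≡.sym (∑-* (λ x → 𝟙 (x ^ t ≟K κ)) (h κ))) ⟩
    ∑ (λ κ → ∑ (λ x → 𝟙 (x ^ t ≟K κ)) ℕ.* h κ)       ≤⟨ ∑-mono (λ κ → ℕₚ.*-monoˡ-≤ (h κ) (power-fibre t κ)) ⟩
    ∑ (λ κ → t ℕ.* h κ)                              ≡⟨ ≡.sym (*-∑ t h) ⟩
    t ℕ.* ∑ h                                        ∎
    where open ℕₚ.≤-Reasoning

  All-⊥ : ∀ {A : Set} {P : A → Set} → (∀ x → ¬ P x) → ∀ xs → All P xs → length xs ≡ 0
  All-⊥ n [] _ = refl
  All-⊥ n (x ∷ _) (px ∷ _) = contradiction px (n x)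

  module _ (t n : ℕ) (α β : Fin n → K) (xs : List K) (u : Unique xs)
    (hyp : All (λ x → (¬ x ≡ 0#) × (¬ x ≡ 1#) × Σ (Fin n) λ l → (x ^ t ≡ α l) × ((x - 1#) ^ t ≡ β l)) xs)
    (h₁ : c₁₂₈ ℕ.* n ℕ.≤ t ℕ.* t) (h₂ : 16 ℕ.* n ℕ.* (t ℕ.* t ℕ.* t ℕ.* t) ℕ.≤ p ℕ.* p ℕ.* p) where

    private
      Goal : Set
      Goal = length xs ℕ.* length xs ℕ.* length xs ℕ.≤ c₆₉₁₂ ℕ.* ((n ℕ.* t) ℕ.* (n ℕ.* t))

    stepanov-list : Goal
    stepanov-list = by-cases (n ℕₚ.≟ 0)
      where
      by-cases : Dec (n ≡ 0) → Goal
      -- Without pairs there are no points; the parameters are available for n ≥ 1.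
      by-cases (yes e) = ≡.subst (λ k → k ℕ.* k ℕ.* k ℕ.≤ c₆₉₁₂ ℕ.* ((n ℕ.* t) ℕ.* (n ℕ.* t))) (≡.sym (All-⊥ (λ { x (_ , _ , i , _) → Fₚ.¬Fin0 (≡.subst Fin e i) }) xs hyp)) z≤n
      by-cases (no n≢0) = let (D , B , 1≤D , 1≤B , cnt , BD≤t , fits , final) = stepanov-parameters n t p (ℕₚ.n≢0⇒n>0 n≢0) h₁ h₂
        in final (length xs) (stepanov-core t n D B {{ℕ.>-nonZero 1≤D}} {{ℕ.>-nonZero 1≤B}} α β xs u hyp cnt BD≤t fits)

  -- Each pair (α, β) alone has at most t solutions y, which trivially gives nt points; the bound
  -- saves a cube root of this.
  stepanov : ∀ t {P : K → Set} (P? : ∀ y → Dec (P y)) {Q : K → K → Set} (Q? : ∀ α β → Dec (Q α β)) →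
    (∀ y → P y → (¬ y ≡ 0#) × (¬ y ≡ 1#) × Q (y ^ t) ((y - 1#) ^ t)) →
    ∀ n Y → n ≡ ∑ (λ α → ∑ (λ β → 𝟙 (Q? α β))) → Y ≡ ∑ (λ y → 𝟙 (P? y)) →
    c₁₂₈ ℕ.* n ℕ.≤ t ℕ.* t → 16 ℕ.* n ℕ.* (t ℕ.* t ℕ.* t ℕ.* t) ℕ.≤ p ℕ.* p ℕ.* p →
    Y ℕ.* Y ℕ.* Y ℕ.≤ c₆₉₁₂ ℕ.* ((n ℕ.* t) ℕ.* (n ℕ.* t))
  stepanov t P? {Q} Q? h n Y en eY h₁ h₂ = go (enumerate P?) (enumerate₂ Q?)
    where
    go : _ → _ → Y ℕ.* Y ℕ.* Y ℕ.≤ c₆₉₁₂ ℕ.* ((n ℕ.* t) ℕ.* (n ℕ.* t))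
    go (xs , u , a , l , _) (zs , lz , cz) = ≡.subst₂ (λ Y n → Y ℕ.* Y ℕ.* Y ℕ.≤ c₆₉₁₂ ℕ.* ((n ℕ.* t) ℕ.* (n ℕ.* t))) (trans l (≡.sym eY)) e
      (stepanov-list t (length zs) (λ l → proj₁ (lookup zs l)) (λ l → proj₂ (lookup zs l)) xs u hyp
        (≡.subst (λ n → c₁₂₈ ℕ.* n ℕ.≤ t ℕ.* t) (≡.sym e) h₁) (≡.subst (λ n → 16 ℕ.* n ℕ.* (t ℕ.* t ℕ.* t ℕ.* t) ℕ.≤ p ℕ.* p ℕ.* p) (≡.sym e) h₂))
      where
      e : length zs ≡ n
      e = trans lz (≡.sym en)
      hyp : All (λ x → (¬ x ≡ 0#) × (¬ x ≡ 1#) × Σ (Fin (length zs)) λ l → (x ^ t ≡ proj₁ (lookup zs l)) × ((x - 1#) ^ t ≡ proj₂ (lookup zs l))) xs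
      hyp = All.map (λ {y} py → let (y≢0 , y≢1 , q) = h y py ; (i , ei) = ∈-lookup (cz _ _ q) in y≢0 , y≢1 , i , cong proj₁ (≡.sym ei) , cong proj₂ (≡.sym ei)) a

-- Changes of variable in sums over the field

module _ where
 open import Data.Nat using (ℕ)
 open import Data.Nat.Primality using (Prime)
 open import Algebra.Bundles using (CommutativeSemiring)
 module FieldSums (p : ℕ) (pr : Prime p) {c ℓ} (CS : CommutativeSemiring c ℓ) where
  open PrimeField p pr
  open Summation CS
  open CommutativeSemiring CS using (Carrier; _≈_)
  open import Relation.Nullary using (¬_; yes; no)
  open import Relation.Binary.PropositionalEquality as ≡ using (_≡_; refl; cong; trans)

  ∑-scale : ∀ g → ¬ g ≡ 0# → (h : K → Carrier) → ∑ h ≈ ∑ (λ x → h (g * x))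
  ∑-scale g g≢0 h = ∑-reindex h (g *_) ((g ⁻¹) *_)
    (λ x → trans (≡.sym (*-assoc _ _ _)) (trans (cong (_* x) (inv-r g≢0)) (*-identityˡ x)))
    (λ x → trans (≡.sym (*-assoc _ _ _)) (trans (cong (_* x) (inv-l g≢0)) (*-identityˡ x)))

  ∑-shift : ∀ a (h : K → Carrier) → ∑ h ≈ ∑ (λ x → h (x + a))
  ∑-shift a h = ∑-reindex h (_+ a) (_- a)
    (λ x → solveK 2 (λ x a → (x :- a) :+ a := x) refl x a)
    (λ x → solveK 2 (λ x a → (x :+ a) :- a := x) refl x a)

  ∑-neg : ∀ (h : K → Carrier) → ∑ h ≈ ∑ (λ x → h (- x))
  ∑-neg h = ∑-reindex h -_ -_ invol invol
    where
    invol : ∀ x → - (- x) ≡ x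
    invol = solveK 1 (λ x → :- (:- x) := x) refl

  inv-inv : ∀ x → (x ⁻¹) ⁻¹ ≡ x
  inv-inv x with x ≟K 0#
  ... | yes refl = trans (cong _⁻¹ inv-0) inv-0
  ... | no x≢0 = *-cancelˡ (inv-≢0 x≢0) (trans (inv-r (inv-≢0 x≢0)) (≡.sym (inv-l x≢0)))

  -- With 0⁻¹ = 0 the map x ↦ 1 - x⁻¹ is a permutation of the whole field; its inverse sends x to (1
  -- - x)⁻¹.
  ∑-1-inv : ∀ (h : K → Carrier) → ∑ h ≈ ∑ (λ x → h (1# - (x ⁻¹)))
  ∑-1-inv h = ∑-reindex h (λ x → 1# - (x ⁻¹)) (λ x → (1# - x) ⁻¹)
    (λ x → trans (cong (λ z → 1# - z) (inv-inv (1# - x))) (lem x))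
    (λ x → trans (cong _⁻¹ (lem (x ⁻¹))) (inv-inv x))
    where
    lem : ∀ x → 1# - (1# - x) ≡ x
    lem = solveK 1 (λ x → :1 :- (:1 :- x) := x) refl

-- The third moment of differences, bounded by the multiplicative energy

module _ where
 open import Data.Nat using (ℕ; NonZero)
 open import Data.Nat.Primality using (Prime)
 open import Relation.Binary.PropositionalEquality using (_≡_)
 module ThirdMoment (p : ℕ) (pr : Prime p) (t : ℕ) .{{_ : NonZero t}} (ν : PrimeField.K p pr → ℕ) (ν0 : ν (PrimeField.0K p pr) ≡ 0) where
  open PrimeField p pr
  open NatSums
  open Arithmetic
  open Fibres p pr
  open import Data.Nat as ℕ using (zero; suc; z≤n; _≤_; _<_)
  import Data.Nat.Properties as ℕₚ
  open ℕₚ using (≤-trans; ≤-reflexive; *-mono-≤; *-monoˡ-≤; *-monoʳ-≤; +-*-commutativeSemiring)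
  open FieldSums p pr +-*-commutativeSemiring
  open import Data.Product using (_,_)
  open import Relation.Nullary using (¬_; Dec; yes; no)
  open import Relation.Binary.PropositionalEquality using (refl; cong; cong₂; trans; sym)
  open import Data.Nat.Solver using (module +-*-Solver)
  open +-*-Solver using (solve) renaming (_:=_ to _:≡_; _:+_ to _⊕_; _:*_ to _⊗_; con to num)
  open ℕₚ.≤-Reasoning

  infixl 7 _·_
  _·_ : ℕ → ℕ → ℕ
  _·_ = ℕ._*_

  N₁ : ℕ
  N₁ = ∑ ν

  -- Weighted number of representations of κ as a ratio β/α; `W₂`, the sum of its squares, is the
  -- multiplicative energy of the weight ν.
  W : K → ℕ
  W κ = ∑ (λ α → ν α · ν (κ * α))

  W₂ : ℕ
  W₂ = ∑ (λ κ → W κ · W κ)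

  -- The substitution u = x y shows that `R x` for x ≠ 0 depends only on ξ = x^t, and `r` is this
  -- function of ξ.
  r : K → ℕ
  r ξ = ∑ (λ y → ν (ξ * y ^ t) · ν (ξ * (y - 1#) ^ t))

  R : K → ℕ
  R x = ∑ (λ u → ν (u ^ t) · ν ((u - x) ^ t))

  1≤t : 1 ≤ t
  1≤t = ℕ.>-nonZero⁻¹ t

  0^t : 0# ^ t ≡ 0#
  0^t = 0^ t 1≤t

  νx0 : ∀ x → ν (x * 0#) ≡ 0
  νx0 x = trans (cong ν (zeroʳ x)) ν0

  R≡r : ∀ x → ¬ x ≡ 0# → R x ≡ r (x ^ t)
  R≡r x x≢0 = trans (∑-scale x x≢0 (λ u → ν (u ^ t) · ν ((u - x) ^ t))) (∑-cong (λ y → cong₂ (λ a b → ν a · ν b) (^-distrib-* x y t) (trans (cong (_^ t) (lem x y)) (^-distrib-* x (y - 1#) t))))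
    where
    lem : ∀ x y → x * y - x ≡ x * (y - 1#)
    lem = solveK 2 (λ x y → x :* y :- x := x :* (y :- :1)) refl

  W-sum : ∑ W ≤ N₁ · N₁
  W-sum = begin
    ∑ (λ κ → ∑ (λ α → ν α · ν (κ * α)))   ≡⟨ ∑-comm (λ κ α → ν α · ν (κ * α)) ⟩
    ∑ (λ α → ∑ (λ κ → ν α · ν (κ * α)))   ≡⟨ ∑-cong (λ α → sym (*-∑ (ν α) (λ κ → ν (κ * α)))) ⟩
    ∑ (λ α → ν α · ∑ (λ κ → ν (κ * α)))   ≤⟨ ∑-mono (λ α → inner α) ⟩
    ∑ (λ α → ν α · N₁)                    ≡⟨ sym (∑-* ν N₁) ⟩
    N₁ · N₁                               ∎
    where
    inner : ∀ α → ν α · ∑ (λ κ → ν (κ * α)) ≤ ν α · N₁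
    inner α with α ≟K 0#
    ... | yes e = ≤-trans (≤-reflexive (cong (_· ∑ (λ κ → ν (κ * α))) (trans (cong ν e) ν0))) z≤n
    ... | no α≢0 = *-monoʳ-≤ (ν α) (≤-reflexive (trans (∑-cong (λ κ → cong ν (*-comm κ α))) (sym (∑-scale α α≢0 ν))))

  W-≤ : ∀ κ → W κ ≤ N₁ · N₁
  W-≤ κ = ≤-trans (term≤∑ W κ) W-sum

  pair : ∀ α β → ¬ α ≡ 0# → ∑ (λ ξ → ν (ξ * α) · ν (ξ * β)) ≡ W (β * (α ⁻¹))
  pair α β α≢0 = sym (trans (∑-scale α α≢0 (λ a → ν a · ν (β * (α ⁻¹) * a))) (∑-cong (λ ξ → cong₂ (λ a b → ν a · ν b) (*-comm α ξ) (trans (lem β (α ⁻¹) α ξ) (trans (cong (λ z → β * ξ * z) (inv-l α≢0)) (trans (*-identityʳ _) (*-comm β ξ)))))))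
    where
    lem : ∀ b i a x → b * i * (a * x) ≡ b * x * (i * a)
    lem = solveK 4 (λ b i a x → b :* i :* (a :* x) := b :* x :* (i :* a)) refl

  ratio-power : ∀ y → ¬ y ≡ 0# → (y - 1#) ^ t * ((y ^ t) ⁻¹) ≡ (1# - (y ⁻¹)) ^ t
  ratio-power y y≢0 = *-cancelˡ (^-≢0 t y≢0) (trans (lem (y ^ t) ((y - 1#) ^ t) ((y ^ t) ⁻¹)) (trans (cong ((y - 1#) ^ t *_) (inv-r (^-≢0 t y≢0))) (trans (*-identityʳ _)
    (sym (trans (sym (^-distrib-* y (1# - (y ⁻¹)) t)) (cong (_^ t) (trans (lem2 y (y ⁻¹)) (cong (λ z → y - z) (inv-r y≢0)))))))))
    where
    lem : ∀ a b c → a * (b * c) ≡ b * (a * c)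
    lem = solveK 3 (λ a b c → a :* (b :* c) := b :* (a :* c)) refl
    lem2 : ∀ y i → y * (1# - i) ≡ y - y * i
    lem2 = solveK 2 (λ y i → y :* (:1 :- i) := y :- y :* i) refl

  -- Summing over ξ first leaves W at the ratio (y - 1)^t / y^t = (1 - y⁻¹)^t. After the permutation
  -- y ↦ 1 - y⁻¹ this is a sum of W over t-th powers, each taken at most t times.
  r-sum : ∑ r ≤ t · (N₁ · N₁)
  r-sum = begin
    ∑ (λ ξ → ∑ (λ y → ν (ξ * y ^ t) · ν (ξ * (y - 1#) ^ t)))   ≡⟨ ∑-comm (λ ξ y → ν (ξ * y ^ t) · ν (ξ * (y - 1#) ^ t)) ⟩
    ∑ (λ y → ∑ (λ ξ → ν (ξ * y ^ t) · ν (ξ * (y - 1#) ^ t)))   ≤⟨ ∑-mono inner ⟩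
    ∑ (λ y → W ((1# - (y ⁻¹)) ^ t))                            ≡⟨ sym (∑-1-inv (λ z → W (z ^ t))) ⟩
    ∑ (λ z → W (z ^ t))                                        ≤⟨ ∑-power t W ⟩
    t · ∑ W                                                    ≤⟨ *-monoʳ-≤ t W-sum ⟩
    t · (N₁ · N₁)                                              ∎
    where
    inner : ∀ y → ∑ (λ ξ → ν (ξ * y ^ t) · ν (ξ * (y - 1#) ^ t)) ≤ W ((1# - (y ⁻¹)) ^ t)
    inner y with y ≟K 0#
    ... | yes e = ≤-trans (≤-reflexive (∑-0 (λ ξ → cong (_· ν (ξ * (y - 1#) ^ t)) (trans (cong (λ z → ν (ξ * z)) (trans (cong (_^ t) e) 0^t)) (νx0 ξ))))) z≤n
    ... | no y≢0 = ≤-reflexive (trans (pair (y ^ t) ((y - 1#) ^ t) (^-≢0 t y≢0)) (cong W (ratio-power y y≢0)))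

  W₂-pairs : ∑ (λ α → ∑ (λ β → ν α · ν β · W (β * (α ⁻¹)))) ≡ W₂
  W₂-pairs = begin-equality
    ∑ (λ α → ∑ (λ β → ν α · ν β · W (β * (α ⁻¹))))    ≡⟨ ∑-cong inner ⟩
    ∑ (λ α → ∑ (λ κ → W κ · (ν α · ν (κ * α))))       ≡⟨ ∑-comm (λ α κ → W κ · (ν α · ν (κ * α))) ⟩
    ∑ (λ κ → ∑ (λ α → W κ · (ν α · ν (κ * α))))       ≡⟨ ∑-cong (λ κ → sym (*-∑ (W κ) (λ α → ν α · ν (κ * α)))) ⟩
    ∑ (λ κ → W κ · W κ)                               ∎
    where
    lem : ∀ a b w → a · b · w ≡ w · (a · b)
    lem = solve 3 (λ a b w → a ⊗ b ⊗ w :≡ w ⊗ (a ⊗ b)) refl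
    inner : ∀ α → ∑ (λ β → ν α · ν β · W (β * (α ⁻¹))) ≡ ∑ (λ κ → W κ · (ν α · ν (κ * α)))
    inner α with α ≟K 0#
    ... | yes e = trans (∑-0 (λ β → cong (λ z → z · ν β · W (β * (α ⁻¹))) (trans (cong ν e) ν0))) (sym (∑-0 (λ κ → trans (cong (λ z → W κ · (z · ν (κ * α))) (trans (cong ν e) ν0)) (ℕₚ.*-zeroʳ (W κ)))))
    ... | no α≢0 = trans (∑-scale α α≢0 (λ β → ν α · ν β · W (β * (α ⁻¹)))) (∑-cong (λ κ → trans (cong₂ (λ a b → ν α · ν a · W b) (*-comm α κ) (trans (lemK α κ (α ⁻¹)) (trans (cong (κ *_) (inv-r α≢0)) (*-identityʳ κ)))) (lem (ν α) (ν (κ * α)) (W κ))))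
      where
      lemK : ∀ a k i → a * k * i ≡ k * (a * i)
      lemK = solveK 3 (λ a k i → a :* k :* i := k :* (a :* i)) refl

  module Level (s : ℕ) (1≤s : 1 ≤ s)
    (hyp₁ : c₁₂₈ · (t · (N₁ · N₁) · W₂) ≤ t · t) (hyp₂ : 16 · (t · (N₁ · N₁) · W₂) · (t · t · t · t) ≤ p · p · p)
    (J : ℕ) (hypJ : t · (N₁ · N₁) < 2 ℕ.^ J) where

    χ : K → ℕ
    χ ξ = 𝟙 (s ℕₚ.≤? r ξ)

    n' : ℕ
    n' = ∑ χ

    -- Weighted number of ξ with r(ξ) ≥ s such that ξα and ξβ both carry weight. Evaluated at (y^t,
    -- (y - 1)^t) and summed over y, it recovers the sum of r over this level set.
    M : K → K → ℕ
    M α β = ∑ (λ ξ → χ ξ · (ν (ξ * α) · ν (ξ * β)))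

    χr : ∀ ξ → s · χ ξ ≤ χ ξ · r ξ
    χr ξ with s ℕₚ.≤? r ξ
    ... | yes l = ≤-trans (≤-reflexive (ℕₚ.*-identityʳ s)) (≤-trans l (≤-reflexive (sym (ℕₚ.*-identityˡ _))))
    ... | no _ = ≤-reflexive (ℕₚ.*-zeroʳ s)

    sn'≤ : s · n' ≤ ∑ (λ y → M (y ^ t) ((y - 1#) ^ t))
    sn'≤ = begin
      s · n'                                ≡⟨ *-∑ s χ ⟩
      ∑ (λ ξ → s · χ ξ)                     ≤⟨ ∑-mono χr ⟩
      ∑ (λ ξ → χ ξ · r ξ)                   ≡⟨ ∑-cong (λ ξ → *-∑ (χ ξ) _) ⟩
      ∑ (λ ξ → ∑ (λ y → χ ξ · (ν (ξ * y ^ t) · ν (ξ * (y - 1#) ^ t))))  ≡⟨ ∑-comm (λ ξ y → χ ξ · (ν (ξ * y ^ t) · ν (ξ * (y - 1#) ^ t))) ⟩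
      ∑ (λ y → M (y ^ t) ((y - 1#) ^ t))    ∎

    n'≤ : n' ≤ t · (N₁ · N₁)
    n'≤ = ≤-trans (∑-mono le) r-sum
      where
      le : ∀ ξ → χ ξ ≤ r ξ
      le ξ with s ℕₚ.≤? r ξ
      ... | yes l = ≤-trans 1≤s l
      ... | no _ = z≤n

    M-0ˡ : ∀ β → M 0# β ≡ 0
    M-0ˡ β = ∑-0 (λ ξ → trans (cong (λ z → χ ξ · (z · ν (ξ * β))) (νx0 ξ)) (ℕₚ.*-zeroʳ (χ ξ)))

    M-0ʳ : ∀ α → M α 0# ≡ 0
    M-0ʳ α = ∑-0 (λ ξ → trans (cong (λ z → χ ξ · (ν (ξ * α) · z)) (νx0 ξ)) (trans (cong (χ ξ ·_) (ℕₚ.*-zeroʳ (ν (ξ * α)))) (ℕₚ.*-zeroʳ (χ ξ))))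

    M≤W : ∀ α β → M α β ≤ W (β * (α ⁻¹))
    M≤W α β with α ≟K 0#
    ... | yes e = ≤-trans (≤-reflexive (trans (cong (λ z → M z β) e) (M-0ˡ β))) z≤n
    ... | no α≢0 = ≤-trans (∑-mono (λ ξ → 𝟙*-≤ (s ℕₚ.≤? r ξ) _)) (≤-reflexive (pair α β α≢0))

    M< : ∀ α β → M α β < 2 ℕ.^ J
    M< α β = ℕₚ.≤-<-trans (≤-trans (M≤W α β) (≤-trans (W-≤ _) (≤-trans (≤-reflexive (sym (ℕₚ.*-identityˡ _))) (*-monoˡ-≤ (N₁ · N₁) 1≤t)))) hypJ

    -- The ratio β/α is unchanged when both are multiplied by ξ, so every ξ of the level contributes
    -- one copy of `W₂-pairs`.
    MW : ∑ (λ α → ∑ (λ β → M α β · W (β * (α ⁻¹)))) ≤ n' · W₂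
    MW = begin
      ∑ (λ α → ∑ (λ β → M α β · W (β * (α ⁻¹))))   ≡⟨ ∑-cong (λ α → ∑-cong (λ β → ∑-* _ (W (β * (α ⁻¹))))) ⟩
      ∑ (λ α → ∑ (λ β → ∑ (λ ξ → χ ξ · (ν (ξ * α) · ν (ξ * β)) · W (β * (α ⁻¹)))))   ≡⟨ ∑-cong (λ α → ∑-comm (λ β ξ → χ ξ · (ν (ξ * α) · ν (ξ * β)) · W (β * (α ⁻¹)))) ⟩
      ∑ (λ α → ∑ (λ ξ → ∑ (λ β → χ ξ · (ν (ξ * α) · ν (ξ * β)) · W (β * (α ⁻¹)))))   ≡⟨ ∑-comm (λ α ξ → ∑ (λ β → χ ξ · (ν (ξ * α) · ν (ξ * β)) · W (β * (α ⁻¹)))) ⟩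
      ∑ (λ ξ → ∑ (λ α → ∑ (λ β → χ ξ · (ν (ξ * α) · ν (ξ * β)) · W (β * (α ⁻¹)))))   ≤⟨ ∑-mono inner ⟩
      ∑ (λ ξ → χ ξ · W₂)                           ≡⟨ sym (∑-* χ W₂) ⟩
      n' · W₂                                      ∎
      where
      inner : ∀ ξ → ∑ (λ α → ∑ (λ β → χ ξ · (ν (ξ * α) · ν (ξ * β)) · W (β * (α ⁻¹)))) ≤ χ ξ · W₂
      inner ξ with ξ ≟K 0#
      ... | yes e = ≤-trans (≤-reflexive (∑-0 (λ α → ∑-0 (λ β → trans (cong (λ z → χ ξ · (z · ν (ξ * β)) · W (β * (α ⁻¹))) (trans (cong (λ z → ν (z * α)) e) (trans (cong ν (zeroˡ α)) ν0))) (cong (_· W (β * (α ⁻¹))) (ℕₚ.*-zeroʳ (χ ξ))))))) z≤n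
      ... | no ξ≢0 = ≤-reflexive (sym (begin-equality
        χ ξ · W₂   ≡⟨ cong (χ ξ ·_) (sym W₂-pairs) ⟩
        χ ξ · ∑ (λ α → ∑ (λ β → ν α · ν β · W (β * (α ⁻¹))))   ≡⟨ cong (χ ξ ·_) (trans (∑-scale ξ ξ≢0 (λ α → ∑ (λ β → ν α · ν β · W (β * (α ⁻¹))))) (∑-cong (λ α → ∑-scale ξ ξ≢0 (λ β → ν (ξ * α) · ν β · W (β * ((ξ * α) ⁻¹)))))) ⟩
        χ ξ · ∑ (λ α → ∑ (λ β → ν (ξ * α) · ν (ξ * β) · W (ξ * β * ((ξ * α) ⁻¹))))   ≡⟨ trans (*-∑ (χ ξ) _) (∑-cong (λ α → *-∑ (χ ξ) _)) ⟩
        ∑ (λ α → ∑ (λ β → χ ξ · (ν (ξ * α) · ν (ξ * β) · W (ξ * β * ((ξ * α) ⁻¹)))))   ≡⟨ ∑-cong (λ α → ∑-cong (λ β → trans (sym (ℕₚ.*-assoc (χ ξ) (ν (ξ * α) · ν (ξ * β)) _)) (last α β))) ⟩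
        ∑ (λ α → ∑ (λ β → χ ξ · (ν (ξ * α) · ν (ξ * β)) · W (β * (α ⁻¹)))) ∎))
        where
        last : ∀ α β → χ ξ · (ν (ξ * α) · ν (ξ * β)) · W (ξ * β * ((ξ * α) ⁻¹)) ≡ χ ξ · (ν (ξ * α) · ν (ξ * β)) · W (β * (α ⁻¹))
        last α β with α ≟K 0#
        ... | yes refl = trans (z _) (sym (z _))
          where
          z : ∀ w → χ ξ · (ν (ξ * 0#) · ν (ξ * β)) · w ≡ 0
          z w = trans (cong (λ z → χ ξ · (z · ν (ξ * β)) · w) (νx0 ξ)) (cong (_· w) (ℕₚ.*-zeroʳ (χ ξ)))
        ... | no α≢0 = cong (λ z → χ ξ · (ν (ξ * α) · ν (ξ * β)) · W z) (*-cancelˡ α≢0 (*-cancelˡ ξ≢0 (trans (lem ξ α β ((ξ * α) ⁻¹)) (trans (cong (ξ * β *_) (inv-r (*-≢0 ξ≢0 α≢0))) (trans (*-identityʳ _) (sym (trans (cong (ξ *_) (lem2 α β (α ⁻¹))) (cong (ξ *_) (trans (cong (β *_) (inv-r α≢0)) (*-identityʳ β))))))))))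
          where
          lem : ∀ x a b i → x * (a * (x * b * i)) ≡ x * b * (x * a * i)
          lem = solveK 4 (λ x a b i → x :* (a :* (x :* b :* i)) := x :* b :* (x :* a :* i)) refl
          lem2 : ∀ a b i → a * (b * i) ≡ b * (a * i)
          lem2 = solveK 3 (λ a b i → a :* (b :* i) := b :* (a :* i)) refl

    module _ (m : ℕ) (1≤m : 1 ≤ m) where

      nₘ : ℕ
      nₘ = ∑ (λ α → ∑ (λ β → 𝟙 (m ℕₚ.≤? M α β)))

      Yₘ : ℕ
      Yₘ = ∑ (λ y → 𝟙 (m ℕₚ.≤? M (y ^ t) ((y - 1#) ^ t)))

      -- A pair counted in `nₘ` satisfies m ≤ M and, by `M≤W`, also m ≤ W at its ratio; hence it
      -- contributes at least m² to `MW`.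
      nₘ-≤ : m · m · nₘ ≤ n' · W₂
      nₘ-≤ = begin
        m · m · nₘ   ≡⟨ trans (*-∑ (m · m) _) (∑-cong (λ α → *-∑ (m · m) _)) ⟩
        ∑ (λ α → ∑ (λ β → m · m · 𝟙 (m ℕₚ.≤? M α β)))   ≤⟨ ∑-mono (λ α → ∑-mono (λ β → le α β)) ⟩
        ∑ (λ α → ∑ (λ β → M α β · W (β * (α ⁻¹))))   ≤⟨ MW ⟩
        n' · W₂ ∎
        where
        le : ∀ α β → m · m · 𝟙 (m ℕₚ.≤? M α β) ≤ M α β · W (β * (α ⁻¹))
        le α β with m ℕₚ.≤? M α β
        ... | yes l = ≤-trans (≤-reflexive (ℕₚ.*-identityʳ _)) (*-mono-≤ l (≤-trans l (M≤W α β)))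
        ... | no _ = ≤-trans (≤-reflexive (ℕₚ.*-zeroʳ (m · m))) z≤n

      nₘ-≤' : nₘ ≤ t · (N₁ · N₁) · W₂
      nₘ-≤' = ≤-trans (≤-trans (≤-reflexive (sym (ℕₚ.*-identityˡ nₘ))) (*-monoˡ-≤ nₘ (*-mono-≤ 1≤m 1≤m))) (≤-trans nₘ-≤ (*-monoˡ-≤ W₂ n'≤))

      Yₘ-cube : Yₘ · Yₘ · Yₘ ≤ c₆₉₁₂ · ((nₘ · t) · (nₘ · t))
      Yₘ-cube = stepanov t (λ y → m ℕₚ.≤? M (y ^ t) ((y - 1#) ^ t)) (λ α β → m ℕₚ.≤? M α β)
        (λ y h → (λ e → ℕₚ.<⇒≱ 1≤m (≤-trans h (≤-reflexive (trans (cong (λ z → M z ((y - 1#) ^ t)) (trans (cong (_^ t) e) 0^t)) (M-0ˡ _))))) ,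
                 (λ e → ℕₚ.<⇒≱ 1≤m (≤-trans h (≤-reflexive (trans (cong (M (y ^ t)) (trans (cong (_^ t) (trans (cong (_- 1#) e) (-‿inverseʳ 1#))) 0^t)) (M-0ʳ _))))) , h)
        nₘ Yₘ refl refl
        (≤-trans (*-monoʳ-≤ c₁₂₈ nₘ-≤') hyp₁) (≤-trans (*-monoˡ-≤ (t · t · t · t) (*-monoʳ-≤ 16 nₘ-≤')) hyp₂)

      -- Stepanov's bound gives m³ Yₘ³ ≪ m³ (nₘ t)². One further factor m is spent so that m² nₘ
      -- appears squared, and the resulting bound is the same for all m.
      mY-cube : (2 · m · Yₘ) · (2 · m · Yₘ) · (2 · m · Yₘ) ≤ 8 · c₆₉₁₂ · (t · t) · ((n' · W₂) · (n' · W₂))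
      mY-cube = begin
        (2 · m · Yₘ) · (2 · m · Yₘ) · (2 · m · Yₘ)    ≡⟨ solve 2 (λ m y → (num 2 ⊗ m ⊗ y) ⊗ (num 2 ⊗ m ⊗ y) ⊗ (num 2 ⊗ m ⊗ y) :≡ num 8 ⊗ (m ⊗ m ⊗ m) ⊗ (y ⊗ y ⊗ y)) refl m Yₘ ⟩
        8 · (m · m · m) · (Yₘ · Yₘ · Yₘ)              ≤⟨ *-mono-≤ (*-monoʳ-≤ 8 (≤-trans (≤-reflexive (sym (ℕₚ.*-identityʳ (m · m · m)))) (*-monoʳ-≤ (m · m · m) 1≤m))) Yₘ-cube ⟩
        8 · (m · m · m · m) · (c₆₉₁₂ · ((nₘ · t) · (nₘ · t)))  ≡⟨ solve 4 (λ m c n t → num 8 ⊗ (m ⊗ m ⊗ m ⊗ m) ⊗ (c ⊗ ((n ⊗ t) ⊗ (n ⊗ t))) :≡ num 8 ⊗ c ⊗ (t ⊗ t) ⊗ ((m ⊗ m ⊗ n) ⊗ (m ⊗ m ⊗ n))) refl m c₆₉₁₂ nₘ t ⟩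
        8 · c₆₉₁₂ · (t · t) · ((m · m · nₘ) · (m · m · nₘ))    ≤⟨ *-monoʳ-≤ (8 · c₆₉₁₂ · (t · t)) (*-mono-≤ nₘ-≤ nₘ-≤) ⟩
        8 · c₆₉₁₂ · (t · t) · ((n' · W₂) · (n' · W₂))  ∎

    -- Splitting `sn'≤` into dyadic levels of M and cubing yields (s n')³ ≪ J³ t² (n' W₂)²; the
    -- factor n'² cancels unless n' = 0.
    level-bound : s · s · s · n' ≤ (J · J · J) · (8 · c₆₉₁₂ · (t · t) · (W₂ · W₂))
    level-bound = by-cases (n' ℕₚ.≟ 0)
      where
      S = sumTo J (λ j → 2 · 2 ℕ.^ j · Yₘ (2 ℕ.^ j) (ℕₚ.m^n>0 2 j))
      sn'≤S : s · n' ≤ S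
      sn'≤S = begin
        s · n'                                ≤⟨ sn'≤ ⟩
        ∑ (λ y → M (y ^ t) ((y - 1#) ^ t))    ≤⟨ ∑-mono (λ y → dyadic (λ x → x) refl (λ h → h) J (M (y ^ t) ((y - 1#) ^ t)) (M< _ _)) ⟩
        ∑ (λ y → sumTo J (λ j → 2 ℕ.^ suc j · 𝟙 (2 ℕ.^ j ℕₚ.≤? M (y ^ t) ((y - 1#) ^ t))))   ≡⟨ ∑-sumTo J (λ j y → 2 ℕ.^ suc j · 𝟙 (2 ℕ.^ j ℕₚ.≤? M (y ^ t) ((y - 1#) ^ t))) ⟩
        sumTo J (λ j → ∑ (λ y → 2 ℕ.^ suc j · 𝟙 (2 ℕ.^ j ℕₚ.≤? M (y ^ t) ((y - 1#) ^ t))))   ≡⟨ sumTo-cong J (λ j → sym (*-∑ (2 ℕ.^ suc j) _)) ⟩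
        S ∎
        where
        sumTo-cong : ∀ J {f g : ℕ → ℕ} → (∀ j → f j ≡ g j) → sumTo J f ≡ sumTo J g
        sumTo-cong zero e = refl
        sumTo-cong (suc J) e = cong₂ ℕ._+_ (e J) (sumTo-cong J e)
      S-cube : S · S · S ≤ (J · J · J) · (8 · c₆₉₁₂ · (t · t) · ((n' · W₂) · (n' · W₂)))
      S-cube = sumTo-cube J _ _ (λ j _ → mY-cube (2 ℕ.^ j) (ℕₚ.m^n>0 2 j))
      by-cases : Dec (n' ≡ 0) → s · s · s · n' ≤ (J · J · J) · (8 · c₆₉₁₂ · (t · t) · (W₂ · W₂))
      by-cases (yes e) = ≤-trans (≤-reflexive (trans (cong (s · s · s ·_) e) (ℕₚ.*-zeroʳ (s · s · s)))) z≤n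
      by-cases (no n'≢0) = ℕₚ.*-cancelˡ-≤ (n' · n') {{ℕₚ.m*n≢0 n' n' {{ℕ.≢-nonZero n'≢0}} {{ℕ.≢-nonZero n'≢0}}}} (begin
        (n' · n') · (s · s · s · n')    ≡⟨ solve 2 (λ n s → (n ⊗ n) ⊗ (s ⊗ s ⊗ s ⊗ n) :≡ (s ⊗ n) ⊗ (s ⊗ n) ⊗ (s ⊗ n)) refl n' s ⟩
        (s · n') · (s · n') · (s · n')  ≤⟨ cube-mono sn'≤S ⟩
        S · S · S                       ≤⟨ S-cube ⟩
        (J · J · J) · (8 · c₆₉₁₂ · (t · t) · ((n' · W₂) · (n' · W₂)))  ≡⟨ solve 4 (λ j c n w → j ⊗ (c ⊗ ((n ⊗ w) ⊗ (n ⊗ w))) :≡ (n ⊗ n) ⊗ (j ⊗ (c ⊗ (w ⊗ w)))) refl (J · J · J) (8 · c₆₉₁₂ · (t · t)) n' W₂ ⟩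
        (n' · n') · ((J · J · J) · (8 · c₆₉₁₂ · (t · t) · (W₂ · W₂)))  ∎)

  R-0 : R 0# ≤ t · W 1#
  R-0 = begin
    ∑ (λ u → ν (u ^ t) · ν ((u - 0#) ^ t))  ≡⟨ ∑-cong (λ u → cong (λ z → ν (u ^ t) · ν (z ^ t)) (solveK 1 (λ u → u :- :0 := u) refl u)) ⟩
    ∑ (λ u → ν (u ^ t) · ν (u ^ t))         ≤⟨ ∑-power t (λ κ → ν κ · ν κ) ⟩
    t · ∑ (λ κ → ν κ · ν κ)                 ≡⟨ cong (t ·_) (∑-cong (λ κ → cong (λ z → ν κ · ν z) (sym (*-identityˡ κ)))) ⟩
    t · W 1#                                ∎

  cube≤fourth : ∀ w → w · w · w ≤ (w · w) · (w · w)
  cube≤fourth zero = z≤n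
  cube≤fourth w@(suc _) = ≤-trans (ℕₚ.m≤m*n (w · w · w) w) (≤-reflexive (ℕₚ.*-assoc (w · w) w w))

  module Energy
    (hyp₁ : c₁₂₈ · (t · (N₁ · N₁) · W₂) ≤ t · t) (hyp₂ : 16 · (t · (N₁ · N₁) · W₂) · (t · t · t · t) ≤ p · p · p)
    (J : ℕ) (hypJ : t · (N₁ · N₁) < 2 ℕ.^ J) where

    A : ℕ
    A = (J · J · J) · (8 · c₆₉₁₂ · (t · t) · (W₂ · W₂))

    r-cubes : ∑ (λ ξ → r ξ · r ξ · r ξ) ≤ J · (8 · A)
    r-cubes = begin
      ∑ (λ ξ → r ξ · r ξ · r ξ)   ≤⟨ ∑-mono (λ ξ → dyadic (λ x → x · x · x) refl cube-mono J (r ξ) (ℕₚ.≤-<-trans (≤-trans (term≤∑ r ξ) r-sum) hypJ)) ⟩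
      ∑ (λ ξ → sumTo J (λ j → g j · 𝟙 (2 ℕ.^ j ℕₚ.≤? r ξ)))   ≡⟨ ∑-sumTo J (λ j ξ → g j · 𝟙 (2 ℕ.^ j ℕₚ.≤? r ξ)) ⟩
      sumTo J (λ j → ∑ (λ ξ → g j · 𝟙 (2 ℕ.^ j ℕₚ.≤? r ξ)))   ≤⟨ sumTo-≤ J _ (8 · A) (λ j _ → term j) ⟩
      J · (8 · A)    ∎
      where
      g : ℕ → ℕ
      g j = 2 ℕ.^ suc j · 2 ℕ.^ suc j · 2 ℕ.^ suc j
      term : ∀ j → ∑ (λ ξ → g j · 𝟙 (2 ℕ.^ j ℕₚ.≤? r ξ)) ≤ 8 · A
      term j = begin
        ∑ (λ ξ → g j · 𝟙 (2 ℕ.^ j ℕₚ.≤? r ξ))  ≡⟨ sym (*-∑ (g j) _) ⟩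
        g j · L.n'                             ≡⟨ solve 2 (λ m n → ((num 2 ⊗ m) ⊗ (num 2 ⊗ m) ⊗ (num 2 ⊗ m)) ⊗ n :≡ num 8 ⊗ (m ⊗ m ⊗ m ⊗ n)) refl (2 ℕ.^ j) L.n' ⟩
        8 · (2 ℕ.^ j · 2 ℕ.^ j · 2 ℕ.^ j · L.n')  ≤⟨ *-monoʳ-≤ 8 L.level-bound ⟩
        8 · A                                  ∎
        where module L = Level (2 ℕ.^ j) (ℕₚ.m^n>0 2 j) hyp₁ hyp₂ J hypJ

    -- Each ξ comes from at most t values x, and the cubes of r are summed over dyadic levels s,
    -- where `level-bound` controls s³ n'. The point x = 0 is treated apart: R(0) ≤ t W(1), and
    -- W(1)³ ≤ W(1)⁴ ≤ W₂².
    energy : ∑ (λ x → R x · R x · R x) ≤ (t · t · t) · (W₂ · W₂) · (1 ℕ.+ 64 · c₆₉₁₂ · (J · J · J · J))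
    energy = begin
      ∑ (λ x → R x · R x · R x)   ≤⟨ ∑-mono split ⟩
      ∑ (λ x → 𝟙 (0# ≟K x) · R₀³ ℕ.+ r (x ^ t) · r (x ^ t) · r (x ^ t))   ≡⟨ ∑-+ (λ x → 𝟙 (0# ≟K x) · R₀³) (λ x → r (x ^ t) · r (x ^ t) · r (x ^ t)) ⟩
      ∑ (λ x → 𝟙 (0# ≟K x) · R₀³) ℕ.+ ∑ (λ x → r (x ^ t) · r (x ^ t) · r (x ^ t))   ≤⟨ ℕₚ.+-mono-≤ (≤-reflexive (∑-𝟙 0# (λ _ → R₀³))) (∑-power t (λ ξ → r ξ · r ξ · r ξ)) ⟩
      R₀³ ℕ.+ t · ∑ (λ ξ → r ξ · r ξ · r ξ)   ≤⟨ ℕₚ.+-mono-≤ R₀³≤ (*-monoʳ-≤ t r-cubes) ⟩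
      (t · t · t) · (W₂ · W₂) ℕ.+ t · (J · (8 · ((J · J · J) · (8 · c₆₉₁₂ · (t · t) · (W₂ · W₂)))))   ≡⟨ solve 4 (λ t w j c → (t ⊗ t ⊗ t) ⊗ (w ⊗ w) ⊕ t ⊗ (j ⊗ (num 8 ⊗ ((j ⊗ j ⊗ j) ⊗ (num 8 ⊗ c ⊗ (t ⊗ t) ⊗ (w ⊗ w))))) :≡ (t ⊗ t ⊗ t) ⊗ (w ⊗ w) ⊗ (num 1 ⊕ num 64 ⊗ c ⊗ (j ⊗ j ⊗ j ⊗ j))) refl t W₂ J c₆₉₁₂ ⟩
      (t · t · t) · (W₂ · W₂) · (1 ℕ.+ 64 · c₆₉₁₂ · (J · J · J · J))  ∎
      where
      R₀³ = R 0# · R 0# · R 0#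
      split : ∀ x → R x · R x · R x ≤ 𝟙 (0# ≟K x) · R₀³ ℕ.+ r (x ^ t) · r (x ^ t) · r (x ^ t)
      split x with 0# ≟K x
      ... | yes refl = ≤-trans (≤-reflexive (sym (ℕₚ.*-identityˡ R₀³))) (ℕₚ.m≤m+n _ _)
      ... | no ne = ≤-reflexive (cong (λ z → z · z · z) (R≡r x (λ e → ne (sym e))))
      R₀³≤ : R₀³ ≤ (t · t · t) · (W₂ · W₂)
      R₀³≤ = begin
        R₀³    ≤⟨ cube-mono R-0 ⟩
        (t · W 1#) · (t · W 1#) · (t · W 1#)    ≡⟨ solve 2 (λ t w → (t ⊗ w) ⊗ (t ⊗ w) ⊗ (t ⊗ w) :≡ (t ⊗ t ⊗ t) ⊗ (w ⊗ w ⊗ w)) refl t (W 1#) ⟩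
        (t · t · t) · (W 1# · W 1# · W 1#)    ≤⟨ *-monoʳ-≤ (t · t · t) (≤-trans (cube≤fourth (W 1#)) (*-mono-≤ w w)) ⟩
        (t · t · t) · (W₂ · W₂) ∎
        where
        w : W 1# · W 1# ≤ W₂
        w = term≤∑ (λ κ → W κ · W κ) 1#

-- Ordered rings and Cauchy's inequality

module OrderedRings where
 open import Level using (0ℓ)
 open import Algebra.Bundles using (CommutativeRing)
 open import Data.Nat as ℕ using (ℕ; zero; suc)
 import Data.Nat.Properties as ℕₚ
 open import Data.Fin using (Fin; zero; suc)
 open import Data.Product using (_×_; _,_; proj₁; proj₂)

 -- These axioms hold for ℚ as well as for bounded sequences modulo O(1/n). The order is not assumed
 -- total, and `cancel-pos` divides only by elements bounded below by some 1/n, since a positive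
 -- sequence may tend to 0. Through `reflect` inequalities between numerals return to ℕ.
 record OrderedRing : Set₁ where
   infix 4 _≤_
   field
     CR : CommutativeRing 0ℓ 0ℓ
   open CommutativeRing CR public using (Carrier; _≈_; _+_; _*_; -_; _-_; 0#; 1#)
   open IntegerSolver CR public using (ι)
   field
     _≤_ : Carrier → Carrier → Set
     ≤-reflexive : ∀ {x y} → x ≈ y → x ≤ y
     ≤-trans : ∀ {x y z} → x ≤ y → y ≤ z → x ≤ z
     ≤-antisym : ∀ {x y} → x ≤ y → y ≤ x → x ≈ y
     +-mono : ∀ {a b c d} → a ≤ b → c ≤ d → a + c ≤ b + d
     *-nonneg : ∀ {x y} → 0# ≤ x → 0# ≤ y → 0# ≤ x * y
     sq-nonneg : ∀ x → 0# ≤ x * x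
     reflect : ∀ {m n} → ι m ≤ ι n → m ℕ.≤ n
     cancel-pos : ∀ n {x y} → 1# ≤ ι n * y → 0# ≤ y * x → 0# ≤ x

 module OrderedRingProperties (O : OrderedRing) where
   open OrderedRing O public
   open CommutativeRing CR public
     using (refl; sym; trans; reflexive; +-cong; +-congˡ; +-congʳ; *-cong; *-congˡ; *-congʳ; -‿cong; +-assoc; +-comm; +-identityˡ; +-identityʳ; *-assoc; *-comm; *-identityˡ; *-identityʳ; zeroˡ; zeroʳ; distribˡ; distribʳ; -‿inverseˡ; -‿inverseʳ; commutativeSemiring; setoid)
   open IntegerSolver CR public using (ι-+; ι-*; ι-suc; solve; _:=_; _:+_; _:*_; _:-_; :-_; :0; :1)
   open Summation commutativeSemiring public

   ≤-refl : ∀ {x} → x ≤ x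
   ≤-refl = ≤-reflexive refl

   ≤-resp : ∀ {x x' y y'} → x ≈ x' → y ≈ y' → x ≤ y → x' ≤ y'
   ≤-resp e e' h = ≤-trans (≤-reflexive (sym e)) (≤-trans h (≤-reflexive e'))

   0≤y-x : ∀ {x y} → x ≤ y → 0# ≤ y - x
   0≤y-x {x} {y} h = ≤-resp (-‿inverseʳ x) refl (+-mono h ≤-refl)

   0≤y-x⁻ : ∀ {x y} → 0# ≤ y - x → x ≤ y
   0≤y-x⁻ {x} {y} h = ≤-resp (+-identityˡ x) (solve 2 (λ x y → y :- x :+ x := y) refl x y) (+-mono h ≤-refl)

   *-monoˡ : ∀ {x y} z → 0# ≤ z → x ≤ y → z * x ≤ z * y
   *-monoˡ {x} {y} z 0≤z h = 0≤y-x⁻ (≤-resp refl (solve 3 (λ z x y → z :* (y :- x) := z :* y :- z :* x) refl z x y) (*-nonneg 0≤z (0≤y-x h)))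

   *-monoʳ : ∀ {x y} z → 0# ≤ z → x ≤ y → x * z ≤ y * z
   *-monoʳ z 0≤z h = ≤-resp (*-comm _ _) (*-comm _ _) (*-monoˡ z 0≤z h)

   *-mono : ∀ {a b c d} → 0# ≤ a → 0# ≤ c → a ≤ b → c ≤ d → a * c ≤ b * d
   *-mono {a} {b} {c} {d} 0≤a 0≤c h h' = ≤-trans (*-monoʳ c 0≤c h) (*-monoˡ b (≤-trans 0≤a h) h')

   +-nonneg : ∀ {x y} → 0# ≤ x → 0# ≤ y → 0# ≤ x + y
   +-nonneg h h' = ≤-resp (+-identityˡ _) refl (+-mono h h')

   0≤1 : 0# ≤ 1#
   0≤1 = ≤-resp refl (*-identityˡ 1#) (sq-nonneg 1#)

   ι-nonneg : ∀ n → 0# ≤ ι n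
   ι-nonneg zero = ≤-refl
   ι-nonneg (suc n) = ≤-resp refl (sym (ι-suc n)) (+-nonneg 0≤1 (ι-nonneg n))

   ι-mono : ∀ {m n} → m ℕ.≤ n → ι m ≤ ι n
   ι-mono {n = n} ℕ.z≤n = ι-nonneg n
   ι-mono {suc m} {suc n} (ℕ.s≤s h) = ≤-resp (sym (ι-suc m)) (sym (ι-suc n)) (+-mono ≤-refl (ι-mono h))

   ∑-mono : ∀ {n} {f g : Fin n → Carrier} → (∀ i → f i ≤ g i) → ∑ f ≤ ∑ g
   ∑-mono {zero} {f} {g} h = ≤-reflexive (trans (∑-zero f) (sym (∑-zero g)))
   ∑-mono {suc n} {f} {g} h = ≤-resp (sym (∑-suc f)) (sym (∑-suc g)) (+-mono (h zero) (∑-mono (λ i → h (suc i))))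

   ∑-nonneg : ∀ {n} {f : Fin n → Carrier} → (∀ i → 0# ≤ f i) → 0# ≤ ∑ f
   ∑-nonneg {n} h = ≤-resp (∑-0 {n} (λ _ → refl)) refl (∑-mono h)

   cancel-≤ : ∀ n {x y z} → 1# ≤ ι n * z → z * x ≤ z * y → x ≤ y
   cancel-≤ n {x} {y} {z} h h' = 0≤y-x⁻ (cancel-pos n h (≤-resp refl (solve 3 (λ z x y → z :* y :- z :* x := z :* (y :- x)) refl z x y) (0≤y-x h')))

   cancel : ∀ n {x y} → ι (suc n) * x ≤ ι (suc n) * y → x ≤ y
   cancel n = cancel-≤ 1 (≤-resp refl (sym (*-identityˡ _)) (ι-mono {1} {suc n} (ℕ.s≤s ℕ.z≤n)))

   cancel₀ : ∀ n {x y} → 1# ≤ ι n * y → y * x ≈ 0# → x ≈ 0#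
   cancel₀ n {x} {y} h e = ≤-antisym (cancel-≤ n h (≤-reflexive (trans e (sym (zeroʳ y))))) (cancel-≤ n h (≤-reflexive (trans (zeroʳ y) (sym e))))

   cancel⁺ : ∀ n {x y} → 1 ℕ.≤ n → ι n * x ≤ ι n * y → x ≤ y
   cancel⁺ (suc n) _ = cancel n

   twice-0 : ∀ {x} → x ≈ - x → x ≈ 0#
   twice-0 {x} e = cancel₀ 1 {x} {1# + 1#} (≤-resp (+-identityʳ 1#) (sym (*-identityˡ _)) (+-mono ≤-refl 0≤1)) (trans (trans (distribʳ x 1# 1#) (+-cong (*-identityˡ x) (*-identityˡ x))) (trans (+-congˡ e) (-‿inverseʳ x)))

   halve-≤ : ∀ {x y} → x + x ≤ y + y → x ≤ y
   halve-≤ {x} {y} h = cancel 1 (≤-resp (lem x) (lem y) h)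
     where
     lem : ∀ x → x + x ≈ (1# + 1#) * x
     lem = solve 1 (λ x → x :+ x := (:1 :+ :1) :* x) refl

   halve : ∀ {x y} → x + x ≈ y + y → x ≈ y
   halve e = ≤-antisym (halve-≤ (≤-reflexive e)) (halve-≤ (≤-reflexive (sym e)))

   sq-mono : ∀ {x y} → 0# ≤ x → x ≤ y → x * x ≤ y * y
   sq-mono 0≤x h = *-mono 0≤x 0≤x h h

   neg-≤ : ∀ {a b} → a ≤ b → - b ≤ - a
   neg-≤ {a} {b} h = 0≤y-x⁻ (≤-resp refl (solve 2 (λ a b → b :- a := (:- a) :- (:- b)) refl a b) (0≤y-x h))

   -- The inequality |A y| ≤ C b without absolute values: (C - A)(b + y) and (C + A)(b - y) are
   -- nonnegative and add up to 2 (C b - A y).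
   abs-* : ∀ {A y C b} → A ≤ C → - C ≤ A → y ≤ b → - b ≤ y → A * y ≤ C * b
   abs-* {A} {y} {C} {b} h₁ h₂ h₃ h₄ = halve-≤ (0≤y-x⁻ (≤-resp refl (solve 4 (λ A y C b → (C :- A) :* (y :- (:- b)) :+ (A :- (:- C)) :* (b :- y) := (C :* b :+ C :* b) :- (A :* y :+ A :* y)) refl A y C b)
     (+-nonneg (*-nonneg (0≤y-x h₁) (0≤y-x h₄)) (*-nonneg (0≤y-x h₂) (0≤y-x h₃)))))

   abs-*' : ∀ {A y C b} → A ≤ C → - C ≤ A → y ≤ b → - b ≤ y → - (C * b) ≤ A * y
   abs-*' {A} {y} {C} {b} h₁ h₂ h₃ h₄ = ≤-resp refl (solve 2 (λ a y → :- ((:- a) :* y) := a :* y) refl A y) (neg-≤ (abs-* { - A} {y} {C} {b} (≤-resp refl (solve 1 (λ c → :- (:- c) := c) refl C) (neg-≤ h₂)) (neg-≤ h₁) h₃ h₄))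

   module Cauchy {I : Set} (E : (I → Carrier) → Carrier)
     (E-cong : ∀ {f g} → (∀ i → f i ≈ g i) → E f ≈ E g)
     (E-+ : ∀ f g → E (λ i → f i + g i) ≈ E f + E g)
     (E-* : ∀ x f → x * E f ≈ E (λ i → x * f i))
     (E-nonneg : ∀ {f} → (∀ i → 0# ≤ f i) → 0# ≤ E f) where

     private
       E-neg : ∀ f → E (λ i → - f i) ≈ - E f
       E-neg f = trans (E-cong (λ i → lem (f i))) (trans (sym (E-* (- 1#) f)) (sym (lem (E f))))
         where
         lem : ∀ x → - x ≈ - 1# * x
         lem = solve 1 (λ x → :- x := (:- :1) :* x) refl

       E-*ʳ : ∀ f x → E f * x ≈ E (λ i → f i * x)
       E-*ʳ f x = trans (*-comm _ x) (trans (E-* x f) (E-cong (λ i → *-comm x (f i))))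

       E-** : ∀ f g → E f * E g ≈ E (λ i → E (λ j → f i * g j))
       E-** f g = trans (E-*ʳ f (E g)) (E-cong (λ i → E-* (f i) g))

       E-lin : ∀ a b k d → E (λ i → a i + (b i + - (k * d i))) ≈ E a + (E b + - (k * E d))
       E-lin a b k d = trans (E-+ a (λ i → b i + - (k * d i))) (+-congˡ (trans (E-+ b (λ i → - (k * d i))) (+-congˡ (trans (E-neg (λ i → k * d i)) (-‿cong (sym (E-* k d)))))))

     -- Lagrange's identity: the double sum of the squares of f_i g_j - f_j g_i is twice the
     -- difference of the two sides. The functional E stands for any positive linear sum, so single
     -- and double sums are served by one proof.
     cauchy : ∀ (f g : I → Carrier) → E (λ i → f i * g i) * E (λ i → f i * g i) ≤ E (λ i → f i * f i) * E (λ i → g i * g i)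
     cauchy f g = halve-≤ (0≤y-x⁻ (≤-resp refl eq (E-nonneg (λ i → E-nonneg (λ j → sq-nonneg (f i * g j - f j * g i))))))
       where
       open import Relation.Binary.Reasoning.Setoid setoid
       FF = E (λ i → f i * f i)
       GG = E (λ i → g i * g i)
       FG = E (λ i → f i * g i)
       lem : ∀ a b c d → (a * d - b * c) * (a * d - b * c) ≈ (a * a) * (d * d) + ((c * c) * (b * b) + - ((1# + 1#) * ((a * c) * (b * d))))
       lem = solve 4 (λ a b c d → (a :* d :- b :* c) :* (a :* d :- b :* c) := (a :* a) :* (d :* d) :+ ((c :* c) :* (b :* b) :+ (:- ((:1 :+ :1) :* ((a :* c) :* (b :* d)))))) refl
       eq : E (λ i → E (λ j → (f i * g j - f j * g i) * (f i * g j - f j * g i))) ≈ (FF * GG + FF * GG) - (FG * FG + FG * FG)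
       eq = begin
         E (λ i → E (λ j → (f i * g j - f j * g i) * (f i * g j - f j * g i)))   ≈⟨ E-cong (λ i → E-cong (λ j → lem (f i) (f j) (g i) (g j))) ⟩
         E (λ i → E (λ j → (f i * f i) * (g j * g j) + ((g i * g i) * (f j * f j) + - ((1# + 1#) * ((f i * g i) * (f j * g j))))))   ≈⟨ E-cong (λ i → E-lin (λ j → (f i * f i) * (g j * g j)) (λ j → (g i * g i) * (f j * f j)) (1# + 1#) (λ j → (f i * g i) * (f j * g j))) ⟩
         E (λ i → E (λ j → (f i * f i) * (g j * g j)) + (E (λ j → (g i * g i) * (f j * f j)) + - ((1# + 1#) * E (λ j → (f i * g i) * (f j * g j)))))   ≈⟨ E-lin (λ i → E (λ j → (f i * f i) * (g j * g j))) (λ i → E (λ j → (g i * g i) * (f j * f j))) (1# + 1#) (λ i → E (λ j → (f i * g i) * (f j * g j))) ⟩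
         E (λ i → E (λ j → (f i * f i) * (g j * g j))) + (E (λ i → E (λ j → (g i * g i) * (f j * f j))) + - ((1# + 1#) * E (λ i → E (λ j → (f i * g i) * (f j * g j)))))   ≈⟨ +-cong (sym (E-** (λ i → f i * f i) (λ j → g j * g j))) (+-cong (sym (E-** (λ i → g i * g i) (λ j → f j * f j))) (-‿cong (*-congˡ (sym (E-** (λ i → f i * g i) (λ j → f j * g j)))))) ⟩
         FF * GG + (GG * FF + - ((1# + 1#) * (FG * FG)))   ≈⟨ solve 3 (λ a b c → a :* b :+ (b :* a :+ (:- ((:1 :+ :1) :* (c :* c)))) := (a :* b :+ a :* b) :- (c :* c :+ c :* c)) refl FF GG FG ⟩
         (FF * GG + FF * GG) - (FG * FG + FG * FG) ∎

   ∑-cauchy : ∀ {n} (f g : Fin n → Carrier) → ∑ (λ i → f i * g i) * ∑ (λ i → f i * g i) ≤ ∑ (λ i → f i * f i) * ∑ (λ i → g i * g i)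
   ∑-cauchy = Cauchy.cauchy ∑ ∑-cong ∑-+ *-∑ ∑-nonneg

   ∑∑-cauchy : ∀ {m n} (f g : Fin m → Fin n → Carrier) → ∑ (λ i → ∑ (λ j → f i j * g i j)) * ∑ (λ i → ∑ (λ j → f i j * g i j)) ≤ ∑ (λ i → ∑ (λ j → f i j * f i j)) * ∑ (λ i → ∑ (λ j → g i j * g i j))
   ∑∑-cauchy {m} {n} f g = Cauchy.cauchy {Fin m × Fin n} (λ h → ∑ (λ i → ∑ (λ j → h (i , j))))
     (λ e → ∑-cong (λ i → ∑-cong (λ j → e (i , j))))
     (λ f g → trans (∑-cong (λ i → ∑-+ (λ j → f (i , j)) (λ j → g (i , j)))) (∑-+ (λ i → ∑ (λ j → f (i , j))) (λ i → ∑ (λ j → g (i , j)))))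
     (λ x f → trans (*-∑ x (λ i → ∑ (λ j → f (i , j)))) (∑-cong (λ i → *-∑ x (λ j → f (i , j)))))
     (λ h → ∑-nonneg (λ i → ∑-nonneg (λ j → h (i , j))))
     (λ k → f (proj₁ k) (proj₂ k)) (λ k → g (proj₁ k) (proj₂ k))

   ∑-neg : ∀ {n} (f : Fin n → Carrier) → ∑ (λ i → - f i) ≈ - ∑ f
   ∑-neg f = trans (∑-cong (λ i → lem (f i))) (trans (sym (*-∑ (- 1#) f)) (sym (lem (∑ f))))
     where
     lem : ∀ x → - x ≈ - 1# * x
     lem = solve 1 (λ x → :- x := (:- :1) :* x) refl

   module ℕ∑ = Summation ℕₚ.+-*-commutativeSemiring

   ι-∑ : ∀ {n} (f : Fin n → ℕ) → ι (ℕ∑.∑ f) ≈ ∑ (λ i → ι (f i))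
   ι-∑ {zero} f = trans (reflexive (cong ι (ℕ∑.∑-zero f))) (sym (∑-zero _))
     where open import Relation.Binary.PropositionalEquality using (cong)
   ι-∑ {suc n} f = trans (reflexive (cong ι (ℕ∑.∑-suc f))) (trans (ι-+ (f zero) (ℕ∑.∑ (λ i → f (suc i)))) (trans (+-congˡ (ι-∑ (λ i → f (suc i)))) (sym (∑-suc _))))
     where open import Relation.Binary.PropositionalEquality using (cong)

-- Fourier analysis on the field in terms of cosine and sine

module _ where
 open import Data.Nat using (ℕ; NonZero)
 open import Data.Nat.Primality using (Prime)
 open OrderedRings using (OrderedRing)
 module FourierAnalysis (p : ℕ) (pr : Prime p) (O : OrderedRing) where
  open OrderedRings using (module OrderedRingProperties)
  open OrderedRingProperties O
  open PrimeField p pr using (K; _≟K_; toℕ≢0; ^-distrib-*; 1≢0)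
    renaming (_+_ to _⊕_; _*_ to _⊗_; -_ to ⊖_; _-_ to _⊝_; 0# to 𝟘; 1# to 𝟏; _^_ to _↑_; zeroˡ to ⊗-zeroˡ; zeroʳ to ⊗-zeroʳ; *-comm to ⊗-comm; *-identityʳ to ⊗-identityʳ; *-identityˡ to ⊗-identityˡ; *-assoc to ⊗-assoc;
      solveK to solveK; _:=_ to _:≡_; _:+_ to _:⊕_; _:*_ to _:⊗_; _:-_ to _:⊝_; :-_ to :⊖_; :0 to :𝟘; :1 to :𝟏; x-y≡0⇒x≡y to ⊝≡0; -‿inverseʳ to ⊖-inverseʳ)
  open FieldSums p pr commutativeSemiring using (∑-scale; ∑-shift) renaming (∑-neg to ∑-⊖)
  open import Data.Nat as ℕ using (zero; suc)
  import Data.Nat.Properties as ℕₚ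
  open import Data.Fin using (Fin; toℕ)
  open import Data.Sum using (inj₁; inj₂)
  import Data.Fin.Properties as Fₚ
  open import Relation.Nullary using (¬_; ¬?; yes; no)
  open import Relation.Binary.PropositionalEquality as ≡ using (_≡_; cong)
  open import Relation.Binary.Reasoning.Setoid setoid

  -- c and s play the roles of cos(2πx/p) and sin(2πx/p).
  record Trig : Set where
    field
      c s : K → Carrier
      c-⊕ : ∀ x y → c (x ⊕ y) ≈ c x * c y - s x * s y
      s-⊕ : ∀ x y → s (x ⊕ y) ≈ s x * c y + c x * s y
      c-𝟘 : c 𝟘 ≈ 1#
      s-𝟘 : s 𝟘 ≈ 0#
      c-⊖ : ∀ x → c (⊖ x) ≈ c x
      s-⊖ : ∀ x → s (⊖ x) ≈ - s x
      -- For x at distance at least h from the multiples of p one has 1 - cos(2πx/p) = 2 sin²(πx/p)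
      -- ≥ 8h²/p²; half of this is required.
      separated : ∀ h x → h ℕ.≤ toℕ x → toℕ x ℕ.+ h ℕ.≤ p → ι (4 ℕ.* (h ℕ.* h)) ≤ ι (p ℕ.* p) * (1# - c x)

  module Fourier (T : Trig) where
    open Trig T

    c-⊝ : ∀ x y → c (x ⊝ y) ≈ c x * c y + s x * s y
    c-⊝ x y = begin
      c (x ⊕ (⊖ y))                       ≈⟨ c-⊕ x (⊖ y) ⟩
      c x * c (⊖ y) - s x * s (⊖ y)       ≈⟨ +-cong (*-congˡ (c-⊖ y)) (-‿cong (*-congˡ (s-⊖ y))) ⟩
      c x * c y - s x * - s y             ≈⟨ solve 3 (λ a b d → a :- b :* (:- d) := a :+ b :* d) refl (c x * c y) (s x) (s y) ⟩
      c x * c y + s x * s y               ∎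

    c²+s² : ∀ x → c x * c x + s x * s x ≈ 1#
    c²+s² x = trans (sym (c-⊝ x x)) (trans (reflexive (cong c (⊖-inverseʳ x))) c-𝟘)

    c-dist : ∀ u x y → c (u ⊗ (x ⊝ y)) ≈ c (u ⊗ x) * c (u ⊗ y) + s (u ⊗ x) * s (u ⊗ y)
    c-dist u x y = trans (reflexive (cong c (solveK 3 (λ u x y → u :⊗ (x :⊝ y) :≡ u :⊗ x :⊝ u :⊗ y) ≡.refl u x y))) (c-⊝ _ _)

    c-distʳ : ∀ x y u → c ((x ⊝ y) ⊗ u) ≈ c (x ⊗ u) * c (y ⊗ u) + s (x ⊗ u) * s (y ⊗ u)
    c-distʳ x y u = trans (reflexive (cong c (solveK 3 (λ u x y → (x :⊝ y) :⊗ u :≡ x :⊗ u :⊝ y :⊗ u) ≡.refl u x y))) (c-⊝ _ _)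

    odd-sum : (f : K → Carrier) → (∀ x → f (⊖ x) ≈ - f x) → ∑ f ≈ 0#
    odd-sum f h = twice-0 (trans (∑-⊖ f) (trans (∑-cong h) (∑-neg f)))

    ⊖-⊗ : ∀ x a → x ⊗ (⊖ a) ≡ ⊖ (x ⊗ a)
    ⊖-⊗ = solveK 2 (λ x a → x :⊗ (:⊖ a) :≡ :⊖ (x :⊗ a)) ≡.refl

    ⊖-⊗ˡ : ∀ x a → (⊖ x) ⊗ a ≡ ⊖ (x ⊗ a)
    ⊖-⊗ˡ = solveK 2 (λ x a → (:⊖ x) :⊗ a :≡ :⊖ (x :⊗ a)) ≡.refl

    c-⊖⊗ : ∀ x a → c (x ⊗ (⊖ a)) ≈ c (x ⊗ a)
    c-⊖⊗ x a = trans (reflexive (cong c (⊖-⊗ x a))) (c-⊖ _)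

    s-⊖⊗ : ∀ x a → s (x ⊗ (⊖ a)) ≈ - s (x ⊗ a)
    s-⊖⊗ x a = trans (reflexive (cong s (⊖-⊗ x a))) (s-⊖ _)

    s-sum : ∀ x → ∑ (λ a → s (x ⊗ a)) ≈ 0#
    s-sum x = odd-sum (λ a → s (x ⊗ a)) (s-⊖⊗ x)

    -- Shifting a by 1 and using that the sines sum to 0 gives C = C c(x), so (1 - c(x)) C = 0.
    -- Separation keeps 1 - c(x) above 4/p², hence it can be cancelled.
    orthogonality : ∀ x → ¬ x ≡ 𝟘 → ∑ (λ a → c (x ⊗ a)) ≈ 0#
    orthogonality x x≢0 = cancel₀ (p ℕ.* p) {_} {1# - c x} (≤-trans (ι-mono {1} {4} (ℕ.s≤s ℕ.z≤n)) (separated 1 x (toℕ≢0 x x≢0) (ℕₚ.≤-trans (ℕₚ.≤-reflexive (ℕₚ.+-comm (toℕ x) 1)) (Fₚ.toℕ<n x)))) eq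
      where
      C = ∑ (λ a → c (x ⊗ a))
      shifted : C ≈ C * c x
      shifted = begin
        C                                                ≈⟨ ∑-shift 𝟏 (λ a → c (x ⊗ a)) ⟩
        ∑ (λ a → c (x ⊗ (a ⊕ 𝟏)))                        ≈⟨ ∑-cong (λ a → trans (reflexive (cong c (solveK 2 (λ x a → x :⊗ (a :⊕ :𝟏) :≡ x :⊗ a :⊕ x) ≡.refl x a))) (trans (c-⊕ _ _) (solve 4 (λ a b d e → a :* b :- d :* e := a :* b :+ d :* (:- e)) refl _ _ _ _))) ⟩
        ∑ (λ a → c (x ⊗ a) * c x + s (x ⊗ a) * - s x)    ≈⟨ ∑-+ _ _ ⟩
        ∑ (λ a → c (x ⊗ a) * c x) + ∑ (λ a → s (x ⊗ a) * - s x)  ≈⟨ +-cong (sym (∑-* _ _)) (sym (∑-* _ _)) ⟩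
        C * c x + ∑ (λ a → s (x ⊗ a)) * - s x            ≈⟨ +-congˡ (trans (*-congʳ (s-sum x)) (zeroˡ _)) ⟩
        C * c x + 0#                                     ≈⟨ +-identityʳ _ ⟩
        C * c x                                          ∎
      eq : (1# - c x) * C ≈ 0#
      eq = begin
        (1# - c x) * C     ≈⟨ solve 2 (λ c C → (:1 :- c) :* C := C :- C :* c) refl (c x) C ⟩
        C - C * c x        ≈⟨ +-congˡ (-‿cong (sym shifted)) ⟩
        C - C              ≈⟨ -‿inverseʳ C ⟩
        0#                 ∎

    -- By orthogonality this is p times the indicator of 0.
    D : K → Carrier
    D x = ∑ (λ a → c (x ⊗ a))

    ∑-one : ∀ n → ∑ {n} (λ _ → 1#) ≈ ι n
    ∑-one zero = ∑-zero _
    ∑-one (suc n) = trans (∑-suc _) (trans (+-congˡ (∑-one n)) (sym (ι-suc n)))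

    D-𝟘 : D 𝟘 ≈ ι p
    D-𝟘 = trans (∑-cong (λ a → trans (reflexive (cong c (⊗-zeroˡ a))) c-𝟘)) (∑-one p)

    ∑-D : ∀ (φ : K → Carrier) x → ∑ (λ y → φ y * D (x ⊝ y)) ≈ φ x * ι p
    ∑-D φ x = trans (∑-single x (λ y → φ y * D (x ⊝ y)) (λ y ne → trans (*-congˡ (orthogonality (x ⊝ y) (λ e → ne (⊝≡0 e)))) (zeroʳ _))) (*-congˡ (trans (reflexive (cong D (⊖-inverseʳ x))) D-𝟘))

    -- The cosine transform, which is the Fourier transform when g is even.
    hat : (K → Carrier) → K → Carrier
    hat g a = ∑ (λ x → g x * c (x ⊗ a))

    cc-sum : ∀ x y → ∑ (λ a → c (x ⊗ a) * c (y ⊗ a)) + ∑ (λ a → c (x ⊗ a) * c (y ⊗ a)) ≈ D (x ⊝ y) + D (x ⊝ (⊖ y))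
    cc-sum x y = begin
      _ ≈⟨ ∑-+ _ _ ⟨
      ∑ (λ a → c (x ⊗ a) * c (y ⊗ a) + c (x ⊗ a) * c (y ⊗ a))   ≈⟨ ∑-cong (λ a → sym (begin
         c ((x ⊝ y) ⊗ a) + c ((x ⊝ (⊖ y)) ⊗ a)   ≈⟨ +-cong (c-distʳ x y a) (trans (c-distʳ x (⊖ y) a) (+-cong (*-congˡ (trans (reflexive (cong c (⊖-⊗ˡ y a))) (c-⊖ _))) (*-congˡ (trans (reflexive (cong s (⊖-⊗ˡ y a))) (s-⊖ _))))) ⟩
         (c (x ⊗ a) * c (y ⊗ a) + s (x ⊗ a) * s (y ⊗ a)) + (c (x ⊗ a) * c (y ⊗ a) + s (x ⊗ a) * - s (y ⊗ a)) ≈⟨ solve 3 (λ u v w → (u :+ v :* w) :+ (u :+ v :* (:- w)) := u :+ u) refl _ (s (x ⊗ a)) (s (y ⊗ a)) ⟩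
         c (x ⊗ a) * c (y ⊗ a) + c (x ⊗ a) * c (y ⊗ a) ∎)) ⟩
      ∑ (λ a → c ((x ⊝ y) ⊗ a) + c ((x ⊝ (⊖ y)) ⊗ a))   ≈⟨ ∑-+ _ _ ⟩
      D (x ⊝ y) + D (x ⊝ (⊖ y)) ∎

    cs-sum : ∀ x y → ∑ (λ a → c (x ⊗ a) * s (y ⊗ a)) ≈ 0#
    cs-sum x y = odd-sum _ (λ a → trans (*-cong (c-⊖⊗ x a) (s-⊖⊗ y a)) (solve 2 (λ u v → u :* (:- v) := :- (u :* v)) refl _ _))

    -- The correlation of two transforms is p times the transform of the product g h. Expanding the
    -- shifted cosine leaves mixed sine terms, which are odd and vanish. All is computed twice over,
    -- because products of cosines become sums only after doubling.
    correlation : ∀ (g h : K → Carrier) → (∀ x → h (⊖ x) ≈ h x) → ∀ b → ∑ (λ a → hat g a * hat h (a ⊝ b)) ≈ ι p * ∑ (λ x → g x * h x * c (x ⊗ b))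
    correlation g h even b = halve (begin
      LHS + LHS     ≈⟨ +-cong expand expand ⟩
      ∑ (λ x → ∑ (λ y → g x * (h y * c (y ⊗ b)) * CC x y)) + ∑ (λ x → ∑ (λ y → g x * (h y * c (y ⊗ b)) * CC x y))   ≈⟨ trans (sym (∑-+ _ _)) (∑-cong (λ x → trans (sym (∑-+ _ _)) (∑-cong (λ y → trans (sym (distribˡ _ _ _)) (*-congˡ (cc-sum x y)))))) ⟩
      ∑ (λ x → ∑ (λ y → g x * (h y * c (y ⊗ b)) * (D (x ⊝ y) + D (x ⊝ (⊖ y)))))   ≈⟨ ∑-cong inner ⟩
      ∑ (λ x → ι p * (g x * h x * c (x ⊗ b)) + ι p * (g x * h x * c (x ⊗ b)))   ≈⟨ trans (∑-+ _ _) (+-cong (sym (*-∑ _ _)) (sym (*-∑ _ _))) ⟩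
      RHS + RHS ∎)
      where
      LHS = ∑ (λ a → hat g a * hat h (a ⊝ b))
      RHS = ι p * ∑ (λ x → g x * h x * c (x ⊗ b))
      CC : K → K → Carrier
      CC x y = ∑ (λ a → c (x ⊗ a) * c (y ⊗ a))
      pull : ∀ x y → ∑ (λ a → (g x * c (x ⊗ a)) * (h y * c (y ⊗ (a ⊝ b)))) ≈ g x * (h y * c (y ⊗ b)) * CC x y
      pull x y = begin
        ∑ (λ a → (g x * c (x ⊗ a)) * (h y * c (y ⊗ (a ⊝ b))))   ≈⟨ ∑-cong (λ a → trans (*-congˡ (*-congˡ (c-dist y a b))) (solve 7 (λ g cx h cy cb sy sb → (g :* cx) :* (h :* (cy :* cb :+ sy :* sb)) := g :* (h :* cb) :* (cx :* cy) :+ g :* (h :* sb) :* (cx :* sy)) refl (g x) (c (x ⊗ a)) (h y) (c (y ⊗ a)) (c (y ⊗ b)) (s (y ⊗ a)) (s (y ⊗ b)))) ⟩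
        ∑ (λ a → g x * (h y * c (y ⊗ b)) * (c (x ⊗ a) * c (y ⊗ a)) + g x * (h y * s (y ⊗ b)) * (c (x ⊗ a) * s (y ⊗ a)))   ≈⟨ trans (∑-+ _ _) (+-cong (sym (*-∑ _ _)) (sym (*-∑ _ _))) ⟩
        g x * (h y * c (y ⊗ b)) * CC x y + g x * (h y * s (y ⊗ b)) * ∑ (λ a → c (x ⊗ a) * s (y ⊗ a))   ≈⟨ +-congˡ (trans (*-congˡ (cs-sum x y)) (zeroʳ _)) ⟩
        g x * (h y * c (y ⊗ b)) * CC x y + 0#   ≈⟨ +-identityʳ _ ⟩
        g x * (h y * c (y ⊗ b)) * CC x y ∎
      expand : LHS ≈ ∑ (λ x → ∑ (λ y → g x * (h y * c (y ⊗ b)) * CC x y))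
      expand = begin
        LHS   ≈⟨ ∑-cong (λ a → ∑-** _ _) ⟩
        ∑ (λ a → ∑ (λ x → ∑ (λ y → (g x * c (x ⊗ a)) * (h y * c (y ⊗ (a ⊝ b))))))   ≈⟨ ∑-comm _ ⟩
        ∑ (λ x → ∑ (λ a → ∑ (λ y → (g x * c (x ⊗ a)) * (h y * c (y ⊗ (a ⊝ b))))))   ≈⟨ ∑-cong (λ x → ∑-comm _) ⟩
        ∑ (λ x → ∑ (λ y → ∑ (λ a → (g x * c (x ⊗ a)) * (h y * c (y ⊗ (a ⊝ b))))))   ≈⟨ ∑-cong (λ x → ∑-cong (λ y → pull x y)) ⟩
        ∑ (λ x → ∑ (λ y → g x * (h y * c (y ⊗ b)) * CC x y)) ∎
      inner : ∀ x → ∑ (λ y → g x * (h y * c (y ⊗ b)) * (D (x ⊝ y) + D (x ⊝ (⊖ y)))) ≈ ι p * (g x * h x * c (x ⊗ b)) + ι p * (g x * h x * c (x ⊗ b))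
      inner x = begin
        ∑ (λ y → φ y * (D (x ⊝ y) + D (x ⊝ (⊖ y))))   ≈⟨ ∑-cong (λ y → distribˡ _ _ _) ⟩
        ∑ (λ y → φ y * D (x ⊝ y) + φ y * D (x ⊝ (⊖ y)))   ≈⟨ ∑-+ _ _ ⟩
        ∑ (λ y → φ y * D (x ⊝ y)) + ∑ (λ y → φ y * D (x ⊝ (⊖ y)))   ≈⟨ +-cong (∑-D φ x) (trans (∑-cong (λ y → *-congʳ (sym (φ-even y)))) (trans (sym (∑-⊖ (λ y → φ y * D (x ⊝ y)))) (∑-D φ x))) ⟩
        φ x * ι p + φ x * ι p   ≈⟨ solve 4 (λ g h c i → g :* (h :* c) :* i :+ g :* (h :* c) :* i := i :* (g :* h :* c) :+ i :* (g :* h :* c)) refl (g x) (h x) (c (x ⊗ b)) (ι p) ⟩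
        ι p * (g x * h x * c (x ⊗ b)) + ι p * (g x * h x * c (x ⊗ b)) ∎
        where
        φ : K → Carrier
        φ y = g x * (h y * c (y ⊗ b))
        φ-even : ∀ y → φ (⊖ y) ≈ φ y
        φ-even y = *-congˡ (*-cong (even y) (trans (reflexive (cong c (⊖-⊗ˡ y b))) (c-⊖ _)))

    ∑-flip : ∀ y (h : K → Carrier) → ∑ h ≈ ∑ (λ d → h (y ⊝ d))
    ∑-flip y h = ∑-reindex h (y ⊝_) (y ⊝_) (lem y) (lem y)
      where
      lem : ∀ y x → y ⊝ (y ⊝ x) ≡ x
      lem = solveK 2 (λ y x → y :⊝ (y :⊝ x) :≡ x) ≡.refl

    auto : (K → Carrier) → K → Carrier
    auto w x = ∑ (λ u → w u * w (u ⊝ x))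

    auto-even : ∀ w x → auto w (⊖ x) ≈ auto w x
    auto-even w x = trans (∑-shift (⊖ x) _) (∑-cong (λ u → trans (*-comm _ _) (*-cong (reflexive (cong w (solveK 2 (λ u x → u :⊕ (:⊖ x) :⊝ (:⊖ x) :≡ u) ≡.refl u x))) refl)))

    cube : Carrier → Carrier
    cube x = x * x * x

    -- The squared modulus of a transform is the transform of the autocorrelation; for even w the
    -- sine part is 0, so the modulus is the cosine transform itself.
    hat² : ∀ w → (∀ x → w (⊖ x) ≈ w x) → ∀ a → hat w a * hat w a ≈ hat (auto w) a
    hat² w even a = begin
      hat w a * hat w a    ≈⟨ ∑-** _ _ ⟩
      ∑ (λ u → ∑ (λ v → (w u * c (u ⊗ a)) * (w v * c (v ⊗ a))))   ≈⟨ +-identityʳ _ ⟨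
      ∑ (λ u → ∑ (λ v → (w u * c (u ⊗ a)) * (w v * c (v ⊗ a)))) + 0#   ≈⟨ +-congˡ (sym (trans (*-congʳ sine) (zeroˡ _))) ⟩
      ∑ (λ u → ∑ (λ v → (w u * c (u ⊗ a)) * (w v * c (v ⊗ a)))) + ∑ (λ u → w u * s (u ⊗ a)) * ∑ (λ u → w u * s (u ⊗ a))   ≈⟨ +-congˡ (∑-** _ _) ⟩
      ∑ (λ u → ∑ (λ v → (w u * c (u ⊗ a)) * (w v * c (v ⊗ a)))) + ∑ (λ u → ∑ (λ v → (w u * s (u ⊗ a)) * (w v * s (v ⊗ a))))   ≈⟨ trans (sym (∑-+ _ _)) (∑-cong (λ u → trans (sym (∑-+ _ _)) (∑-cong (λ v → trans (solve 6 (λ w v a b d e → (w :* a) :* (v :* b) :+ (w :* d) :* (v :* e) := w :* v :* (a :* b :+ d :* e)) refl (w u) (w v) _ _ _ _) (*-congˡ (sym (c-distʳ u v a))))))) ⟩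
      ∑ (λ u → ∑ (λ v → w u * w v * c ((u ⊝ v) ⊗ a)))   ≈⟨ ∑-cong (λ u → trans (∑-flip u _) (∑-cong (λ x → *-congˡ (reflexive (cong (λ z → c (z ⊗ a)) (solveK 2 (λ u x → u :⊝ (u :⊝ x) :≡ x) ≡.refl u x)))))) ⟩
      ∑ (λ u → ∑ (λ x → w u * w (u ⊝ x) * c (x ⊗ a)))   ≈⟨ ∑-comm _ ⟩
      ∑ (λ x → ∑ (λ u → w u * w (u ⊝ x) * c (x ⊗ a)))   ≈⟨ ∑-cong (λ x → sym (∑-* _ _)) ⟩
      hat (auto w) a ∎
      where
      sine : ∑ (λ u → w u * s (u ⊗ a)) ≈ 0#
      sine = odd-sum _ (λ u → trans (*-cong (even u) (trans (reflexive (cong s (⊖-⊗ˡ u a))) (s-⊖ _))) (solve 2 (λ u v → u :* (:- v) := :- (u :* v)) refl _ _))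

    -- With F = f², the transform of the autocorrelation, the double sum is that of F(b) F(a) F(a -
    -- b). The correlation identity is applied once in a and once in b, each time producing a factor
    -- p.
    sixth-moment : ∀ w → (∀ x → w (⊖ x) ≈ w x) → let f = hat w in
      ∑ (λ a → ∑ (λ b → (f a * f b * f (a ⊝ b)) * (f a * f b * f (a ⊝ b)))) ≈ ι p * (ι p * ∑ (λ x → cube (auto w x)))
    sixth-moment w even = begin
      ∑ (λ a → ∑ (λ b → (f a * f b * f (a ⊝ b)) * (f a * f b * f (a ⊝ b))))   ≈⟨ ∑-cong (λ a → ∑-cong (λ b → trans (solve 3 (λ x y z → (x :* y :* z) :* (x :* y :* z) := (y :* y) :* ((x :* x) :* (z :* z))) refl (f a) (f b) (f (a ⊝ b))) (*-cong (hat² w even b) (*-cong (hat² w even a) (hat² w even (a ⊝ b)))))) ⟩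
      ∑ (λ a → ∑ (λ b → F b * (F a * F (a ⊝ b))))   ≈⟨ ∑-comm _ ⟩
      ∑ (λ b → ∑ (λ a → F b * (F a * F (a ⊝ b))))   ≈⟨ ∑-cong (λ b → sym (*-∑ _ _)) ⟩
      ∑ (λ b → F b * ∑ (λ a → F a * F (a ⊝ b)))     ≈⟨ ∑-cong (λ b → *-congˡ (correlation (auto w) (auto w) (auto-even w) b)) ⟩
      ∑ (λ b → F b * (ι p * hat H b))               ≈⟨ ∑-cong (λ b → solve 3 (λ x i y → x :* (i :* y) := i :* (x :* y)) refl (F b) (ι p) (hat H b)) ⟩
      ∑ (λ b → ι p * (F b * hat H b))               ≈⟨ *-∑ _ _ ⟨
      ι p * ∑ (λ b → F b * hat H b)                 ≈⟨ *-congˡ (trans (∑-cong (λ b → *-congˡ (reflexive (cong (hat H) (solveK 1 (λ b → b :≡ b :⊝ :𝟘) ≡.refl b))))) (correlation (auto w) H H-even 𝟘)) ⟩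
      ι p * (ι p * ∑ (λ x → auto w x * H x * c (x ⊗ 𝟘)))   ≈⟨ *-congˡ (*-congˡ (∑-cong (λ x → trans (*-congˡ (trans (reflexive (cong c (⊗-zeroʳ x))) c-𝟘)) (trans (*-identityʳ _) (sym (*-assoc _ _ _)))))) ⟩
      ι p * (ι p * ∑ (λ x → cube (auto w x))) ∎
      where
      f = hat w
      F = hat (auto w)
      H : K → Carrier
      H x = auto w x * auto w x
      H-even : ∀ x → H (⊖ x) ≈ H x
      H-even x = *-cong (auto-even w x) (auto-even w x)

    -- The subgroup Γ and its exponential sums

    open NatSums using (𝟙; 𝟙-yes; 𝟙-no; 𝟙≤1)

    module Subgroup (t : ℕ) .{{_ : NonZero t}} where

      G : K → ℕ
      G x = 𝟙 (x ↑ t ≟K 𝟏)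

      g : K → Carrier
      g x = ι (G x)

      τ : Carrier
      τ = ∑ g

      Γ : K → Set
      Γ x = x ↑ t ≡ 𝟏

      Γ≢𝟘 : ∀ {γ} → Γ γ → ¬ γ ≡ 𝟘
      Γ≢𝟘 {γ} h ≡.refl = 1≢0 (≡.trans (≡.sym h) (PrimeField.0^ p pr t (ℕ.>-nonZero⁻¹ t)))

      Γ-↑ : ∀ {γ} → Γ γ → ∀ y → (γ ⊗ y) ↑ t ≡ y ↑ t
      Γ-↑ {γ} h y = ≡.trans (^-distrib-* γ y t) (≡.trans (cong (_⊗ y ↑ t) h) (⊗-identityˡ _))

      g-inv : ∀ {γ} → Γ γ → ∀ y → g (γ ⊗ y) ≈ g y
      g-inv h y = reflexive (cong (λ z → ι (𝟙 (z ≟K 𝟏))) (Γ-↑ h y))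

      g-nonneg : ∀ x → 0# ≤ g x
      g-nonneg x = ι-nonneg (G x)

      g≤1 : ∀ x → g x ≤ 1#
      g≤1 x = ι-mono (𝟙≤1 (x ↑ t ≟K 𝟏))

      g-idem : ∀ x → g x * g x ≈ g x
      g-idem x with x ↑ t ≟K 𝟏
      ... | yes _ = *-identityˡ 1#
      ... | no _ = zeroˡ 0#

      -- Allows an equation to be used under the factor g(x) when it is known only for x in Γ.
      g-elim : ∀ x {a b} → (Γ x → a ≈ b) → g x * a ≈ g x * b
      g-elim x h with x ↑ t ≟K 𝟏
      ... | yes e = *-congˡ (h e)
      ... | no _ = trans (zeroˡ _) (sym (zeroˡ _))

      -- Real part, imaginary part and squared modulus of the exponential sum S(u).
      Sc Ss S² : K → Carrier
      Sc u = ∑ (λ x → g x * c (u ⊗ x))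
      Ss u = ∑ (λ x → g x * s (u ⊗ x))
      S² u = Sc u * Sc u + Ss u * Ss u

      S²-nonneg : ∀ u → 0# ≤ S² u
      S²-nonneg u = +-nonneg (sq-nonneg _) (sq-nonneg _)

      S²-expand : ∀ u → S² u ≈ ∑ (λ x → ∑ (λ y → g x * g y * c (u ⊗ (x ⊝ y))))
      S²-expand u = trans (+-cong (∑-** _ _) (∑-** _ _)) (trans (sym (∑-+ _ _)) (∑-cong (λ x → trans (sym (∑-+ _ _)) (∑-cong (λ y → trans (solve 6 (λ w v a b d e → (w :* a) :* (v :* b) :+ (w :* d) :* (v :* e) := w :* v :* (a :* b :+ d :* e)) refl (g x) (g y) _ _ _ _) (*-congˡ (sym (c-dist u x y))))))))

      S²-inv : ∀ {γ} → Γ γ → ∀ u → S² (γ ⊗ u) ≈ S² u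
      S²-inv {γ} h u = +-cong (*-cong (e c) (e c)) (*-cong (e s) (e s))
        where
        e : ∀ (k : K → Carrier) → ∑ (λ x → g x * k (γ ⊗ u ⊗ x)) ≈ ∑ (λ x → g x * k (u ⊗ x))
        e k = sym (trans (∑-scale γ (Γ≢𝟘 h) _) (∑-cong (λ x → *-cong (g-inv h x) (reflexive (cong k (solveK 3 (λ g u x → u :⊗ (g :⊗ x) :≡ g :⊗ u :⊗ x) ≡.refl γ u x))))))

      parseval : ∑ S² ≈ ι p * τ
      parseval = begin
        ∑ S²    ≈⟨ ∑-cong S²-expand ⟩
        ∑ (λ u → ∑ (λ x → ∑ (λ y → g x * g y * c (u ⊗ (x ⊝ y)))))   ≈⟨ trans (∑-comm _) (∑-cong (λ x → ∑-comm _)) ⟩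
        ∑ (λ x → ∑ (λ y → ∑ (λ u → g x * g y * c (u ⊗ (x ⊝ y)))))   ≈⟨ ∑-cong (λ x → ∑-cong (λ y → trans (sym (*-∑ _ _)) (*-congˡ (∑-cong (λ u → reflexive (cong c (⊗-comm u (x ⊝ y)))))))) ⟩
        ∑ (λ x → ∑ (λ y → g x * g y * D (x ⊝ y)))   ≈⟨ ∑-cong (λ x → ∑-D (λ y → g x * g y) x) ⟩
        ∑ (λ x → g x * g x * ι p)   ≈⟨ ∑-cong (λ x → *-congʳ (g-idem x)) ⟩
        ∑ (λ x → g x * ι p)   ≈⟨ trans (sym (∑-* _ _)) (*-comm _ _) ⟩
        ι p * τ ∎

      -- |S|² is constant on the coset uΓ, so τ copies of |S(u)|² form a part of Parseval's sum.
      τS²≤pτ : ∀ u → ¬ u ≡ 𝟘 → τ * S² u ≤ ι p * τ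
      τS²≤pτ u u≢0 = ≤-resp (sym (∑-* g (S² u))) (trans (sym (trans (∑-scale u u≢0 S²) (∑-cong (λ γ → reflexive (cong S² (⊗-comm u γ)))))) parseval)
        (∑-mono (λ γ → ≤-trans (≤-reflexive (g-elim γ (λ h → sym (S²-inv h u)))) (≤-resp refl (*-identityˡ _) (*-monoʳ (S² (γ ⊗ u)) (S²-nonneg _) (g≤1 γ)))))

      -- The weighted mean square of the exponential sums

      module Weighted (w : K → Carrier) (w-nonneg : ∀ u → 0# ≤ w u) (w-even : ∀ u → w (⊖ u) ≈ w u) (w-inv : ∀ {γ} → Γ γ → ∀ u → w (γ ⊗ u) ≈ w u) where

        f : K → Carrier
        f = hat w

        row : K → Carrier
        row x = ∑ (λ y → g y * f (x ⊝ y))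

        V : Carrier
        V = ∑ (λ u → w u * S² u)

        V-nonneg : 0# ≤ V
        V-nonneg = ∑-nonneg (λ u → *-nonneg (w-nonneg u) (S²-nonneg u))

        f-inv : ∀ {γ} → Γ γ → ∀ d → f (γ ⊗ d) ≈ f d
        f-inv {γ} h d = sym (trans (∑-scale γ (Γ≢𝟘 h) _) (∑-cong (λ u → *-cong (w-inv h u) (reflexive (cong c (solveK 3 (λ g u d → g :⊗ u :⊗ d :≡ u :⊗ (g :⊗ d)) ≡.refl γ u d))))))

        row-inv : ∀ {γ} → Γ γ → row γ ≈ row 𝟏
        row-inv {γ} h = trans (∑-scale γ (Γ≢𝟘 h) _) (∑-cong (λ y → *-cong (g-inv h y) (trans (reflexive (cong f (solveK 2 (λ g y → g :⊝ g :⊗ y :≡ g :⊗ (:𝟏 :⊝ y)) ≡.refl γ y))) (f-inv h _))))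

        -- The common row sum of the matrix f(x - y) with x and y in Γ; it does not depend on the
        -- row because f is invariant under Γ.
        ρ : Carrier
        ρ = row 𝟏

        g-row : ∀ x → g x * row x ≈ g x * ρ
        g-row x = g-elim x row-inv

        V-row : V ≈ τ * ρ
        V-row = begin
          V      ≈⟨ ∑-cong (λ u → trans (*-congˡ (S²-expand u)) (trans (*-∑ _ _) (∑-cong (λ x → *-∑ _ _)))) ⟩
          ∑ (λ u → ∑ (λ x → ∑ (λ y → w u * (g x * g y * c (u ⊗ (x ⊝ y))))))   ≈⟨ trans (∑-comm _) (∑-cong (λ x → ∑-comm _)) ⟩
          ∑ (λ x → ∑ (λ y → ∑ (λ u → w u * (g x * g y * c (u ⊗ (x ⊝ y))))))   ≈⟨ ∑-cong (λ x → ∑-cong (λ y → trans (∑-cong (λ u → solve 3 (λ w g c → w :* (g :* c) := g :* (w :* c)) refl (w u) (g x * g y) _)) (sym (*-∑ _ _)))) ⟩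
          ∑ (λ x → ∑ (λ y → g x * g y * f (x ⊝ y)))   ≈⟨ ∑-cong (λ x → trans (∑-cong (λ y → *-assoc _ _ _)) (sym (*-∑ _ _))) ⟩
          ∑ (λ x → g x * row x)   ≈⟨ ∑-cong g-row ⟩
          ∑ (λ x → g x * ρ)   ≈⟨ ∑-* _ _ ⟨
          τ * ρ ∎

        amp : (K → Carrier) → K → K → Carrier
        amp k u y = ∑ (λ x → g x * k (u ⊗ x) * f (x ⊝ y))

        amp-sum : ∀ k u → ∑ (λ y → g y * amp k u y) ≈ ρ * ∑ (λ x → g x * k (u ⊗ x))
        amp-sum k u = begin
          ∑ (λ y → g y * amp k u y)   ≈⟨ ∑-cong (λ y → *-∑ _ _) ⟩
          ∑ (λ y → ∑ (λ x → g y * (g x * k (u ⊗ x) * f (x ⊝ y))))   ≈⟨ ∑-comm _ ⟩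
          ∑ (λ x → ∑ (λ y → g y * (g x * k (u ⊗ x) * f (x ⊝ y))))   ≈⟨ ∑-cong (λ x → trans (∑-cong (λ y → solve 4 (λ a b d e → a :* (b :* d :* e) := d :* b :* (a :* e)) refl (g y) (g x) (k (u ⊗ x)) (f (x ⊝ y)))) (sym (*-∑ _ _))) ⟩
          ∑ (λ x → k (u ⊗ x) * g x * row x)   ≈⟨ ∑-cong (λ x → trans (*-assoc _ _ _) (trans (*-congˡ (g-row x)) (solve 3 (λ a b d → a :* (b :* d) := d :* (b :* a)) refl (k (u ⊗ x)) (g x) ρ))) ⟩
          ∑ (λ x → ρ * (g x * k (u ⊗ x)))   ≈⟨ *-∑ _ _ ⟨
          ρ * ∑ (λ x → g x * k (u ⊗ x)) ∎

        amp-cauchy : ∀ k u → let S = ∑ (λ x → g x * k (u ⊗ x)) in ρ * ρ * (S * S) ≤ τ * ∑ (λ y → g y * (amp k u y * amp k u y))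
        amp-cauchy k u = ≤-resp (trans (*-cong e e) (solve 2 (λ r s → (r :* s) :* (r :* s) := r :* r :* (s :* s)) refl ρ (∑ (λ x → g x * k (u ⊗ x)))))
          (*-cong (∑-cong g-idem) (∑-cong (λ y → trans (solve 2 (λ g a → (g :* a) :* (g :* a) := (g :* g) :* (a :* a)) refl (g y) (amp k u y)) (*-congʳ (g-idem y)))))
          (∑-cauchy g (λ y → g y * amp k u y))
          where
          e : ∑ (λ y → g y * (g y * amp k u y)) ≈ ρ * ∑ (λ x → g x * k (u ⊗ x))
          e = trans (∑-cong (λ y → trans (sym (*-assoc _ _ _)) (*-congʳ (g-idem y)))) (amp-sum k u)

        -- The trace of the cube of the matrix f(x - y) on Γ. Its form as a weighted sum of squares
        -- reflects that the matrix is positive semidefinite, w being the nonnegative spectral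
        -- weight.
        triple : Carrier
        triple = ∑ (λ u → w u * ∑ (λ y → g y * (amp c u y * amp c u y + amp s u y * amp s u y)))

        -- The matrix is applied to the restriction of each character u to Γ. The sum of the
        -- resulting vector is ρ S(u), so Cauchy's inequality bounds ρ² |S(u)|² by τ times its
        -- squared length. Averaging over u with weight w replaces the comparison of eigenvalues.
        ρ²V≤ : ρ * ρ * V ≤ τ * triple
        ρ²V≤ = ≤-resp (trans (∑-cong (λ u → solve 3 (λ w r a → w :* (r :* a) := r :* (w :* a)) refl (w u) (ρ * ρ) (S² u))) (sym (*-∑ _ _)))
          (trans (∑-cong (λ u → solve 3 (λ w r a → w :* (r :* a) := r :* (w :* a)) refl (w u) τ _)) (sym (*-∑ _ _)))
          (∑-mono (λ u → *-monoˡ (w u) (w-nonneg u) (≤-resp (sym (distribˡ _ _ _)) (trans (sym (distribˡ _ _ _)) (*-congˡ (trans (sym (∑-+ _ _)) (∑-cong (λ y → sym (distribˡ _ _ _)))))) (+-mono (amp-cauchy c u) (amp-cauchy s u)))))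

        τ-nonneg : 0# ≤ τ
        τ-nonneg = ∑-nonneg g-nonneg

        V³≤ : cube V ≤ cube τ * triple
        V³≤ = ≤-resp (trans (solve 3 (λ t r v → (t :* t) :* (r :* r :* v) := (t :* r) :* (t :* r) :* v) refl τ ρ V) (*-congʳ (*-cong (sym V-row) (sym V-row)))) (sym (*-assoc _ _ _)) (*-monoˡ (τ * τ) (sq-nonneg τ) ρ²V≤)

        C₃ : K → K → Carrier
        C₃ a b = ∑ (λ y → g y * g (a ⊕ y) * g (b ⊕ y))

        triple-expand : triple ≈ ∑ (λ a → ∑ (λ b → C₃ a b * (f a * f b * f (a ⊝ b))))
        triple-expand = begin
          triple   ≈⟨ ∑-cong (λ u → *-congˡ (∑-cong (λ y → *-congˡ (trans (+-cong (∑-** _ _) (∑-** _ _)) (trans (sym (∑-+ _ _)) (∑-cong (λ x → trans (sym (∑-+ _ _)) (∑-cong (λ z → trans (solve 8 (λ gx cx fx gz cz fz sx sz → (gx :* cx :* fx) :* (gz :* cz :* fz) :+ (gx :* sx :* fx) :* (gz :* sz :* fz) := gx :* gz :* (fx :* fz) :* (cx :* cz :+ sx :* sz)) refl (g x) (c (u ⊗ x)) (f (x ⊝ y)) (g z) (c (u ⊗ z)) (f (z ⊝ y)) (s (u ⊗ x)) (s (u ⊗ z))) (*-congˡ (sym (c-dist u x z)))))))))))) ⟩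
          ∑ (λ u → w u * ∑ (λ y → g y * ∑ (λ x → ∑ (λ z → H y x z * c (u ⊗ (x ⊝ z))))))   ≈⟨ ∑-cong (λ u → trans (*-∑ _ _) (∑-cong (λ y → trans (*-congˡ (trans (*-∑ _ _) (∑-cong (λ x → *-∑ _ _)))) (trans (*-∑ _ _) (∑-cong (λ x → *-∑ _ _)))))) ⟩
          ∑ (λ u → ∑ (λ y → ∑ (λ x → ∑ (λ z → w u * (g y * (H y x z * c (u ⊗ (x ⊝ z))))))))   ≈⟨ trans (∑-comm _) (∑-cong (λ y → trans (∑-comm _) (∑-cong (λ x → ∑-comm _)))) ⟩
          ∑ (λ y → ∑ (λ x → ∑ (λ z → ∑ (λ u → w u * (g y * (H y x z * c (u ⊗ (x ⊝ z))))))))   ≈⟨ ∑-cong (λ y → ∑-cong (λ x → ∑-cong (λ z → trans (∑-cong (λ u → solve 4 (λ w g h c → w :* (g :* (h :* c)) := g :* h :* (w :* c)) refl (w u) (g y) (H y x z) _)) (sym (*-∑ _ _))))) ⟩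
          ∑ (λ y → ∑ (λ x → ∑ (λ z → g y * H y x z * f (x ⊝ z))))   ≈⟨ ∑-cong (λ y → trans (∑-shift y _) (∑-cong (λ a → trans (∑-shift y _) (∑-cong (λ b → shifted y a b))))) ⟩
          ∑ (λ y → ∑ (λ a → ∑ (λ b → g y * g (a ⊕ y) * g (b ⊕ y) * (f a * f b * f (a ⊝ b)))))   ≈⟨ trans (∑-comm _) (∑-cong (λ a → ∑-comm _)) ⟩
          ∑ (λ a → ∑ (λ b → ∑ (λ y → g y * g (a ⊕ y) * g (b ⊕ y) * (f a * f b * f (a ⊝ b)))))   ≈⟨ ∑-cong (λ a → ∑-cong (λ b → sym (∑-* _ _))) ⟩
          ∑ (λ a → ∑ (λ b → C₃ a b * (f a * f b * f (a ⊝ b)))) ∎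
          where
          H : K → K → K → Carrier
          H y x z = g x * g z * (f (x ⊝ y) * f (z ⊝ y))
          shifted : ∀ y a b → g y * H y (a ⊕ y) (b ⊕ y) * f ((a ⊕ y) ⊝ (b ⊕ y)) ≈ g y * g (a ⊕ y) * g (b ⊕ y) * (f a * f b * f (a ⊝ b))
          shifted y a b = trans (*-cong (*-congˡ (*-congˡ (*-cong (reflexive (cong f (e₁ a y))) (reflexive (cong f (e₁ b y)))))) (reflexive (cong f (e₂ a b y)))) (solve 6 (λ a b d e f h → a :* (b :* d :* (e :* f)) :* h := a :* b :* d :* (e :* f :* h)) refl (g y) (g (a ⊕ y)) (g (b ⊕ y)) (f a) (f b) (f (a ⊝ b)))
            where
            e₁ : ∀ a y → (a ⊕ y) ⊝ y ≡ a
            e₁ = solveK 2 (λ a y → (a :⊕ y) :⊝ y :≡ a) ≡.refl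
            e₂ : ∀ a b y → (a ⊕ y) ⊝ (b ⊕ y) ≡ a ⊝ b
            e₂ = solveK 3 (λ a b y → (a :⊕ y) :⊝ (b :⊕ y) :≡ a :⊝ b) ≡.refl

        -- In the square of C₃ the two variables y and y - d are compared. For fixed y and d the
        -- sums over a and over b separate, and each equals the autocorrelation of g at d.
        C₃-energy : ∑ (λ a → ∑ (λ b → C₃ a b * C₃ a b)) ≈ ∑ (λ d → cube (auto g d))
        C₃-energy = begin
          ∑ (λ a → ∑ (λ b → C₃ a b * C₃ a b))   ≈⟨ ∑-cong (λ a → ∑-cong (λ b → trans (∑-** _ _) (∑-cong (λ y → trans (∑-flip y _) (∑-cong (λ d → solve 6 (λ a b c d e f → (a :* b :* c) :* (d :* e :* f) := a :* d :* ((b :* e) :* (c :* f))) refl (g y) (g (a ⊕ y)) (g (b ⊕ y)) (g (y ⊝ d)) (g (a ⊕ (y ⊝ d))) (g (b ⊕ (y ⊝ d))))))))) ⟩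
          ∑ (λ a → ∑ (λ b → ∑ (λ y → ∑ (λ d → g y * g (y ⊝ d) * (P y d a * P y d b)))))   ≈⟨ trans (∑-cong (λ a → trans (∑-comm _) (∑-cong (λ y → ∑-comm _)))) (trans (∑-comm _) (∑-cong (λ y → ∑-comm _))) ⟩
          ∑ (λ y → ∑ (λ d → ∑ (λ a → ∑ (λ b → g y * g (y ⊝ d) * (P y d a * P y d b)))))   ≈⟨ ∑-cong (λ y → ∑-cong (λ d → trans (∑-cong (λ a → sym (*-∑ _ _))) (trans (sym (*-∑ _ _)) (*-congˡ (trans (sym (∑-** _ _)) (*-cong (Pauto y d) (Pauto y d))))))) ⟩
          ∑ (λ y → ∑ (λ d → g y * g (y ⊝ d) * (auto g d * auto g d)))   ≈⟨ trans (∑-comm _) (∑-cong (λ d → trans (sym (∑-* _ _)) (sym (*-assoc _ _ _)))) ⟩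
          ∑ (λ d → cube (auto g d)) ∎
          where
          P : K → K → K → Carrier
          P y d a = g (a ⊕ y) * g (a ⊕ (y ⊝ d))
          Pauto : ∀ y d → ∑ (P y d) ≈ auto g d
          Pauto y d = sym (trans (∑-shift y _) (∑-cong (λ a → *-congˡ (reflexive (cong g (solveK 3 (λ a y d → a :⊕ y :⊝ d :≡ a :⊕ (y :⊝ d)) ≡.refl a y d))))))

        -- The trace is a sum over (a, b) of C₃ times f(a) f(b) f(a - b). Cauchy's inequality
        -- separates Γ from w: the squares of C₃ give the third moment of Γ, the other factor is
        -- `sixth-moment`.
        sixth-power : cube V * cube V ≤ (cube τ * cube τ) * (∑ (λ d → cube (auto g d)) * (ι p * (ι p * ∑ (λ x → cube (auto w x)))))
        sixth-power = ≤-trans (sq-mono (*-nonneg (*-nonneg V-nonneg V-nonneg) V-nonneg) V³≤)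
          (≤-resp (solve 2 (λ t r → (t :* t) :* (r :* r) := (t :* r) :* (t :* r)) refl (cube τ) triple) refl
            (*-monoˡ (cube τ * cube τ) (sq-nonneg (cube τ))
              (≤-resp (*-cong (sym triple-expand) (sym triple-expand)) (*-cong C₃-energy (sixth-moment w w-even)) (∑∑-cauchy C₃ (λ a b → f a * f b * f (a ⊝ b))))))

      open PrimeField p pr using ([_]; []-+; []-0; []-1)

      φᶜ φˢ : ℕ → K → Carrier
      φᶜ j y = c ([ j ] ⊗ y)
      φˢ j y = s ([ j ] ⊗ y)

      [suc]⊗ : ∀ j y → [ suc j ] ⊗ y ≡ [ j ] ⊗ y ⊕ y
      [suc]⊗ j y = ≡.trans (cong (_⊗ y) (≡.trans ([]-+ 1 j) (cong (_⊕ [ j ]) []-1))) (solveK 2 (λ j y → (:𝟏 :⊕ j) :⊗ y :≡ j :⊗ y :⊕ y) ≡.refl [ j ] y)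

      [+]⊗ : ∀ i j y → [ i ℕ.+ j ] ⊗ y ≡ [ i ] ⊗ y ⊕ [ j ] ⊗ y
      [+]⊗ i j y = ≡.trans (cong (_⊗ y) ([]-+ i j)) (solveK 3 (λ i j y → (i :⊕ j) :⊗ y :≡ i :⊗ y :⊕ j :⊗ y) ≡.refl [ i ] [ j ] y)

      telescope : ∀ n (φ : ℕ → Carrier) → ∑ {n} (λ j → φ (toℕ j) - φ (suc (toℕ j))) ≈ φ 0 - φ n
      telescope zero φ = trans (∑-zero _) (sym (-‿inverseʳ (φ 0)))
      telescope (suc n) φ = trans (∑-suc _) (trans (+-congˡ (telescope n (λ j → φ (suc j)))) (solve 3 (λ a b d → (a :- b) :+ (b :- d) := a :- d) refl (φ 0) (φ 1) (φ (suc n))))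

      c-bound : ∀ x → 1# - c x ≤ 1# + 1#
      c-bound x = halve-≤ (0≤y-x⁻ (≤-resp refl (begin
        (1# + c x) * (1# + c x) + s x * s x     ≈⟨ solve 2 (λ c s → (:1 :+ c) :* (:1 :+ c) :+ s :* s := :1 :+ c :+ c :+ (c :* c :+ s :* s)) refl (c x) (s x) ⟩
        1# + c x + c x + (c x * c x + s x * s x) ≈⟨ +-congˡ (c²+s² x) ⟩
        1# + c x + c x + 1#                     ≈⟨ solve 1 (λ c → :1 :+ c :+ c :+ :1 := ((:1 :+ :1) :+ (:1 :+ :1)) :- ((:1 :- c) :+ (:1 :- c))) refl (c x) ⟩
        ((1# + 1#) + (1# + 1#)) - ((1# - c x) + (1# - c x)) ∎) (+-nonneg (sq-nonneg (1# + c x)) (sq-nonneg (s x)))))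

      -- Powers of the Dirichlet kernel

      module Kernel (N : ℕ) where

        Ec Es E² : K → Carrier
        Ec y = ∑ {N} (λ j → φᶜ (toℕ j) y)
        Es y = ∑ {N} (λ j → φˢ (toℕ j) y)
        E² y = Ec y * Ec y + Es y * Es y

        E²-nonneg : ∀ y → 0# ≤ E² y
        E²-nonneg y = +-nonneg (sq-nonneg _) (sq-nonneg _)

        E-re : ∀ y → (1# - c y) * Ec y + s y * Es y ≈ 1# - φᶜ N y
        E-re y = begin
          (1# - c y) * Ec y + s y * Es y   ≈⟨ +-cong (*-∑ _ _) (*-∑ _ _) ⟩
          ∑ {N} (λ j → (1# - c y) * φᶜ (toℕ j) y) + ∑ {N} (λ j → s y * φˢ (toℕ j) y)   ≈⟨ ∑-+ _ _ ⟨
          ∑ {N} (λ j → (1# - c y) * φᶜ (toℕ j) y + s y * φˢ (toℕ j) y)   ≈⟨ ∑-cong (λ j → trans (solve 4 (λ c s a b → (:1 :- c) :* a :+ s :* b := a :- (a :* c :- b :* s)) refl (c y) (s y) _ _) (+-congˡ (-‿cong (sym (trans (reflexive (cong c ([suc]⊗ (toℕ j) y))) (c-⊕ _ _)))))) ⟩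
          ∑ {N} (λ j → φᶜ (toℕ j) y - φᶜ (suc (toℕ j)) y)   ≈⟨ telescope N (λ j → φᶜ j y) ⟩
          φᶜ 0 y - φᶜ N y   ≈⟨ +-congʳ (trans (reflexive (cong c (≡.trans (cong (_⊗ y) []-0) (⊗-zeroˡ y)))) c-𝟘) ⟩
          1# - φᶜ N y ∎

        E-im : ∀ y → (1# - c y) * Es y - s y * Ec y ≈ - φˢ N y
        E-im y = begin
          (1# - c y) * Es y - s y * Ec y   ≈⟨ +-cong (*-∑ _ _) (-‿cong (*-∑ _ _)) ⟩
          ∑ {N} (λ j → (1# - c y) * φˢ (toℕ j) y) - ∑ {N} (λ j → s y * φᶜ (toℕ j) y)   ≈⟨ trans (+-congˡ (sym (∑-neg _))) (sym (∑-+ _ _)) ⟩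
          ∑ {N} (λ j → (1# - c y) * φˢ (toℕ j) y + - (s y * φᶜ (toℕ j) y))   ≈⟨ ∑-cong (λ j → trans (solve 4 (λ c s a b → (:1 :- c) :* b :+ (:- (s :* a)) := b :- (b :* c :+ a :* s)) refl (c y) (s y) _ _) (+-congˡ (-‿cong (sym (trans (reflexive (cong s ([suc]⊗ (toℕ j) y))) (s-⊕ _ _)))))) ⟩
          ∑ {N} (λ j → φˢ (toℕ j) y - φˢ (suc (toℕ j)) y)   ≈⟨ telescope N (λ j → φˢ j y) ⟩
          φˢ 0 y - φˢ N y   ≈⟨ +-congʳ (trans (reflexive (cong s (≡.trans (cong (_⊗ y) []-0) (⊗-zeroˡ y)))) s-𝟘) ⟩
          0# - φˢ N y   ≈⟨ +-identityˡ _ ⟩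
          - φˢ N y ∎

        -- The geometric series: `E-re` and `E-im` are the two components of (1 - e(y)) E(y) = 1 -
        -- e(Ny). Taking squared moduli gives twice the claim, as |1 - e(y)|² = 2 (1 - c(y)).
        E²-eq : ∀ y → (1# - c y) * E² y ≈ 1# - φᶜ N y
        E²-eq y = halve (begin
          (1# - c y) * E² y + (1# - c y) * E² y   ≈⟨ solve 4 (λ c s a b → (:1 :- c) :* (a :* a :+ b :* b) :+ (:1 :- c) :* (a :* a :+ b :* b) := ((:1 :- c) :* a :+ s :* b) :* ((:1 :- c) :* a :+ s :* b) :+ ((:1 :- c) :* b :- s :* a) :* ((:1 :- c) :* b :- s :* a) :+ (:1 :- (c :* c :+ s :* s)) :* (a :* a :+ b :* b)) refl (c y) (s y) (Ec y) (Es y) ⟩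
          _ + (1# - (c y * c y + s y * s y)) * E² y   ≈⟨ +-cong (+-cong (*-cong (E-re y) (E-re y)) (*-cong (E-im y) (E-im y))) (*-congʳ (trans (+-congˡ (-‿cong (c²+s² y))) (-‿inverseʳ 1#))) ⟩
          (1# - φᶜ N y) * (1# - φᶜ N y) + (- φˢ N y) * (- φˢ N y) + 0# * E² y   ≈⟨ solve 3 (λ a b e → (:1 :- a) :* (:1 :- a) :+ (:- b) :* (:- b) :+ :0 :* e := :1 :- a :- a :+ (a :* a :+ b :* b)) refl (φᶜ N y) (φˢ N y) (E² y) ⟩
          1# - φᶜ N y - φᶜ N y + (φᶜ N y * φᶜ N y + φˢ N y * φˢ N y)   ≈⟨ +-congˡ (c²+s² _) ⟩
          1# - φᶜ N y - φᶜ N y + 1#   ≈⟨ solve 1 (λ a → :1 :- a :- a :+ :1 := (:1 :- a) :+ (:1 :- a)) refl (φᶜ N y) ⟩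
          (1# - φᶜ N y) + (1# - φᶜ N y) ∎)

        E²-bound : ∀ h y → h ℕ.≤ toℕ y → toℕ y ℕ.+ h ℕ.≤ p → ι (2 ℕ.* (h ℕ.* h)) * E² y ≤ ι (p ℕ.* p)
        E²-bound h y h≤ ≤p = cancel 1 (≤-resp (trans (*-congʳ (trans (reflexive (cong ι (ℕₚ.*-assoc 2 2 (h ℕ.* h)))) (ι-* 2 (2 ℕ.* (h ℕ.* h))))) (*-assoc _ _ _)) (*-comm _ _)
          (≤-trans (*-monoʳ (E² y) (E²-nonneg y) (separated h y h≤ ≤p)) (≤-resp (sym (trans (*-assoc _ _ _) (*-congˡ (E²-eq y)))) refl (*-monoˡ (ι (p ℕ.* p)) (ι-nonneg (p ℕ.* p)) (c-bound _)))))

        Pc Ps P² : ℕ → K → Carrier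
        Pc zero y = 1#
        Pc (suc m) y = Pc m y * Ec y - Ps m y * Es y
        Ps zero y = 0#
        Ps (suc m) y = Ps m y * Ec y + Pc m y * Es y
        P² m y = Pc m y * Pc m y + Ps m y * Ps m y

        P²-suc : ∀ m y → P² (suc m) y ≈ P² m y * E² y
        P²-suc m y = solve 4 (λ a b d e → (a :* d :- b :* e) :* (a :* d :- b :* e) :+ (b :* d :+ a :* e) :* (b :* d :+ a :* e) := (a :* a :+ b :* b) :* (d :* d :+ e :* e)) refl (Pc m y) (Ps m y) (Ec y) (Es y)

        P²-bound : ∀ h y → h ℕ.≤ toℕ y → toℕ y ℕ.+ h ℕ.≤ p → ∀ m → ι ((2 ℕ.* (h ℕ.* h)) ℕ.^ m) * P² m y ≤ ι ((p ℕ.* p) ℕ.^ m)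
        P²-bound h y h≤ ≤p zero = ≤-reflexive (solve 0 (:1 :* (:1 :* :1 :+ :0 :* :0) := :1) refl)
        P²-bound h y h≤ ≤p (suc m) = ≤-resp
          (trans (solve 4 (λ a b d e → (a :* b) :* (d :* e) := (a :* d) :* (e :* b)) refl (ι A) (E² y) (ι (A ℕ.^ m)) (P² m y)) (*-cong (sym (ι-* A (A ℕ.^ m))) (sym (P²-suc m y))))
          (sym (ι-* (p ℕ.* p) ((p ℕ.* p) ℕ.^ m)))
          (≤-trans (*-monoˡ (ι A * E² y) (*-nonneg (ι-nonneg A) (E²-nonneg y)) (P²-bound h y h≤ ≤p m)) (*-monoʳ (ι ((p ℕ.* p) ℕ.^ m)) (ι-nonneg ((p ℕ.* p) ℕ.^ m)) (E²-bound h y h≤ ≤p)))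
          where A = 2 ℕ.* (h ℕ.* h)

        δ : ℕ → ℕ → Carrier
        δ i j = ι (𝟙 (i ℕₚ.≟ j))

        ∑-δ : ∀ {L} i (φ : ℕ → Carrier) → i ℕ.< L → ∑ {L} (λ k → δ i (toℕ k) * φ (toℕ k)) ≈ φ i
        ∑-δ {L} i φ i<L = trans (∑-single k _ (λ k' ne → trans (*-congʳ (reflexive (cong ι (𝟙-no (i ℕₚ.≟ toℕ k') (λ e → ne (Fₚ.toℕ-injective (≡.trans ek e))))))) (zeroˡ _)))
          (trans (*-cong (reflexive (cong ι (𝟙-yes (i ℕₚ.≟ toℕ k) (≡.sym ek)))) (reflexive (cong φ ek))) (*-identityˡ _))
          where
          open import Data.Fin using (fromℕ<)
          k = fromℕ< i<L
          ek : toℕ k ≡ i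
          ek = Fₚ.toℕ-fromℕ< i<L

        record Coefficients (L m : ℕ) : Set where
          field
            ν : Fin L → Carrier
            ν-c : ∀ y → Pc m y ≈ ∑ (λ i → ν i * φᶜ (toℕ i) y)
            ν-s : ∀ y → Ps m y ≈ ∑ (λ i → ν i * φˢ (toℕ i) y)

        -- Convolution with the N unit coefficients of the kernel. The length m N + 1 is slightly
        -- generous; it makes each step extend the range by exactly N. Later the coefficients enter
        -- only through their sum N^m, the value at 0, and their sum of squares.
        coefficients : ∀ m → Coefficients (m ℕ.* N ℕ.+ 1) m
        coefficients zero = record
          { ν = λ _ → 1#
          ; ν-c = λ y → sym (trans (∑-suc _) (trans (+-cong (trans (*-identityˡ _) (trans (reflexive (cong c (0⊗ y))) c-𝟘)) (∑-zero _)) (+-identityʳ _)))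
          ; ν-s = λ y → sym (trans (∑-suc _) (trans (+-cong (trans (*-identityˡ _) (trans (reflexive (cong s (0⊗ y))) s-𝟘)) (∑-zero _)) (+-identityʳ _))) }
          where
          0⊗ : ∀ y → [ 0 ] ⊗ y ≡ 𝟘
          0⊗ y = ≡.trans (cong (_⊗ y) []-0) (⊗-zeroˡ y)
        coefficients (suc m) = ≡.subst (λ L → Coefficients L (suc m)) (≡.sym (ℕₚ.+-assoc N (m ℕ.* N) 1)) (record { ν = ν' ; ν-c = νc ; ν-s = νs })
          where
          L = m ℕ.* N ℕ.+ 1
          open Coefficients (coefficients m)
          ν' : Fin (N ℕ.+ L) → Carrier
          ν' k = ∑ {N} (λ j → ∑ (λ i → δ (toℕ j ℕ.+ toℕ i) (toℕ k) * ν i))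
          conv : ∀ (φ : ℕ → Carrier) → ∑ (λ k → ν' k * φ (toℕ k)) ≈ ∑ {N} (λ j → ∑ (λ i → ν i * φ (toℕ j ℕ.+ toℕ i)))
          conv φ = begin
            ∑ (λ k → ν' k * φ (toℕ k))   ≈⟨ ∑-cong (λ k → trans (∑-* _ _) (∑-cong (λ j → ∑-* _ _))) ⟩
            ∑ (λ k → ∑ {N} (λ j → ∑ (λ i → δ (toℕ j ℕ.+ toℕ i) (toℕ k) * ν i * φ (toℕ k))))   ≈⟨ trans (∑-comm _) (∑-cong (λ j → ∑-comm _)) ⟩
            ∑ {N} (λ j → ∑ (λ i → ∑ (λ k → δ (toℕ j ℕ.+ toℕ i) (toℕ k) * ν i * φ (toℕ k))))   ≈⟨ ∑-cong (λ j → ∑-cong (λ i → trans (∑-cong (λ k → solve 3 (λ d n f → d :* n :* f := n :* (d :* f)) refl _ _ _)) (trans (sym (*-∑ _ _)) (*-congˡ (∑-δ (toℕ j ℕ.+ toℕ i) φ (ℕₚ.+-mono-< (Fₚ.toℕ<n j) (Fₚ.toℕ<n i))))))) ⟩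
            ∑ {N} (λ j → ∑ (λ i → ν i * φ (toℕ j ℕ.+ toℕ i))) ∎
          νc : ∀ y → Pc (suc m) y ≈ ∑ (λ k → ν' k * φᶜ (toℕ k) y)
          νc y = sym (begin
            ∑ (λ k → ν' k * φᶜ (toℕ k) y)   ≈⟨ conv (λ k → φᶜ k y) ⟩
            ∑ {N} (λ j → ∑ (λ i → ν i * φᶜ (toℕ j ℕ.+ toℕ i) y))   ≈⟨ ∑-cong (λ j → trans (∑-cong (λ i → trans (*-congˡ (trans (reflexive (cong c ([+]⊗ (toℕ j) (toℕ i) y))) (c-⊕ _ _))) (solve 5 (λ n a b d e → n :* (a :* b :- d :* e) := a :* (n :* b) :+ (:- d) :* (n :* e)) refl (ν i) _ _ _ _))) (trans (∑-+ _ _) (+-cong (sym (*-∑ _ _)) (sym (*-∑ _ _))))) ⟩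
            ∑ {N} (λ j → φᶜ (toℕ j) y * ∑ (λ i → ν i * φᶜ (toℕ i) y) + - φˢ (toℕ j) y * ∑ (λ i → ν i * φˢ (toℕ i) y))   ≈⟨ ∑-cong (λ j → +-cong (*-congˡ (sym (ν-c y))) (*-congˡ (sym (ν-s y)))) ⟩
            ∑ {N} (λ j → φᶜ (toℕ j) y * Pc m y + - φˢ (toℕ j) y * Ps m y)   ≈⟨ trans (∑-+ _ _) (+-cong (sym (∑-* _ _)) (trans (sym (∑-* _ _)) (*-congʳ (∑-neg _)))) ⟩
            Ec y * Pc m y + - Es y * Ps m y   ≈⟨ solve 4 (λ a b d e → a :* b :+ (:- d) :* e := b :* a :- e :* d) refl (Ec y) (Pc m y) (Es y) (Ps m y) ⟩
            Pc m y * Ec y - Ps m y * Es y ∎)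
          νs : ∀ y → Ps (suc m) y ≈ ∑ (λ k → ν' k * φˢ (toℕ k) y)
          νs y = sym (begin
            ∑ (λ k → ν' k * φˢ (toℕ k) y)   ≈⟨ conv (λ k → φˢ k y) ⟩
            ∑ {N} (λ j → ∑ (λ i → ν i * φˢ (toℕ j ℕ.+ toℕ i) y))   ≈⟨ ∑-cong (λ j → trans (∑-cong (λ i → trans (*-congˡ (trans (reflexive (cong s ([+]⊗ (toℕ j) (toℕ i) y))) (s-⊕ _ _))) (solve 5 (λ n a b d e → n :* (a :* b :+ d :* e) := a :* (n :* b) :+ d :* (n :* e)) refl (ν i) _ _ _ _))) (trans (∑-+ _ _) (+-cong (sym (*-∑ _ _)) (sym (*-∑ _ _))))) ⟩
            ∑ {N} (λ j → φˢ (toℕ j) y * ∑ (λ i → ν i * φᶜ (toℕ i) y) + φᶜ (toℕ j) y * ∑ (λ i → ν i * φˢ (toℕ i) y))   ≈⟨ ∑-cong (λ j → +-cong (*-congˡ (sym (ν-c y))) (*-congˡ (sym (ν-s y)))) ⟩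
            ∑ {N} (λ j → φˢ (toℕ j) y * Pc m y + φᶜ (toℕ j) y * Ps m y)   ≈⟨ trans (∑-+ _ _) (+-cong (sym (∑-* _ _)) (sym (∑-* _ _))) ⟩
            Es y * Pc m y + Ec y * Ps m y   ≈⟨ solve 4 (λ a b d e → a :* b :+ d :* e := e :* d :+ b :* a) refl (Es y) (Pc m y) (Ec y) (Ps m y) ⟩
            Ps m y * Ec y + Pc m y * Es y ∎)

      S²-even : ∀ u → S² (⊖ u) ≈ S² u
      S²-even u = +-cong (*-cong ec ec) (trans (*-cong es es) (solve 1 (λ x → (:- x) :* (:- x) := x :* x) refl (Ss u)))
        where
        ec : Sc (⊖ u) ≈ Sc u
        ec = ∑-cong (λ x → *-congˡ (trans (reflexive (cong c (⊖-⊗ˡ u x))) (c-⊖ _)))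
        es : Ss (⊖ u) ≈ - Ss u
        es = trans (∑-cong (λ x → trans (*-congˡ (trans (reflexive (cong s (⊖-⊗ˡ u x))) (s-⊖ _))) (solve 2 (λ g x → g :* (:- x) := :- (g :* x)) refl (g x) _))) (∑-neg _)

      off : ∀ {L} → Fin L → Fin L → Carrier
      off i i' = ι (𝟙 (¬? (i Fₚ.≟ i')))

      on : ∀ {L} → Fin L → Fin L → Carrier
      on i i' = ι (𝟙 (i Fₚ.≟ i'))

      on+off : ∀ {L} (i i' : Fin L) → on i i' + off i i' ≈ 1#
      on+off i i' with i Fₚ.≟ i'
      ... | yes _ = +-identityʳ 1#
      ... | no _ = +-identityˡ 1#

      off-idem : ∀ {L} (i i' : Fin L) → off i i' * off i i' ≈ off i i'
      off-idem i i' with i Fₚ.≟ i'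
      ... | yes _ = zeroˡ 0#
      ... | no _ = *-identityˡ 1#

      off-suc : ∀ {L} (i i' : Fin L) → off (Fin.suc i) (Fin.suc i') ≈ off i i'
      off-suc i i' with i Fₚ.≟ i'
      ... | yes _ = refl
      ... | no _ = refl

      ∑-last : ∀ n (φ : ℕ → Carrier) → ∑ {suc n} (λ k → φ (toℕ k)) ≈ φ n + ∑ {n} (λ k → φ (toℕ k))
      ∑-last zero φ = trans (∑-suc _) (+-congˡ (trans (∑-zero _) (sym (∑-zero _))))
      ∑-last (suc n) φ = begin
        ∑ {suc (suc n)} (λ k → φ (toℕ k))     ≈⟨ ∑-suc _ ⟩
        φ 0 + ∑ {suc n} (λ k → φ (suc (toℕ k)))  ≈⟨ +-congˡ (∑-last n (λ k → φ (suc k))) ⟩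
        φ 0 + (φ (suc n) + ∑ {n} (λ k → φ (suc (toℕ k))))  ≈⟨ solve 3 (λ a b d → a :+ (b :+ d) := b :+ (a :+ d)) refl (φ 0) (φ (suc n)) _ ⟩
        φ (suc n) + (φ 0 + ∑ {n} (λ k → φ (suc (toℕ k))))  ≈⟨ +-congˡ (sym (∑-suc _)) ⟩
        φ (suc n) + ∑ {suc n} (λ k → φ (toℕ k))   ∎

      module Differences (φ : ℕ → Carrier) (φ-nonneg : ∀ n → 0# ≤ φ n) where

        A : ℕ → Carrier
        A n = ∑ {n} (λ k → φ (suc (toℕ k)))

        A-suc : ∀ n → A (suc n) ≈ φ (suc n) + A n
        A-suc n = ∑-last n (λ k → φ (suc k))

        A-step : ∀ n → A n ≤ A (suc n)
        A-step n = ≤-resp (+-identityˡ _) (sym (A-suc n)) (+-mono (φ-nonneg (suc n)) ≤-refl)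

        A-mono : ∀ {m n} → m ℕ.≤ n → A m ≤ A n
        A-mono {m} {n} h = go (ℕₚ.≤⇒≤′ h)
          where
          go : ∀ {n} → m ℕ.≤′ n → A m ≤ A n
          go ℕ.≤′-refl = ≤-refl
          go (ℕ.≤′-step l) = ≤-trans (go l) (A-step _)

        -- The differences i - i' on either side of i' run through distinct positive integers up to
        -- i' and up to L respectively.
        differences : ∀ L (i' : Fin L) → ∑ {L} (λ i → off i i' * φ ℕ.∣ toℕ i - toℕ i' ∣) ≤ A (toℕ i') + A L
        differences (suc L) Fin.zero = ≤-trans (≤-reflexive (trans (∑-suc _) (trans (+-cong (zeroˡ _) (∑-cong (λ i → *-identityˡ _))) refl))) (+-mono (≤-reflexive (sym (∑-zero _))) (A-step L))
        differences (suc L) (Fin.suc i') = ≤-trans (≤-reflexive (trans (∑-suc _) (+-cong (*-identityˡ _) (∑-cong (λ i → *-congʳ (off-suc i i'))))))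
          (≤-trans (+-mono ≤-refl (differences L i')) (≤-trans (≤-reflexive (sym (+-assoc _ _ _))) (+-mono (≤-reflexive (sym (A-suc (toℕ i')))) (A-step L))))

        differences₂ : ∀ L (i' : Fin L) → ∑ {L} (λ i → off i i' * φ ℕ.∣ toℕ i - toℕ i' ∣) ≤ A L + A L
        differences₂ L i' = ≤-trans (differences L i') (+-mono (A-mono (ℕₚ.<⇒≤ (Fₚ.toℕ<n i'))) ≤-refl)

      open import Data.Product using (_×_; _,_; proj₁; proj₂)

      -- The gap inequality

      module Gap (a u₀ : K) (h N m : ℕ) (1≤h : 1 ℕ.≤ h) (1≤N : 1 ℕ.≤ N)
        (gap : ∀ x → Γ x → (h ℕ.≤ toℕ ((a ⊗ x) ⊝ u₀)) × (toℕ ((a ⊗ x) ⊝ u₀) ℕ.+ h ℕ.≤ p))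
        (large : 2 ℕ.* (m ℕ.* N ℕ.+ 1) ℕ.* (p ℕ.* p) ℕ.^ m ℕ.≤ (2 ℕ.* (h ℕ.* h)) ℕ.^ m ℕ.* (N ℕ.^ m ℕ.* N ℕ.^ m)) where

        L : ℕ
        L = m ℕ.* N ℕ.+ 1

        open Kernel N
        open Coefficients (coefficients m)

        σ : ℕ → Carrier
        σ n = S² ([ n ] ⊗ a)

        open Differences σ (λ n → S²-nonneg _)

        q : Carrier
        q = ∑ (λ i → ν i * ν i)

        q-nonneg : 0# ≤ q
        q-nonneg = ∑-nonneg (λ i → sq-nonneg (ν i))

        d : Fin L → Fin L → K
        d i i' = [ toℕ i ] ⊝ [ toℕ i' ]

        pos : K → K
        pos x = (a ⊗ x) ⊝ u₀

        ρ : Fin L → Fin L → Carrier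
        ρ i i' = ∑ (λ x → g x * c (d i i' ⊗ pos x))

        -- What remains of the sum of |E^m|² over the translated coset after removal of the
        -- diagonal, which contributes τ q.
        Off : Carrier
        Off = ∑ (λ i → ∑ (λ i' → ν i * (off i i' * (ν i' * ρ i i'))))

        P²-expand : ∀ y → P² m y ≈ ∑ (λ i → ∑ (λ i' → ν i * ν i' * c (d i i' ⊗ y)))
        P²-expand y = trans (+-cong (trans (*-cong (ν-c y) (ν-c y)) (∑-** _ _)) (trans (*-cong (ν-s y) (ν-s y)) (∑-** _ _)))
          (trans (sym (∑-+ _ _)) (∑-cong (λ i → trans (sym (∑-+ _ _)) (∑-cong (λ i' → trans (solve 6 (λ w v a b d e → (w :* a) :* (v :* b) :+ (w :* d) :* (v :* e) := w :* v :* (a :* b :+ d :* e)) refl (ν i) (ν i') _ _ _ _) (*-congˡ (sym (c-distʳ _ _ y))))))))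

        split : ∀ y → P² m y ≈ q + ∑ (λ i → ∑ (λ i' → ν i * (off i i' * (ν i' * c (d i i' ⊗ y)))))
        split y = trans (P²-expand y) (trans (∑-cong (λ i → trans (∑-cong (λ i' → e i i')) (trans (∑-+ _ _) (+-congʳ (diag i))))) (∑-+ _ _))
          where
          on-c : ∀ i i' → on i i' * (ν i * ν i' * c (d i i' ⊗ y)) ≈ on i i' * (ν i * ν i')
          on-c i i' with i Fₚ.≟ i'
          ... | yes ≡.refl = *-congˡ (trans (*-congˡ (trans (reflexive (cong c (≡.trans (cong (_⊗ y) (⊖-inverseʳ [ toℕ i ])) (⊗-zeroˡ y)))) c-𝟘)) (*-identityʳ _))
          ... | no _ = trans (zeroˡ _) (sym (zeroˡ _))
          e : ∀ i i' → ν i * ν i' * c (d i i' ⊗ y) ≈ on i i' * (ν i * ν i') + ν i * (off i i' * (ν i' * c (d i i' ⊗ y)))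
          e i i' = begin
            ν i * ν i' * c (d i i' ⊗ y)    ≈⟨ *-identityˡ _ ⟨
            1# * (ν i * ν i' * c (d i i' ⊗ y))    ≈⟨ *-congʳ (sym (on+off i i')) ⟩
            (on i i' + off i i') * (ν i * ν i' * c (d i i' ⊗ y))    ≈⟨ solve 5 (λ k o n n' x → (k :+ o) :* (n :* n' :* x) := k :* (n :* n' :* x) :+ n :* (o :* (n' :* x))) refl (on i i') (off i i') (ν i) (ν i') _ ⟩
            on i i' * (ν i * ν i' * c (d i i' ⊗ y)) + ν i * (off i i' * (ν i' * c (d i i' ⊗ y)))   ≈⟨ +-congʳ (on-c i i') ⟩
            on i i' * (ν i * ν i') + ν i * (off i i' * (ν i' * c (d i i' ⊗ y))) ∎
          diag : ∀ i → ∑ (λ i' → on i i' * (ν i * ν i')) ≈ ν i * ν i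
          diag i = trans (∑-single i _ (λ i' ne → trans (*-congʳ (reflexive (cong ι (𝟙-no (i Fₚ.≟ i') ne)))) (zeroˡ _))) (trans (*-congʳ (reflexive (cong ι (𝟙-yes (i Fₚ.≟ i) ≡.refl)))) (*-identityˡ _))

        total : ∑ (λ x → g x * P² m (pos x)) ≈ τ * q + Off
        total = begin
          ∑ (λ x → g x * P² m (pos x))   ≈⟨ ∑-cong (λ x → trans (*-congˡ (split (pos x))) (distribˡ _ _ _)) ⟩
          ∑ (λ x → g x * q + g x * ∑ (λ i → ∑ (λ i' → ν i * (off i i' * (ν i' * c (d i i' ⊗ pos x))))))   ≈⟨ trans (∑-+ _ _) (+-congʳ (sym (∑-* _ _))) ⟩
          τ * q + ∑ (λ x → g x * ∑ (λ i → ∑ (λ i' → ν i * (off i i' * (ν i' * c (d i i' ⊗ pos x))))))   ≈⟨ +-congˡ (begin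
            ∑ (λ x → g x * ∑ (λ i → ∑ (λ i' → ν i * (off i i' * (ν i' * c (d i i' ⊗ pos x))))))   ≈⟨ ∑-cong (λ x → trans (*-∑ _ _) (∑-cong (λ i → *-∑ _ _))) ⟩
            ∑ (λ x → ∑ (λ i → ∑ (λ i' → g x * (ν i * (off i i' * (ν i' * c (d i i' ⊗ pos x)))))))   ≈⟨ trans (∑-comm _) (∑-cong (λ i → ∑-comm _)) ⟩
            ∑ (λ i → ∑ (λ i' → ∑ (λ x → g x * (ν i * (off i i' * (ν i' * c (d i i' ⊗ pos x)))))))   ≈⟨ ∑-cong (λ i → ∑-cong (λ i' → trans (∑-cong (λ x → solve 5 (λ g n o n' x → g :* (n :* (o :* (n' :* x))) := n :* (o :* n') :* (g :* x)) refl (g x) (ν i) (off i i') (ν i') _)) (trans (sym (*-∑ _ _)) (solve 4 (λ n o n' x → n :* (o :* n') :* x := n :* (o :* (n' :* x))) refl (ν i) (off i i') (ν i') _)))) ⟩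
            Off ∎) ⟩
          τ * q + Off ∎

        b e : ℕ
        b = (2 ℕ.* (h ℕ.* h)) ℕ.^ m
        e = (p ℕ.* p) ℕ.^ m

        upper : ι b * (τ * q + Off) ≤ τ * ι e
        upper = ≤-resp (trans (trans (∑-cong (λ x → solve 3 (λ g b x → g :* (b :* x) := b :* (g :* x)) refl (g x) (ι b) _)) (sym (*-∑ _ _))) (*-congˡ total)) (sym (∑-* _ _)) (∑-mono le)
          where
          le : ∀ x → g x * (ι b * P² m (pos x)) ≤ g x * ι e
          le x with x ↑ t ≟K 𝟏
          ... | yes γ = *-monoˡ 1# 0≤1 (P²-bound h (pos x) (proj₁ (gap x γ)) (proj₂ (gap x γ)) m)
          ... | no _ = ≤-reflexive (trans (zeroˡ _) (sym (zeroˡ _)))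

        -- The translation by u₀ only rotates S(d a), and ρ is the real part of the rotated value.
        -- Its square is at most |S(d a)|², which depends on the absolute difference of the indices
        -- alone because |S|² is even.
        ρ²≤ : ∀ i i' → ρ i i' * ρ i i' ≤ σ ℕ.∣ toℕ i - toℕ i' ∣
        ρ²≤ i i' = ≤-resp (*-cong (sym ρ-eq) (sym ρ-eq)) (trans sum-eq (S²-σ (toℕ i) (toℕ i')))
            (≤-resp (+-identityʳ _) refl (+-mono ≤-refl (sq-nonneg (α * Y - β * X))))
          where
          D' = d i i'
          α = c (D' ⊗ u₀)
          β = s (D' ⊗ u₀)
          X = Sc (D' ⊗ a)
          Y = Ss (D' ⊗ a)
          ρ-eq : ρ i i' ≈ α * X + β * Y
          ρ-eq = trans (∑-cong (λ x → trans (*-congˡ (trans (c-dist D' (a ⊗ x) u₀) (+-cong (*-congʳ (reflexive (cong c (≡.sym (⊗-assoc D' a x))))) (*-congʳ (reflexive (cong s (≡.sym (⊗-assoc D' a x)))))))) (solve 5 (λ g a b e f → g :* (e :* a :+ f :* b) := a :* (g :* e) :+ b :* (g :* f)) refl (g x) α β _ _)))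
            (trans (∑-+ _ _) (+-cong (sym (*-∑ _ _)) (sym (*-∑ _ _))))
          sum-eq : (α * X + β * Y) * (α * X + β * Y) + (α * Y - β * X) * (α * Y - β * X) ≈ S² (D' ⊗ a)
          sum-eq = trans (solve 4 (λ a b x y → (a :* x :+ b :* y) :* (a :* x :+ b :* y) :+ (a :* y :- b :* x) :* (a :* y :- b :* x) := (a :* a :+ b :* b) :* (x :* x :+ y :* y)) refl α β X Y) (trans (*-congʳ (c²+s² _)) (*-identityˡ _))
          S²-σ : ∀ i i' → S² (([ i ] ⊝ [ i' ]) ⊗ a) ≈ σ ℕ.∣ i - i' ∣
          S²-σ i i' with ℕₚ.≤-total i' i
          ... | inj₁ l = reflexive (cong (λ z → S² (z ⊗ a)) (≡.trans (cong (_⊝ [ i' ]) (≡.trans (cong [_] (≡.sym (ℕₚ.m∸n+n≡m l))) ([]-+ (i ℕ.∸ i') i'))) (≡.trans (solveK 2 (λ x y → (x :⊕ y) :⊝ y :≡ x) ≡.refl [ i ℕ.∸ i' ] [ i' ]) (cong [_] (≡.sym (ℕₚ.m≤n⇒∣n-m∣≡n∸m l))))))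
          ... | inj₂ l = trans (sym (S²-even _)) (reflexive (cong S² (≡.trans (solveK 3 (λ x y a → :⊖ ((x :⊝ y) :⊗ a) :≡ (y :⊝ x) :⊗ a) ≡.refl [ i ] [ i' ] a) (cong (_⊗ a) (≡.trans (cong (_⊝ [ i ]) (≡.trans (cong [_] (≡.sym (ℕₚ.m∸n+n≡m l))) ([]-+ (i' ℕ.∸ i) i))) (≡.trans (solveK 2 (λ x y → (x :⊕ y) :⊝ y :≡ x) ≡.refl [ i' ℕ.∸ i ] [ i ]) (cong [_] (≡.sym (ℕₚ.m≤n⇒∣m-n∣≡n∸m l)))))))))

        -- Cauchy over the pairs (i, i'), with ν_i as one factor repeated L times. For fixed i' the
        -- squares of ρ are bounded by values of σ at differences, which sum to at most 2 A(L).
        Off²≤ : Off * Off ≤ (ι L * q) * (q * (A L + A L))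
        Off²≤ = ≤-trans (∑∑-cauchy (λ i _ → ν i) (λ i i' → off i i' * (ν i' * ρ i i'))) (*-mono (∑-nonneg (λ i → ∑-nonneg (λ _ → sq-nonneg (ν i)))) (∑-nonneg (λ i → ∑-nonneg (λ i' → sq-nonneg (off i i' * (ν i' * ρ i i')))))
            (≤-reflexive (trans (∑-cong (λ i → trans (∑-cong (λ _ → sym (*-identityˡ _))) (trans (sym (∑-* _ _)) (*-congʳ (∑-one L))))) (sym (*-∑ _ _))))
            (≤-trans (≤-reflexive (∑-comm _)) (≤-resp refl (sym (∑-* _ _)) (∑-mono inner))))
          where
          off-nonneg : ∀ (i i' : Fin L) → 0# ≤ off i i'
          off-nonneg i i' = ι-nonneg (𝟙 (¬? (i Fₚ.≟ i')))
          inner : ∀ i' → ∑ (λ i → (off i i' * (ν i' * ρ i i')) * (off i i' * (ν i' * ρ i i'))) ≤ ν i' * ν i' * (A L + A L)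
          inner i' = ≤-trans (≤-reflexive (∑-cong (λ i → trans (solve 3 (λ o n r → (o :* (n :* r)) :* (o :* (n :* r)) := (n :* n) :* ((o :* o) :* (r :* r))) refl (off i i') (ν i') (ρ i i')) (*-congˡ (*-congʳ (off-idem i i'))))))
            (≤-trans (∑-mono (λ i → *-monoˡ (ν i' * ν i') (sq-nonneg (ν i')) (*-monoˡ (off i i') (off-nonneg i i') (ρ²≤ i i'))))
            (≤-trans (≤-reflexive (sym (*-∑ _ _))) (*-monoˡ (ν i' * ν i') (sq-nonneg (ν i')) (differences₂ L i'))))

        P-𝟘 : ∀ m → (Pc m 𝟘 ≈ ι (N ℕ.^ m)) × (Ps m 𝟘 ≈ 0#)
        P-𝟘 zero = refl , refl
        P-𝟘 (suc m) = trans (+-cong (*-cong (proj₁ (P-𝟘 m)) Ec𝟘) (-‿cong (*-cong (proj₂ (P-𝟘 m)) Es𝟘))) (trans (solve 2 (λ a b → a :* b :- :0 :* :0 := b :* a) refl (ι (N ℕ.^ m)) (ι N)) (sym (ι-* N (N ℕ.^ m)))) ,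
                       trans (+-cong (*-cong (proj₂ (P-𝟘 m)) Ec𝟘) (*-cong (proj₁ (P-𝟘 m)) Es𝟘)) (solve 2 (λ a b → :0 :* b :+ a :* :0 := :0) refl (ι (N ℕ.^ m)) (ι N))
          where
          Ec𝟘 : Ec 𝟘 ≈ ι N
          Ec𝟘 = trans (∑-cong (λ j → trans (reflexive (cong c (⊗-zeroʳ _))) c-𝟘)) (∑-one N)
          Es𝟘 : Es 𝟘 ≈ 0#
          Es𝟘 = ∑-0 (λ j → trans (reflexive (cong s (⊗-zeroʳ _))) s-𝟘)

        -- Cauchy for the sum of the L coefficients, which is N^m, the value of the m-th power of
        -- the kernel at 0.
        N²ᵐ≤ : ι (N ℕ.^ m ℕ.* N ℕ.^ m) ≤ ι L * q
        N²ᵐ≤ = ≤-resp (trans (*-cong eq eq) (sym (ι-* (N ℕ.^ m) (N ℕ.^ m)))) (*-congʳ (trans (∑-cong (λ _ → *-identityˡ 1#)) (∑-one L))) (∑-cauchy (λ _ → 1#) ν)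
          where
          eq : ∑ (λ i → 1# * ν i) ≈ ι (N ℕ.^ m)
          eq = trans (∑-cong (λ i → trans (*-comm _ _) (*-congˡ (sym (trans (reflexive (cong c (⊗-zeroʳ _))) c-𝟘))))) (trans (sym (ν-c 𝟘)) (proj₁ (P-𝟘 m)))

        1≤L : 1 ℕ.≤ L
        1≤L = ℕₚ.m≤n+m 1 (m ℕ.* N)

        2e≤bq : (1# + 1#) * ι e ≤ ι b * q
        2e≤bq = cancel⁺ L 1≤L (≤-resp (trans (ι-* (2 ℕ.* L) e) (trans (*-congʳ (ι-* 2 L)) (solve 2 (λ l e → ((:1 :+ :1) :* l) :* e := l :* ((:1 :+ :1) :* e)) refl (ι L) (ι e)))) (solve 3 (λ b l q → b :* (l :* q) := l :* (b :* q)) refl (ι b) (ι L) q)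
          (≤-trans (ι-mono large) (≤-resp (sym (ι-* b (N ℕ.^ m ℕ.* N ℕ.^ m))) refl (*-monoˡ (ι b) (ι-nonneg b) N²ᵐ≤))))

        1≤b : 1 ℕ.≤ b
        1≤b = ℕₚ.m^n>0 (2 ℕ.* (h ℕ.* h)) {{ℕ.>-nonZero (ℕₚ.*-mono-≤ {1} {2} {1} (ℕ.s≤s ℕ.z≤n) (ℕₚ.*-mono-≤ 1≤h 1≤h))}} m

        τ-nonneg : 0# ≤ τ
        τ-nonneg = ∑-nonneg g-nonneg

        -- On the coset the kernel is so small that τ q + Off is at most half of τ q. Hence Off is
        -- negative and absorbs at least half of the diagonal.
        τq≤ : τ * q ≤ - (Off + Off)
        τq≤ = 0≤y-x⁻ (≤-resp refl (solve 3 (λ t q o → t :* q :- ((:1 :+ :1) :* (t :* q :+ o)) := :- (o :+ o) :- t :* q) refl τ q Off) (0≤y-x (cancel⁺ b 1≤b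
          (≤-resp (solve 2 (λ b x → (:1 :+ :1) :* (b :* x) := b :* ((:1 :+ :1) :* x)) refl (ι b) _) (solve 3 (λ t b q → t :* (b :* q) := b :* (t :* q)) refl τ (ι b) q)
            (≤-trans (*-monoˡ (1# + 1#) (+-nonneg 0≤1 0≤1) upper) (≤-resp (solve 2 (λ t e → t :* ((:1 :+ :1) :* e) := (:1 :+ :1) :* (t :* e)) refl τ (ι e)) refl (*-monoˡ τ τ-nonneg 2e≤bq)))))))

        conclusion : τ * τ ≤ ι (8 ℕ.* L) * A L
        conclusion = cancel-≤ (L ℕ.* L) {z = q * q} big (≤-resp (solve 2 (λ t q → (t :* q) :* (t :* q) := (q :* q) :* (t :* t)) refl τ q)
            (trans (*-congˡ (refl {x = (ι L * q) * (q * (A L + A L))})) (trans (solve 3 (λ l q a → ((:1 :+ :1) :* (:1 :+ :1)) :* ((l :* q) :* (q :* (a :+ a))) := (q :* q) :* (((:1 :+ (:1 :+ (:1 :+ (:1 :+ (:1 :+ (:1 :+ (:1 :+ :1))))))) :* l) :* a)) refl (ι L) q (A L)) (*-congˡ (*-congʳ (sym (ι-* 8 L))))))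
            (≤-trans (sq-mono (*-nonneg τ-nonneg q-nonneg) τq≤) (≤-resp (solve 1 (λ o → ((:1 :+ :1) :* (:1 :+ :1)) :* (o :* o) := (:- (o :+ o)) :* (:- (o :+ o))) refl Off) refl (*-monoˡ ((1# + 1#) * (1# + 1#)) (sq-nonneg (1# + 1#)) Off²≤))))
          where
          1≤Lq : 1# ≤ ι L * q
          1≤Lq = ≤-trans (ι-mono (ℕₚ.*-mono-≤ n n)) N²ᵐ≤
            where n = ℕₚ.m^n>0 N {{ℕ.>-nonZero 1≤N}} m
          -- Since Lq is at least N^(2m) and thus at least 1, q² is bounded below and may be
          -- cancelled.
          big : 1# ≤ ι (L ℕ.* L) * (q * q)
          big = ≤-resp (*-identityˡ 1#) (trans (solve 2 (λ l q → (l :* q) :* (l :* q) := (l :* l) :* (q :* q)) refl (ι L) q) (*-congʳ (sym (ι-* L L)))) (sq-mono 0≤1 1≤Lq)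

-- The rational numbers as an ordered ring

module Rationals where
 open import Data.Nat as ℕ using (ℕ; zero; suc)
 open import Data.Rational as ℚ using (ℚ; 0ℚ; 1ℚ; _+_; _*_; -_; _-_; _≤_)
 import Data.Rational.Properties as ℚₚ
 open import Data.Integer using (+≤+)
 open import Data.Product using (Σ; _,_)
 open import Data.Sum using (inj₁; inj₂)
 open import Relation.Nullary using (contradiction)
 open import Relation.Binary.PropositionalEquality using (_≡_; refl; sym; trans; cong; subst; subst₂)
 open OrderedRings using (OrderedRing)

 private
   open IntegerSolver ℚₚ.+-*-commutativeRing using (ι; ι-suc; solve; _:=_; _:+_; _:*_; _:-_; :-_; :1)

   *-nonneg : ∀ {x y} → 0ℚ ≤ x → 0ℚ ≤ y → 0ℚ ≤ x * y
   *-nonneg {x} {y} h h' = subst (_≤ x * y) (ℚₚ.*-zeroʳ x) (ℚₚ.*-monoˡ-≤-nonNeg x {{ℚ.nonNegative h}} h')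

   neg-nonneg : ∀ {x} → x ≤ 0ℚ → 0ℚ ≤ - x
   neg-nonneg {x} h = ℚₚ.neg-antimono-≤ h

   sq-nonneg : ∀ x → 0ℚ ≤ x * x
   sq-nonneg x with ℚₚ.≤-total 0ℚ x
   ... | inj₁ h = *-nonneg h h
   ... | inj₂ h = subst (0ℚ ≤_) (solve 1 (λ x → (:- x) :* (:- x) := x :* x) refl x) (*-nonneg (neg-nonneg h) (neg-nonneg h))

   0≤1 : 0ℚ ≤ 1ℚ
   0≤1 = sq-nonneg 1ℚ

   ι-nonneg : ∀ n → 0ℚ ≤ ι n
   ι-nonneg zero = ℚₚ.≤-refl
   ι-nonneg (suc n) = subst (0ℚ ≤_) (sym (ι-suc n)) (subst (_≤ 1ℚ + ι n) (ℚₚ.+-identityˡ 0ℚ) (ℚₚ.+-mono-≤ 0≤1 (ι-nonneg n)))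

   -- For x ≤ 0 the identity x = (n y - 1)(-x) + n (y x) writes x as a sum of two nonnegative terms.
   cancel-pos : ∀ n {x y} → 1ℚ ≤ ι n * y → 0ℚ ≤ y * x → 0ℚ ≤ x
   cancel-pos n {x} {y} h h' with ℚₚ.≤-total 0ℚ x
   ... | inj₁ g = g
   ... | inj₂ g = subst (0ℚ ≤_) (solve 3 (λ i x y → (i :* y :- :1) :* (:- x) :+ i :* (y :* x) := x) refl (ι n) x y)
         (subst (_≤ (ι n * y - 1ℚ) * (- x) + ι n * (y * x)) (ℚₚ.+-identityˡ 0ℚ) (ℚₚ.+-mono-≤ (*-nonneg (subst (_≤ ι n * y - 1ℚ) (ℚₚ.+-inverseʳ 1ℚ) (ℚₚ.+-monoˡ-≤ (- 1ℚ) h)) (neg-nonneg g)) (*-nonneg (ι-nonneg n) h')))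

   reflect : ∀ {m n} → ι m ≤ ι n → m ℕ.≤ n
   reflect {zero} h = ℕ.z≤n
   reflect {suc m} {zero} h = contradiction (ℚₚ.≤-trans (subst₂ _≤_ (ℚₚ.+-identityʳ 1ℚ) (sym (ι-suc m)) (ℚₚ.+-monoʳ-≤ 1ℚ (ι-nonneg m))) h) λ { (ℚ.*≤* (+≤+ ())) }
   reflect {suc m} {suc n} h = ℕ.s≤s (reflect (subst₂ _≤_ (e m) (e n) (ℚₚ.+-monoʳ-≤ (- 1ℚ) h)))
     where
     e : ∀ n → - 1ℚ + ι (suc n) ≡ ι n
     e n = trans (cong (- 1ℚ +_) (ι-suc n)) (solve 1 (λ x → (:- :1) :+ (:1 :+ x) := x) refl (ι n))

 ℚ-ordered : OrderedRing
 ℚ-ordered = record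
   { CR = ℚₚ.+-*-commutativeRing ; _≤_ = _≤_ ; ≤-reflexive = ℚₚ.≤-reflexive ; ≤-trans = ℚₚ.≤-trans ; ≤-antisym = ℚₚ.≤-antisym
   ; +-mono = ℚₚ.+-mono-≤ ; *-nonneg = *-nonneg ; sq-nonneg = sq-nonneg ; reflect = reflect ; cancel-pos = cancel-pos }

 abstract
   ℚ-inverse : ∀ n → Σ ℚ λ i → ι (suc n) * i ≡ 1ℚ
   ℚ-inverse n = (ℚ.1/ ι (suc n)) {{ι≢0}} , ℚₚ.*-inverseʳ (ι (suc n)) {{ι≢0}}
     where
     ι≢0 : ℚ.NonZero (ι (suc n))
     ι≢0 = ℚ.≢-nonZero (λ e → contradiction (reflect {suc n} {0} (ℚₚ.≤-reflexive e)) λ ())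

-- Bounded sequences over a totally ordered ring, compared up to an error O(1/n).
module _ where
 open OrderedRings using (OrderedRing)
 open import Data.Sum using (_⊎_; inj₁; inj₂)
 module BoundedSequences (Q : OrderedRing) (≤-total : ∀ x y → OrderedRing._≤_ Q x y ⊎ OrderedRing._≤_ Q y x) where
  open import Level using (0ℓ)
  open import Algebra.Bundles using (CommutativeRing)
  open import Data.Nat as ℕ using (ℕ; zero; suc)
  import Data.Nat.Properties as ℕₚ
  open import Data.Product using (Σ; _,_; proj₁; _×_)
  open import Relation.Binary.PropositionalEquality as ≡ using (_≡_)
  open OrderedRings using (module OrderedRingProperties)
  open OrderedRingProperties Q

  record Seq : Set where
    field
      _!_ : ℕ → Carrier
      bound : ℕ
      upper : ∀ n → _!_ n ≤ ι bound
      lower : ∀ n → - ι bound ≤ _!_ n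
  open Seq public

  -- N n · (a - b) ≤ C expresses a ≤ b + C/(n+1) without division.
  N : ℕ → Carrier
  N n = ι (suc n)

  N-nonneg : ∀ n → 0# ≤ N n
  N-nonneg n = ι-nonneg (suc n)

  1≤N : ∀ n → 1# ≤ N n
  1≤N n = ι-mono {1} {suc n} (ℕ.s≤s ℕ.z≤n)

  infix 4 _≲_ _≃_
  _≲_ : Seq → Seq → Set
  x ≲ y = Σ ℕ λ C → ∀ n → N n * (x ! n - y ! n) ≤ ι C

  _≃_ : Seq → Seq → Set
  x ≃ y = x ≲ y × y ≲ x

  _+ˢ_ _*ˢ_ : Seq → Seq → Seq
  (x +ˢ y) ! n = x ! n + y ! n
  (x +ˢ y) .bound = bound x ℕ.+ bound y
  (x +ˢ y) .upper n = ≤-resp refl (sym (ι-+ (bound x) (bound y))) (+-mono (upper x n) (upper y n))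
  (x +ˢ y) .lower n = ≤-resp (trans (solve 2 (λ a b → (:- a) :+ (:- b) := :- (a :+ b)) refl (ι (bound x)) (ι (bound y))) (-‿cong (sym (ι-+ (bound x) (bound y))))) refl (+-mono (lower x n) (lower y n))
  (x *ˢ y) ! n = x ! n * y ! n
  (x *ˢ y) .bound = bound x ℕ.* bound y
  (x *ˢ y) .upper n = ≤-resp refl (sym (ι-* (bound x) (bound y))) (abs-* (upper x n) (lower x n) (upper y n) (lower y n))
  (x *ˢ y) .lower n = ≤-resp (-‿cong (sym (ι-* (bound x) (bound y)))) refl (abs-*' (upper x n) (lower x n) (upper y n) (lower y n))

  -ˢ_ : Seq → Seq
  (-ˢ x) ! n = - (x ! n)
  (-ˢ x) .bound = bound x
  (-ˢ x) .upper n = ≤-resp refl (solve 1 (λ c → :- (:- c) := c) refl (ι (bound x))) (neg-≤ (lower x n))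
  (-ˢ x) .lower n = neg-≤ (upper x n)

  0ˢ 1ˢ : Seq
  0ˢ ! n = 0#
  0ˢ .bound = 0
  0ˢ .upper n = ≤-refl
  0ˢ .lower n = ≤-reflexive (solve 0 ((:- :0) := :0) refl)
  1ˢ ! n = 1#
  1ˢ .bound = 1
  1ˢ .upper n = ≤-refl
  1ˢ .lower n = 0≤y-x⁻ (≤-resp refl (solve 0 (:1 :+ :1 := :1 :- (:- :1)) refl) (+-nonneg 0≤1 0≤1))

  pointwise≲ : ∀ {x y} → (∀ n → x ! n ≤ y ! n) → x ≲ y
  pointwise≲ {x} {y} h = 0 , λ n → ≤-resp (solve 3 (λ N x y → :0 :- N :* (y :- x) := N :* (x :- y)) refl (N n) (x ! n) (y ! n)) (-‿inverseʳ 0#)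
    (+-mono ≤-refl (neg-≤ (*-nonneg (N-nonneg n) (0≤y-x (h n)))))

  pointwise : ∀ {x y} → (∀ n → x ! n ≈ y ! n) → x ≃ y
  pointwise {x} {y} h = pointwise≲ {x} {y} (λ n → ≤-reflexive (h n)) , pointwise≲ {y} {x} (λ n → ≤-reflexive (sym (h n)))

  ≲-trans : ∀ {x y z} → x ≲ y → y ≲ z → x ≲ z
  ≲-trans {x} {y} {z} (C , h) (C' , h') = C ℕ.+ C' , λ n → ≤-resp (solve 4 (λ N x y z → N :* (x :- y) :+ N :* (y :- z) := N :* (x :- z)) refl (N n) (x ! n) (y ! n) (z ! n)) (sym (ι-+ C C')) (+-mono (h n) (h' n))

  +ˢ-mono : ∀ {a b c d} → a ≲ b → c ≲ d → (a +ˢ c) ≲ (b +ˢ d)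
  +ˢ-mono {a} {b} {c} {d} (C , h) (C' , h') = C ℕ.+ C' , λ n → ≤-resp (solve 5 (λ N a b c d → N :* (a :- b) :+ N :* (c :- d) := N :* ((a :+ c) :- (b :+ d))) refl (N n) (a ! n) (b ! n) (c ! n) (d ! n)) (sym (ι-+ C C')) (+-mono (h n) (h' n))

  -ˢ-anti : ∀ {x y} → x ≲ y → (-ˢ y) ≲ (-ˢ x)
  -ˢ-anti {x} {y} (C , h) = C , λ n → ≤-resp (solve 3 (λ N x y → N :* (x :- y) := N :* ((:- y) :- (:- x))) refl (N n) (x ! n) (y ! n)) refl (h n)

  -- This is where boundedness is essential: x y - x' y' = (x - x') y + (y - y') x', and the errors
  -- O(1/n) are multiplied by bounded factors only.
  *ˢ-cong≲ : ∀ {x x' y y'} → x ≃ x' → y ≃ y' → (x *ˢ y) ≲ (x' *ˢ y')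
  *ˢ-cong≲ {x} {x'} {y} {y'} ((C₁ , h₁) , (C₂ , h₂)) ((D₁ , k₁) , (D₂ , k₂)) = C ℕ.* bound y ℕ.+ D ℕ.* bound x' , λ n →
    ≤-resp (solve 5 (λ N x x' y y' → (N :* (x :- x')) :* y :+ (N :* (y :- y')) :* x' := N :* (x :* y :- x' :* y')) refl (N n) (x ! n) (x' ! n) (y ! n) (y' ! n))
      (trans (+-cong (sym (ι-* C (bound y))) (sym (ι-* D (bound x')))) (sym (ι-+ (C ℕ.* bound y) (D ℕ.* bound x'))))
      (+-mono (abs-* (≤-trans (h₁ n) (ι-mono (ℕₚ.m≤m+n C₁ C₂))) (≤-resp refl (solve 3 (λ N x x' → :- (N :* (x' :- x)) := N :* (x :- x')) refl (N n) (x ! n) (x' ! n)) (neg-≤ (≤-trans (h₂ n) (ι-mono (ℕₚ.m≤n+m C₂ C₁))))) (upper y n) (lower y n))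
              (abs-* (≤-trans (k₁ n) (ι-mono (ℕₚ.m≤m+n D₁ D₂))) (≤-resp refl (solve 3 (λ N x x' → :- (N :* (x' :- x)) := N :* (x :- x')) refl (N n) (y ! n) (y' ! n)) (neg-≤ (≤-trans (k₂ n) (ι-mono (ℕₚ.m≤n+m D₂ D₁))))) (upper x' n) (lower x' n)))
    where
    C = C₁ ℕ.+ C₂
    D = D₁ ℕ.+ D₂

  ≃-sym : ∀ {x y} → x ≃ y → y ≃ x
  ≃-sym (h , h') = h' , h

  SeqCR : CommutativeRing 0ℓ 0ℓ
  SeqCR = record
    { Carrier = Seq ; _≈_ = _≃_ ; _+_ = _+ˢ_ ; _*_ = _*ˢ_ ; -_ = -ˢ_ ; 0# = 0ˢ ; 1# = 1ˢ
    ; isCommutativeRing = record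
      { isRing = record
        { +-isAbelianGroup = record
          { isGroup = record
            { isMonoid = record
              { isSemigroup = record
                { isMagma = record
                  { isEquivalence = record { refl = λ {x} → pointwise {x} {x} (λ n → refl) ; sym = λ {x} {y} → ≃-sym {x} {y} ; trans = λ {x} {y} {z} (h , h') (k , k') → ≲-trans {x} {y} {z} h k , ≲-trans {z} {y} {x} k' h' }
                  ; ∙-cong = λ {a} {b} {c} {d} (h , h') (k , k') → +ˢ-mono {a} {b} {c} {d} h k , +ˢ-mono {b} {a} {d} {c} h' k' }
                ; assoc = λ x y z → pointwise {(x +ˢ y) +ˢ z} {x +ˢ (y +ˢ z)} (λ n → +-assoc _ _ _) }
              ; identity = (λ x → pointwise {0ˢ +ˢ x} {x} (λ n → +-identityˡ _)) , (λ x → pointwise {x +ˢ 0ˢ} {x} (λ n → +-identityʳ _)) }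
            ; inverse = (λ x → pointwise {(-ˢ x) +ˢ x} {0ˢ} (λ n → -‿inverseˡ _)) , (λ x → pointwise {x +ˢ (-ˢ x)} {0ˢ} (λ n → -‿inverseʳ _))
            ; ⁻¹-cong = λ {x} {y} (h , h') → -ˢ-anti {y} {x} h' , -ˢ-anti {x} {y} h }
          ; comm = λ x y → pointwise {x +ˢ y} {y +ˢ x} (λ n → +-comm _ _) }
        ; *-cong = λ {x} {x'} {y} {y'} h k → *ˢ-cong≲ {x} {x'} {y} {y'} h k , *ˢ-cong≲ {x'} {x} {y'} {y} (≃-sym {x} {x'} h) (≃-sym {y} {y'} k)
        ; *-assoc = λ x y z → pointwise {(x *ˢ y) *ˢ z} {x *ˢ (y *ˢ z)} (λ n → *-assoc _ _ _)
        ; *-identity = (λ x → pointwise {1ˢ *ˢ x} {x} (λ n → *-identityˡ _)) , (λ x → pointwise {x *ˢ 1ˢ} {x} (λ n → *-identityʳ _))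
        ; distrib = (λ x y z → pointwise {x *ˢ (y +ˢ z)} {(x *ˢ y) +ˢ (x *ˢ z)} (λ n → distribˡ _ _ _)) , (λ x y z → pointwise {(y +ˢ z) *ˢ x} {(y *ˢ x) +ˢ (z *ˢ x)} (λ n → distribʳ _ _ _))
        }
      ; *-comm = λ x y → pointwise {x *ˢ y} {y *ˢ x} (λ n → *-comm _ _) } }

  open IntegerSolver SeqCR using () renaming (ι to ιˢ)

  ιˢ-! : ∀ k n → ιˢ k ! n ≈ ι k
  ιˢ-! zero n = refl
  ιˢ-! (suc zero) n = refl
  ιˢ-! (suc (suc k)) n = +-congˡ (ιˢ-! (suc k) n)

  Seq-ordered : OrderedRing
  Seq-ordered = record
    { CR = SeqCR ; _≤_ = _≲_ ; ≤-reflexive = λ {x} {y} (h : x ≃ y) → proj₁ h ; ≤-trans = λ {x} {y} {z} → ≲-trans {x} {y} {z} ; ≤-antisym = λ h h' → h , h' ; +-mono = λ {a} {b} {c} {d} → +ˢ-mono {a} {b} {c} {d}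
    ; *-nonneg = λ {x} {y} → nonneg {x} {y} ; sq-nonneg = λ x → pointwise≲ {0ˢ} {x *ˢ x} (λ n → sq-nonneg (x ! n)) ; reflect = λ {m} {n} → rfl {m} {n} ; cancel-pos = λ n {x} {y} → cpos n {x} {y} }
    where
    nonneg : ∀ {x y} → 0ˢ ≲ x → 0ˢ ≲ y → 0ˢ ≲ (x *ˢ y)
    -- From a ≥ -C/N and b ≥ -D/N the product (a + C/N)(b + D/N) is nonnegative. So -N a b is at
    -- most D a + C b + C D/N, which is bounded.
    nonneg {x} {y} (C , h) (D , k) = B , λ n → let N' = N n ; a = x ! n ; b = y ! n in
      cancel n (≤-trans
        (≤-resp (+-identityˡ _) (solve 5 (λ N a b c d → ((c :- N :* (:0 :- a)) :* (d :- N :* (:0 :- b))) :+ N :* (N :* (:0 :- a :* b)) := (N :* (d :* a) :+ N :* (c :* b)) :+ :1 :* (c :* d)) refl N' a b (ι C) (ι D))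
          (+-mono (*-nonneg (0≤y-x (h n)) (0≤y-x (k n))) ≤-refl))
        (≤-resp refl (trans (solve 6 (λ N d bx c by z → (N :* (d :* bx) :+ N :* (c :* by)) :+ N :* z := N :* ((d :* bx :+ c :* by) :+ z)) refl N' (ι D) (ι (bound x)) (ι C) (ι (bound y)) (ι C * ι D)) (*-congˡ eqB))
          (+-mono (+-mono (*-monoˡ N' (N-nonneg n) (*-monoˡ (ι D) (ι-nonneg D) (upper x n))) (*-monoˡ N' (N-nonneg n) (*-monoˡ (ι C) (ι-nonneg C) (upper y n)))) (*-monoʳ (ι C * ι D) (*-nonneg (ι-nonneg C) (ι-nonneg D)) (1≤N n)))))
      where
      B = (D ℕ.* bound x ℕ.+ C ℕ.* bound y) ℕ.+ C ℕ.* D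
      eqB : (ι D * ι (bound x) + ι C * ι (bound y)) + ι C * ι D ≈ ι B
      eqB = sym (trans (ι-+ (D ℕ.* bound x ℕ.+ C ℕ.* bound y) (C ℕ.* D)) (+-cong (trans (ι-+ (D ℕ.* bound x) (C ℕ.* bound y)) (+-cong (ι-* D (bound x)) (ι-* C (bound y)))) (ι-* C D)))
    rfl : ∀ {m n} → ιˢ m ≲ ιˢ n → m ℕ.≤ n
    -- If n < m, the hypothesis taken at index C would read (C + 1)(m - n) ≤ C.
    rfl {m} {n} (C , h) = ℕₚ.≮⇒≥ λ n<m → ℕₚ.<-irrefl ≡.refl (reflect {suc C} {C} (≤-trans (1·N n<m) (h C)))
      where
      1·N : n ℕ.< m → N C ≤ N C * (ιˢ m ! C - ιˢ n ! C)
      1·N n<m = ≤-resp (*-identityʳ _) (*-congˡ (sym (+-cong (ιˢ-! m C) (-‿cong (ιˢ-! n C))))) (*-monoˡ (N C) (N-nonneg C)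
        (≤-resp (solve 1 (λ x → (:1 :+ x) :- x := :1) refl (ι n)) refl (+-mono (≤-resp (ι-suc n) refl (ι-mono n<m)) (≤-refl { - ι n}))))
    cpos : ∀ k {x y} → 1ˢ ≲ (ιˢ k *ˢ y) → 0ˢ ≲ (y *ˢ x) → 0ˢ ≲ x
    cpos k {x} {y} (C , h) (D , h') = bound x ℕ.* C ℕ.+ k ℕ.* D , go
      where
      go : ∀ n → N n * (0# - x ! n) ≤ ι (bound x ℕ.* C ℕ.+ k ℕ.* D)
      -- Totality of the base order decides the sign at each index. For a negative term the
      -- inequality 1 - k y ≤ C/N is multiplied by -x, which is bounded.
      go n with ≤-total 0# (x ! n)
      ... | inj₁ pos = ≤-trans (≤-resp (solve 2 (λ N x → :- (N :* x) := N :* (:0 :- x)) refl (N n) (x ! n)) (solve 0 ((:- :0) := :0) refl) (neg-≤ (*-nonneg (N-nonneg n) pos))) (ι-nonneg (bound x ℕ.* C ℕ.+ k ℕ.* D))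
      ... | inj₂ neg = ≤-resp (trans (+-congʳ (*-congˡ (*-congˡ (+-congˡ (-‿cong (*-congʳ (ιˢ-! k n))))))) (solve 4 (λ N x y k → (:- x) :* (N :* (:1 :- k :* y)) :+ k :* (N :* (:0 :- y :* x)) := N :* (:0 :- x)) refl (N n) (x ! n) (y ! n) (ι k)))
          (sym (trans (ι-+ (bound x ℕ.* C) (k ℕ.* D)) (+-cong (ι-* (bound x) C) (ι-* k D))))
          (+-mono (≤-trans (*-monoˡ (- (x ! n)) (≤-resp (solve 0 ((:- :0) := :0) refl) refl (neg-≤ neg)) (h n)) (*-monoʳ (ι C) (ι-nonneg C) (upper (-ˢ x) n))) (*-monoˡ (ι k) (ι-nonneg k) (h' n)))

-- Rational rotations stopped at a half turn

module _ where
 open OrderedRings using (OrderedRing; module OrderedRingProperties)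
 open import Data.Sum using (_⊎_; inj₁; inj₂)
 open import Data.Nat as ℕ using (ℕ; zero; suc)
 open import Relation.Nullary using (¬_; Dec; yes; no; contradiction)
 module Rotations (Q : OrderedRing) where
  open OrderedRingProperties Q
  import Data.Nat.Properties as ℕₚ
  import Data.Nat.DivMod as DM
  open import Data.Product using (Σ; _,_; proj₁; proj₂; _×_)
  open import Relation.Binary.PropositionalEquality as ≡ using (_≡_; cong)
  open import Relation.Binary.Reasoning.Setoid setoid

  first-failure : ∀ {P : ℕ → Set} → (∀ i → Dec (P i)) → ∀ b → ¬ (∀ i → i ℕ.< b → P i) → Σ ℕ λ j → (¬ P j) × (∀ i → i ℕ.< j → P i)
  first-failure P? zero nh = contradiction (λ _ ()) nh
  first-failure {P} P? (suc b) nh with ℕₚ.allUpTo? P? b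
  ... | no nall = first-failure P? b (λ h → nall (λ {i} l → h i l))
  ... | yes all = b , (λ pb → nh (ext pb)) , λ i l → all l
    where
    ext : P b → ∀ i → i ℕ.< suc b → P i
    ext pb i (ℕ.s≤s i≤b) with ℕₚ.m≤n⇒m<n∨m≡n i≤b
    ... | inj₁ l = all l
    ... | inj₂ ≡.refl = pb

  -- Powers of a rotation (c , s) by a small angle, of size about 2/M.
  module Rotation (≤-total : ∀ x y → x ≤ y ⊎ y ≤ x) (_≤?_ : ∀ x y → Dec (x ≤ y))
    (M : ℕ) (c s : Carrier) (unit : c * c + s * s ≈ 1#) (0≤c : 0# ≤ c) (c≤1 : c ≤ 1#)
    (1≤Ms : 1# ≤ ι M * s) (Ms≤2 : ι M * s ≤ ι 2) (M[1-c]≤2 : ι M * (1# - c) ≤ ι 2) where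

    C S : ℕ → Carrier
    C zero = 1#
    C (suc k) = C k * c - S k * s
    S zero = 0#
    S (suc k) = S k * c + C k * s

    0≤s : 0# ≤ s
    0≤s = cancel-pos M 1≤Ms (sq-nonneg s)

    C-+ : ∀ j k → C (j ℕ.+ k) ≈ C j * C k - S j * S k
    S-+ : ∀ j k → S (j ℕ.+ k) ≈ S j * C k + C j * S k
    C-+ zero k = solve 2 (λ a b → a := :1 :* a :- :0 :* b) refl (C k) (S k)
    C-+ (suc j) k = trans (+-cong (*-congʳ (C-+ j k)) (-‿cong (*-congʳ (S-+ j k)))) (solve 6 (λ cj sj ck sk c s → (cj :* ck :- sj :* sk) :* c :- (sj :* ck :+ cj :* sk) :* s := (cj :* c :- sj :* s) :* ck :- (sj :* c :+ cj :* s) :* sk) refl (C j) (S j) (C k) (S k) c s)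
    S-+ zero k = solve 2 (λ a b → b := :0 :* a :+ :1 :* b) refl (C k) (S k)
    S-+ (suc j) k = trans (+-cong (*-congʳ (S-+ j k)) (*-congʳ (C-+ j k))) (solve 6 (λ cj sj ck sk c s → (sj :* ck :+ cj :* sk) :* c :+ (cj :* ck :- sj :* sk) :* s := (sj :* c :+ cj :* s) :* ck :+ (cj :* c :- sj :* s) :* sk) refl (C j) (S j) (C k) (S k) c s)

    C²+S² : ∀ k → C k * C k + S k * S k ≈ 1#
    C²+S² zero = solve 0 (:1 :* :1 :+ :0 :* :0 := :1) refl
    C²+S² (suc k) = trans (solve 4 (λ C S c s → (C :* c :- S :* s) :* (C :* c :- S :* s) :+ (S :* c :+ C :* s) :* (S :* c :+ C :* s) := (C :* C :+ S :* S) :* (c :* c :+ s :* s)) refl (C k) (S k) c s) (trans (*-cong (C²+S² k) unit) (*-identityˡ 1#))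

    -- w^j = w^(j+k) · conj(w^k)
    C-∸ : ∀ j k → C j ≈ C (j ℕ.+ k) * C k + S (j ℕ.+ k) * S k
    C-∸ j k = sym (trans (+-cong (*-congʳ (C-+ j k)) (*-congʳ (S-+ j k))) (trans (solve 4 (λ a b d e → (a :* d :- b :* e) :* d :+ (b :* d :+ a :* e) :* e := a :* (d :* d :+ e :* e)) refl (C j) (S j) (C k) (S k)) (trans (*-congˡ (C²+S² k)) (*-identityʳ _))))

    S-∸ : ∀ j k → S j ≈ S (j ℕ.+ k) * C k - C (j ℕ.+ k) * S k
    S-∸ j k = sym (trans (+-cong (*-congʳ (S-+ j k)) (-‿cong (*-congʳ (C-+ j k)))) (trans (solve 4 (λ a b d e → (b :* d :+ a :* e) :* d :- (a :* d :- b :* e) :* e := b :* (d :* d :+ e :* e)) refl (C j) (S j) (C k) (S k)) (trans (*-congˡ (C²+S² k)) (*-identityʳ _))))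

    sq≤1 : ∀ {x} → x * x ≤ 1# → x ≤ 1#
    sq≤1 {x} h with ≤-total x 1#
    ... | inj₁ l = l
    ... | inj₂ l = ≤-trans (≤-resp (*-identityˡ x) refl (*-monoʳ x (≤-trans 0≤1 l) l)) h

    -sq≤1 : ∀ {x} → x * x ≤ 1# → - 1# ≤ x
    -sq≤1 {x} h = ≤-resp refl (solve 1 (λ x → :- (:- x) := x) refl x) (neg-≤ (sq≤1 { - x} (≤-resp (solve 1 (λ x → x :* x := (:- x) :* (:- x)) refl x) refl h)))

    private
      C²≤1 : ∀ k → C k * C k ≤ 1#
      C²≤1 k = ≤-resp (+-identityʳ _) (C²+S² k) (+-mono ≤-refl (sq-nonneg (S k)))
      S²≤1 : ∀ k → S k * S k ≤ 1#
      S²≤1 k = ≤-resp (+-identityˡ _) (C²+S² k) (+-mono (sq-nonneg (C k)) ≤-refl)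

    C≤1 : ∀ k → C k ≤ 1#
    C≤1 k = sq≤1 (C²≤1 k)
    -1≤C : ∀ k → - 1# ≤ C k
    -1≤C k = -sq≤1 (C²≤1 k)
    S≤1 : ∀ k → S k ≤ 1#
    S≤1 k = sq≤1 (S²≤1 k)
    -1≤S : ∀ k → - 1# ≤ S k
    -1≤S k = -sq≤1 (S²≤1 k)

    private
      -1≤c : - 1# ≤ c
      -1≤c = ≤-trans (≤-resp refl (solve 0 ((:- :0) := :0) refl) (neg-≤ 0≤1)) 0≤c

    C-1 : C 1 ≈ c
    C-1 = solve 2 (λ c s → :1 :* c :- :0 :* s := c) refl c s
    S-1 : S 1 ≈ s
    S-1 = solve 2 (λ c s → :0 :* c :+ :1 :* s := s) refl c s

    S-bound : ∀ r → (S r ≤ ι r * s) × (- (ι r * s) ≤ S r)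
    S-bound zero = ≤-reflexive (sym (zeroˡ s)) , ≤-reflexive (solve 1 (λ s → :- (:0 :* s) := :0) refl s)
    S-bound (suc r) = ≤-resp refl eq (+-mono (abs-* u l c≤1 -1≤c) (abs-* (C≤1 r) (-1≤C r) ≤-refl (neg-s))) ,
                      ≤-resp (trans (solve 3 (λ i s x → (:- (i :* s :* :1)) :+ (:- (:1 :* s)) := :- (i :* s :* :1 :+ :1 :* s)) refl (ι r) s s) (-‿cong eq)) refl (+-mono (abs-*' u l c≤1 -1≤c) (abs-*' (C≤1 r) (-1≤C r) ≤-refl neg-s))
      where
      u = proj₁ (S-bound r)
      l = proj₂ (S-bound r)
      neg-s : - s ≤ s
      neg-s = ≤-trans (≤-resp refl (solve 0 ((:- :0) := :0) refl) (neg-≤ 0≤s)) 0≤s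
      eq : ι r * s * 1# + 1# * s ≈ ι (suc r) * s
      eq = trans (solve 2 (λ i s → i :* s :* :1 :+ :1 :* s := (:1 :+ i) :* s) refl (ι r) s) (*-congʳ (sym (ι-suc r)))

    C-bound : ∀ r → 1# - C r ≤ ι r * ((1# - c) + s)
    C-bound zero = ≤-reflexive (solve 2 (λ c s → :1 :- :1 := :0 :* ((:1 :- c) :+ s)) refl c s)
    C-bound (suc r) = ≤-resp (solve 4 (λ C S c s → (:1 :- C) :+ (C :* (:1 :- c) :+ S :* s) := :1 :- (C :* c :- S :* s)) refl (C r) (S r) c s)
      (trans (solve 3 (λ i c s → i :* ((:1 :- c) :+ s) :+ (:1 :* (:1 :- c) :+ :1 :* s) := (:1 :+ i) :* ((:1 :- c) :+ s)) refl (ι r) c s) (*-congʳ (sym (ι-suc r))))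
      (+-mono (C-bound r) (+-mono (*-monoʳ (1# - c) (0≤y-x c≤1) (C≤1 r)) (*-monoʳ s 0≤s (S≤1 r))))

    -- As C(k+2) - C(k) = -2 s S(k+1), the sum of two neighbouring cosines falls by at least 2s² in
    -- each step while the sine stays above s.
    C-descent : ∀ k → (∀ i → 1 ℕ.≤ i → i ℕ.≤ k → s ≤ S i) → (C (suc k) + C k) + ι k * (ι 2 * (s * s)) ≤ ι 2
    C-descent zero h = ≤-resp (solve 3 (λ a x y → a :+ :1 := (a :+ :1) :+ :0 :* x) refl (C 1) (ι 2 * (s * s)) s) refl (+-mono (C≤1 1) (≤-refl {1#}))
    C-descent (suc k) h = ≤-resp eq (+-identityʳ _) (+-mono (C-descent k (λ i a b → h i a (ℕₚ.m≤n⇒m≤1+n b))) neg)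
      where
      t = ι 2 * (s * s)
      C-back : C k ≈ C (suc k) * c + S (suc k) * s
      C-back = trans (C-∸ k 1) (+-cong (*-cong (reflexive (cong C (ℕₚ.+-comm k 1))) C-1) (*-cong (reflexive (cong S (ℕₚ.+-comm k 1))) S-1))
      eq : ((C (suc k) + C k) + ι k * t) + (t - ι 2 * (s * S (suc k))) ≈ (C (suc (suc k)) + C (suc k)) + ι (suc k) * t
      eq = trans (+-congʳ (+-congʳ (+-congˡ C-back))) (trans (solve 6 (λ C₁ S₁ c s i t → ((C₁ :+ (C₁ :* c :+ S₁ :* s)) :+ i :* t) :+ (t :- (:1 :+ :1) :* (s :* S₁)) := (C₁ :* c :- S₁ :* s :+ C₁) :+ (:1 :+ i) :* t) refl (C (suc k)) (S (suc k)) c s (ι k) t) (+-congˡ (*-congʳ (sym (ι-suc k)))))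
      neg : t - ι 2 * (s * S (suc k)) ≤ 0#
      neg = ≤-resp refl (-‿inverseʳ (ι 2 * (s * S (suc k)))) (+-mono (*-monoˡ (ι 2) (ι-nonneg 2) (*-monoˡ s 0≤s (h (suc k) (ℕ.s≤s ℕ.z≤n) ℕₚ.≤-refl))) ≤-refl)

    abstract
      -- The first power whose sine is below s; the angle is then within about one step of π.
      -- Otherwise `C-descent` and cosines above -1 would give k s² ≤ 2, contrary to Ms ≥ 1 when k =
      -- 2M² + 1.
      half-turn : Σ ℕ λ j → (¬ s ≤ S (suc j)) × (∀ i → i ℕ.< j → s ≤ S (suc i))
      half-turn = first-failure (λ i → s ≤? S (suc i)) k λ h → ℕₚ.<⇒≱ (ℕₚ.n<1+n (2 ℕ.* (M ℕ.* M))) (reflect {k} {2 ℕ.* (M ℕ.* M)} (bound h))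
        where
        k : ℕ
        k = suc (2 ℕ.* (M ℕ.* M))
        bound : (∀ i → i ℕ.< k → s ≤ S (suc i)) → ι k ≤ ι (2 ℕ.* (M ℕ.* M))
        bound h = ≤-trans (≤-resp (*-identityʳ _) refl (*-monoˡ (ι k) (ι-nonneg k) (≤-resp (*-identityˡ 1#) refl (sq-mono 0≤1 1≤Ms))))
          (≤-resp (solve 3 (λ k m s → (k :* (s :* s)) :* (m :* m) := k :* ((m :* s) :* (m :* s))) refl (ι k) (ι M) s) (sym (trans (ι-* 2 (M ℕ.* M)) (*-congˡ (ι-* M M))))
            (*-monoʳ (ι M * ι M) (sq-nonneg (ι M)) ks²≤2))
          where
          hyp : ∀ i → 1 ℕ.≤ i → i ℕ.≤ k → s ≤ S i
          hyp (suc i) _ l = h i l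
          ks²≤2 : ι k * (s * s) ≤ ι 2
          ks²≤2 = cancel 1 (0≤y-x⁻ (≤-resp refl (solve 4 (λ a b i q → ((:1 :+ :1) :- ((a :+ b) :+ i :* ((:1 :+ :1) :* q))) :+ ((a :- (:- :1)) :+ (b :- (:- :1))) := (:1 :+ :1) :* (:1 :+ :1) :- (:1 :+ :1) :* (i :* q)) refl (C (suc k)) (C k) (ι k) (s * s)) (≤-resp refl refl
            (+-nonneg (0≤y-x (C-descent k hyp)) (+-nonneg (0≤y-x (-1≤C (suc k))) (0≤y-x (-1≤C k)))))) )

    j J : ℕ
    j = proj₁ half-turn
    J = suc j

    before : ∀ i → 1 ℕ.≤ i → i ℕ.< J → s ≤ S i
    before (suc i) _ (ℕ.s≤s l) = proj₂ (proj₂ half-turn) i l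

    1≤j : 1 ℕ.≤ j
    1≤j = ℕₚ.n≢0⇒n>0 λ e → proj₁ (proj₂ half-turn) (≤-resp (S-1) (reflexive (cong (λ z → S (suc z)) (≡.sym e))) ≤-refl)

    s≤1 : s ≤ 1#
    s≤1 = ≤-resp S-1 refl (S≤1 1)

    SJ≤s : S J ≤ s
    SJ≤s with ≤-total (S J) s
    ... | inj₁ l = l
    ... | inj₂ l = contradiction l (proj₁ (proj₂ half-turn))

    Sj≥s : s ≤ S j
    Sj≥s = before j 1≤j (ℕₚ.n<1+n j)

    -s≤SJ : - s ≤ S J
    -s≤SJ = ≤-resp (solve 1 (λ s → :0 :+ (:- :1) :* s := :- s) refl s) refl (+-mono (*-nonneg (≤-trans 0≤s Sj≥s) 0≤c) (*-monoʳ s 0≤s (-1≤C j)))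

    CJ≤0 : C J ≤ 0#
    CJ≤0 = 0≤y-x⁻ (≤-resp refl (sym (+-identityˡ _)) (cancel-pos M 1≤Ms (≤-resp refl eq (0≤y-x (≤-trans SJc≤s Sj≥s)))))
      where
      eq : S j - S J * c ≈ s * - C J
      eq = trans (+-congʳ (trans (S-∸ j 1) (+-cong (*-cong (reflexive (cong S (ℕₚ.+-comm j 1))) C-1) (-‿cong (*-cong (reflexive (cong C (ℕₚ.+-comm j 1))) S-1))))) (solve 4 (λ S C c s → (S :* c :- C :* s) :- S :* c := s :* (:- C)) refl (S J) (C J) c s)
      SJc≤s : S J * c ≤ s
      SJc≤s with ≤-total 0# (S J)
      ... | inj₁ l = ≤-trans (≤-resp refl (*-identityʳ _) (*-monoˡ (S J) l c≤1)) SJ≤s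
      ... | inj₂ l = ≤-trans (≤-resp refl (zeroˡ c) (*-monoʳ c 0≤c l)) 0≤s

    -- Here (1 + C)(1 - C) = S² ≤ s², and 1 - C ≥ 1 because the cosine is no longer positive.
    1+CJ≤s² : 1# + C J ≤ s * s
    1+CJ≤s² = ≤-trans (≤-resp (*-identityʳ _) (trans (solve 2 (λ C S → (:1 :+ C) :* (:1 :- C) := S :* S :+ (:1 :- (C :* C :+ S :* S))) refl (C J) (S J)) (trans (+-congˡ (trans (+-congˡ (-‿cong (C²+S² J))) (-‿inverseʳ 1#))) (+-identityʳ _)))
        (*-monoˡ (1# + C J) 0≤1+C (≤-resp (+-identityʳ 1#) refl (+-mono (≤-refl {1#}) (≤-resp (solve 0 ((:- :0) := :0) refl) refl (neg-≤ CJ≤0))))))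
      (abs-* SJ≤s -s≤SJ SJ≤s -s≤SJ)
      where
      0≤1+C : 0# ≤ 1# + C J
      0≤1+C = ≤-resp (-‿inverseʳ 1#) refl (+-mono (≤-refl {1#}) (-1≤C J))

    module Roots (p : ℕ) .{{_ : ℕ.NonZero p}} (3≤p : 3 ℕ.≤ p) where

      abstract
        m r : ℕ
        m = J ℕ./ p
        r = J ℕ.% p

        J≡ : m ℕ.* p ℕ.+ r ≡ J
        J≡ = ≡.trans (ℕₚ.+-comm (m ℕ.* p) r) (≡.sym (DM.m≡m%n+[m/n]*n J p))

        r<p : r ℕ.< p
        r<p = DM.m%n<n J p

      mp≤J : m ℕ.* p ℕ.≤ J
      mp≤J = ℕₚ.≤-trans (ℕₚ.m≤m+n _ r) (ℕₚ.≤-reflexive J≡)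

      C-mp : C (m ℕ.* p) ≈ C J * C r + S J * S r
      C-mp = trans (C-∸ (m ℕ.* p) r) (reflexive (cong (λ z → C z * C r + S z * S r) J≡))

      S-mp : S (m ℕ.* p) ≈ S J * C r - C J * S r
      S-mp = trans (S-∸ (m ℕ.* p) r) (reflexive (cong (λ z → S z * C r - C z * S r) J≡))

      private
        rs-eq : s * 1# + 1# * (ι r * s) ≈ ι (suc r) * s
        rs-eq = trans (solve 2 (λ s i → s :* :1 :+ :1 :* (i :* s) := (:1 :+ i) :* s) refl s (ι r)) (*-congʳ (sym (ι-suc r)))
        M-rs : ι M * (ι (suc r) * s) ≤ ι (2 ℕ.* p)
        M-rs = ≤-resp (solve 3 (λ i m s → i :* (m :* s) := m :* (i :* s)) refl (ι (suc r)) (ι M) s) (trans (sym (ι-* p 2)) (reflexive (cong ι (ℕₚ.*-comm p 2)))) (*-mono (ι-nonneg (suc r)) (*-nonneg (ι-nonneg M) 0≤s) (ι-mono r<p) Ms≤2)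

      S-mp-upper : ι M * S (m ℕ.* p) ≤ ι (2 ℕ.* p)
      S-mp-upper = ≤-trans (*-monoˡ (ι M) (ι-nonneg M) (≤-resp (sym S-mp) rs-eq (+-mono (abs-* SJ≤s -s≤SJ (C≤1 r) (-1≤C r)) (≤-resp refl (solve 1 (λ x → :- (:- x) := x) refl _) (neg-≤ (abs-*' (C≤1 J) (-1≤C J) (proj₁ (S-bound r)) (proj₂ (S-bound r)))))))) M-rs

      S-mp-lower : ι M * - S (m ℕ.* p) ≤ ι (2 ℕ.* p)
      S-mp-lower = ≤-trans (*-monoˡ (ι M) (ι-nonneg M) (≤-resp (trans (solve 2 (λ a b → (:- a) :+ b := :- (a :- b)) refl (S J * C r) (C J * S r)) (-‿cong (sym S-mp))) rs-eq (+-mono (≤-resp refl (solve 1 (λ x → :- (:- x) := x) refl _) (neg-≤ (abs-*' SJ≤s -s≤SJ (C≤1 r) (-1≤C r)))) (abs-* (C≤1 J) (-1≤C J) (proj₁ (S-bound r)) (proj₂ (S-bound r)))))) M-rs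

      -- With J = m p + r, the power m p misses the half turn by fewer than p steps, each of size at
      -- most 2/M; its distance from -1 is therefore O(p/M).
      C-mp-upper : ι M * (1# + C (m ℕ.* p)) ≤ ι (2 ℕ.+ 6 ℕ.* p)
      C-mp-upper = ≤-trans (*-monoˡ (ι M) (ι-nonneg M) step₁) step₂
        where
        0≤1+C : 0# ≤ 1# + C J
        0≤1+C = ≤-resp (-‿inverseʳ 1#) refl (+-mono (≤-refl {1#}) (-1≤C J))
        step₁ : 1# + C (m ℕ.* p) ≤ (s * s) * 1# + (ι r * ((1# - c) + s) + s * (ι r * s))
        step₁ = ≤-resp (trans (solve 4 (λ a b d e → (:1 :+ a) :* b :+ ((:1 :- b) :+ d :* e) := :1 :+ (a :* b :+ d :* e)) refl (C J) (C r) (S J) (S r)) (+-congˡ (sym C-mp))) refl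
          (+-mono (≤-trans (*-monoˡ (1# + C J) 0≤1+C (C≤1 r)) (*-monoʳ 1# 0≤1 1+CJ≤s²)) (+-mono (C-bound r) (abs-* SJ≤s -s≤SJ (proj₁ (S-bound r)) (proj₂ (S-bound r)))))
        step₂ : ι M * ((s * s) * 1# + (ι r * ((1# - c) + s) + s * (ι r * s))) ≤ ι (2 ℕ.+ 6 ℕ.* p)
        step₂ = ≤-resp (solve 4 (λ m s i d → (m :* s) :* s :+ (i :* (m :* d :+ m :* s) :+ (m :* s) :* (i :* s)) := m :* ((s :* s) :* :1 :+ (i :* (d :+ s) :+ s :* (i :* s)))) refl (ι M) s (ι r) (1# - c))
          (trans (solve 1 (λ i → (:1 :+ :1) :* :1 :+ (i :* ((:1 :+ :1) :+ (:1 :+ :1)) :+ (:1 :+ :1) :* (i :* :1)) := (:1 :+ :1) :+ (:1 :+ (:1 :+ (:1 :+ (:1 :+ (:1 :+ :1))))) :* i) refl (ι p)) (sym (trans (ι-+ 2 (6 ℕ.* p)) (+-congˡ (ι-* 6 p)))))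
          (+-mono (*-mono (*-nonneg (ι-nonneg M) 0≤s) 0≤s Ms≤2 s≤1) (+-mono (*-mono (ι-nonneg r) (+-nonneg (*-nonneg (ι-nonneg M) (0≤y-x c≤1)) (*-nonneg (ι-nonneg M) 0≤s)) r≤p (+-mono M[1-c]≤2 Ms≤2))
            (*-mono (*-nonneg (ι-nonneg M) 0≤s) (*-nonneg (ι-nonneg r) 0≤s) Ms≤2 (*-mono (ι-nonneg r) 0≤s r≤p s≤1))))
          where
          r≤p = ι-mono (ℕₚ.<⇒≤ r<p)

      C-mp-lower : 0# ≤ 1# + C (m ℕ.* p)
      C-mp-lower = ≤-resp (-‿inverseʳ 1#) refl (+-mono (≤-refl {1#}) (-1≤C (m ℕ.* p)))

      S-nonneg : ∀ k → k ℕ.< p → 0# ≤ S (m ℕ.* k)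
      S-nonneg k k<p with (m ℕ.* k) ℕₚ.≟ 0
      -- The quotient m is 0 as long as J < p, that is, for coarse rotations.
      ... | yes e = ≤-reflexive (reflexive (cong S (≡.sym e)))
      ... | no ne = ≤-trans 0≤s (before (m ℕ.* k) (ℕₚ.n≢0⇒n>0 ne) (ℕₚ.<-≤-trans (ℕₚ.*-monoʳ-< m {{ℕ.≢-nonZero (λ e → ne (cong (ℕ._* k) e))}} k<p) mp≤J))

      -- As p ≥ 3, the power 2m still comes before the half turn. Its sine 2 S(m) C(m) is positive,
      -- and so is S(m).
      C-nonneg : 0# ≤ C (m ℕ.* 1)
      C-nonneg with m ℕₚ.≟ 0
      ... | yes e = ≤-trans 0≤1 (≤-reflexive (reflexive (cong (λ z → C (z ℕ.* 1)) (≡.sym e))))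
      ... | no ne = ≤-resp refl (reflexive (cong C (≡.sym (ℕₚ.*-identityʳ m)))) (cancel-≤ 1 {z = ι 2} (≤-resp refl (sym (*-identityˡ _)) (ι-mono {1} {2} (ℕ.s≤s ℕ.z≤n)))
          (≤-resp (sym (zeroʳ _)) refl (cancel-pos M {ι 2 * C m} {S m} (≤-trans 1≤Ms (*-monoˡ (ι M) (ι-nonneg M) (before m 1≤m (ℕₚ.<-≤-trans (ℕₚ.m<m+n m 1≤m) (ℕₚ.<⇒≤ 2m<J)))))
            (≤-resp refl (trans (S-+ m m) (solve 2 (λ s c → s :* c :+ c :* s := s :* ((:1 :+ :1) :* c)) refl (S m) (C m))) (≤-trans 0≤s (before (m ℕ.+ m) (ℕₚ.≤-trans 1≤m (ℕₚ.m≤m+n m m)) 2m<J))))))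
        where
        1≤m = ℕₚ.n≢0⇒n>0 ne
        2m<J : m ℕ.+ m ℕ.< J
        2m<J = ℕₚ.<-≤-trans (ℕₚ.m<m+n (m ℕ.+ m) 1≤m) (ℕₚ.≤-trans (ℕₚ.≤-reflexive (≡.trans (ℕₚ.+-assoc m m m) (≡.sym (≡.trans (ℕₚ.*-comm m 3) (cong (λ z → m ℕ.+ (m ℕ.+ z)) (ℕₚ.+-identityʳ m)))))) (ℕₚ.≤-trans (ℕₚ.*-monoʳ-≤ m 3≤p) mp≤J))

-- From an approximate half turn to trigonometric functions on the field

module _ where
 open import Data.Nat using (ℕ)
 open import Data.Nat.Primality using (Prime)
 open OrderedRings using (OrderedRing; module OrderedRingProperties)
 module HalfTurns (O : OrderedRing) (p : ℕ) where
  open import Data.Nat as ℕ using (zero; suc)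
  import Data.Nat.Properties as ℕₚ
  import Data.Nat.DivMod as DM
  open import Data.Fin using (toℕ)
  open import Data.Product using (Σ; _,_; proj₁; proj₂; _×_)
  open import Data.Sum using (inj₂)
  open import Relation.Nullary using (¬_; Dec; yes; no)
  open import Relation.Binary.PropositionalEquality as ≡ using (_≡_; cong)
  open OrderedRingProperties O
  open import Relation.Binary.Reasoning.Setoid setoid

  -- Vc k and Vs k play the roles of cos(πk/p) and sin(πk/p).
  record HalfTurn : Set where
    field
      Vc Vs : ℕ → Carrier
      Vc-0 : Vc 0 ≈ 1#
      Vs-0 : Vs 0 ≈ 0#
      Vc-+ : ∀ j k → Vc (j ℕ.+ k) ≈ Vc j * Vc k - Vs j * Vs k
      Vs-+ : ∀ j k → Vs (j ℕ.+ k) ≈ Vs j * Vc k + Vc j * Vs k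
      V-unit : ∀ k → Vc k * Vc k + Vs k * Vs k ≈ 1#
      Vs-p : Vs p ≈ 0#
      Vc-p : Vc p ≈ - 1#
      Vs-nonneg : ∀ k → k ℕ.< p → 0# ≤ Vs k
      Vc1-nonneg : 0# ≤ Vc 1
      Vc1≤1 : Vc 1 ≤ 1#

  module FromHalfTurn (pr : Prime p) (3≤p : 3 ℕ.≤ p) (H : HalfTurn) where
    open HalfTurn H
    open PrimeField p pr using (K; toℕ-[]; []-toℕ; []-+; p-nonZero)

    Vs-rec : ∀ k → Vs (suc (suc k)) + Vs k ≈ (Vc 1 + Vc 1) * Vs (suc k)
    Vs-rec k = begin
      Vs (suc (suc k)) + Vs k   ≈⟨ +-cong (trans (Vs-+ 1 (suc k)) (+-cong (*-congˡ (Vc-+ 1 k)) (*-congˡ (Vs-+ 1 k)))) (sym (*-identityˡ _)) ⟩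
      (Vs 1 * (Vc 1 * Vc k - Vs 1 * Vs k) + Vc 1 * (Vs 1 * Vc k + Vc 1 * Vs k)) + 1# * Vs k   ≈⟨ +-congˡ (*-congʳ (sym (V-unit 1))) ⟩
      (Vs 1 * (Vc 1 * Vc k - Vs 1 * Vs k) + Vc 1 * (Vs 1 * Vc k + Vc 1 * Vs k)) + (Vc 1 * Vc 1 + Vs 1 * Vs 1) * Vs k   ≈⟨ solve 4 (λ c s a b → (s :* (c :* a :- s :* b) :+ c :* (s :* a :+ c :* b)) :+ (c :* c :+ s :* s) :* b := (c :+ c) :* (s :* a :+ c :* b)) refl (Vc 1) (Vs 1) (Vc k) (Vs k) ⟩
      (Vc 1 + Vc 1) * (Vs 1 * Vc k + Vc 1 * Vs k)   ≈⟨ *-congˡ (Vs-+ 1 k) ⟨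
      (Vc 1 + Vc 1) * Vs (suc k) ∎

    -- Concavity of the sine on [0, π]: the second difference is a multiple of the middle value with
    -- factor 2 (Vc 1 - 1). It follows that `Vs k` divided by k decreases, which is `chord`.
    concave : ∀ k → suc k ℕ.< p → Vs (suc (suc k)) + Vs k ≤ Vs (suc k) + Vs (suc k)
    concave k h = ≤-resp (sym (Vs-rec k)) (solve 1 (λ x → (:1 :+ :1) :* x := x :+ x) refl (Vs (suc k))) (*-monoʳ (Vs (suc k)) (Vs-nonneg (suc k) h) (+-mono Vc1≤1 Vc1≤1))

    slope : ∀ k → k ℕ.< p → ι k * Vs (suc k) ≤ ι (suc k) * Vs k
    slope zero _ = ≤-reflexive (trans (zeroˡ _) (sym (trans (*-identityˡ _) Vs-0)))
    slope (suc k) h = 0≤y-x⁻ (≤-resp refl (trans (solve 4 (λ i a b d → (:1 :+ i) :* ((b :+ b) :- (a :+ d)) :+ ((:1 :+ i) :* d :- i :* b) := ((:1 :+ (:1 :+ i)) :* b) :- ((:1 :+ i) :* a)) refl (ι k) (Vs (suc (suc k))) (Vs (suc k)) (Vs k)) (sym (+-cong (*-congʳ (trans (ι-suc (suc k)) (+-congˡ (ι-suc k)))) (-‿cong (*-congʳ (ι-suc k))))))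
      (+-nonneg (*-nonneg (≤-resp refl (ι-suc k) (ι-nonneg (suc k))) (0≤y-x (concave k h))) (≤-resp refl (+-congʳ (*-congʳ (ι-suc k))) (0≤y-x (slope k (ℕₚ.<-trans (ℕₚ.n<1+n k) h))))))

    chord : ∀ x y → 1 ℕ.≤ x → x ℕ.≤ y → y ℕ.< p → ι x * Vs y ≤ ι y * Vs x
    chord x y 1≤x x≤y y<p = go (ℕₚ.≤⇒≤′ x≤y) y<p
      where
      go : ∀ {y} → x ℕ.≤′ y → y ℕ.< p → ι x * Vs y ≤ ι y * Vs x
      go ℕ.≤′-refl _ = ≤-refl
      go (ℕ.≤′-step {y} l) h = cancel⁺ y (ℕₚ.≤-trans 1≤x (ℕₚ.≤′⇒≤ l)) (≤-trans
        (≤-resp (solve 3 (λ x y v → x :* (y :* v) := y :* (x :* v)) refl (ι x) (ι y) (Vs (suc y))) (solve 3 (λ x y v → x :* (y :* v) := y :* (x :* v)) refl (ι x) (ι (suc y)) (Vs y)) (*-monoˡ (ι x) (ι-nonneg x) (slope y y<)))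
        (≤-resp refl (solve 3 (λ x y v → x :* (y :* v) := y :* (x :* v)) refl (ι (suc y)) (ι y) (Vs x)) (*-monoˡ (ι (suc y)) (ι-nonneg (suc y)) (go l y<))))
        where
        y< : y ℕ.< p
        y< = ℕₚ.<-trans (ℕₚ.n<1+n y) h

    mirror : ∀ k → k ℕ.≤ p → (Vs (p ℕ.∸ k) ≈ Vs k) × (Vc (p ℕ.∸ k) ≈ - Vc k)
    mirror k k≤p = trans (sym (trans (*-congˡ (V-unit k)) (*-identityʳ _))) (trans (solve 4 (λ X Y c s → X :* (c :* c :+ s :* s) := c :* (X :* c :+ Y :* s) :- s :* (Y :* c :- X :* s)) refl X Y (Vc k) (Vs k)) (trans (+-cong (*-congˡ es) (-‿cong (*-congˡ ec))) (solve 2 (λ c s → c :* :0 :- s :* (:- :1) := s) refl (Vc k) (Vs k)))) ,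
                   trans (sym (trans (*-congˡ (V-unit k)) (*-identityʳ _))) (trans (solve 4 (λ X Y c s → Y :* (c :* c :+ s :* s) := c :* (Y :* c :- X :* s) :+ s :* (X :* c :+ Y :* s)) refl X Y (Vc k) (Vs k)) (trans (+-cong (*-congˡ ec) (*-congˡ es)) (solve 2 (λ c s → c :* (:- :1) :+ s :* :0 := :- c) refl (Vc k) (Vs k))))
      where
      X = Vs (p ℕ.∸ k)
      Y = Vc (p ℕ.∸ k)
      e = ℕₚ.m∸n+n≡m k≤p
      es : X * Vc k + Y * Vs k ≈ 0#
      es = trans (sym (Vs-+ (p ℕ.∸ k) k)) (trans (reflexive (cong Vs e)) Vs-p)
      ec : Y * Vc k - X * Vs k ≈ - 1#
      ec = trans (sym (Vc-+ (p ℕ.∸ k) k)) (trans (reflexive (cong Vc e)) Vc-p)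

    odd : Σ ℕ λ y → suc (y ℕ.+ y) ≡ p
    odd = p ℕ./ 2 , ≡.trans (cong (λ z → suc z) (≡.trans (cong (p ℕ./ 2 ℕ.+_) (≡.sym (ℕₚ.+-identityʳ _))) (ℕₚ.*-comm 2 (p ℕ./ 2)))) (≡.trans (cong (ℕ._+ p ℕ./ 2 ℕ.* 2) (≡.sym r≡1)) (≡.sym (DM.m≡m%n+[m/n]*n p 2)))
      where
      open import Data.Nat.Divisibility using (m%n≡0⇒n∣m)
      open import Data.Nat.Primality using (prime⇒irreducible)
      not-even : ¬ p ℕ.% 2 ≡ 0
      not-even e with prime⇒irreducible pr (m%n≡0⇒n∣m p 2 e)
      ... | inj₂ 2≡p = ℕₚ.<⇒≢ (ℕₚ.<-≤-trans (ℕₚ.n<1+n 2) 3≤p) 2≡p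
      r≡1 : p ℕ.% 2 ≡ 1
      r≡1 = ℕₚ.≤-antisym (ℕₚ.≤-pred (DM.m%n<n p 2)) (ℕₚ.n≢0⇒n>0 not-even)

    private
      y = proj₁ odd
      p≡ = proj₂ odd

      y≤p : y ℕ.≤ p
      y≤p = ℕₚ.≤-trans (ℕₚ.m≤m+n y y) (ℕₚ.≤-trans (ℕₚ.n≤1+n _) (ℕₚ.≤-reflexive p≡))

      p∸y : p ℕ.∸ y ≡ suc y
      p∸y = ≡.trans (cong (ℕ._∸ y) (≡.sym p≡)) (ℕₚ.m+n∸n≡m (suc y) y)

      -- For y = (p - 1)/2 the angle πy/p is next to a right angle: 2 sin²(πy/p) = 1 + cos(π/p).
      mid : 1# ≤ Vs y * Vs y + Vs y * Vs y
      mid = ≤-resp (+-identityʳ 1#) eq (+-mono ≤-refl Vc1-nonneg)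
        where
        eq : 1# + Vc 1 ≈ Vs y * Vs y + Vs y * Vs y
        eq = begin
          1# + Vc 1    ≈⟨ +-cong (sym (V-unit y)) (sym (trans (*-congˡ (V-unit y)) (*-identityʳ _))) ⟩
          (Vc y * Vc y + Vs y * Vs y) + Vc 1 * (Vc y * Vc y + Vs y * Vs y)    ≈⟨ +-congˡ (trans (solve 4 (λ c s a b → c :* (a :* a :+ b :* b) := (c :* a :- s :* b) :* a :+ (s :* a :+ c :* b) :* b) refl (Vc 1) (Vs 1) (Vc y) (Vs y)) (+-cong (*-congʳ (trans (sym (Vc-+ 1 y)) (trans (reflexive (cong Vc (≡.sym p∸y))) (proj₂ (mirror y y≤p))))) (*-congʳ (trans (sym (Vs-+ 1 y)) (trans (reflexive (cong Vs (≡.sym p∸y))) (proj₁ (mirror y y≤p))))))) ⟩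
          (Vc y * Vc y + Vs y * Vs y) + (- Vc y * Vc y + Vs y * Vs y)    ≈⟨ solve 2 (λ a b → (a :* a :+ b :* b) :+ ((:- a) :* a :+ b :* b) := b :* b :+ b :* b) refl (Vc y) (Vs y) ⟩
          Vs y * Vs y + Vs y * Vs y ∎

      y<p : y ℕ.< p
      y<p = ℕₚ.≤-trans (ℕ.s≤s (ℕₚ.m≤m+n y y)) (ℕₚ.≤-reflexive p≡)

      -- Compares the sine with the chord up to y: y Vs(k) ≥ k Vs(y), where 2 Vs(y)² ≥ 1 and 2y ≤ p.
      sine-small : ∀ k → 1 ℕ.≤ k → k ℕ.≤ y → ι (2 ℕ.* (k ℕ.* k)) ≤ ι (p ℕ.* p) * (Vs k * Vs k)
      sine-small k 1≤k k≤y = ≤-trans (≤-trans (≤-resp (trans (solve 1 (λ k → (k :* k) :* (:1 :+ :1) := (:1 :+ :1) :* (k :* k)) refl (ι k)) (sym (trans (ι-* 2 (k ℕ.* k)) (*-congˡ (ι-* k k))))) (solve 2 (λ k v → (k :* k) :* ((v :* v :+ v :* v) :+ (v :* v :+ v :* v)) := ((:1 :+ :1) :* (:1 :+ :1)) :* ((k :* v) :* (k :* v))) refl (ι k) (Vs y))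
            (*-monoˡ (ι k * ι k) (sq-nonneg (ι k)) (+-mono mid mid)))
          (*-monoˡ ((1# + 1#) * (1# + 1#)) (sq-nonneg (1# + 1#)) (sq-mono (*-nonneg (ι-nonneg k) (Vs-nonneg y y<p)) (chord k y 1≤k k≤y y<p))))
        (≤-resp (trans (*-congʳ (trans (ι-* (y ℕ.+ y) (y ℕ.+ y)) (*-cong (ι-+ y y) (ι-+ y y)))) (solve 2 (λ y v → ((y :+ y) :* (y :+ y)) :* (v :* v) := ((:1 :+ :1) :* (:1 :+ :1)) :* ((y :* v) :* (y :* v))) refl (ι y) (Vs k))) refl
          (*-monoʳ (Vs k * Vs k) (sq-nonneg (Vs k)) (ι-mono (ℕₚ.*-mono-≤ 2y≤p 2y≤p))))
        where
        2y≤p : y ℕ.+ y ℕ.≤ p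
        2y≤p = ℕₚ.≤-trans (ℕₚ.n≤1+n _) (ℕₚ.≤-reflexive p≡)

      sine : ∀ h k → h ℕ.≤ k → k ℕ.+ h ℕ.≤ p → ι (2 ℕ.* (h ℕ.* h)) ≤ ι (p ℕ.* p) * (Vs k * Vs k)
      sine zero k _ _ = *-nonneg (ι-nonneg (p ℕ.* p)) (sq-nonneg (Vs k))
      sine h@(suc _) k h≤k k+h≤p = go (k ℕₚ.≤? y)
        where
        mono : ∀ {a} → h ℕ.≤ a → ι (2 ℕ.* (h ℕ.* h)) ≤ ι (2 ℕ.* (a ℕ.* a))
        mono l = ι-mono (ℕₚ.*-monoʳ-≤ 2 (ℕₚ.*-mono-≤ l l))
        go : Dec (k ℕ.≤ y) → ι (2 ℕ.* (h ℕ.* h)) ≤ ι (p ℕ.* p) * (Vs k * Vs k)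
        go (yes l) = ≤-trans (mono h≤k) (sine-small k (ℕₚ.≤-trans (ℕ.s≤s ℕ.z≤n) h≤k) l)
        go (no nl) = ≤-trans (mono h≤k') (≤-resp refl (*-congˡ (*-cong e e)) (sine-small k' (ℕₚ.≤-trans (ℕ.s≤s ℕ.z≤n) h≤k') k'≤y))
          where
          k' = p ℕ.∸ k
          k≤p : k ℕ.≤ p
          k≤p = ℕₚ.≤-trans (ℕₚ.m≤m+n k h) k+h≤p
          e = proj₁ (mirror k k≤p)
          h≤k' : h ℕ.≤ k'
          h≤k' = ℕₚ.≤-trans (ℕₚ.≤-reflexive (≡.sym (ℕₚ.m+n∸m≡n k h))) (ℕₚ.∸-monoˡ-≤ k k+h≤p)
          k'≤y : k' ℕ.≤ y
          k'≤y = ℕₚ.≤-trans (ℕₚ.∸-monoʳ-≤ p (ℕₚ.≰⇒> nl)) (ℕₚ.≤-reflexive (≡.trans (cong (ℕ._∸ suc y) (≡.sym p≡)) (ℕₚ.m+n∸m≡n (suc y) y)))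

      -- Doubled angles, that is, cosine and sine of 2πk/p. Starting from half angles makes 1 -
      -- wc(k) = 2 Vs(k)², so separation becomes a lower bound for a concave sine.
      wc ws : ℕ → Carrier
      wc k = Vc (k ℕ.+ k)
      ws k = Vs (k ℕ.+ k)

      dbl : ∀ j k → (j ℕ.+ k) ℕ.+ (j ℕ.+ k) ≡ (j ℕ.+ j) ℕ.+ (k ℕ.+ k)
      dbl j k = ℕ-solve 2 (λ j k → (j ℕ:+ k) ℕ:+ (j ℕ:+ k) ℕ:= (j ℕ:+ j) ℕ:+ (k ℕ:+ k)) ≡.refl j k
        where
        open import Data.Nat.Solver using (module +-*-Solver)
        open +-*-Solver using () renaming (solve to ℕ-solve; _:+_ to _ℕ:+_; _:=_ to _ℕ:=_)

      wc-+ : ∀ j k → wc (j ℕ.+ k) ≈ wc j * wc k - ws j * ws k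
      wc-+ j k = trans (reflexive (cong Vc (dbl j k))) (Vc-+ _ _)
      ws-+ : ∀ j k → ws (j ℕ.+ k) ≈ ws j * wc k + wc j * ws k
      ws-+ j k = trans (reflexive (cong Vs (dbl j k))) (Vs-+ _ _)

      wc-p : wc p ≈ 1#
      wc-p = trans (Vc-+ p p) (trans (+-cong (*-cong Vc-p Vc-p) (-‿cong (*-cong Vs-p Vs-p))) (solve 0 ((:- :1) :* (:- :1) :- :0 :* :0 := :1) refl))
      ws-p : ws p ≈ 0#
      ws-p = trans (Vs-+ p p) (trans (+-cong (*-cong Vs-p Vc-p) (*-cong Vc-p Vs-p)) (solve 0 (:0 :* (:- :1) :+ (:- :1) :* :0 := :0) refl))

      wc-period : ∀ q k → (wc (k ℕ.+ q ℕ.* p) ≈ wc k) × (ws (k ℕ.+ q ℕ.* p) ≈ ws k)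
      wc-period zero k = reflexive (cong wc (ℕₚ.+-identityʳ k)) , reflexive (cong ws (ℕₚ.+-identityʳ k))
      wc-period (suc q) k =
        trans (reflexive (cong wc e)) (trans (wc-+ (k ℕ.+ q ℕ.* p) p) (trans (+-cong (*-cong (proj₁ ih) wc-p) (-‿cong (*-cong (proj₂ ih) ws-p))) (solve 2 (λ a b → a :* :1 :- b :* :0 := a) refl (wc k) (ws k)))) ,
        trans (reflexive (cong ws e)) (trans (ws-+ (k ℕ.+ q ℕ.* p) p) (trans (+-cong (*-cong (proj₂ ih) wc-p) (*-cong (proj₁ ih) ws-p)) (solve 2 (λ a b → b :* :1 :+ a :* :0 := b) refl (wc k) (ws k))))
        where
        ih = wc-period q k
        e : k ℕ.+ (p ℕ.+ q ℕ.* p) ≡ k ℕ.+ q ℕ.* p ℕ.+ p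
        e = ≡.trans (cong (k ℕ.+_) (ℕₚ.+-comm p (q ℕ.* p))) (≡.sym (ℕₚ.+-assoc k (q ℕ.* p) p))

      w-mod : ∀ n → (wc (n ℕ.% p) ≈ wc n) × (ws (n ℕ.% p) ≈ ws n)
      w-mod n = trans (sym (proj₁ h)) (reflexive (cong wc e)) , trans (sym (proj₂ h)) (reflexive (cong ws e))
        where
        h = wc-period (n ℕ./ p) (n ℕ.% p)
        e = ≡.sym (DM.m≡m%n+[m/n]*n n p)

    open FourierAnalysis p pr O using (Trig)
    open PrimeField p pr using () renaming (_+_ to _⊕_; -_ to ⊖_; 0# to 𝟘; []-0 to []-𝟘; 0%p to 0%p≡0; -‿inverseʳ to ⊖-inverseʳ)

    private
      cK sK : K → Carrier
      cK x = wc (toℕ x)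
      sK x = ws (toℕ x)

      toℕ-⊕ : ∀ x z → toℕ (x ⊕ z) ≡ (toℕ x ℕ.+ toℕ z) ℕ.% p
      toℕ-⊕ x z = ≡.trans (cong toℕ (≡.sym (≡.trans ([]-+ (toℕ x) (toℕ z)) (≡.cong₂ _⊕_ ([]-toℕ x) ([]-toℕ z))))) (toℕ-[] _)

      toℕ-𝟘 : toℕ 𝟘 ≡ 0
      toℕ-𝟘 = ≡.trans (cong toℕ (≡.sym []-𝟘)) (≡.trans (toℕ-[] 0) 0%p≡0)

      c⊕ : ∀ x z → cK (x ⊕ z) ≈ cK x * cK z - sK x * sK z
      c⊕ x z = trans (reflexive (cong wc (toℕ-⊕ x z))) (trans (proj₁ (w-mod _)) (wc-+ (toℕ x) (toℕ z)))
      s⊕ : ∀ x z → sK (x ⊕ z) ≈ sK x * cK z + cK x * sK z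
      s⊕ x z = trans (reflexive (cong ws (toℕ-⊕ x z))) (trans (proj₂ (w-mod _)) (ws-+ (toℕ x) (toℕ z)))
      c𝟘 : cK 𝟘 ≈ 1#
      c𝟘 = trans (reflexive (cong wc toℕ-𝟘)) Vc-0
      s𝟘 : sK 𝟘 ≈ 0#
      s𝟘 = trans (reflexive (cong ws toℕ-𝟘)) Vs-0

      module _ (x : K) where
        c₀ = cK x
        s₀ = sK x
        c₁ = cK (⊖ x)
        s₁ = sK (⊖ x)
        u : c₀ * c₀ + s₀ * s₀ ≈ 1#
        u = V-unit (toℕ x ℕ.+ toℕ x)
        e₁ : c₀ * c₁ - s₀ * s₁ ≈ 1#
        e₁ = trans (sym (c⊕ x (⊖ x))) (trans (reflexive (cong cK (⊖-inverseʳ x))) c𝟘)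
        e₂ : s₀ * c₁ + c₀ * s₁ ≈ 0#
        e₂ = trans (sym (s⊕ x (⊖ x))) (trans (reflexive (cong sK (⊖-inverseʳ x))) s𝟘)
        c⊖ : c₁ ≈ c₀
        c⊖ = trans (sym (trans (*-congˡ u) (*-identityʳ _))) (trans (solve 4 (λ c s a b → a :* (c :* c :+ s :* s) := c :* (c :* a :- s :* b) :+ s :* (s :* a :+ c :* b)) refl c₀ s₀ c₁ s₁) (trans (+-cong (*-congˡ e₁) (*-congˡ e₂)) (solve 2 (λ c s → c :* :1 :+ s :* :0 := c) refl c₀ s₀)))
        s⊖ : s₁ ≈ - s₀
        s⊖ = trans (sym (trans (*-congˡ u) (*-identityʳ _))) (trans (solve 4 (λ c s a b → b :* (c :* c :+ s :* s) := c :* (s :* a :+ c :* b) :- s :* (c :* a :- s :* b)) refl c₀ s₀ c₁ s₁) (trans (+-cong (*-congˡ e₂) (-‿cong (*-congˡ e₁))) (solve 2 (λ c s → c :* :0 :- s :* :1 := :- s) refl c₀ s₀)))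

      sep : ∀ h x → h ℕ.≤ toℕ x → toℕ x ℕ.+ h ℕ.≤ p → ι (4 ℕ.* (h ℕ.* h)) ≤ ι (p ℕ.* p) * (1# - cK x)
      sep h x h≤ ≤p = ≤-resp (sym (trans (reflexive (cong ι (ℕₚ.*-assoc 2 2 (h ℕ.* h)))) (ι-* 2 (2 ℕ.* (h ℕ.* h)))))
        (trans (solve 2 (λ q v → (:1 :+ :1) :* (q :* (v :* v)) := q :* (v :* v :+ v :* v)) refl (ι (p ℕ.* p)) (Vs k)) (*-congˡ (sym eq)))
        (*-monoˡ (1# + 1#) (+-nonneg 0≤1 0≤1) (sine h k h≤ ≤p))
        where
        k = toℕ x
        eq : 1# - cK x ≈ Vs k * Vs k + Vs k * Vs k
        eq = trans (+-cong (sym (V-unit k)) (-‿cong (Vc-+ k k))) (solve 2 (λ a b → (a :* a :+ b :* b) :- (a :* a :- b :* b) := b :* b :+ b :* b) refl (Vc k) (Vs k))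

    trig : Trig
    trig = record { c = cK ; s = sK ; c-⊕ = c⊕ ; s-⊕ = s⊕ ; c-𝟘 = c𝟘 ; s-𝟘 = s𝟘 ; c-⊖ = c⊖ ; s-⊖ = s⊖ ; separated = sep }

-- Trigonometric functions with values in bounded rational sequences

module _ where
 open import Data.Nat using (ℕ)
 import Data.Nat as Nat
 open import Data.Nat.Primality using (Prime)
 open import Data.Product using (Σ)
 open import Data.Sum using (_⊎_)
 open import Relation.Nullary using (Dec)
 open OrderedRings using (OrderedRing)
 module Trigonometry (Q : OrderedRing) (≤-totalᵠ : ∀ x y → OrderedRing._≤_ Q x y ⊎ OrderedRing._≤_ Q y x) (≤?ᵠ : ∀ x y → Dec (OrderedRing._≤_ Q x y))
   (invᵠ : ∀ n → Σ (OrderedRing.Carrier Q) λ i → OrderedRing._≈_ Q (OrderedRing._*_ Q (OrderedRing.ι Q (Nat.suc n)) i) (OrderedRing.1# Q))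
   (p : ℕ) (pr : Prime p) (3≤p : 3 Nat.≤ p) where
  open import Data.Nat as ℕ using (suc)
  import Data.Nat.Properties as ℕₚ
  open import Data.Product using (_,_; proj₁; proj₂; _×_)
  open import Relation.Binary.PropositionalEquality using (cong)
  open OrderedRings using (module OrderedRingProperties)
  open Rotations Q using (module Rotation)
  open BoundedSequences Q ≤-totalᵠ using (Seq; _!_; bound; upper; lower; Seq-ordered; pointwise; pointwise≲; _≲_; N)
  open PrimeField p pr using (p-nonZero)
  private
    module Qp = OrderedRingProperties Q

  module Small (n : ℕ) where
    open OrderedRingProperties Q
    M : ℕ
    M = suc n
    -- The rational point ((M² - 1)/(M² + 1), 2M/(M² + 1)) of the unit circle; half of its angle has
    -- tangent 1/M.
    μ d i c s : Carrier
    μ = ι M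
    d = ι (suc (M ℕ.* M))
    i = proj₁ (invᵠ (M ℕ.* M))
    c = (μ * μ - 1#) * i
    s = (1# + 1#) * μ * i

    di : (1# + μ * μ) * i ≈ 1#
    di = trans (*-congʳ (sym (trans (ι-suc (M ℕ.* M)) (+-congˡ (ι-* M M))))) (proj₂ (invᵠ (M ℕ.* M)))

    1≤μ : 1# ≤ μ
    1≤μ = ι-mono {1} {M} (ℕ.s≤s ℕ.z≤n)

    1≤μμ : 1# ≤ μ * μ
    1≤μμ = ≤-resp (*-identityˡ 1#) refl (sq-mono 0≤1 1≤μ)

    0≤i : 0# ≤ i
    0≤i = cancel-pos 1 {i} {d} (≤-resp refl (sym (*-identityˡ d)) (ι-mono {1} {suc (M ℕ.* M)} (ℕ.s≤s ℕ.z≤n))) (≤-trans 0≤1 (≤-reflexive (sym (proj₂ (invᵠ (M ℕ.* M))))))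

    unit : c * c + s * s ≈ 1#
    unit = trans (solve 2 (λ m i → ((m :* m :- :1) :* i) :* ((m :* m :- :1) :* i) :+ ((:1 :+ :1) :* m :* i) :* ((:1 :+ :1) :* m :* i) := ((:1 :+ m :* m) :* i) :* ((:1 :+ m :* m) :* i)) refl μ i) (trans (*-cong di di) (*-identityˡ 1#))

    1-c : 1# - c ≈ (1# + 1#) * i
    1-c = trans (+-congʳ (sym di)) (solve 2 (λ m i → (:1 :+ m :* m) :* i :- (m :* m :- :1) :* i := (:1 :+ :1) :* i) refl μ i)

    0≤c : 0# ≤ c
    0≤c = *-nonneg (0≤y-x 1≤μμ) 0≤i

    c≤1 : c ≤ 1#
    c≤1 = 0≤y-x⁻ (≤-resp refl (sym 1-c) (*-nonneg (+-nonneg 0≤1 0≤1) 0≤i))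

    1≤Ms : 1# ≤ μ * s
    1≤Ms = ≤-resp di (solve 2 (λ m i → (m :* m :+ m :* m) :* i := m :* ((:1 :+ :1) :* m :* i)) refl μ i) (*-monoʳ i 0≤i (+-mono 1≤μμ ≤-refl))

    Ms≤2 : μ * s ≤ ι 2
    Ms≤2 = ≤-resp (solve 2 (λ m i → (:1 :+ :1) :* ((m :* m) :* i) := m :* ((:1 :+ :1) :* m :* i)) refl μ i) (trans (*-congˡ di) (*-identityʳ _)) (*-monoˡ (1# + 1#) (+-nonneg 0≤1 0≤1) (*-monoʳ i 0≤i (≤-resp (+-identityˡ _) refl (+-mono 0≤1 ≤-refl))))

    M[1-c]≤2 : μ * (1# - c) ≤ ι 2
    M[1-c]≤2 = ≤-resp (trans (solve 2 (λ m i → (:1 :+ :1) :* (m :* i) := m :* ((:1 :+ :1) :* i)) refl μ i) (*-congˡ (sym 1-c))) (trans (*-congˡ di) (*-identityʳ _)) (*-monoˡ (1# + 1#) (+-nonneg 0≤1 0≤1) (*-monoʳ i 0≤i (≤-trans (≤-resp (*-identityˡ μ) refl (*-monoʳ μ (≤-trans 0≤1 1≤μ) 1≤μ)) (≤-resp (+-identityˡ _) refl (+-mono 0≤1 ≤-refl)))))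

  module Rt (n : ℕ) where
    open Small n
    open Rotation ≤-totalᵠ ≤?ᵠ M c s unit 0≤c c≤1 1≤Ms Ms≤2 M[1-c]≤2 public
    open Roots p 3≤p public

  open OrderedRing Q using (Carrier; ι) renaming (_≤_ to _≤ᵠ_; _≈_ to _≈ᵠ_; _+_ to _+ᵠ_; _*_ to _*ᵠ_; -_ to -ᵠ_; _-_ to _-ᵠ_; 0# to 0ᵠ; 1# to 1ᵠ)

  abstract
    -- Opaque, so that comparing two such values never unfolds the search for the half turn.
    cc ss : ℕ → ℕ → Carrier
    cc n k = Rt.C n (Rt.m n ℕ.* k)
    ss n k = Rt.S n (Rt.m n ℕ.* k)

    cc-0 : ∀ n → cc n 0 ≈ᵠ 1ᵠ
    cc-0 n = Qp.reflexive (cong (Rt.C n) (ℕₚ.*-zeroʳ (Rt.m n)))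
    ss-0 : ∀ n → ss n 0 ≈ᵠ 0ᵠ
    ss-0 n = Qp.reflexive (cong (Rt.S n) (ℕₚ.*-zeroʳ (Rt.m n)))
    cc-+ : ∀ n j k → cc n (j ℕ.+ k) ≈ᵠ cc n j *ᵠ cc n k -ᵠ ss n j *ᵠ ss n k
    cc-+ n j k = Qp.trans (Qp.reflexive (cong (Rt.C n) (ℕₚ.*-distribˡ-+ (Rt.m n) j k))) (Rt.C-+ n (Rt.m n ℕ.* j) (Rt.m n ℕ.* k))
    ss-+ : ∀ n j k → ss n (j ℕ.+ k) ≈ᵠ ss n j *ᵠ cc n k +ᵠ cc n j *ᵠ ss n k
    ss-+ n j k = Qp.trans (Qp.reflexive (cong (Rt.S n) (ℕₚ.*-distribˡ-+ (Rt.m n) j k))) (Rt.S-+ n (Rt.m n ℕ.* j) (Rt.m n ℕ.* k))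
    cc²+ss² : ∀ n k → cc n k *ᵠ cc n k +ᵠ ss n k *ᵠ ss n k ≈ᵠ 1ᵠ
    cc²+ss² n k = Rt.C²+S² n (Rt.m n ℕ.* k)
    cc≤1 : ∀ n k → cc n k ≤ᵠ 1ᵠ
    cc≤1 n k = Rt.C≤1 n (Rt.m n ℕ.* k)
    -1≤cc : ∀ n k → -ᵠ 1ᵠ ≤ᵠ cc n k
    -1≤cc n k = Rt.-1≤C n (Rt.m n ℕ.* k)
    ss≤1 : ∀ n k → ss n k ≤ᵠ 1ᵠ
    ss≤1 n k = Rt.S≤1 n (Rt.m n ℕ.* k)
    -1≤ss : ∀ n k → -ᵠ 1ᵠ ≤ᵠ ss n k
    -1≤ss n k = Rt.-1≤S n (Rt.m n ℕ.* k)
    ss-p : ∀ n → (N n *ᵠ ss n p ≤ᵠ ι (2 ℕ.* p)) × (N n *ᵠ (-ᵠ ss n p) ≤ᵠ ι (2 ℕ.* p))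
    ss-p n = Rt.S-mp-upper n , Rt.S-mp-lower n
    cc-p : ∀ n → (N n *ᵠ (1ᵠ +ᵠ cc n p) ≤ᵠ ι (2 ℕ.+ 6 ℕ.* p)) × (0ᵠ ≤ᵠ 1ᵠ +ᵠ cc n p)
    cc-p n = Rt.C-mp-upper n , Rt.C-mp-lower n
    ss-nonneg : ∀ n k → k ℕ.< p → 0ᵠ ≤ᵠ ss n k
    ss-nonneg n k h = Rt.S-nonneg n k h
    cc-nonneg : ∀ n → 0ᵠ ≤ᵠ cc n 1
    cc-nonneg n = Rt.C-nonneg n

  open OrderedRing Seq-ordered using (_≈_; _+_; _*_; -_; _-_; 0#; 1#)
  open HalfTurns Seq-ordered p using (HalfTurn; module FromHalfTurn)
  open FourierAnalysis p pr Seq-ordered using (Trig)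

  Vc Vs : ℕ → Seq
  Vc k ! n = cc n k
  Vc k .bound = 1
  Vc k .upper n = cc≤1 n k
  Vc k .lower n = -1≤cc n k
  Vs k ! n = ss n k
  Vs k .bound = 1
  Vs k .upper n = ss≤1 n k
  Vs k .lower n = -1≤ss n k

  Vc-0 : Vc 0 ≈ 1#
  Vc-0 = pointwise {Vc 0} {1#} cc-0
  Vs-0 : Vs 0 ≈ 0#
  Vs-0 = pointwise {Vs 0} {0#} ss-0

  Vc-+ : ∀ j k → Vc (j ℕ.+ k) ≈ Vc j * Vc k - Vs j * Vs k
  Vc-+ j k = pointwise {Vc (j ℕ.+ k)} {Vc j * Vc k - Vs j * Vs k} (λ n → cc-+ n j k)
  Vs-+ : ∀ j k → Vs (j ℕ.+ k) ≈ Vs j * Vc k + Vc j * Vs k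
  Vs-+ j k = pointwise {Vs (j ℕ.+ k)} {Vs j * Vc k + Vc j * Vs k} (λ n → ss-+ n j k)

  V-unit : ∀ k → Vc k * Vc k + Vs k * Vs k ≈ 1#
  V-unit k = pointwise {Vc k * Vc k + Vs k * Vs k} {1#} (λ n → cc²+ss² n k)

  Vs-p : Vs p ≈ 0#
  Vs-p = (2 ℕ.* p , λ n → Qp.≤-resp (Qp.*-congˡ (Qp.solve 1 (λ x → x Qp.:= x Qp.:- Qp.:0) Qp.refl (ss n p))) Qp.refl (proj₁ (ss-p n))) ,
         (2 ℕ.* p , λ n → Qp.≤-resp (Qp.*-congˡ (Qp.solve 1 (λ x → Qp.:- x Qp.:= Qp.:0 Qp.:- x) Qp.refl (ss n p))) Qp.refl (proj₂ (ss-p n)))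

  Vc-p : Vc p ≈ - 1#
  Vc-p = (2 ℕ.+ 6 ℕ.* p , λ n → Qp.≤-resp (Qp.*-congˡ (Qp.solve 1 (λ x → Qp.:1 Qp.:+ x Qp.:= x Qp.:- (Qp.:- Qp.:1)) Qp.refl (cc n p))) Qp.refl (proj₁ (cc-p n))) ,
         pointwise≲ { - 1#} {Vc p} (λ n → Qp.0≤y-x⁻ (Qp.≤-resp Qp.refl (Qp.solve 1 (λ x → Qp.:1 Qp.:+ x Qp.:= x Qp.:- (Qp.:- Qp.:1)) Qp.refl (cc n p)) (proj₂ (cc-p n))))

  Vs-nonneg : ∀ k → k ℕ.< p → 0# ≲ Vs k
  Vs-nonneg k h = pointwise≲ {0#} {Vs k} (λ n → ss-nonneg n k h)

  Vc1-nonneg : 0# ≲ Vc 1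
  Vc1-nonneg = pointwise≲ {0#} {Vc 1} cc-nonneg

  Vc1≤1 : Vc 1 ≲ 1#
  Vc1≤1 = pointwise≲ {Vc 1} {1#} (λ n → cc≤1 n 1)

  half-turn : HalfTurn
  half-turn = record { Vc = Vc ; Vs = Vs ; Vc-0 = Vc-0 ; Vs-0 = Vs-0 ; Vc-+ = Vc-+ ; Vs-+ = Vs-+ ; V-unit = V-unit ; Vs-p = Vs-p ; Vc-p = Vc-p ; Vs-nonneg = Vs-nonneg ; Vc1-nonneg = Vc1-nonneg ; Vc1≤1 = Vc1≤1 }

  trig : Trig
  trig = FromHalfTurn.trig pr 3≤p half-turn

-- Fermat's theorem and the order of Γ

module _ where
 open import Data.Nat using (ℕ)
 open import Data.Nat.Primality using (Prime)
 module SubgroupOrder (p : ℕ) (pr : Prime p) where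
  open PrimeField p pr
  open NatSums
  open Fibres p pr
  open import Data.Nat as ℕ using (zero; suc; NonZero)
  import Data.Nat.Properties as ℕₚ
  open import Data.Nat.Divisibility using (_∣_; divides)
  open import Data.Fin as F using (Fin)
  open import Data.Fin.Permutation using (permutation)
  open import Relation.Nullary using (¬_; ¬?; Dec; yes; no; contradiction)
  open import Relation.Binary.PropositionalEquality using (_≡_; refl; cong; trans; sym; module ≡-Reasoning)
  import Algebra.Properties.CommutativeMonoid.Sum *-commutativeMonoid as Π

  abstract
    ∏ : ∀ {n} → (Fin n → K) → K
    ∏ = Π.sum

    ∏-cong : ∀ {n} {f g : Fin n → K} → (∀ i → f i ≡ g i) → ∏ f ≡ ∏ g
    ∏-cong = Π.sum-cong-≗

    ∏-* : ∀ {n} (f g : Fin n → K) → ∏ (λ i → f i * g i) ≡ ∏ f * ∏ g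
    ∏-* = Π.∑-distrib-+

    ∏-reindex : ∀ {n} (h : Fin n → K) (f g : Fin n → Fin n) → (∀ x → f (g x) ≡ x) → (∀ x → g (f x) ≡ x) → ∏ h ≡ ∏ (λ x → h (f x))
    ∏-reindex h f g fg gf = Π.sum-permute h (permutation f g (λ x → fg x) (λ x → gf x))

    ∏-≢0 : ∀ {n} {f : Fin n → K} → (∀ i → ¬ f i ≡ 0#) → ¬ ∏ f ≡ 0#
    ∏-≢0 {zero} h = 1≢0
    ∏-≢0 {suc n} h = *-≢0 (h F.zero) (∏-≢0 (λ i → h (F.suc i)))

    ∏-power : ∀ {n} {P : Fin n → Set} (P? : ∀ i → Dec (P i)) x → ∏ (λ i → x ^ 𝟙 (P? i)) ≡ x ^ ∑ (λ i → 𝟙 (P? i))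
    ∏-power {zero} P? x = cong (x ^_) (sym (∑-zero (λ i → 𝟙 (P? i))))
    ∏-power {suc n} P? x = trans (cong (x ^ 𝟙 (P? F.zero) *_) (∏-power (λ i → P? (F.suc i)) x)) (trans (sym (^-homo-* x (𝟙 (P? F.zero)) _)) (cong (x ^_) (sym (∑-suc (λ i → 𝟙 (P? i))))))

  nonzero-count : ∑ (λ x → 𝟙 (¬? (0# ≟K x))) ≡ p ℕ.∸ 1
  nonzero-count = trans (sym (ℕₚ.m+n∸m≡n 1 _)) (cong (ℕ._∸ 1) (begin
    1 ℕ.+ ∑ (λ x → 𝟙 (¬? (0# ≟K x)))                        ≡⟨ cong (ℕ._+ ∑ (λ x → 𝟙 (¬? (0# ≟K x)))) (sym (∑-𝟙 0# (λ _ → 1))) ⟩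
    ∑ (λ x → 𝟙 (0# ≟K x) ℕ.* 1) ℕ.+ ∑ (λ x → 𝟙 (¬? (0# ≟K x)))  ≡⟨ sym (∑-+ (λ x → 𝟙 (0# ≟K x) ℕ.* 1) (λ x → 𝟙 (¬? (0# ≟K x)))) ⟩
    ∑ (λ x → 𝟙 (0# ≟K x) ℕ.* 1 ℕ.+ 𝟙 (¬? (0# ≟K x)))        ≡⟨ ∑-cong one ⟩
    ∑ {p} (λ _ → 1)                                         ≡⟨ ∑-const p 1 ⟩
    p ℕ.* 1                                                 ≡⟨ ℕₚ.*-identityʳ p ⟩
    p                                                       ∎))
    where
    open ≡-Reasoning
    one : ∀ x → 𝟙 (0# ≟K x) ℕ.* 1 ℕ.+ 𝟙 (¬? (0# ≟K x)) ≡ 1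
    one x with 0# ≟K x
    ... | yes _ = refl
    ... | no _ = refl

  -- The product of all nonzero elements is unchanged when each is multiplied by x. To index it by
  -- the whole field, `h` replaces 0 by 1 and `k` omits the factor x there.
  fermat : ∀ x → ¬ x ≡ 0# → x ^ (p ℕ.∸ 1) ≡ 1#
  fermat x x≢0 = trans (cong (x ^_) (sym nonzero-count)) (trans (sym (∏-power (λ y → ¬? (0# ≟K y)) x)) (*-cancelˡ (∏-≢0 h≢0) (begin
    ∏ h * ∏ k               ≡⟨ *-comm (∏ h) (∏ k) ⟩
    ∏ k * ∏ h               ≡⟨ sym (∏-* k h) ⟩
    ∏ (λ y → k y * h y)     ≡⟨ ∏-cong (λ y → sym (hx y)) ⟩
    ∏ (λ y → h (x * y))     ≡⟨ sym (∏-reindex h (x *_) ((x ⁻¹) *_) (λ y → trans (sym (*-assoc x (x ⁻¹) y)) (trans (cong (_* y) (inv-r x≢0)) (*-identityˡ y))) (λ y → trans (sym (*-assoc (x ⁻¹) x y)) (trans (cong (_* y) (inv-l x≢0)) (*-identityˡ y)))) ⟩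
    ∏ h                     ≡⟨ sym (*-identityʳ (∏ h)) ⟩
    ∏ h * 1#                ∎)))
    where
    open ≡-Reasoning
    h k : K → K
    h y with 0# ≟K y
    ... | yes _ = 1#
    ... | no _ = y
    k y = x ^ 𝟙 (¬? (0# ≟K y))
    h≢0 : ∀ y → ¬ h y ≡ 0#
    h≢0 y with 0# ≟K y
    ... | yes _ = 1≢0
    ... | no ne = λ e → ne (sym e)
    hx : ∀ y → h (x * y) ≡ k y * h y
    hx y with 0# ≟K y | 0# ≟K (x * y)
    ... | yes _ | yes _ = sym (*-identityˡ 1#)
    ... | no _ | no _ = cong (_* y) (sym (*-identityʳ x))
    ... | yes e | no ne = contradiction (trans (sym (zeroʳ x)) (cong (x *_) e)) ne
    ... | no ne | yes e = contradiction (sym e) (*-≢0 x≢0 (λ q → ne (sym q)))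

  -- At most t by counting roots. Conversely p - 1 = k t, and x ↦ x^k sends all p - 1 nonzero
  -- elements into the subgroup while being at most k to one.
  subgroup-order : ∀ t .{{_ : NonZero t}} → t ∣ p ℕ.∸ 1 → ∑ (λ x → 𝟙 (x ^ t ≟K 1#)) ≡ t
  subgroup-order t (divides k e) = ℕₚ.≤-antisym (power-fibre t 1#) (ℕₚ.*-cancelˡ-≤ k (begin
    k ℕ.* t                         ≡⟨ sym e ⟩
    p ℕ.∸ 1                         ≡⟨ sym nonzero-count ⟩
    ∑ (λ x → 𝟙 (¬? (0# ≟K x)))      ≤⟨ ∑-mono (λ x → 𝟙-mono (¬? (0# ≟K x)) ((x ^ k) ^ t ≟K 1#) (λ ne → trans (^-assocʳ x k t) (trans (cong (x ^_) (sym e)) (fermat x (λ q → ne (sym q)))))) ⟩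
    ∑ (λ x → 𝟙 ((x ^ k) ^ t ≟K 1#)) ≤⟨ ∑-power k (λ y → 𝟙 (y ^ t ≟K 1#)) ⟩
    k ℕ.* ∑ (λ x → 𝟙 (x ^ t ≟K 1#)) ∎))
    where
    open ℕₚ.≤-Reasoning
    instance
      k≢0 : NonZero k
      k≢0 = ℕ.≢-nonZero λ { refl → ℕₚ.<⇒≢ (ℕₚ.m<n⇒0<n∸m 1<p) (sym e) }

-- The divisor bound

module Divisors where
 open import Data.Nat
 open import Data.Nat.Properties
 open import Data.Nat.Divisibility
 open import Data.Nat.DivMod using (m/n*n≤m; m≡m%n+[m/n]*n; m%n<n; _/_)
 open import Data.Nat.GCD using (gcd; gcd[m,n]∣m; gcd[m,n]∣n; gcd[m,n]≢0)
 open import Data.Nat.Coprimality using (coprime-divisor; Coprime)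
 open import Data.Nat.Primality using (Prime; prime?; ¬prime⇒composite; prime⇒irreducible; prime⇒nonZero; prime⇒nonTrivial)
 open import Data.Nat.Induction using (<-rec)
 open import Data.Fin as F using (Fin; toℕ; fromℕ<)
 import Data.Fin.Properties as Fₚ
 open import Data.Product using (Σ; _,_; _×_; proj₁; proj₂)
 open import Data.Sum using (_⊎_; inj₁; inj₂)
 open import Relation.Nullary using (Dec; yes; no; ¬_; contradiction)
 open import Relation.Binary.PropositionalEquality using (_≡_; refl; sym; trans; cong; cong₂; subst)
 open NatSums
 open import Data.Nat.Solver using (module +-*-Solver)
 open +-*-Solver using (solve; _:=_; _:*_)

 τ : ℕ → ℕ
 τ n = ∑ {n} (λ a → 𝟙 (suc (toℕ a) ∣? n))

 ∑-unique : ∀ {n} {P : Fin n → Set} (P? : ∀ i → Dec (P i)) → (∀ {i j} → P i → P j → i ≡ j) → ∑ (λ i → 𝟙 (P? i)) ≤ 1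
 ∑-unique {zero} P? u = ≤-trans (≤-reflexive (∑-zero _)) z≤n
 ∑-unique {suc n} {P} P? u = ≤-trans (≤-reflexive (∑-suc _)) (go (P? F.zero))
   where
   go : (d : Dec (P F.zero)) → 𝟙 d + ∑ (λ i → 𝟙 (P? (F.suc i))) ≤ 1
   go (yes q) = ≤-reflexive (cong (1 +_) (∑-0 (λ i → 𝟙-no (P? (F.suc i)) (λ q' → Fₚ.0≢1+n (u q q')))))
   go (no _) = ∑-unique (λ i → P? (F.suc i)) (λ a b → Fₚ.suc-injective (u a b))

 index : ∀ {d n} → 1 ≤ d → d ≤ n → Σ (Fin n) λ i → suc (toℕ i) ≡ d
 index {suc d} _ l = fromℕ< l , cong suc (Fₚ.toℕ-fromℕ< l)

 -- With g = gcd(m, d), the quotient d/g is coprime to m/g and divides (m/g) n, hence divides n.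
 divisor-split : ∀ m n d .{{_ : NonZero m}} → d ∣ m * n → Σ ℕ λ a → Σ ℕ λ b → (a ∣ m) × (b ∣ n) × (a * b ≡ d)
 divisor-split m n d d∣mn = g , quotient g∣d , gcd[m,n]∣m m d , coprime-divisor cop (subst (quotient g∣d ∣_) refl q∣) , sym (trans (_∣_.equality g∣d) (*-comm (quotient g∣d) g))
   where
   g = gcd m d
   g∣m = gcd[m,n]∣m m d
   g∣d = gcd[m,n]∣n m d
   instance
     g≢0 : NonZero g
     g≢0 = ≢-nonZero (gcd[m,n]≢0 m d (inj₁ (≢-nonZero⁻¹ m)))
   m' = quotient g∣m
   d' = quotient g∣d
   cop : Coprime d' m'
   cop {i} (i∣d' , i∣m') = ∣1⇒≡1 (*-cancelˡ-∣ g (subst (g * i ∣_) (sym (*-identityʳ g)) gi∣g))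
     where
     open import Data.Nat.GCD using (gcd-greatest)
     gi∣g : g * i ∣ g
     gi∣g = gcd-greatest (subst (g * i ∣_) (trans (*-comm g m') (sym (_∣_.equality g∣m))) (*-monoʳ-∣ g i∣m')) (subst (g * i ∣_) (trans (*-comm g d') (sym (_∣_.equality g∣d))) (*-monoʳ-∣ g i∣d'))
   q∣ : d' ∣ m' * n
   q∣ = *-cancelˡ-∣ g (subst (_∣ g * (m' * n)) (trans (_∣_.equality g∣d) (*-comm d' g)) (subst (d ∣_) (trans (cong (_* n) (_∣_.equality g∣m)) (trans (cong (_* n) (*-comm m' g)) (*-assoc g m' n))) d∣mn))

 -- Every divisor of m n is a product of a divisor of m and one of n, and such a pair determines the
 -- product.
 τ-* : ∀ m n .{{_ : NonZero m}} .{{_ : NonZero n}} → τ (m * n) ≤ τ m * τ n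
 τ-* m n = begin
   ∑ (λ d → 𝟙 (suc (toℕ d) ∣? m * n))   ≤⟨ ∑-mono cover ⟩
   ∑ (λ d → ∑ {m} (λ a → ∑ {n} (λ b → w a * v b * e d a b)))   ≡⟨ trans (∑-comm _) (∑-cong (λ a → ∑-comm _)) ⟩
   ∑ {m} (λ a → ∑ {n} (λ b → ∑ (λ d → w a * v b * e d a b)))   ≤⟨ ∑-mono (λ a → ∑-mono (λ b → ≤-trans (≤-reflexive (sym (*-∑ (w a * v b) _))) (≤-trans (*-monoʳ-≤ (w a * v b) (∑-unique (λ d → suc (toℕ a) * suc (toℕ b) ≟ suc (toℕ d)) (λ p q → Fₚ.toℕ-injective (suc-injective (trans (sym p) q))))) (≤-reflexive (*-identityʳ _))))) ⟩
   ∑ {m} (λ a → ∑ {n} (λ b → w a * v b))   ≡⟨ sym (∑-** w v) ⟩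
   τ m * τ n ∎
   where
   open ≤-Reasoning
   w : Fin m → ℕ
   w a = 𝟙 (suc (toℕ a) ∣? m)
   v : Fin n → ℕ
   v b = 𝟙 (suc (toℕ b) ∣? n)
   e : Fin (m * n) → Fin m → Fin n → ℕ
   e d a b = 𝟙 (suc (toℕ a) * suc (toℕ b) ≟ suc (toℕ d))
   cover : ∀ d → 𝟙 (suc (toℕ d) ∣? m * n) ≤ ∑ {m} (λ a → ∑ {n} (λ b → w a * v b * e d a b))
   cover d = go (suc (toℕ d) ∣? m * n)
     where
     go : (D : Dec (suc (toℕ d) ∣ m * n)) → 𝟙 D ≤ ∑ {m} (λ a → ∑ {n} (λ b → w a * v b * e d a b))
     go (no _) = z≤n
     go (yes h) with divisor-split m n (suc (toℕ d)) h
     ... | a , b , a∣m , b∣n , ab≡ = ≤-trans (≤-reflexive (sym one)) (≤-trans (term≤∑ (λ b → w i * v b * e d i b) j) (term≤∑ (λ a → ∑ {n} (λ b → w a * v b * e d a b)) i))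
       where
       1≤a : 1 ≤ a
       1≤a = n≢0⇒n>0 λ { refl → contradiction (0∣⇒≡0 a∣m) (≢-nonZero⁻¹ m) }
       1≤b : 1 ≤ b
       1≤b = n≢0⇒n>0 λ { refl → contradiction (0∣⇒≡0 b∣n) (≢-nonZero⁻¹ n) }
       ia = index 1≤a (∣⇒≤ a∣m)
       ib = index 1≤b (∣⇒≤ b∣n)
       i = proj₁ ia
       j = proj₁ ib
       one : w i * v j * e d i j ≡ 1
       one = cong₂ _*_ (cong₂ _*_ (𝟙-yes (suc (toℕ i) ∣? m) (subst (_∣ m) (sym (proj₂ ia)) a∣m)) (𝟙-yes (suc (toℕ j) ∣? n) (subst (_∣ n) (sym (proj₂ ib)) b∣n))) (𝟙-yes (suc (toℕ i) * suc (toℕ j) ≟ suc (toℕ d)) (trans (cong₂ _*_ (proj₂ ia) (proj₂ ib)) ab≡))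

 prime-power-divisor : ∀ q → Prime q → ∀ e d → d ∣ q ^ e → Σ ℕ λ i → (i ≤ e) × (q ^ i ≡ d)
 prime-power-divisor q pq zero d h = 0 , z≤n , sym (∣1⇒≡1 h)
 prime-power-divisor q pq (suc e) d h with q ∣? d
 ... | yes (divides d' refl) = let (i , i≤e , eq) = prime-power-divisor q pq e d' (*-cancelˡ-∣ q {{prime⇒nonZero pq}} (subst (_∣ q * q ^ e) (*-comm d' q) h)) in suc i , s≤s i≤e , trans (cong (q *_) eq) (*-comm q d')
 ... | no q∤d = let (i , i≤e , eq) = prime-power-divisor q pq e d (coprime-divisor (λ {i} (i∣d , i∣q) → cop i i∣d (prime⇒irreducible pq i∣q)) h) in i , m≤n⇒m≤1+n i≤e , eq
   where
   cop : ∀ i → i ∣ d → i ≡ 1 ⊎ i ≡ q → i ≡ 1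
   cop i i∣d (inj₁ e) = e
   cop i i∣d (inj₂ refl) = contradiction i∣d q∤d

 τ-prime-power : ∀ q → Prime q → ∀ e → τ (q ^ e) ≤ suc e
 τ-prime-power q pq e = begin
   ∑ (λ d → 𝟙 (suc (toℕ d) ∣? q ^ e))   ≤⟨ ∑-mono cover ⟩
   ∑ (λ d → ∑ {suc e} (λ i → 𝟙 (q ^ toℕ i ≟ suc (toℕ d))))   ≡⟨ ∑-comm _ ⟩
   ∑ {suc e} (λ i → ∑ (λ d → 𝟙 (q ^ toℕ i ≟ suc (toℕ d))))   ≤⟨ ∑-≤-const 1 (λ i → ∑-unique (λ d → q ^ toℕ i ≟ suc (toℕ d)) (λ p q → Fₚ.toℕ-injective (suc-injective (trans (sym p) q)))) ⟩
   suc e * 1   ≡⟨ *-identityʳ (suc e) ⟩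
   suc e ∎
   where
   open ≤-Reasoning
   cover : ∀ d → 𝟙 (suc (toℕ d) ∣? q ^ e) ≤ ∑ {suc e} (λ i → 𝟙 (q ^ toℕ i ≟ suc (toℕ d)))
   cover d = go (suc (toℕ d) ∣? q ^ e)
     where
     go : (D : Dec (suc (toℕ d) ∣ q ^ e)) → 𝟙 D ≤ ∑ {suc e} (λ i → 𝟙 (q ^ toℕ i ≟ suc (toℕ d)))
     go (no _) = z≤n
     go (yes h) = let (i , i≤e , eq) = prime-power-divisor q pq e (suc (toℕ d)) h ; k = fromℕ< (s≤s i≤e) in
       ≤-trans (≤-reflexive (sym (𝟙-yes (q ^ toℕ k ≟ suc (toℕ d)) (trans (cong (q ^_) (Fₚ.toℕ-fromℕ< (s≤s i≤e))) eq)))) (term≤∑ (λ i → 𝟙 (q ^ toℕ i ≟ suc (toℕ d))) k)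

 prime-divisor : ∀ n → 2 ≤ n → Σ ℕ λ q → Prime q × q ∣ n
 prime-divisor = <-rec _ λ n rec 2≤n → go n rec 2≤n (prime? n)
   where
   go : ∀ n → (∀ {m} → m < n → 2 ≤ m → Σ ℕ λ q → Prime q × q ∣ m) → 2 ≤ n → Dec (Prime n) → Σ ℕ λ q → Prime q × q ∣ n
   go n rec 2≤n (yes pn) = n , pn , ∣-refl
   go n rec 2≤n (no np) with ¬prime⇒composite {{n>1⇒nonTrivial 2≤n}} np
   ... | hasNonTrivialDivisor {divisor = d} d<n d∣n = let (q , pq , q∣d) = rec d<n (nonTrivial⇒n>1 d) in q , pq , ∣-trans q∣d d∣n

 suc≤2^ : ∀ e → suc e ≤ 2 ^ e
 suc≤2^ zero = ≤-refl
 suc≤2^ (suc e) = ≤-trans (+-mono-≤ (m^n>0 2 e) (suc≤2^ e)) (≤-reflexive (cong (2 ^ e +_) (sym (+-identityʳ _))))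

 ^-distribʳ-* : ∀ k a b → (a * b) ^ k ≡ a ^ k * b ^ k
 ^-distribʳ-* zero a b = refl
 ^-distribʳ-* (suc k) a b = trans (cong (a * b *_) (^-distribʳ-* k a b)) (solve 4 (λ a b x y → (a :* b) :* (x :* y) := (a :* x) :* (b :* y)) refl a b (a ^ k) (b ^ k))

 -- Division of e by k gives e + 1 ≤ k (q + 1) ≤ k 2^q with q k ≤ e; then take k-th powers.
 polynomial≤exponential : ∀ k .{{_ : NonZero k}} e → suc e ^ k ≤ k ^ k * 2 ^ e
 polynomial≤exponential k e = begin
   suc e ^ k              ≤⟨ ^-monoˡ-≤ k base ⟩
   (k * 2 ^ (e / k)) ^ k  ≡⟨ ^-distribʳ-* k k (2 ^ (e / k)) ⟩
   k ^ k * (2 ^ (e / k)) ^ k  ≡⟨ cong (k ^ k *_) (^-*-assoc 2 (e / k) k) ⟩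
   k ^ k * 2 ^ (e / k * k)    ≤⟨ *-monoʳ-≤ (k ^ k) (^-monoʳ-≤ 2 (m/n*n≤m e k)) ⟩
   k ^ k * 2 ^ e          ∎
   where
   open ≤-Reasoning
   base : suc e ≤ k * 2 ^ (e / k)
   base = begin
     suc e                        ≤⟨ s≤s (≤-reflexive (m≡m%n+[m/n]*n e k)) ⟩
     suc (e % k) + e / k * k      ≤⟨ +-monoˡ-≤ (e / k * k) (m%n<n e k) ⟩
     suc (e / k) * k              ≡⟨ *-comm (suc (e / k)) k ⟩
     k * suc (e / k)              ≤⟨ *-monoʳ-≤ k (suc≤2^ (e / k)) ⟩
     k * 2 ^ (e / k)              ∎

 extract : ∀ b → 2 ≤ b → ∀ n → 1 ≤ n → Σ ℕ λ e → Σ ℕ λ n' → (n ≡ b ^ e * n') × (1 ≤ n') × ¬ b ∣ n'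
 extract b 2≤b = <-rec _ λ n rec 1≤n → go n rec 1≤n (b ∣? n)
   where
   go : ∀ n → (∀ {m} → m < n → 1 ≤ m → Σ ℕ λ e → Σ ℕ λ n' → (m ≡ b ^ e * n') × (1 ≤ n') × ¬ b ∣ n') → 1 ≤ n → Dec (b ∣ n) → Σ ℕ λ e → Σ ℕ λ n' → (n ≡ b ^ e * n') × (1 ≤ n') × ¬ b ∣ n'
   go n rec 1≤n (no nd) = 0 , n , sym (+-identityʳ n) , 1≤n , nd
   go .(m * b) rec 1≤n (yes (divides m refl)) = let (e , n' , eq , 1≤n' , nd) = rec (m<m*n m b {{>-nonZero 1≤m}} 2≤b) 1≤m in
       suc e , n' , trans (*-comm m b) (trans (cong (b *_) eq) (sym (*-assoc b (b ^ e) n'))) , 1≤n' , nd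
     where
     1≤m : 1 ≤ m
     1≤m = n≢0⇒n>0 λ { refl → contradiction 1≤n λ () }

 τ-1 : τ 1 ≤ 1
 τ-1 = ≤-trans (∑-≤-const {1} 1 (λ a → 𝟙≤1 (suc (toℕ a) ∣? 1))) ≤-refl

 module _ (k : ℕ) .{{_ : NonZero k}} where

   Rough : ℕ → ℕ → Set
   Rough b n = ∀ q → Prime q → q ∣ n → b ≤ q

   -- Each prime factor multiplies τ by at most 2, hence its k-th power by at most 2^k, and n by at
   -- least b ≥ 2^k.
   rough-bound : ∀ b → 2 ^ k ≤ b → ∀ n → 1 ≤ n → Rough b n → τ n ^ k ≤ n
   rough-bound b 2ᵏ≤b = <-rec _ λ n rec 1≤n rough → go n rec 1≤n rough (n ≟ 1)
     where
     go : ∀ n → (∀ {m} → m < n → 1 ≤ m → Rough b m → τ m ^ k ≤ m) → 1 ≤ n → Rough b n → Dec (n ≡ 1) → τ n ^ k ≤ n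
     go n rec 1≤n rough (yes refl) = ≤-trans (^-monoˡ-≤ k τ-1) (≤-reflexive (^-zeroˡ k))
     go n rec 1≤n rough (no n≢1) with prime-divisor n (≤∧≢⇒< 1≤n (λ e → n≢1 (sym e)))
     ... | q , pq , divides m refl = begin
       τ (m * q) ^ k        ≤⟨ ^-monoˡ-≤ k (≤-trans (τ-* m q) (*-monoʳ-≤ (τ m) τq≤2)) ⟩
       (τ m * 2) ^ k        ≡⟨ ^-distribʳ-* k (τ m) 2 ⟩
       τ m ^ k * 2 ^ k      ≤⟨ *-mono-≤ (rec (m<m*n m q (nonTrivial⇒n>1 q {{prime⇒nonTrivial pq}})) (>-nonZero⁻¹ m) (λ q' pq' d → rough q' pq' (∣m⇒∣m*n q d))) (≤-trans 2ᵏ≤b (rough q pq (divides m refl))) ⟩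
       m * q                ∎
       where
       open ≤-Reasoning
       instance
         m≢0 : NonZero m
         m≢0 = ≢-nonZero λ { refl → contradiction 1≤n λ () }
         q≢0 : NonZero q
         q≢0 = prime⇒nonZero pq
       τq≤2 : τ q ≤ 2
       τq≤2 = subst (λ z → τ z ≤ 2) (*-identityʳ q) (τ-prime-power q pq 1)

   -- The powers of 2, 3, ... are removed from n one base at a time, at the cost of a factor k^k
   -- each, until only prime factors of size at least 2^k remain; f bounds the number of steps. A
   -- composite b is harmless, since it cannot divide n once the smaller primes are gone.
   divisor-bound′ : ∀ f b → 2 ≤ b → 2 ^ k ≤ b + f → ∀ n → 1 ≤ n → Rough b n → τ n ^ k ≤ (k ^ k) ^ f * n
   divisor-bound′ zero b 2≤b h n 1≤n rough = ≤-trans (rough-bound b (subst (2 ^ k ≤_) (+-identityʳ b) h) n 1≤n rough) (≤-reflexive (sym (+-identityʳ n)))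
   divisor-bound′ (suc f) b 2≤b h n 1≤n rough with extract b 2≤b n 1≤n
   ... | e , n' , refl , 1≤n' , nd = begin
     τ (b ^ e * n') ^ k            ≤⟨ ^-monoˡ-≤ k (τ-* (b ^ e) n') ⟩
     (τ (b ^ e) * τ n') ^ k        ≡⟨ ^-distribʳ-* k (τ (b ^ e)) (τ n') ⟩
     τ (b ^ e) ^ k * τ n' ^ k      ≤⟨ *-mono-≤ small (divisor-bound′ f (suc b) (m≤n⇒m≤1+n 2≤b) (≤-trans h (≤-reflexive (+-suc b f))) n' 1≤n' rough') ⟩
     (k ^ k * b ^ e) * ((k ^ k) ^ f * n')   ≡⟨ solve 4 (λ c x y z → (c :* x) :* (y :* z) := (c :* y) :* (x :* z)) refl (k ^ k) (b ^ e) ((k ^ k) ^ f) n' ⟩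
     (k ^ k) ^ suc f * (b ^ e * n')   ∎
     where
     open ≤-Reasoning
     instance
       b≢0 : NonZero b
       b≢0 = >-nonZero (≤-trans (s≤s z≤n) 2≤b)
       bᵉ≢0 : NonZero (b ^ e)
       bᵉ≢0 = m^n≢0 b e
       n'≢0 : NonZero n'
       n'≢0 = >-nonZero 1≤n'
     rough' : Rough (suc b) n'
     rough' q pq d = ≤∧≢⇒< (rough q pq (∣n⇒∣m*n (b ^ e) d)) λ { refl → nd d }
     b-prime : 1 ≤ e → Prime b
     b-prime 1≤e with prime-divisor b 2≤b
     ... | q , pq , q∣b = subst Prime (≤-antisym (∣⇒≤ q∣b) (rough q pq (∣-trans q∣b (∣-trans (m∣m^n b 1≤e) (m∣m*n n'))))) pq
       where
       m∣m^n : ∀ b {e} → 1 ≤ e → b ∣ b ^ e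
       m∣m^n b {suc e} _ = m∣m*n (b ^ e)
     τ≤ : ∀ e → (1 ≤ e → Prime b) → τ (b ^ e) ≤ suc e
     τ≤ zero _ = τ-1
     τ≤ (suc e) h = τ-prime-power b (h (s≤s z≤n)) (suc e)
     small : τ (b ^ e) ^ k ≤ k ^ k * b ^ e
     small = ≤-trans (^-monoˡ-≤ k (τ≤ e b-prime)) (≤-trans (polynomial≤exponential k e) (*-monoʳ-≤ (k ^ k) (^-monoˡ-≤ e 2≤b)))

   abstract
    divisor-bound : Σ ℕ λ C → ∀ n → 1 ≤ n → τ n ^ k ≤ C * n
    divisor-bound = (k ^ k) ^ (2 ^ k) , λ n 1≤n → divisor-bound′ (2 ^ k) 2 ≤-refl (m≤n+m (2 ^ k) 2) n 1≤n (λ q pq _ → nonTrivial⇒n>1 q {{prime⇒nonTrivial pq}})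

-- Multiplicative coincidences among small integers

module _ where
 open import Data.Nat
 open import Relation.Nullary using (Dec; yes; no)
 open Divisors using (τ; ∑-unique; index)
 module ProductSets (_~_ : ℕ → ℕ → Set) (_~?_ : ∀ m n → Dec (m ~ n)) (~-* : ∀ {k l m n} → k ~ l → m ~ n → (k * m) ~ (l * n))
   (D B : ℕ) (τ≤D : ∀ n → 1 ≤ n → n ≤ B → τ n ≤ D) where
  open NatSums
  open import Data.Nat.Properties
  open import Data.Nat.Divisibility
  open Arithmetic using (sq-cancel)
  open import Data.Nat.DivMod using (m≡m%n+[m/n]*n; m%n<n; m*n/n≡m; /-monoˡ-≤; m/n*n≤m; m/n≤m)
  open import Data.Nat.GCD using (gcd; gcd[m,n]∣m; gcd[m,n]∣n; gcd[m,n]≢0; gcd-greatest)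
  open import Data.Nat.Coprimality using (Coprime; coprime?)
  open import Data.Fin using (Fin; toℕ)
  import Data.Fin.Properties as Fₚ
  open import Data.Product using (Σ; _,_; _×_; proj₁; proj₂)
  open import Data.Sum using (inj₁)
  open import Relation.Nullary.Decidable using (_×-dec_)
  open import Relation.Binary.PropositionalEquality using (_≡_; refl; sym; trans; cong; cong₂; subst)
  open import Data.Nat.Solver using (module +-*-Solver)
  open +-*-Solver using (solve; _:=_; _:+_; _:*_; con)
  open ≤-Reasoning

  succ : ∀ {n} → Fin n → ℕ
  succ i = suc (toℕ i)

  succ-injective : ∀ {n k} {i j : Fin n} → succ i ≡ k → succ j ≡ k → i ≡ j
  succ-injective e e' = Fₚ.toℕ-injective (suc-injective (trans e (sym e')))

  ∑-succ≡≤1 : ∀ {n} k → ∑ {n} (λ i → 𝟙 (succ i ≟ k)) ≤ 1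
  ∑-succ≡≤1 k = ∑-unique (λ i → succ i ≟ k) succ-injective

  -- Evaluating f at a number in [1, n] is the same as summing f against the indicator of that number.
  ≤∑-succ : ∀ {n} k (f : ℕ → ℕ) → 1 ≤ k → k ≤ n → f k ≤ ∑ {n} (λ i → 𝟙 (succ i ≟ k) * f (succ i))
  ≤∑-succ {n} k f 1≤k k≤n = ≤-trans (≤-reflexive (sym (trans (cong₂ _*_ (𝟙-yes (succ i ≟ k) e) (cong f e)) (*-identityˡ (f k))))) (term≤∑ (λ i → 𝟙 (succ i ≟ k) * f (succ i)) i)
    where
    i = proj₁ (index 1≤k k≤n)
    e = proj₂ (index 1≤k k≤n)

  ∑-divisors≤τ : ∀ X n → 1 ≤ n → ∑ {X} (λ i → 𝟙 (succ i ∣? n)) ≤ τ n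
  ∑-divisors≤τ X n 1≤n = begin
    ∑ {X} (λ i → 𝟙 (succ i ∣? n))                                      ≤⟨ ∑-mono (λ i → cover i (succ i ∣? n)) ⟩
    ∑ {X} (λ i → ∑ {n} (λ a → 𝟙 (succ a ∣? n) * 𝟙 (succ i ≟ succ a)))   ≡⟨ ∑-comm _ ⟩
    ∑ {n} (λ a → ∑ {X} (λ i → 𝟙 (succ a ∣? n) * 𝟙 (succ i ≟ succ a)))   ≤⟨ ∑-mono (λ a → ≤-trans (≤-reflexive (sym (*-∑ (𝟙 (succ a ∣? n)) _))) (≤-trans (*-monoʳ-≤ (𝟙 (succ a ∣? n)) (∑-succ≡≤1 (succ a))) (≤-reflexive (*-identityʳ _)))) ⟩
    τ n ∎
    where
    cover : ∀ i (d : Dec (succ i ∣ n)) → 𝟙 d ≤ ∑ {n} (λ a → 𝟙 (succ a ∣? n) * 𝟙 (succ i ≟ succ a))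
    cover i (no _) = z≤n
    cover i (yes h) = let (a , e) = index (s≤s z≤n) (∣⇒≤ {{>-nonZero 1≤n}} h) in
      ≤-trans (≤-reflexive (sym (cong₂ _*_ (𝟙-yes (succ a ∣? n) (subst (_∣ n) (sym e) h)) (𝟙-yes (succ i ≟ succ a) (sym e))))) (term≤∑ (λ a → 𝟙 (succ a ∣? n) * 𝟙 (succ i ≟ succ a)) a)

  ∑-factorisations : ∀ X Y n → 1 ≤ n → n ≤ B → ∑ {X} (λ i → ∑ {Y} (λ j → 𝟙 (n ≟ succ i * succ j))) ≤ D
  ∑-factorisations X Y n 1≤n n≤B = ≤-trans (∑-mono (λ i → inner i (succ i ∣? n))) (≤-trans (∑-divisors≤τ X n 1≤n) (τ≤D n 1≤n n≤B))
    where
    inner : ∀ i (d : Dec (succ i ∣ n)) → ∑ {Y} (λ j → 𝟙 (n ≟ succ i * succ j)) ≤ 𝟙 d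
    inner i (yes _) = ∑-unique (λ j → n ≟ succ i * succ j) (λ {j} {j'} e e' → Fₚ.toℕ-injective (suc-injective (*-cancelˡ-≡ (succ j) (succ j') (succ i) (trans (sym e) e'))))
    inner i (no nd) = ≤-reflexive (∑-0 (λ j → 𝟙-no (n ≟ succ i * succ j) (λ e → nd (divides (succ j) (trans e (*-comm (succ i) (succ j)))))))

  -- Each n up to XY ≤ B is a product i j in at most τ(n) ≤ D ways.
  product-sum : ∀ X Y (f : ℕ → ℕ) → X * Y ≤ B → ∑ {X} (λ i → ∑ {Y} (λ j → f (succ i * succ j))) ≤ D * ∑ {X * Y} (λ n → f (succ n))
  product-sum X Y f h = begin
    ∑ {X} (λ i → ∑ {Y} (λ j → f (succ i * succ j)))   ≤⟨ ∑-mono (λ i → ∑-mono (λ j → ≤∑-succ (succ i * succ j) f (s≤s z≤n) (*-mono-≤ (Fₚ.toℕ<n i) (Fₚ.toℕ<n j)))) ⟩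
    ∑ {X} (λ i → ∑ {Y} (λ j → ∑ {X * Y} (λ n → e n i j * f (succ n))))   ≡⟨ trans (∑-cong (λ i → ∑-comm _)) (∑-comm _) ⟩
    ∑ {X * Y} (λ n → ∑ {X} (λ i → ∑ {Y} (λ j → e n i j * f (succ n))))   ≡⟨ ∑-cong (λ n → trans (∑-cong (λ i → sym (∑-* (e n i) (f (succ n))))) (sym (∑-* (λ i → ∑ (e n i)) (f (succ n))))) ⟩
    ∑ {X * Y} (λ n → ∑ {X} (λ i → ∑ {Y} (e n i)) * f (succ n))   ≤⟨ ∑-mono (λ n → *-monoˡ-≤ (f (succ n)) (∑-factorisations X Y (succ n) (s≤s z≤n) (≤-trans (Fₚ.toℕ<n n) h))) ⟩
    ∑ {X * Y} (λ n → D * f (succ n))   ≡⟨ sym (*-∑ D _) ⟩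
    D * ∑ {X * Y} (λ n → f (succ n)) ∎
    where
    e : Fin (X * Y) → Fin X → Fin Y → ℕ
    e n i j = 𝟙 (succ n ≟ succ i * succ j)

  product-sum₂ : ∀ X Y (F : ℕ → ℕ → ℕ) → X * Y ≤ B →
    ∑ {X} (λ i → ∑ {Y} (λ j → ∑ {X} (λ i' → ∑ {Y} (λ j' → F (succ i * succ j) (succ i' * succ j'))))) ≤ D * D * ∑ {X * Y} (λ n → ∑ {X * Y} (λ n' → F (succ n) (succ n')))
  product-sum₂ X Y F h = begin
    ∑ {X} (λ i → ∑ {Y} (λ j → ∑ {X} (λ i' → ∑ {Y} (λ j' → F (succ i * succ j) (succ i' * succ j')))))   ≤⟨ product-sum X Y (λ n → ∑ {X} (λ i' → ∑ {Y} (λ j' → F n (succ i' * succ j')))) h ⟩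
    D * ∑ {X * Y} (λ n → ∑ {X} (λ i' → ∑ {Y} (λ j' → F (succ n) (succ i' * succ j'))))   ≤⟨ *-monoʳ-≤ D (∑-mono (λ n → product-sum X Y (F (succ n)) h)) ⟩
    D * ∑ {X * Y} (λ n → D * ∑ {X * Y} (λ n' → F (succ n) (succ n')))   ≡⟨ cong (D *_) (sym (*-∑ D _)) ⟩
    D * (D * ∑ {X * Y} (λ n → ∑ {X * Y} (λ n' → F (succ n) (succ n'))))   ≡⟨ sym (*-assoc D D _) ⟩
    D * D * ∑ {X * Y} (λ n → ∑ {X * Y} (λ n' → F (succ n) (succ n'))) ∎

  𝟙-*-× : ∀ {P Q R : Set} (d : Dec P) (e : Dec Q) (f : Dec R) → (P → Q → R) → 𝟙 d * 𝟙 e ≤ 𝟙 f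
  𝟙-*-× (yes x) (yes y) f h = ≤-reflexive (sym (𝟙-yes f (h x y)))
  𝟙-*-× (yes x) (no _) f h = z≤n
  𝟙-*-× (no _) e f h = z≤n

  w : ℕ → ℕ
  w X = ∑ {X} (λ i → ∑ {X} (λ j → 𝟙 (succ i ~? succ j)))

  -- Two coincidences multiply to a coincidence between products. A pair of products comes from at
  -- most D² quadruples.
  w-* : ∀ X Y → X * Y ≤ B → w X * w Y ≤ D * D * w (X * Y)
  w-* X Y h = begin
    w X * w Y   ≡⟨ ∑-** _ _ ⟩
    ∑ {X} (λ i → ∑ {Y} (λ j → ∑ {X} (λ i' → 𝟙 (succ i ~? succ i')) * ∑ {Y} (λ j' → 𝟙 (succ j ~? succ j'))))   ≡⟨ ∑-cong (λ i → ∑-cong (λ j → ∑-** _ _)) ⟩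
    ∑ {X} (λ i → ∑ {Y} (λ j → ∑ {X} (λ i' → ∑ {Y} (λ j' → 𝟙 (succ i ~? succ i') * 𝟙 (succ j ~? succ j')))))   ≤⟨ ∑-mono (λ i → ∑-mono (λ j → ∑-mono (λ i' → ∑-mono (λ j' → 𝟙-*-× (succ i ~? succ i') (succ j ~? succ j') ((succ i * succ j) ~? (succ i' * succ j')) (~-* {succ i} {succ i'} {succ j} {succ j'}))))) ⟩
    ∑ {X} (λ i → ∑ {Y} (λ j → ∑ {X} (λ i' → ∑ {Y} (λ j' → 𝟙 ((succ i * succ j) ~? (succ i' * succ j'))))))   ≤⟨ product-sum₂ X Y (λ m n → 𝟙 (m ~? n)) h ⟩
    D * D * w (X * Y) ∎

  coprime~? : ∀ x y → Dec (Coprime x y × (x ~ y))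
  coprime~? x y = coprime? x y ×-dec (x ~? y)

  a : ℕ → ℕ
  a X = ∑ {X} (λ x → ∑ {X} (λ y → 𝟙 (coprime~? (succ x) (succ y))))

  a≤w : ∀ X → a X ≤ w X
  a≤w X = ∑-mono (λ x → ∑-mono (λ y → 𝟙-mono (coprime~? (succ x) (succ y)) (succ x ~? succ y) proj₂))

  w≤square : ∀ X → w X ≤ X * X
  w≤square X = ∑-≤-const X (λ x → ≤-trans (∑-≤-const 1 (λ y → 𝟙≤1 (succ x ~? succ y))) (≤-reflexive (*-identityʳ X)))

  reduce : ∀ m n → 1 ≤ m → Σ ℕ λ g → Σ ℕ λ x → Σ ℕ λ y → (m ≡ g * x) × (n ≡ g * y) × Coprime x y
  reduce m n 1≤m = g , x , y , eqm , eqn , cop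
    where
    g = gcd m n
    g∣m = gcd[m,n]∣m m n
    g∣n = gcd[m,n]∣n m n
    x = quotient g∣m
    y = quotient g∣n
    instance
      g≢0 : NonZero g
      g≢0 = ≢-nonZero (gcd[m,n]≢0 m n (inj₁ (>⇒≢ 1≤m)))
    eqm : m ≡ g * x
    eqm = trans (_∣_.equality g∣m) (*-comm x g)
    eqn : n ≡ g * y
    eqn = trans (_∣_.equality g∣n) (*-comm y g)
    cop : Coprime x y
    cop {i} (i∣x , i∣y) = ∣1⇒≡1 (*-cancelˡ-∣ g (subst (g * i ∣_) (sym (*-identityʳ g)) (gcd-greatest (subst (g * i ∣_) (sym eqm) (*-monoʳ-∣ g i∣x)) (subst (g * i ∣_) (sym eqn) (*-monoʳ-∣ g i∣y)))))

  -- Every related pair is g times a related coprime pair, g being the greatest common divisor; both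
  -- members of the coprime pair are at most Y/g.
  w≤∑a : ∀ Y → (∀ g x y → 1 ≤ g → g ≤ Y → (g * x) ~ (g * y) → x ~ y) → w Y ≤ ∑ {Y} (λ g → a (Y / succ g))
  w≤∑a Y cancel = begin
    w Y   ≤⟨ ∑-mono (λ m → ∑-mono (λ n → cover m n (succ m ~? succ n))) ⟩
    ∑ {Y} (λ m → ∑ {Y} (λ n → ∑ {Y} (λ g → ∑ {Y / succ g} (λ x → ∑ {Y / succ g} (λ y → term m n g x y)))))   ≡⟨ trans (∑-cong (λ m → ∑-comm _)) (∑-comm _) ⟩
    ∑ {Y} (λ g → ∑ {Y} (λ m → ∑ {Y} (λ n → ∑ {Y / succ g} (λ x → ∑ {Y / succ g} (λ y → term m n g x y)))))   ≤⟨ ∑-mono inner ⟩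
    ∑ {Y} (λ g → a (Y / succ g)) ∎
    where
    c : (g : Fin Y) (x y : Fin (Y / succ g)) → ℕ
    c g x y = 𝟙 (coprime~? (succ x) (succ y))
    term : Fin Y → Fin Y → (g : Fin Y) (x y : Fin (Y / succ g)) → ℕ
    term m n g x y = 𝟙 (succ m ≟ succ g * succ x) * (𝟙 (succ n ≟ succ g * succ y) * c g x y)
    inner : ∀ g → ∑ {Y} (λ m → ∑ {Y} (λ n → ∑ {Y / succ g} (λ x → ∑ {Y / succ g} (λ y → term m n g x y)))) ≤ a (Y / succ g)
    inner g = begin
      ∑ {Y} (λ m → ∑ {Y} (λ n → ∑ (λ x → ∑ (λ y → term m n g x y))))   ≡⟨ trans (∑-cong (λ m → trans (∑-comm _) (∑-cong (λ x → ∑-comm _)))) (trans (∑-comm _) (∑-cong (λ x → ∑-comm _))) ⟩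
      ∑ (λ x → ∑ (λ y → ∑ {Y} (λ m → ∑ {Y} (λ n → term m n g x y))))   ≡⟨ ∑-cong (λ x → ∑-cong (λ y → ∑-cong (λ m → trans (sym (*-∑ (𝟙 (succ m ≟ succ g * succ x)) _)) (cong (𝟙 (succ m ≟ succ g * succ x) *_) (sym (∑-* _ (c g x y))))))) ⟩
      ∑ (λ x → ∑ (λ y → ∑ {Y} (λ m → 𝟙 (succ m ≟ succ g * succ x) * (∑ {Y} (λ n → 𝟙 (succ n ≟ succ g * succ y)) * c g x y))))   ≡⟨ ∑-cong (λ x → ∑-cong (λ y → sym (∑-* _ _))) ⟩
      ∑ (λ x → ∑ (λ y → ∑ {Y} (λ m → 𝟙 (succ m ≟ succ g * succ x)) * (∑ {Y} (λ n → 𝟙 (succ n ≟ succ g * succ y)) * c g x y)))   ≤⟨ ∑-mono (λ x → ∑-mono (λ y → *-mono-≤ (∑-succ≡≤1 (succ g * succ x)) (*-monoˡ-≤ (c g x y) (∑-succ≡≤1 (succ g * succ y))))) ⟩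
      ∑ (λ x → ∑ (λ y → 1 * (1 * c g x y)))   ≡⟨ ∑-cong (λ x → ∑-cong (λ y → trans (*-identityˡ _) (*-identityˡ _))) ⟩
      a (Y / succ g) ∎
    cover : ∀ m n (d : Dec (succ m ~ succ n)) → 𝟙 d ≤ ∑ {Y} (λ g → ∑ {Y / succ g} (λ x → ∑ {Y / succ g} (λ y → term m n g x y)))
    cover m n (no _) = z≤n
    cover m n (yes m~n) = go (reduce (succ m) (succ n) (s≤s z≤n))
      where
      positive : ∀ {i} j k → suc i ≡ j * k → (1 ≤ j) × (1 ≤ k)
      positive zero k ()
      positive (suc j) zero e with trans e (*-zeroʳ (suc j))
      ... | ()
      positive (suc j) (suc k) e = s≤s z≤n , s≤s z≤n
      small : ∀ (i : Fin Y) (j : Fin Y) {k} → succ i ≡ succ j * k → k ≤ Y / succ j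
      small i j {k} e = subst (_≤ Y / succ j) (m*n/n≡m k (succ j)) (/-monoˡ-≤ (succ j) (≤-trans (≤-reflexive (trans (*-comm k (succ j)) (sym e))) (Fₚ.toℕ<n i)))
      go : (Σ ℕ λ g → Σ ℕ λ x → Σ ℕ λ y → (succ m ≡ g * x) × (succ n ≡ g * y) × Coprime x y) → 1 ≤ ∑ {Y} (λ g → ∑ {Y / succ g} (λ x → ∑ {Y / succ g} (λ y → term m n g x y)))
      go (g , x , y , em , en , cop) = finish (index 1≤g g≤Y)
        where
        1≤g = proj₁ (positive g x em)
        1≤x = proj₂ (positive g x em)
        1≤y = proj₂ (positive g y en)
        g≤Y : g ≤ Y
        g≤Y = ≤-trans (m≤m*n g x {{>-nonZero 1≤x}}) (≤-trans (≤-reflexive (sym em)) (Fₚ.toℕ<n m))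
        x~y : x ~ y
        x~y = cancel g x y 1≤g g≤Y (subst (_~ (g * y)) em (subst (succ m ~_) en m~n))
        finish : (Σ (Fin Y) λ i → succ i ≡ g) → 1 ≤ ∑ {Y} (λ g → ∑ {Y / succ g} (λ x → ∑ {Y / succ g} (λ y → term m n g x y)))
        finish (i , refl) = put (index 1≤x (small m i {x} em)) (index 1≤y (small n i {y} en))
          where
          put : (Σ (Fin (Y / succ i)) λ j → succ j ≡ x) → (Σ (Fin (Y / succ i)) λ j → succ j ≡ y) → 1 ≤ ∑ {Y} (λ g → ∑ {Y / succ g} (λ x → ∑ {Y / succ g} (λ y → term m n g x y)))
          put (j , refl) (k , refl) = begin
            1   ≡⟨ sym (cong₂ _*_ (𝟙-yes (succ m ≟ succ i * succ j) em) (cong₂ _*_ (𝟙-yes (succ n ≟ succ i * succ k) en) (𝟙-yes (coprime~? (succ j) (succ k)) (cop , x~y)))) ⟩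
            term m n i j k   ≤⟨ term≤∑ (λ y → term m n i j y) k ⟩
            ∑ (λ y → term m n i j y)   ≤⟨ term≤∑ (λ x → ∑ (λ y → term m n i x y)) j ⟩
            ∑ (λ x → ∑ (λ y → term m n i x y))   ≤⟨ term≤∑ (λ g → ∑ {Y / succ g} (λ x → ∑ {Y / succ g} (λ y → term m n g x y))) i ⟩
            ∑ {Y} (λ g → ∑ {Y / succ g} (λ x → ∑ {Y / succ g} (λ y → term m n g x y))) ∎

  ∑-initial-≥ : ∀ Z k → k ≤ Z → k ≤ ∑ {Z} (λ i → 𝟙 (succ i ≤? k))
  ∑-initial-≥ zero .zero z≤n = z≤n
  ∑-initial-≥ (suc Z) zero k≤ = z≤n
  ∑-initial-≥ (suc Z) (suc k) (s≤s k≤Z) = begin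
    1 + k   ≤⟨ +-mono-≤ (≤-reflexive (sym (𝟙-yes (1 ≤? suc k) (s≤s z≤n)))) (∑-initial-≥ Z k k≤Z) ⟩
    𝟙 (1 ≤? suc k) + ∑ {Z} (λ i → 𝟙 (succ i ≤? k))   ≤⟨ +-monoʳ-≤ (𝟙 (1 ≤? suc k)) (∑-mono (λ i → 𝟙-mono (succ i ≤? k) (suc (succ i) ≤? suc k) s≤s)) ⟩
    𝟙 (1 ≤? suc k) + ∑ {Z} (λ i → 𝟙 (suc (succ i) ≤? suc k))   ≡⟨ sym (∑-suc {Z} (λ i → 𝟙 (succ i ≤? suc k))) ⟩
    ∑ {suc Z} (λ i → 𝟙 (succ i ≤? suc k)) ∎

  ∑-initial-≤ : ∀ Z k → ∑ {Z} (λ i → 𝟙 (succ i ≤? k)) ≤ k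
  ∑-initial-≤ Z zero = ≤-reflexive (∑-0 (λ i → 𝟙-no (succ i ≤? 0) λ ()))
  ∑-initial-≤ zero (suc k) = ≤-trans (≤-reflexive (∑-zero _)) z≤n
  ∑-initial-≤ (suc Z) (suc k) = begin
    ∑ {suc Z} (λ i → 𝟙 (succ i ≤? suc k))   ≡⟨ ∑-suc {Z} (λ i → 𝟙 (succ i ≤? suc k)) ⟩
    𝟙 (1 ≤? suc k) + ∑ {Z} (λ i → 𝟙 (suc (succ i) ≤? suc k))   ≤⟨ +-mono-≤ (𝟙≤1 (1 ≤? suc k)) (∑-mono (λ i → 𝟙-mono (suc (succ i) ≤? suc k) (succ i ≤? k) s≤s⁻¹)) ⟩
    1 + ∑ {Z} (λ i → 𝟙 (succ i ≤? k))   ≤⟨ +-monoʳ-≤ 1 (∑-initial-≤ Z k) ⟩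
    1 + k ∎

  -- The left side counts the pairs (g, m) with g m ≤ Z.
  ∑-quotients : ∀ Z → Z * Z ≤ B → ∑ {Z} (λ g → Z / succ g) ≤ D * Z
  ∑-quotients Z h = begin
    ∑ {Z} (λ g → Z / succ g)   ≤⟨ ∑-mono (λ g → ∑-initial-≥ Z (Z / succ g) (m/n≤m Z (succ g))) ⟩
    ∑ {Z} (λ g → ∑ {Z} (λ m → 𝟙 (succ m ≤? Z / succ g)))   ≤⟨ ∑-mono (λ g → ∑-mono (λ m → 𝟙-mono (succ m ≤? Z / succ g) (succ g * succ m ≤? Z) (λ l → ≤-trans (≤-reflexive (*-comm (succ g) (succ m))) (≤-trans (*-monoˡ-≤ (succ g) l) (m/n*n≤m Z (succ g)))))) ⟩
    ∑ {Z} (λ g → ∑ {Z} (λ m → 𝟙 (succ g * succ m ≤? Z)))   ≤⟨ product-sum Z Z (λ n → 𝟙 (n ≤? Z)) h ⟩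
    D * ∑ {Z * Z} (λ n → 𝟙 (succ n ≤? Z))   ≤⟨ *-monoʳ-≤ D (∑-initial-≤ (Z * Z) Z) ⟩
    D * Z ∎

  module Bounds (p r : ℕ) (1≤p : 1 ≤ p) (1≤D : 1 ≤ D) (p²≤B : p * p ≤ B)
    (cancel : ∀ g x y → 1 ≤ g → g < p → (g * x) ~ (g * y) → x ~ y)
    (a-lattice : ∀ X → X < p → a X * p ≤ r * (p + 2 * (X * X))) where

    w-divide : ∀ Y → Y < p → w Y ≤ ∑ {Y} (λ g → a (Y / succ g))
    w-divide Y Y<p = w≤∑a Y (λ g x y 1≤g g≤Y → cancel g x y 1≤g (≤-<-trans g≤Y Y<p))

    -- For g ≤ G the lattice bound is used, for larger g the trivial bound q² with q = Y/g and q G ≤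
    -- Y. After division the estimate reads r G + 2 r D Y²/p + D Y²/G.
    w-split : ∀ Y G → Y < p → w Y * (G * p) ≤ G * (r * p * G) + (2 * r * G * Y + p * Y) * (D * Y)
    w-split Y G Y<p = begin
      w Y * (G * p)   ≤⟨ *-monoˡ-≤ (G * p) (w-divide Y Y<p) ⟩
      ∑ {Y} (λ g → a (Y / succ g)) * (G * p)   ≡⟨ ∑-* _ _ ⟩
      ∑ {Y} (λ g → a (Y / succ g) * (G * p))   ≤⟨ ∑-mono (λ g → each g (succ g ≤? G)) ⟩
      ∑ {Y} (λ g → 𝟙 (succ g ≤? G) * (r * p * G) + (2 * r * G * Y + p * Y) * (Y / succ g))   ≡⟨ trans (∑-+ _ _) (cong₂ _+_ (sym (∑-* _ _)) (sym (*-∑ (2 * r * G * Y + p * Y) (λ g → Y / succ g)))) ⟩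
      ∑ {Y} (λ g → 𝟙 (succ g ≤? G)) * (r * p * G) + (2 * r * G * Y + p * Y) * ∑ {Y} (λ g → Y / succ g)   ≤⟨ +-mono-≤ (*-monoˡ-≤ (r * p * G) (∑-initial-≤ Y G)) (*-monoʳ-≤ (2 * r * G * Y + p * Y) (∑-quotients Y (≤-trans (*-mono-≤ (<⇒≤ Y<p) (<⇒≤ Y<p)) p²≤B))) ⟩
      G * (r * p * G) + (2 * r * G * Y + p * Y) * (D * Y) ∎
      where
      few : ∀ q → q ≤ Y → a q * (G * p) ≤ 1 * (r * p * G) + (2 * r * G * Y + p * Y) * q
      few q q≤Y = begin
        a q * (G * p)   ≡⟨ solve 3 (λ a G p → a :* (G :* p) := a :* p :* G) refl (a q) G p ⟩
        a q * p * G     ≤⟨ *-monoˡ-≤ G (a-lattice q (≤-<-trans q≤Y Y<p)) ⟩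
        r * (p + 2 * (q * q)) * G   ≡⟨ solve 4 (λ r p q G → r :* (p :+ con 2 :* (q :* q)) :* G := con 1 :* (r :* p :* G) :+ con 2 :* r :* G :* q :* q) refl r p q G ⟩
        1 * (r * p * G) + 2 * r * G * q * q   ≤⟨ +-monoʳ-≤ (1 * (r * p * G)) (*-monoˡ-≤ q (≤-trans (*-monoʳ-≤ (2 * r * G) q≤Y) (m≤m+n (2 * r * G * Y) (p * Y)))) ⟩
        1 * (r * p * G) + (2 * r * G * Y + p * Y) * q ∎
      many : ∀ q → q * G ≤ Y → a q * (G * p) ≤ 0 * (r * p * G) + (2 * r * G * Y + p * Y) * q
      many q qG≤Y = begin
        a q * (G * p)   ≤⟨ *-monoˡ-≤ (G * p) (≤-trans (a≤w q) (w≤square q)) ⟩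
        q * q * (G * p)   ≡⟨ solve 3 (λ q G p → q :* q :* (G :* p) := p :* (q :* G) :* q) refl q G p ⟩
        p * (q * G) * q   ≤⟨ *-monoˡ-≤ q (≤-trans (*-monoʳ-≤ p qG≤Y) (m≤n+m (p * Y) (2 * r * G * Y))) ⟩
        (2 * r * G * Y + p * Y) * q ∎
      each : ∀ g (d : Dec (succ g ≤ G)) → a (Y / succ g) * (G * p) ≤ 𝟙 d * (r * p * G) + (2 * r * G * Y + p * Y) * (Y / succ g)
      each g (yes _) = few (Y / succ g) (m/n≤m Y (succ g))
      each g (no g≰G) = many (Y / succ g) (≤-trans (*-monoʳ-≤ (Y / succ g) (<⇒≤ (≰⇒> g≰G))) (m/n*n≤m Y (succ g)))

    module Exponents (d₀ E M : ℕ) (1≤E : 1 ≤ E) (d₀²<p : d₀ * d₀ < p) (M<p : M < p)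
      (h₁ : r ≤ d₀ * E) (h₂ : r * (d₀ * d₀) ≤ E * E * p) (h₃ : r * M ≤ E * p) (h₄ : r * 2 ≤ E * E * (E * E)) where

      -- The choice of G close to d²/E² makes all three terms of `w-split` at most D d² E² up to
      -- constants.
      w-square : ∀ d → d < d₀ → E ≤ d → ∀ G → d * d ≤ E * E * G → E * E * G ≤ d * d + E * E → 1 ≤ G → w (d * d) ≤ 4 * D * (d * d) * (E * E)
      w-square d d<d₀ E≤d G lo hi 1≤G = *-cancelʳ-≤ (w Y) (4 * D * Y * (E * E)) (G * p) {{>-nonZero (*-mono-≤ 1≤G 1≤p)}} (begin
        w Y * (G * p)   ≤⟨ w-split Y G Y<p ⟩
        G * (r * p * G) + (2 * r * G * Y + p * Y) * (D * Y)   ≡⟨ solve 5 (λ G r p Y D → G :* (r :* p :* G) :+ (con 2 :* r :* G :* Y :+ p :* Y) :* (D :* Y) := G :* p :* (r :* G) :+ con 2 :* D :* Y :* G :* (r :* Y) :+ D :* Y :* p :* Y) refl G r p Y D ⟩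
        G * p * (r * G) + 2 * D * Y * G * (r * Y) + D * Y * p * Y   ≤⟨ +-mono-≤ (+-mono-≤ (*-monoʳ-≤ (G * p) rG≤) (*-monoʳ-≤ (2 * D * Y * G) rY≤)) (*-monoʳ-≤ (D * Y * p) lo) ⟩
        G * p * (Y * (E * E)) + 2 * D * Y * G * (E * E * p) + D * Y * p * (E * E * G)   ≤⟨ +-monoˡ-≤ _ (+-monoˡ-≤ _ (≤-trans (≤-reflexive (sym (*-identityˡ _))) (*-monoˡ-≤ _ 1≤D))) ⟩
        D * (G * p * (Y * (E * E))) + 2 * D * Y * G * (E * E * p) + D * Y * p * (E * E * G)   ≡⟨ solve 5 (λ D G p Y E → D :* (G :* p :* (Y :* E)) :+ con 2 :* D :* Y :* G :* (E :* p) :+ D :* Y :* p :* (E :* G) := con 4 :* D :* Y :* E :* (G :* p)) refl D G p Y (E * E) ⟩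
        4 * D * Y * (E * E) * (G * p) ∎)
        where
        Y = d * d
        Y<p : Y < p
        Y<p = ≤-<-trans (*-mono-≤ (<⇒≤ d<d₀) (<⇒≤ d<d₀)) d₀²<p
        rY≤ : r * Y ≤ E * E * p
        rY≤ = ≤-trans (*-monoʳ-≤ r (*-mono-≤ (<⇒≤ d<d₀) (<⇒≤ d<d₀))) h₂
        rG≤ : r * G ≤ Y * (E * E)
        rG≤ = *-cancelˡ-≤ (E * E) {{>-nonZero (*-mono-≤ 1≤E 1≤E)}} (begin
          E * E * (r * G)   ≡⟨ solve 3 (λ e r G → e :* (r :* G) := r :* (e :* G)) refl (E * E) r G ⟩
          r * (E * E * G)   ≤⟨ *-monoʳ-≤ r (≤-trans hi (+-monoʳ-≤ Y (*-mono-≤ E≤d E≤d))) ⟩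
          r * (Y + Y)       ≡⟨ solve 2 (λ r Y → r :* (Y :+ Y) := r :* con 2 :* Y) refl r Y ⟩
          r * 2 * Y         ≤⟨ *-monoˡ-≤ Y h₄ ⟩
          E * E * (E * E) * Y   ≡⟨ solve 2 (λ e Y → e :* e :* Y := e :* (Y :* e)) refl (E * E) Y ⟩
          E * E * (Y * (E * E)) ∎)

      -- From d₀ on, the lattice bound r (1 + 2d²/p) is already of order E d; up to E the trivial
      -- bound d² is. In between, a(d)² ≤ w(d)² ≤ D² w(d²), and `w-square` controls the right side.
      a-bound : ∀ d → d ≤ M → a d ≤ 3 * (D * D) * E * d
      a-bound d d≤M = by-cases (d₀ ≤? d) (E ≤? d)
        where
        Goal = a d ≤ 3 * (D * D) * E * d
        enough : ∀ c → c ≤ 3 → a d ≤ c * (D * D) * E * d → Goal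
        enough c c≤3 h = ≤-trans h (*-monoˡ-≤ d (*-monoˡ-≤ E (*-monoˡ-≤ (D * D) c≤3)))
        1≤D² : ∀ c → c * E * d ≤ c * (D * D) * E * d
        1≤D² c = *-monoˡ-≤ d (*-monoˡ-≤ E (≤-trans (≤-reflexive (sym (*-identityʳ c))) (*-monoʳ-≤ c (*-mono-≤ 1≤D 1≤D))))
        large : d₀ ≤ d → Goal
        large d₀≤d = ≤-trans (*-cancelʳ-≤ (a d) (3 * E * d) p {{>-nonZero 1≤p}} (begin
          a d * p   ≤⟨ a-lattice d (≤-<-trans d≤M M<p) ⟩
          r * (p + 2 * (d * d))   ≡⟨ solve 3 (λ r p d → r :* (p :+ con 2 :* (d :* d)) := r :* p :+ con 2 :* (r :* d) :* d) refl r p d ⟩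
          r * p + 2 * (r * d) * d   ≤⟨ +-mono-≤ (*-monoˡ-≤ p (≤-trans h₁ (*-monoˡ-≤ E d₀≤d))) (*-monoˡ-≤ d (*-monoʳ-≤ 2 (≤-trans (*-monoʳ-≤ r d≤M) h₃))) ⟩
          d * E * p + 2 * (E * p) * d   ≡⟨ solve 3 (λ d E p → d :* E :* p :+ con 2 :* (E :* p) :* d := con 3 :* E :* d :* p) refl d E p ⟩
          3 * E * d * p ∎)) (1≤D² 3)
        tiny : d ≤ E → Goal
        tiny d≤E = enough 1 (s≤s z≤n) (≤-trans (≤-trans (a≤w d) (w≤square d)) (≤-trans (*-monoˡ-≤ d (≤-trans d≤E (≤-reflexive (sym (*-identityˡ E))))) (1≤D² 1)))
        medium : d < d₀ → E ≤ d → Goal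
        medium d<d₀ E≤d = enough 2 (s≤s (s≤s z≤n)) (sq-cancel (begin
          a d * a d   ≤⟨ *-mono-≤ (a≤w d) (a≤w d) ⟩
          w d * w d   ≤⟨ w-* d d (≤-trans (<⇒≤ (≤-<-trans (*-mono-≤ (<⇒≤ d<d₀) (<⇒≤ d<d₀)) d₀²<p)) (≤-trans (m≤m*n p p {{>-nonZero 1≤p}}) p²≤B)) ⟩
          D * D * w (d * d)   ≤⟨ *-monoʳ-≤ (D * D) (quot (d * d / (E * E)) (m≡m%n+[m/n]*n (d * d) (E * E)) (m%n<n (d * d) (E * E))) ⟩
          D * D * (4 * D * (d * d) * (E * E))   ≤⟨ ≤-trans (≤-reflexive (sym (*-identityˡ _))) (*-monoˡ-≤ _ 1≤D) ⟩
          D * (D * D * (4 * D * (d * d) * (E * E)))   ≡⟨ solve 3 (λ D E d → D :* (D :* D :* (con 4 :* D :* (d :* d) :* (E :* E))) := con 2 :* (D :* D) :* E :* d :* (con 2 :* (D :* D) :* E :* d)) refl D E d ⟩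
          2 * (D * D) * E * d * (2 * (D * D) * E * d) ∎))
          where
          instance
            E²≢0 : NonZero (E * E)
            E²≢0 = >-nonZero (*-mono-≤ 1≤E 1≤E)
          quot : ∀ q → d * d ≡ d * d % (E * E) + q * (E * E) → d * d % (E * E) < E * E → w (d * d) ≤ 4 * D * (d * d) * (E * E)
          quot q e l = w-square d d<d₀ E≤d (suc q)
            (≤-trans (≤-reflexive e) (≤-trans (+-monoˡ-≤ (q * (E * E)) (<⇒≤ l)) (≤-reflexive (*-comm (suc q) (E * E)))))
            (≤-trans (≤-reflexive (*-comm (E * E) (suc q))) (≤-trans (+-monoʳ-≤ (E * E) (m≤n+m (q * (E * E)) (d * d % (E * E)))) (≤-trans (≤-reflexive (cong (E * E +_) (sym e))) (≤-reflexive (+-comm (E * E) (d * d))))))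
            (s≤s z≤n)
        by-cases : Dec (d₀ ≤ d) → Dec (E ≤ d) → Goal
        by-cases (yes l) _ = large l
        by-cases (no l) (yes l') = medium (≰⇒> l) l'
        by-cases (no _) (no l') = tiny (<⇒≤ (≰⇒> l'))

      w-bound : w M ≤ 3 * (D * D) * E * (D * M)
      w-bound = begin
        w M   ≤⟨ w-divide M M<p ⟩
        ∑ {M} (λ g → a (M / succ g))   ≤⟨ ∑-mono (λ g → a-bound (M / succ g) (m/n≤m M (succ g))) ⟩
        ∑ {M} (λ g → 3 * (D * D) * E * (M / succ g))   ≡⟨ sym (*-∑ (3 * (D * D) * E) (λ g → M / succ g)) ⟩
        3 * (D * D) * E * ∑ {M} (λ g → M / succ g)   ≤⟨ *-monoʳ-≤ (3 * (D * D) * E) (∑-quotients M (≤-trans (*-mono-≤ (<⇒≤ M<p) (<⇒≤ M<p)) p²≤B)) ⟩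
        3 * (D * D) * E * (D * M) ∎

      -- The step from X to X³ makes the loss E in `w-bound` cost only its cube root.
      w-cube : ∀ X → X * X * X ≡ M → w X * w X * w X ≤ D * D * (D * D * (3 * (D * D) * E * (D * M)))
      w-cube X refl = begin
        w X * w X * w X   ≤⟨ *-monoˡ-≤ (w X) (w-* X X X²≤B) ⟩
        D * D * w (X * X) * w X   ≡⟨ *-assoc (D * D) _ _ ⟩
        D * D * (w (X * X) * w X)   ≤⟨ *-monoʳ-≤ (D * D) (w-* (X * X) X X³≤B) ⟩
        D * D * (D * D * w M)   ≤⟨ *-monoʳ-≤ (D * D) (*-monoʳ-≤ (D * D) w-bound) ⟩
        D * D * (D * D * (3 * (D * D) * E * (D * M))) ∎
        where
        X³≤B : X * X * X ≤ B
        X³≤B = ≤-trans (<⇒≤ M<p) (≤-trans (m≤m*n p p {{>-nonZero 1≤p}}) p²≤B)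
        X²≤B : X * X ≤ B
        X²≤B = ≤-trans (sq X) X³≤B
          where
          sq : ∀ X → X * X ≤ X * X * X
          sq zero = z≤n
          sq (suc X) = m≤m*n (suc X * suc X) (suc X)

-- Lattice points on lines x ≡ ρy

module _ where
 open import Data.Nat using (ℕ; NonZero)
 open import Data.Nat.Primality using (Prime)
 module LatticePoints (p : ℕ) (pr : Prime p) (r : ℕ) .{{_ : NonZero r}} where
  open PrimeField p pr
  open NatSums
  open Divisors using (∑-unique)
  open Fibres p pr using (power-fibre)
  open import Data.Nat as ℕ using (zero; suc; z≤n; s≤s; _≤_; _<_; _/_; _∸_)
  import Data.Nat.Properties as ℕₚ
  open ℕₚ using (≤-trans; ≤-reflexive; *-mono-≤; *-monoˡ-≤; *-monoʳ-≤)
  open import Data.Nat.Divisibility using (_∣_; ∣⇒≤; ∣m+n∣m⇒∣n; m∣m*n)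
  open import Data.Nat.DivMod using (m≡m%n+[m/n]*n; /-monoˡ-≤; m/n*n≤m)
  open import Data.Nat.Coprimality using (Coprime; coprime?; coprime-divisor)
  open import Data.Fin as F using (Fin; toℕ; fromℕ<)
  import Data.Fin.Properties as Fₚ
  open import Data.Product using (Σ; _,_; proj₁; proj₂; _×_; ∃)
  open import Data.Sum using (_⊎_; inj₁; inj₂)
  open import Relation.Nullary using (¬_; Dec; yes; no; contradiction)
  open import Relation.Nullary.Decidable using (_×-dec_)
  open import Relation.Binary.PropositionalEquality using (_≡_; refl; cong; cong₂; trans; sym; subst)
  open import Data.Nat.Solver using (module +-*-Solver)
  open +-*-Solver using (solve) renaming (_:=_ to _:≡_; _:+_ to _⊕_; _:*_ to _⊗_)
  open ℕₚ.≤-Reasoning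

  _·_ : ℕ → ℕ → ℕ
  _·_ = ℕ._*_
  infixl 7 _·_

  succ : ∀ {n} → Fin n → ℕ
  succ i = suc (toℕ i)

  ∑∑-unique : ∀ {m n} {R : Fin m → Fin n → Set} (R? : ∀ i j → Dec (R i j)) →
    (∀ {i j i' j'} → R i j → R i' j' → (i ≡ i') × (j ≡ j')) → ∑ (λ i → ∑ (λ j → 𝟙 (R? i j))) ≤ 1
  ∑∑-unique {R = R} R? u = ≤-trans (∑-mono (λ i → row i (Fₚ.any? (R? i)))) (∑-unique (λ i → Fₚ.any? (R? i)) (λ (_ , a) (_ , b) → proj₁ (u a b)))
    where
    row : ∀ i (d : Dec (∃ (R i))) → ∑ (λ j → 𝟙 (R? i j)) ≤ 𝟙 d
    row i (yes _) = ∑-unique (R? i) (λ a b → proj₂ (u a b))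
    row i (no h) = ≤-reflexive (∑-0 (λ j → 𝟙-no (R? i j) (λ q → h (j , q))))

  ∑∑-injection : ∀ {m n} {Q : Fin m → Fin n → Set} (Q? : ∀ i j → Dec (Q i j)) M (key : Fin m → Fin n → ℕ) →
    (∀ i j → Q i j → key i j < M) → (∀ {i j i' j'} → Q i j → Q i' j' → key i j ≡ key i' j' → (i ≡ i') × (j ≡ j')) → ∑ (λ i → ∑ (λ j → 𝟙 (Q? i j))) ≤ M
  ∑∑-injection {Q = Q} Q? M key bound inj = begin
    ∑ (λ i → ∑ (λ j → 𝟙 (Q? i j)))   ≤⟨ ∑-mono (λ i → ∑-mono (λ j → cover i j (Q? i j) refl)) ⟩
    ∑ (λ i → ∑ (λ j → ∑ {M} (λ k → 𝟙 (R? k i j))))   ≡⟨ trans (∑-cong (λ i → ∑-comm _)) (∑-comm _) ⟩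
    ∑ {M} (λ k → ∑ (λ i → ∑ (λ j → 𝟙 (R? k i j))))   ≤⟨ ∑-≤-const 1 (λ k → ∑∑-unique (R? k) (λ (q , e) (q' , e') → inj q q' (trans e (sym e')))) ⟩
    M · 1   ≡⟨ ℕₚ.*-identityʳ M ⟩
    M ∎
    where
    R? : ∀ (k : Fin M) i j → Dec (Q i j × key i j ≡ toℕ k)
    R? k i j = Q? i j ×-dec (key i j ℕₚ.≟ toℕ k)
    cover : ∀ i j (d : Dec (Q i j)) → d ≡ Q? i j → 𝟙 d ≤ ∑ {M} (λ k → 𝟙 (R? k i j))
    cover i j (no _) _ = z≤n
    cover i j (yes q) _ = ≤-trans (≤-reflexive (sym (𝟙-yes (R? k i j) (q , sym (Fₚ.toℕ-fromℕ< (bound i j q)))))) (term≤∑ (λ k → 𝟙 (R? k i j)) k)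
      where k = fromℕ< (bound i j q)

  greatest : ∀ {n} {P : Fin n → Set} (P? : ∀ i → Dec (P i)) → (Σ (Fin n) λ i → P i × (∀ j → P j → toℕ j ≤ toℕ i)) ⊎ (∀ i → ¬ P i)
  greatest {zero} P? = inj₂ λ ()
  greatest {suc n} {P} P? = go (greatest (λ i → P? (F.suc i))) (P? F.zero)
    where
    go : (Σ (Fin n) λ i → P (F.suc i) × (∀ j → P (F.suc j) → toℕ j ≤ toℕ i)) ⊎ (∀ i → ¬ P (F.suc i)) → Dec (P F.zero) →
      (Σ (Fin (suc n)) λ i → P i × (∀ j → P j → toℕ j ≤ toℕ i)) ⊎ (∀ i → ¬ P i)
    go (inj₁ (i , Pi , max)) _ = inj₁ (F.suc i , Pi , λ { F.zero _ → z≤n ; (F.suc j) Pj → s≤s (max j Pj) })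
    go (inj₂ none) (yes P0) = inj₁ (F.zero , P0 , λ { F.zero _ → z≤n ; (F.suc j) Pj → contradiction Pj (none j) })
    go (inj₂ none) (no ¬P0) = inj₂ λ { F.zero → ¬P0 ; (F.suc i) → none i }

  _~_ : ℕ → ℕ → Set
  m ~ n = [ m ] ^ r ≡ [ n ] ^ r

  _~?_ : ∀ m n → Dec (m ~ n)
  m ~? n = [ m ] ^ r ≟K [ n ] ^ r

  []-*-^ : ∀ m n → [ m · n ] ^ r ≡ [ m ] ^ r * [ n ] ^ r
  []-*-^ m n = trans (cong (_^ r) ([]-* m n)) (^-distrib-* [ m ] [ n ] r)

  ~-* : ∀ {k l m n} → k ~ l → m ~ n → (k · m) ~ (l · n)
  ~-* {k} {l} {m} {n} e e' = trans ([]-*-^ k m) (trans (cong₂ _*_ e e') (sym ([]-*-^ l n)))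

  ~-cancel : ∀ g x y → 1 ≤ g → g < p → (g · x) ~ (g · y) → x ~ y
  ~-cancel g x y 1≤g g<p e = *-cancelˡ (^-≢0 r ([]≢0 g 1≤g g<p)) (trans (sym ([]-*-^ g x)) (trans e ([]-*-^ g y)))

  module Line (X : ℕ) (ρ : K) where

    Q : Fin X → Fin X → Set
    Q x y = Coprime (succ x) (succ y) × ([ succ x ] ≡ ρ * [ succ y ])

    Q? : ∀ x y → Dec (Q x y)
    Q? x y = coprime? (succ x) (succ y) ×-dec ([ succ x ] ≟K ρ * [ succ y ])

    -- All points (x, y) of the line satisfy x₀ y ≡ y₀ x modulo p, so x₀ y - y₀ x takes few values; it determines (x, y)
    -- up to multiples of (x₀, y₀), hence uniquely by the maximality of x₀.
    module Maximal (x₀ y₀ : Fin X) (q₀ : Q x₀ y₀) (max : ∀ x y → Q x y → toℕ x ≤ toℕ x₀) where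

      -- The determinant x₀ y - y₀ x, shifted by X² to stay within ℕ. It is at most 2X² and
      -- congruent to X² modulo p, so its quotient by p determines it.
      v : Fin X → Fin X → ℕ
      v x y = succ x₀ · succ y ℕ.+ (X · X ∸ succ y₀ · succ x)

      small : ∀ x → succ y₀ · succ x ≤ X · X
      small x = *-mono-≤ (Fₚ.toℕ<n y₀) (Fₚ.toℕ<n x)

      v+ : ∀ x y → v x y ℕ.+ succ y₀ · succ x ≡ succ x₀ · succ y ℕ.+ X · X
      v+ x y = trans (ℕₚ.+-assoc (succ x₀ · succ y) _ _) (cong (succ x₀ · succ y ℕ.+_) (ℕₚ.m∸n+n≡m (small x)))

      v-residue : ∀ x y → Q x y → [ v x y ] ≡ [ X · X ]
      v-residue x y (_ , e) = +-cancelʳ [ succ y₀ · succ x ] [ v x y ] [ X · X ] (trans (sym ([]-+ (v x y) (succ y₀ · succ x))) (trans (cong [_] (v+ x y)) (trans (trans ([]-+ (succ x₀ · succ y) (X · X)) (+-comm _ _)) (cong ([ X · X ] +_) cross))))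
        where
        +-cancelʳ : ∀ z x y → x + z ≡ y + z → x ≡ y
        +-cancelʳ z x y e = trans (lem x z) (trans (cong (_- z) e) (sym (lem y z)))
          where
          lem : ∀ x z → x ≡ (x + z) - z
          lem = solveK 2 (λ x z → x := (x :+ z) :- z) refl
        cross : [ succ x₀ · succ y ] ≡ [ succ y₀ · succ x ]
        cross = trans ([]-* (succ x₀) (succ y)) (trans (cong (_* [ succ y ]) (proj₂ q₀)) (trans (lem ρ [ succ y₀ ] [ succ y ]) (trans (cong ([ succ y₀ ] *_) (sym e)) (sym ([]-* (succ y₀) (succ x))))))
          where
          lem : ∀ a b c → (a * b) * c ≡ b * (a * c)
          lem = solveK 3 (λ a b c → (a :* b) :* c := b :* (a :* c)) refl

      v-injective : ∀ {x y x' y'} → Q x y → Q x' y' → v x y ≡ v x' y' → (x ≡ x') × (y ≡ y')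
      v-injective {x} {y} {x'} {y'} q q' e = by-order (ℕₚ.≤-total (toℕ x) (toℕ x'))
        where
        balance : succ x₀ · succ y ℕ.+ succ y₀ · succ x' ≡ succ x₀ · succ y' ℕ.+ succ y₀ · succ x
        balance = ℕₚ.+-cancelʳ-≡ (X · X) _ _ (begin-equality
          succ x₀ · succ y ℕ.+ succ y₀ · succ x' ℕ.+ X · X   ≡⟨ solve 3 (λ a b c → a ⊕ b ⊕ c :≡ a ⊕ c ⊕ b) refl (succ x₀ · succ y) (succ y₀ · succ x') (X · X) ⟩
          succ x₀ · succ y ℕ.+ X · X ℕ.+ succ y₀ · succ x'   ≡⟨ cong (ℕ._+ succ y₀ · succ x') (sym (v+ x y)) ⟩
          v x y ℕ.+ succ y₀ · succ x ℕ.+ succ y₀ · succ x'   ≡⟨ cong (λ z → z ℕ.+ succ y₀ · succ x ℕ.+ succ y₀ · succ x') e ⟩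
          v x' y' ℕ.+ succ y₀ · succ x ℕ.+ succ y₀ · succ x'   ≡⟨ solve 3 (λ a b c → a ⊕ b ⊕ c :≡ a ⊕ c ⊕ b) refl (v x' y') (succ y₀ · succ x) (succ y₀ · succ x') ⟩
          v x' y' ℕ.+ succ y₀ · succ x' ℕ.+ succ y₀ · succ x   ≡⟨ cong (ℕ._+ succ y₀ · succ x) (v+ x' y') ⟩
          succ x₀ · succ y' ℕ.+ X · X ℕ.+ succ y₀ · succ x   ≡⟨ solve 3 (λ a b c → a ⊕ c ⊕ b :≡ a ⊕ b ⊕ c) refl (succ x₀ · succ y') (succ y₀ · succ x) (X · X) ⟩
          succ x₀ · succ y' ℕ.+ succ y₀ · succ x ℕ.+ X · X ∎)
        same : ∀ (x x' y y' : Fin X) → toℕ x' ≤ toℕ x₀ → toℕ x ≤ toℕ x' → succ x₀ · succ y ℕ.+ succ y₀ · succ x' ≡ succ x₀ · succ y' ℕ.+ succ y₀ · succ x → toℕ x' ∸ toℕ x ≡ 0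
        same x x' y y' x'≤x₀ x≤x' bal = vanish (toℕ x' ∸ toℕ x) refl
          where
          δ = toℕ x' ∸ toℕ x
          x'≡ : succ x' ≡ succ x ℕ.+ δ
          x'≡ = cong suc (sym (ℕₚ.m+[n∸m]≡n x≤x'))
          shifted : succ x₀ · succ y ℕ.+ succ y₀ · δ ≡ succ x₀ · succ y'
          shifted = ℕₚ.+-cancelʳ-≡ (succ y₀ · succ x) _ _ (trans (solve 4 (λ A b x δ → A ⊕ b ⊗ δ ⊕ b ⊗ x :≡ A ⊕ b ⊗ (x ⊕ δ)) refl (succ x₀ · succ y) (succ y₀) (succ x) δ) (trans (cong (λ z → succ x₀ · succ y ℕ.+ succ y₀ · z) (sym x'≡)) bal))
          divs : succ x₀ ∣ δ
          divs = coprime-divisor (proj₁ q₀) (∣m+n∣m⇒∣n (subst (succ x₀ ∣_) (sym shifted) (m∣m*n (succ y'))) (m∣m*n (succ y)))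
          vanish : ∀ z → z ≡ δ → δ ≡ 0
          vanish zero e = sym e
          -- The divisor is x₀ as an integer, one more than its index, whereas δ is at most the
          -- largest index; a positive δ is too small to be divisible.
          vanish (suc z) e = contradiction (≤-trans (∣⇒≤ (subst (succ x₀ ∣_) (sym e) divs)) (≤-trans (≤-reflexive e) (≤-trans (ℕₚ.m∸n≤m (toℕ x') (toℕ x)) x'≤x₀))) (ℕₚ.<-irrefl refl)
        conclude : toℕ x ≡ toℕ x' → (x ≡ x') × (y ≡ y')
        conclude ex = Fₚ.toℕ-injective ex , Fₚ.toℕ-injective (ℕₚ.suc-injective (ℕₚ.*-cancelˡ-≡ (succ y) (succ y') (succ x₀) (ℕₚ.+-cancelʳ-≡ (succ y₀ · succ x) _ _ (trans (cong (λ z → succ x₀ · succ y ℕ.+ succ y₀ · suc z) ex) balance))))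
        by-order : toℕ x ≤ toℕ x' ⊎ toℕ x' ≤ toℕ x → (x ≡ x') × (y ≡ y')
        by-order (inj₁ l) = conclude (ℕₚ.≤-antisym l (ℕₚ.m∸n≡0⇒m≤n (same x x' y y' (max x' y' q') l balance)))
        by-order (inj₂ l) = conclude (ℕₚ.≤-antisym (ℕₚ.m∸n≡0⇒m≤n (same x' x y' y (max x y q) l (sym balance))) l)

      key : Fin X → Fin X → ℕ
      key x y = v x y / p

      key-bound : ∀ x y → Q x y → key x y < suc (2 · (X · X) / p)
      key-bound x y q = s≤s (/-monoˡ-≤ p (≤-trans (ℕₚ.+-mono-≤ (*-mono-≤ (Fₚ.toℕ<n x₀) (Fₚ.toℕ<n y)) (ℕₚ.m∸n≤m (X · X) (succ y₀ · succ x))) (≤-reflexive (cong (X · X ℕ.+_) (sym (ℕₚ.+-identityʳ _))))))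

      key-injective : ∀ {x y x' y'} → Q x y → Q x' y' → key x y ≡ key x' y' → (x ≡ x') × (y ≡ y')
      key-injective {x} {y} {x'} {y'} q q' e = v-injective q q' (trans (m≡m%n+[m/n]*n (v x y) p) (trans (cong₂ (λ a b → a ℕ.+ b · p) ([]-inj (trans (v-residue x y q) (sym (v-residue x' y' q')))) e) (sym (m≡m%n+[m/n]*n (v x' y') p))))

      count : ∑ (λ x → ∑ (λ y → 𝟙 (Q? x y))) ≤ suc (2 · (X · X) / p)
      count = ∑∑-injection Q? _ key key-bound key-injective

    count : ∑ (λ x → ∑ (λ y → 𝟙 (Q? x y))) ≤ suc (2 · (X · X) / p)
    count = go (greatest (λ x → Fₚ.any? (Q? x)))
      where
      go : (Σ (Fin X) λ x → ∃ (Q x) × (∀ x' → ∃ (Q x') → toℕ x' ≤ toℕ x)) ⊎ (∀ x → ¬ ∃ (Q x)) → ∑ (λ x → ∑ (λ y → 𝟙 (Q? x y))) ≤ suc (2 · (X · X) / p)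
      go (inj₁ (x₀ , (y₀ , q₀) , max)) = Maximal.count x₀ y₀ q₀ (λ x y q → max x (y , q))
      go (inj₂ none) = ≤-trans (≤-reflexive (∑-0 (λ x → ∑-0 (λ y → 𝟙-no (Q? x y) (λ q → none x (y , q)))))) z≤n

  -- A coincidence x^r = y^r puts (x, y) on the line with slope ρ = x/y, an r-th root of unity.
  -- There are at most r such lines, with at most 1 + 2X²/p coprime points each.
  a-lattice : ∀ X → X < p → ∑ {X} (λ x → ∑ {X} (λ y → 𝟙 (coprime? (succ x) (succ y) ×-dec (succ x ~? succ y)))) · p ≤ r · (p ℕ.+ 2 · (X · X))
  a-lattice X X<p = begin
    ∑ {X} (λ x → ∑ {X} (λ y → 𝟙 (cop? x y))) · p   ≤⟨ *-monoˡ-≤ p (∑-mono (λ x → ∑-mono (λ y → cover x y (cop? x y)))) ⟩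
    ∑ {X} (λ x → ∑ {X} (λ y → ∑ {p} (λ ρ → root ρ · pt ρ x y))) · p   ≡⟨ cong (_· p) (trans (∑-cong (λ x → ∑-comm _)) (trans (∑-comm _) (∑-cong (λ ρ → trans (∑-cong (λ x → sym (*-∑ (root ρ) _))) (sym (*-∑ (root ρ) _)))))) ⟩
    ∑ {p} (λ ρ → root ρ · ∑ (λ x → ∑ (λ y → pt ρ x y))) · p   ≤⟨ *-monoˡ-≤ p (∑-mono (λ ρ → *-monoʳ-≤ (root ρ) (Line.count X ρ))) ⟩
    ∑ {p} (λ ρ → root ρ · m) · p   ≡⟨ cong (_· p) (sym (∑-* root m)) ⟩
    ∑ root · m · p   ≤⟨ *-monoˡ-≤ p (*-monoˡ-≤ m (power-fibre r 1#)) ⟩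
    r · m · p   ≡⟨ ℕₚ.*-assoc r m p ⟩
    r · (m · p)   ≤⟨ *-monoʳ-≤ r (ℕₚ.+-monoʳ-≤ p (m/n*n≤m (2 · (X · X)) p)) ⟩
    r · (p ℕ.+ 2 · (X · X)) ∎
    where
    m = suc (2 · (X · X) / p)
    cop? : ∀ (x y : Fin X) → Dec (Coprime (succ x) (succ y) × (succ x ~ succ y))
    cop? x y = coprime? (succ x) (succ y) ×-dec (succ x ~? succ y)
    root : K → ℕ
    root ρ = 𝟙 (ρ ^ r ≟K 1#)
    pt : K → Fin X → Fin X → ℕ
    pt ρ x y = 𝟙 (Line.Q? X ρ x y)
    cover : ∀ x y (d : Dec (Coprime (succ x) (succ y) × (succ x ~ succ y))) → 𝟙 d ≤ ∑ {p} (λ ρ → root ρ · pt ρ x y)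
    cover x y (no _) = z≤n
    cover x y (yes (c , e)) = ≤-trans (≤-reflexive (sym (cong₂ _·_ (𝟙-yes (ρ ^ r ≟K 1#) ρʳ≡1) (𝟙-yes (Line.Q? X ρ x y) (c , line))))) (term≤∑ (λ ρ → root ρ · pt ρ x y) ρ)
      where
      [y] = [ succ y ]
      y≢0 : ¬ [y] ≡ 0#
      y≢0 = []≢0 (succ y) (s≤s z≤n) (ℕₚ.≤-<-trans (Fₚ.toℕ<n y) X<p)
      ρ = [ succ x ] * ([y] ⁻¹)
      line : [ succ x ] ≡ ρ * [y]
      line = sym (trans (*-assoc [ succ x ] _ _) (trans (cong ([ succ x ] *_) (inv-l y≢0)) (*-identityʳ _)))
      ρʳ≡1 : ρ ^ r ≡ 1#
      ρʳ≡1 = *-cancelˡ (^-≢0 r y≢0) (trans (*-comm _ _) (trans (sym (^-distrib-* ρ [y] r)) (trans (cong (_^ r) (sym line)) (trans e (sym (*-identityʳ _))))))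

-- Weights on unions of cosets of Γ

module _ where
 open import Data.Nat using (ℕ; NonZero)
 open import Data.Nat.Primality using (Prime)
 open import Data.Fin using (Fin)
 open import Relation.Nullary using (¬_)
 open import Relation.Binary.PropositionalEquality using (_≡_)
 module CosetWeights (p : ℕ) (pr : Prime p) (t : ℕ) .{{_ : NonZero t}} (n : ℕ) (c : Fin n → PrimeField.K p pr) (c≢0 : ∀ j → ¬ c j ≡ PrimeField.0K p pr) where
  open PrimeField p pr
  open NatSums
  open Fibres p pr using (power-fibre)
  open import Data.Nat as ℕ using (z≤n; s≤s; _≤_)
  import Data.Nat.Properties as ℕₚ
  open ℕₚ using (≤-trans; ≤-reflexive; *-mono-≤; *-monoˡ-≤; *-monoʳ-≤)
  open import Relation.Nullary using (Dec; yes; no; contradiction)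
  open import Relation.Binary.PropositionalEquality using (refl; cong; trans; sym)
  open import Data.Nat.Solver using (module +-*-Solver)
  open +-*-Solver using (solve) renaming (_:=_ to _:≡_; _:*_ to _⊗_; con to num)
  open ℕₚ.≤-Reasoning

  infixl 7 _·_
  _·_ : ℕ → ℕ → ℕ
  _·_ = ℕ._*_

  A : Fin n → K
  A j = c j ^ (t · 2)

  A≢0 : ∀ j → ¬ A j ≡ 0#
  A≢0 j = ^-≢0 (t · 2) (c≢0 j)

  -- κ ^ 2 instead of κ makes u ↦ ν (u ^ t) even.
  ν : K → ℕ
  ν κ = ∑ (λ j → 𝟙 (κ ^ 2 ≟K A j))

  ν0 : ν 0# ≡ 0
  ν0 = ∑-0 (λ j → 𝟙-no (0# ^ 2 ≟K A j) (λ e → A≢0 j (trans (sym e) (0^ 2 (s≤s z≤n)))))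

  open ThirdMoment p pr t ν ν0 using (N₁; W; W₂)

  N₁≤ : N₁ ≤ n · 2
  N₁≤ = ≤-trans (≤-reflexive (∑-comm _)) (∑-≤-const 2 (λ j → power-fibre 2 (A j)))

  𝟙²≤ : ∀ {P Q R : Set} (d : Dec P) (e : Dec Q) (f : Dec R) → (P → Q → R) → 𝟙 d · 𝟙 e ≤ 𝟙 d · 𝟙 f
  𝟙²≤ (yes x) e f h = *-monoʳ-≤ 1 (𝟙-mono e f (h x))
  𝟙²≤ (no _) e f h = z≤n

  z : K → Fin n → Fin n → ℕ
  z κ i j = 𝟙 (κ ^ 2 * A i ≟K A j)

  Z : K → ℕ
  Z κ = ∑ (λ i → ∑ (λ j → z κ i j))

  W≤ : ∀ κ → W κ ≤ 2 · Z κ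
  W≤ κ = begin
    ∑ (λ α → ν α · ν (κ * α))   ≡⟨ ∑-cong (λ α → ∑-** _ _) ⟩
    ∑ (λ α → ∑ (λ i → ∑ (λ j → 𝟙 (α ^ 2 ≟K A i) · 𝟙 ((κ * α) ^ 2 ≟K A j))))   ≤⟨ ∑-mono (λ α → ∑-mono (λ i → ∑-mono (λ j → 𝟙²≤ (α ^ 2 ≟K A i) ((κ * α) ^ 2 ≟K A j) (κ ^ 2 * A i ≟K A j) (λ e e' → trans (cong (κ ^ 2 *_) (sym e)) (trans (sym (^-distrib-* κ α 2)) e'))))) ⟩
    ∑ (λ α → ∑ (λ i → ∑ (λ j → 𝟙 (α ^ 2 ≟K A i) · z κ i j)))   ≡⟨ trans (∑-comm _) (∑-cong (λ i → ∑-comm _)) ⟩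
    ∑ (λ i → ∑ (λ j → ∑ (λ α → 𝟙 (α ^ 2 ≟K A i) · z κ i j)))   ≤⟨ ∑-mono (λ i → ∑-mono (λ j → ≤-trans (≤-reflexive (sym (∑-* _ (z κ i j)))) (*-monoˡ-≤ (z κ i j) (power-fibre 2 (A i))))) ⟩
    ∑ (λ i → ∑ (λ j → 2 · z κ i j))   ≡⟨ trans (∑-cong (λ i → sym (*-∑ 2 (z κ i)))) (sym (*-∑ 2 (λ i → ∑ (z κ i)))) ⟩
    2 · Z κ ∎

  quad : Fin n → Fin n → Fin n → Fin n → ℕ
  quad i l j k = 𝟙 (A i * A l ≟K A j * A k)

  -- Eliminating κ² from the two conditions yields A_i A_l = A_j A_k; given i and j, at most two κ
  -- have the prescribed square.
  pairs≤ : ∀ i j k l → ∑ (λ κ → z κ i j · z κ k l) ≤ 2 · quad i l j k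
  pairs≤ i j k l = go (A i * A l ≟K A j * A k)
    where
    go : (d : Dec (A i * A l ≡ A j * A k)) → ∑ (λ κ → z κ i j · z κ k l) ≤ 2 · 𝟙 d
    go (yes _) = ≤-trans (∑-mono (λ κ → ≤-trans (≤-trans (*-monoʳ-≤ (z κ i j) (𝟙≤1 (κ ^ 2 * A k ≟K A l))) (≤-reflexive (ℕₚ.*-identityʳ _))) (𝟙-mono (κ ^ 2 * A i ≟K A j) (κ ^ 2 ≟K A j * (A i ⁻¹)) (λ e → trans (sym (trans (*-assoc (κ ^ 2) (A i) _) (trans (cong (κ ^ 2 *_) (inv-r (A≢0 i))) (*-identityʳ _)))) (cong (_* (A i ⁻¹)) e))))) (power-fibre 2 (A j * (A i ⁻¹)))
    go (no ne) = ≤-reflexive (∑-0 (λ κ → zero-product (κ ^ 2 * A i ≟K A j) (κ ^ 2 * A k ≟K A l) (λ e e' → ne (trans (cong (A i *_) (sym e')) (trans (lem (A i) (κ ^ 2) (A k)) (cong (_* A k) e))))))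
      where
      lem : ∀ a b c → a * (b * c) ≡ (b * a) * c
      lem = solveK 3 (λ a b c → a :* (b :* c) := (b :* a) :* c) refl
      zero-product : ∀ {P Q : Set} (d : Dec P) (e : Dec Q) → (P → ¬ Q) → 𝟙 d · 𝟙 e ≡ 0
      zero-product (yes x) (yes y) h = contradiction y (h x)
      zero-product (yes x) (no _) h = refl
      zero-product (no _) e h = refl

  -- The factor 8 consists of a 2 from each of the two factors W and a 2 from the choice of κ.
  W₂≤ : W₂ ≤ 8 · ∑ (λ i → ∑ (λ l → ∑ (λ j → ∑ (λ k → quad i l j k))))
  W₂≤ = begin
    ∑ (λ κ → W κ · W κ)   ≤⟨ ∑-mono (λ κ → *-mono-≤ (W≤ κ) (W≤ κ)) ⟩
    ∑ (λ κ → (2 · Z κ) · (2 · Z κ))   ≡⟨ ∑-cong (λ κ → solve 1 (λ z → (num 2 ⊗ z) ⊗ (num 2 ⊗ z) :≡ num 4 ⊗ (z ⊗ z)) refl (Z κ)) ⟩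
    ∑ (λ κ → 4 · (Z κ · Z κ))   ≡⟨ sym (*-∑ 4 (λ κ → Z κ · Z κ)) ⟩
    4 · ∑ (λ κ → Z κ · Z κ)   ≡⟨ cong (4 ·_) (∑-cong (λ κ → trans (∑-** _ _) (∑-cong (λ i → ∑-cong (λ k → ∑-** _ _))))) ⟩
    4 · ∑ (λ κ → ∑ (λ i → ∑ (λ k → ∑ (λ j → ∑ (λ l → z κ i j · z κ k l)))))   ≡⟨ cong (4 ·_) (trans (∑-comm _) (∑-cong (λ i → trans (∑-comm _) (∑-cong (λ k → trans (∑-comm _) (∑-cong (λ j → ∑-comm _))))))) ⟩
    4 · ∑ (λ i → ∑ (λ k → ∑ (λ j → ∑ (λ l → ∑ (λ κ → z κ i j · z κ k l)))))   ≤⟨ *-monoʳ-≤ 4 (∑-mono (λ i → ∑-mono (λ k → ∑-mono (λ j → ∑-mono (λ l → pairs≤ i j k l))))) ⟩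
    4 · ∑ (λ i → ∑ (λ k → ∑ (λ j → ∑ (λ l → 2 · quad i l j k))))   ≡⟨ cong (4 ·_) (trans (∑-cong (λ i → trans (∑-cong (λ k → trans (∑-cong (λ j → sym (*-∑ 2 (λ l → quad i l j k)))) (sym (*-∑ 2 (λ j → ∑ (λ l → quad i l j k)))))) (sym (*-∑ 2 (λ k → ∑ (λ j → ∑ (λ l → quad i l j k))))))) (sym (*-∑ 2 (λ i → ∑ (λ k → ∑ (λ j → ∑ (λ l → quad i l j k))))))) ⟩
    4 · (2 · ∑ (λ i → ∑ (λ k → ∑ (λ j → ∑ (λ l → quad i l j k)))))   ≡⟨ sym (ℕₚ.*-assoc 4 2 (∑ (λ i → ∑ (λ k → ∑ (λ j → ∑ (λ l → quad i l j k)))))) ⟩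
    8 · ∑ (λ i → ∑ (λ k → ∑ (λ j → ∑ (λ l → quad i l j k))))   ≡⟨ cong (8 ·_) (∑-cong (λ i → trans (∑-cong (λ k → ∑-comm _)) (trans (∑-comm _) (∑-cong (λ l → ∑-comm _))))) ⟩
    8 · ∑ (λ i → ∑ (λ l → ∑ (λ j → ∑ (λ k → quad i l j k)))) ∎

  W₂≤n⁴ : W₂ ≤ 8 · (n · (n · (n · n)))
  W₂≤n⁴ = ≤-trans W₂≤ (*-monoʳ-≤ 8 (∑-≤-const (n · (n · n)) (λ i → ∑-≤-const (n · n) (λ l → ∑-≤-const n (λ j → ≤-trans (∑-≤-const 1 (λ k → 𝟙≤1 (A i * A l ≟K A j * A k))) (≤-reflexive (ℕₚ.*-identityʳ n)))))))

  ν-even : ∀ u → ν ((- u) ^ t) ≡ ν (u ^ t)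
  ν-even u = ∑-cong (λ j → cong (λ x → 𝟙 (x ≟K A j)) (trans (swap (- u)) (trans (cong (_^ t) (lem u)) (sym (swap u)))))
    where
    lem : ∀ u → (- u) ^ 2 ≡ u ^ 2
    lem = solveK 1 (λ u → (:- u) :* ((:- u) :* :1) := u :* (u :* :1)) refl
    swap : ∀ u → (u ^ t) ^ 2 ≡ (u ^ 2) ^ t
    swap u = trans (^-assocʳ u t 2) (trans (cong (u ^_) (ℕₚ.*-comm t 2)) (sym (^-assocʳ u 2 t)))

  -- Membership of x in the coset c_j Γ gives x^t = c_j^t, and squaring gives the condition counted
  -- by ν. Only this inequality is required, so the passage to squares does no harm.
  ν-coset : ∀ x → ∑ (λ j → 𝟙 ((x * (c j ⁻¹)) ^ t ≟K 1#)) ≤ ν (x ^ t)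
  ν-coset x = ∑-mono (λ j → 𝟙-mono ((x * (c j ⁻¹)) ^ t ≟K 1#) ((x ^ t) ^ 2 ≟K A j) (λ e → trans (cong (_^ 2) (member j e)) (^-assocʳ (c j) t 2)))
    where
    member : ∀ j → (x * (c j ⁻¹)) ^ t ≡ 1# → x ^ t ≡ c j ^ t
    member j e = trans (cong (_^ t) (sym (trans (*-comm _ _) (trans (*-assoc x _ _) (trans (cong (x *_) (inv-l (c≢0 j))) (*-identityʳ x)))))) (trans (^-distrib-* (c j) (x * (c j ⁻¹)) t) (trans (cong (c j ^ t *_) e) (*-identityʳ _)))

-- Energy of the classes of an interval

module _ where
 open import Data.Nat using (ℕ; NonZero; _<_; _≤_; suc)
 import Data.Nat as Nat
 open import Data.Nat.Primality using (Prime)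
 open import Relation.Nullary using (¬_)
 open import Relation.Binary.PropositionalEquality using (_≡_)
 module IntervalWeights (p : ℕ) (pr : Prime p) (t : ℕ) .{{_ : NonZero t}} (L : ℕ) (L<p : L < p) (b : PrimeField.K p pr) (b≢0 : ¬ b ≡ PrimeField.0K p pr)
   (D : ℕ) (1≤D : 1 ≤ D) (τ≤D : ∀ n → 1 ≤ n → n ≤ p Nat.* p → Divisors.τ n ≤ D) where
  open PrimeField p pr
  open NatSums
  open Arithmetic using (cube-cancel; cube-mono)
  open import Data.Nat as ℕ using (zero; z≤n; s≤s)
  import Data.Nat.Properties as ℕₚ
  open ℕₚ using (≤-trans; *-mono-≤; *-monoˡ-≤; *-monoʳ-≤)
  open import Data.Fin using (Fin)
  import Data.Fin.Properties as Fₚ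
  open import Relation.Binary.PropositionalEquality using (refl; cong; cong₂; trans; sym)
  open import Data.Nat.Solver using (module +-*-Solver)
  open +-*-Solver using (solve) renaming (_:=_ to _:≡_; _:*_ to _⊗_; con to num)
  open ℕₚ.≤-Reasoning

  r : ℕ
  r = t ℕ.* 2

  instance
    r≢0 : NonZero r
    r≢0 = ℕₚ.m*n≢0 t 2

  open LatticePoints p pr r using (_~_; _~?_; ~-*; ~-cancel; a-lattice; []-*-^)
  open ProductSets _~_ _~?_ (λ {k} {l} {m} {n} → ~-* {k} {l} {m} {n}) D (p ℕ.* p) τ≤D using (w; succ; product-sum₂; module Bounds)

  c : Fin L → K
  c j = [ succ j ] * b

  c≢0 : ∀ j → ¬ c j ≡ 0#
  c≢0 j = *-≢0 ([]≢0 (succ j) (s≤s z≤n) (ℕₚ.≤-<-trans (Fₚ.toℕ<n j) L<p)) b≢0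

  open CosetWeights p pr t L c c≢0 public using (_·_; A; ν; ν0; N₁≤; W₂≤; quad)
  open ThirdMoment p pr t ν ν0 public using (W₂)

  1≤p : 1 ≤ p
  1≤p = ℕₚ.<⇒≤ 1<p

  p≤p² : p ≤ p · p
  p≤p² = ℕₚ.m≤m*n p p

  A-product : ∀ i j → A i * A j ≡ [ succ i · succ j ] ^ r * (b ^ r * b ^ r)
  A-product i j = trans (cong₂ _*_ (^-distrib-* [ succ i ] b r) (^-distrib-* [ succ j ] b r)) (trans (lem ([ succ i ] ^ r) ([ succ j ] ^ r) (b ^ r)) (cong (_* (b ^ r * b ^ r)) (sym ([]-*-^ (succ i) (succ j)))))
    where
    lem : ∀ x y z → (x * z) * (y * z) ≡ (x * y) * (z * z)
    lem = solveK 3 (λ x y z → (x :* z) :* (y :* z) := (x :* y) :* (z :* z)) refl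

  W₂≤w : L · L ≤ p → W₂ ≤ 8 · (D · D · w (L · L))
  W₂≤w L²≤p = ≤-trans W₂≤ (*-monoʳ-≤ 8 (≤-trans (∑-mono (λ i → ∑-mono (λ l → ∑-mono (λ j → ∑-mono (λ k → 𝟙-mono (A i * A l ≟K A j * A k) ((succ i · succ l) ~? (succ j · succ k)) (λ e → *-cancelˡ (*-≢0 (^-≢0 r b≢0) (^-≢0 r b≢0)) (trans (*-comm _ _) (trans (sym (A-product i l)) (trans e (trans (A-product j k) (*-comm _ _))))))))))) (product-sum₂ L L (λ m n → 𝟙 (m ~? n)) (≤-trans L²≤p p≤p²))))

  -- The energy is at most w(L²) up to divisor factors, because a product of two indices has few
  -- factorisations and the common factor b cancels. With X = L² in `w-cube`, the loss over L² is
  -- the cube root e of E.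
  multiplicative-energy : (d₀ e : ℕ) → 1 ≤ e → d₀ · d₀ < p → (L · L) · (L · L) · (L · L) < p →
    r ≤ d₀ · (e · e · e) → r · (d₀ · d₀) ≤ (e · e · e) · (e · e · e) · p → r · ((L · L) · (L · L) · (L · L)) ≤ (e · e · e) · p →
    r · 2 ≤ (e · e · e) · (e · e · e) · ((e · e · e) · (e · e · e)) → W₂ ≤ 16 · (D · D · D · D · D) · e · (L · L)
  multiplicative-energy d₀ e 1≤e d₀²<p M<p h₁ h₂ h₃ h₄ = cube-cancel (begin
    W₂ · W₂ · W₂   ≤⟨ cube-mono (W₂≤w L²≤p) ⟩
    (8 · (D · D · w X)) · (8 · (D · D · w X)) · (8 · (D · D · w X))   ≡⟨ solve 2 (λ D w → (num 8 ⊗ (D ⊗ D ⊗ w)) ⊗ (num 8 ⊗ (D ⊗ D ⊗ w)) ⊗ (num 8 ⊗ (D ⊗ D ⊗ w)) :≡ num 512 ⊗ (D ⊗ D ⊗ D ⊗ D ⊗ D ⊗ D) ⊗ (w ⊗ w ⊗ w)) refl D (w X) ⟩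
    512 · (D · D · D · D · D · D) · (w X · w X · w X)   ≤⟨ *-monoʳ-≤ (512 · (D · D · D · D · D · D)) (Bounds.Exponents.w-cube p r 1≤p 1≤D ℕₚ.≤-refl ~-cancel a-lattice d₀ E M (*-mono-≤ (*-mono-≤ 1≤e 1≤e) 1≤e) d₀²<p M<p h₁ h₂ h₃ h₄ X refl) ⟩
    512 · (D · D · D · D · D · D) · (D · D · (D · D · (3 · (D · D) · E · (D · M))))   ≡⟨ solve 3 (λ D E M → num 512 ⊗ (D ⊗ D ⊗ D ⊗ D ⊗ D ⊗ D) ⊗ (D ⊗ D ⊗ (D ⊗ D ⊗ (num 3 ⊗ (D ⊗ D) ⊗ E ⊗ (D ⊗ M)))) :≡ num 1536 ⊗ (num 1 ⊗ num 1) ⊗ ((D ⊗ D ⊗ D ⊗ D ⊗ D ⊗ D) ⊗ (D ⊗ D ⊗ D ⊗ D ⊗ D ⊗ D) ⊗ D ⊗ E ⊗ M)) refl D E M ⟩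
    -- The constant is raised to 16³ and D¹³ to D¹⁵, so that the right side becomes a perfect cube.
    1536 · (1 · 1) · Q   ≤⟨ *-monoˡ-≤ Q (*-mono-≤ {1536} {4096} (ℕₚ.≤ᵇ⇒≤ 1536 4096 _) (*-mono-≤ 1≤D 1≤D)) ⟩
    4096 · (D · D) · Q   ≡⟨ solve 3 (λ D e X → num 4096 ⊗ (D ⊗ D) ⊗ ((D ⊗ D ⊗ D ⊗ D ⊗ D ⊗ D) ⊗ (D ⊗ D ⊗ D ⊗ D ⊗ D ⊗ D) ⊗ D ⊗ (e ⊗ e ⊗ e) ⊗ (X ⊗ X ⊗ X)) :≡ num 16 ⊗ (D ⊗ D ⊗ D ⊗ D ⊗ D) ⊗ e ⊗ X ⊗ (num 16 ⊗ (D ⊗ D ⊗ D ⊗ D ⊗ D) ⊗ e ⊗ X) ⊗ (num 16 ⊗ (D ⊗ D ⊗ D ⊗ D ⊗ D) ⊗ e ⊗ X)) refl D e X ⟩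
    16 · D⁵ · e · X · (16 · D⁵ · e · X) · (16 · D⁵ · e · X) ∎)
    where
    X = L · L
    E = e · e · e
    M = X · X · X
    D⁵ = D · D · D · D · D
    Q = (D · D · D · D · D · D) · (D · D · D · D · D · D) · D · E · M
    cube≥ : ∀ x → x ≤ x · x · x
    cube≥ zero = z≤n
    cube≥ (suc x) = ℕₚ.≤-trans (ℕₚ.m≤m*n (suc x) (suc x)) (ℕₚ.m≤m*n (suc x · suc x) (suc x))
    L²≤p : X ≤ p
    L²≤p = ≤-trans (cube≥ X) (ℕₚ.<⇒≤ M<p)

-- The third moments of Γ and of the weights

module _ where
 open import Data.Nat using (ℕ; NonZero)
 open import Data.Nat.Primality using (Prime)
 module Energies (p : ℕ) (pr : Prime p) (t : ℕ) .{{_ : NonZero t}} where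
  open PrimeField p pr using (K; _≟K_; 0#; 1#; 1≢0; 1^) renaming (_^_ to _↑_)
  open NatSums
  open Arithmetic using (c₁₂₈; c₆₉₁₂; cube-mono)
  open import Data.Nat
  import Data.Nat.Properties as ℕₚ
  open ℕₚ using (≤-trans; *-mono-≤; *-monoˡ-≤; *-monoʳ-≤)
  open import Data.Fin as F using (Fin)
  open import Relation.Nullary using (¬_)
  open import Relation.Binary.PropositionalEquality using (_≡_; refl; sym; trans)

  ν₁ : K → ℕ
  ν₁ κ = 𝟙 (κ ≟K 1#)

  ν₁0 : ν₁ 0# ≡ 0
  ν₁0 = 𝟙-no (0# ≟K 1#) (λ e → 1≢0 (sym e))

  energy₁ : ℕ
  energy₁ = ∑ (λ x → ThirdMoment.R p pr t ν₁ ν₁0 x * ThirdMoment.R p pr t ν₁ ν₁0 x * ThirdMoment.R p pr t ν₁ ν₁0 x)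

  module _ (n : ℕ) (c : Fin n → K) (c≢0 : ∀ j → ¬ c j ≡ 0#) where

    open CosetWeights p pr t n c c≢0 using (ν; ν0; N₁≤)
    open ThirdMoment p pr t ν ν0 using (R; W₂; N₁; module Energy)

    energy : ℕ
    energy = ∑ (λ x → R x * R x * R x)

    energy-bound : ∀ X Y Z C J → W₂ ≤ X → (n * 2) * (n * 2) ≤ Y → X * X ≤ Z → 1 + 64 * c₆₉₁₂ * (J * J * J * J) ≤ C →
      c₁₂₈ * (t * Y * X) ≤ t * t → 16 * (t * Y * X) * (t * t * t * t) ≤ p * p * p → t * Y < 2 ^ J → energy ≤ (t * t * t) * Z * C
    energy-bound X Y Z C J W₂≤X n≤Y X²≤Z ≤C h₁ h₂ h₃ = ≤-trans
      (Energy.energy (≤-trans (*-monoʳ-≤ c₁₂₈ tNW) h₁) (≤-trans (*-monoˡ-≤ (t * t * t * t) (*-monoʳ-≤ 16 tNW)) h₂) J (ℕₚ.≤-<-trans tN h₃))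
      (*-mono-≤ (*-monoʳ-≤ (t * t * t) (≤-trans (*-mono-≤ W₂≤X W₂≤X) X²≤Z)) ≤C)
      where
      tN : t * (N₁ * N₁) ≤ t * Y
      tN = *-monoʳ-≤ t (≤-trans (*-mono-≤ N₁≤ N₁≤) n≤Y)
      tNW : t * (N₁ * N₁) * W₂ ≤ t * Y * X
      tNW = *-mono-≤ tN W₂≤X

  -- The indicator of Γ is dominated by the weight of the single element 1, which counts the 2t-th
  -- roots of unity.
  energy₁≤ : energy₁ ≤ energy 1 (λ _ → 1#) (λ _ → 1≢0)
  energy₁≤ = ∑-mono (λ x → cube-mono (∑-mono (λ u → *-mono-≤ (ν₁≤ν _) (ν₁≤ν _))))
    where
    ν₁≤ν : ∀ κ → ν₁ κ ≤ CosetWeights.ν p pr t 1 (λ _ → 1#) (λ _ → 1≢0) κ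
    ν₁≤ν κ = ≤-trans (𝟙-mono (κ ≟K 1#) (κ ↑ 2 ≟K 1# ↑ (t * 2)) (λ { refl → trans (1^ 2) (sym (1^ (t * 2))) })) (term≤∑ {1} (λ _ → 𝟙 (κ ↑ 2 ≟K 1# ↑ (t * 2))) F.zero)

-- Moment inequalities for the exponential sums

module _ where
 open import Data.Nat using (ℕ; NonZero)
 open import Data.Nat.Primality using (Prime)
 open import Data.Nat.Divisibility using (_∣_)
 open OrderedRings using (OrderedRing)
 import Data.Nat as Nat
 module Moments (p : ℕ) (pr : Prime p) (O : OrderedRing) (T : FourierAnalysis.Trig p pr O) (t : ℕ) .{{_ : NonZero t}} (t∣p-1 : t ∣ p Nat.∸ 1) where
  open OrderedRings using (module OrderedRingProperties)
  open OrderedRingProperties O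
  open PrimeField p pr using (K; [_]; []≢0; *-≢0; inv-r)
    renaming (_+_ to _⊕_; _*_ to _⊗_; -_ to ⊖_; _-_ to _⊝_; 0# to 𝟘; 1# to 𝟏; _^_ to _↑_; _⁻¹ to _ⁱ; *-comm to ⊗-comm; *-identityʳ to ⊗-identityʳ; *-assoc to ⊗-assoc)
  open FieldSums p pr commutativeSemiring using (∑-scale)
  open import Data.Nat as ℕ using (suc; z≤n; s≤s)
  import Data.Nat.Properties as ℕₚ
  open import Data.Fin using (Fin; toℕ)
  import Data.Fin.Properties as Fₚ
  open import Data.Product using (_×_)
  open import Relation.Nullary using (¬_)
  open import Relation.Binary.PropositionalEquality as ≡ using (_≡_; cong)
  open FourierAnalysis p pr O
  open Energies p pr t using (ν₁; ν₁0; energy₁; energy)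
  open Fourier T
  open Subgroup t

  τ≈ : τ ≈ ι t
  τ≈ = trans (sym (ι-∑ G)) (reflexive (cong ι (SubgroupOrder.subgroup-order p pr t t∣p-1)))

  cube-ι : ∀ k → cube (ι k) ≈ ι (k ℕ.* k ℕ.* k)
  cube-ι k = sym (trans (ι-* (k ℕ.* k) k) (*-congʳ (ι-* k k)))

  auto-ι : (ν : K → ℕ) (ν0 : ν 𝟘 ≡ 0) → ∑ (λ x → cube (auto (λ u → ι (ν (u ↑ t))) x)) ≈ ι (NatSums.∑ (λ x → ThirdMoment.R p pr t ν ν0 x ℕ.* ThirdMoment.R p pr t ν ν0 x ℕ.* ThirdMoment.R p pr t ν ν0 x))
  auto-ι ν ν0 = sym (trans (ι-∑ _) (∑-cong (λ x → trans (sym (cube-ι (ThirdMoment.R p pr t ν ν0 x))) (*-cong (*-cong (e x) (e x)) (e x)))))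
    where
    e : ∀ x → ι (ThirdMoment.R p pr t ν ν0 x) ≈ auto (λ u → ι (ν (u ↑ t))) x
    e x = trans (ι-∑ (λ u → ν (u ↑ t) ℕ.* ν ((u ⊝ x) ↑ t))) (∑-cong (λ u → ι-* (ν (u ↑ t)) (ν ((u ⊝ x) ↑ t))))

  module _ (n : ℕ) (c : Fin n → K) (c≢0 : ∀ j → ¬ c j ≡ 𝟘) where

    open CosetWeights p pr t n c c≢0 using (ν; ν0; ν-even; ν-coset)

    w : K → Carrier
    w u = ι (ν (u ↑ t))

    open Weighted w (λ u → ι-nonneg (ν (u ↑ t))) (λ u → reflexive (cong ι (ν-even u))) (λ h u → reflexive (cong (λ z → ι (ν z)) (Γ-↑ h u))) using (V; sixth-power)

    mass : Carrier
    mass = ∑ (λ j → S² (c j))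

    mass-nonneg : 0# ≤ mass
    mass-nonneg = ∑-nonneg (λ j → S²-nonneg (c j))

    coset-sum : ∀ j → τ * S² (c j) ≈ ∑ (λ u → g (u ⊗ (c j ⁱ)) * S² u)
    coset-sum j = trans (∑-* g (S² (c j))) (trans (∑-cong (λ x → trans (g-elim x (λ h → sym (S²-inv h (c j)))) (*-cong (reflexive (cong g (e x))) (reflexive (cong S² (⊗-comm x (c j))))))) (sym (∑-scale (c j) (c≢0 j) (λ u → g (u ⊗ (c j ⁱ)) * S² u))))
      where
      e : ∀ x → x ≡ (c j ⊗ x) ⊗ (c j ⁱ)
      e x = ≡.sym (≡.trans (cong (_⊗ (c j ⁱ)) (⊗-comm (c j) x)) (≡.trans (⊗-assoc x (c j) (c j ⁱ)) (≡.trans (cong (x ⊗_) (inv-r (c≢0 j))) (⊗-identityʳ x))))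

    -- |S|² is constant on each coset c_j Γ, so τ |S(c_j)|² is its sum over that coset; the number
    -- of cosets containing u is at most the weight of u.
    τmass≤V : τ * mass ≤ V
    τmass≤V = ≤-resp (sym (trans (*-∑ τ _) (trans (∑-cong coset-sum) (trans (∑-comm _) (∑-cong (λ u → sym (∑-* _ (S² u)))))))) refl
      (∑-mono (λ u → *-monoʳ (S² u) (S²-nonneg u) (≤-trans (≤-reflexive (sym (ι-∑ (λ j → G (u ⊗ (c j ⁱ)))))) (ι-mono (ν-coset u)))))

    -- Since τ mass ≤ V, the factor τ⁶ of the sixth-power inequality cancels and leaves the third
    -- moments and p².
    moment : cube mass * cube mass ≤ ι (energy₁ ℕ.* (p ℕ.* (p ℕ.* energy n c c≢0)))
    moment = cancel⁺ (t³ ℕ.* t³) 1≤t⁶ (≤-resp lhs rhs (≤-trans (sq-mono (cube-nonneg τmass-nonneg) (cube-mono′ τmass-nonneg τmass≤V)) sixth-power))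
      where
      t³ = t ℕ.* t ℕ.* t
      1≤t : 1 ℕ.≤ t
      1≤t = ℕ.>-nonZero⁻¹ t
      1≤t³ : 1 ℕ.≤ t³
      1≤t³ = ℕₚ.*-mono-≤ (ℕₚ.*-mono-≤ 1≤t 1≤t) 1≤t
      1≤t⁶ : 1 ℕ.≤ t³ ℕ.* t³
      1≤t⁶ = ℕₚ.*-mono-≤ 1≤t³ 1≤t³
      cube-nonneg : ∀ {x} → 0# ≤ x → 0# ≤ cube x
      cube-nonneg h = *-nonneg (*-nonneg h h) h
      cube-mono′ : ∀ {x y} → 0# ≤ x → x ≤ y → cube x ≤ cube y
      cube-mono′ h l = *-mono (*-nonneg h h) h (sq-mono h l) l
      τmass-nonneg : 0# ≤ τ * mass
      τmass-nonneg = *-nonneg (∑-nonneg g-nonneg) mass-nonneg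
      τ⁶ : cube τ * cube τ ≈ ι (t³ ℕ.* t³)
      τ⁶ = trans (*-cong e e) (sym (ι-* t³ t³))
        where
        e : cube τ ≈ ι t³
        e = trans (*-cong (*-cong τ≈ τ≈) τ≈) (cube-ι t)
      lhs : cube (τ * mass) * cube (τ * mass) ≈ ι (t³ ℕ.* t³) * (cube mass * cube mass)
      lhs = trans (solve 2 (λ x y → ((x :* y) :* (x :* y) :* (x :* y)) :* ((x :* y) :* (x :* y) :* (x :* y)) := ((x :* x :* x) :* (x :* x :* x)) :* ((y :* y :* y) :* (y :* y :* y))) refl τ mass) (*-congʳ τ⁶)
      rhs : (cube τ * cube τ) * (∑ (λ d → cube (auto g d)) * (ι p * (ι p * ∑ (λ x → cube (auto w x))))) ≈ ι (t³ ℕ.* t³) * ι (energy₁ ℕ.* (p ℕ.* (p ℕ.* energy n c c≢0)))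
      rhs = *-cong τ⁶ (trans (*-cong (auto-ι ν₁ ν₁0) (*-congˡ (*-congˡ (auto-ι ν ν0)))) (sym (trans (ι-* energy₁ (p ℕ.* (p ℕ.* energy n c c≢0))) (*-congˡ (trans (ι-* p (p ℕ.* energy n c c≢0)) (*-congˡ (ι-* p (energy n c c≢0))))))))

  -- The order need not be total, so no case distinction on x is possible. Instead B⁶ - x⁶ is
  -- factored as (B - x) y with y ≥ 1, and y is cancelled.
  sixth-root : ∀ {x} B → 1 ℕ.≤ B → 0# ≤ x → cube x * cube x ≤ cube (ι B) * cube (ι B) → x ≤ ι B
  sixth-root {x} B 1≤B 0≤x h = 0≤y-x⁻ (cancel-pos 1 {ι B - x} {y} (≤-resp refl (trans (sym (*-identityˡ y)) (*-congʳ ι1)) 1≤y) (≤-resp refl factor (0≤y-x h)))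
    where
    b = ι B
    0≤b : 0# ≤ b
    0≤b = ι-nonneg B
    ι1 : 1# ≈ ι 1
    ι1 = refl
    y rest : Carrier
    rest = cube b * b * x + cube b * (x * x) + b * b * cube x + b * (cube x * x) + cube x * (x * x)
    y = cube b * (b * b) + rest
    infixl 7 _⋆_
    _⋆_ : ∀ {a c} → 0# ≤ a → 0# ≤ c → 0# ≤ a * c
    _⋆_ = *-nonneg
    1≤b : 1# ≤ b
    1≤b = ≤-trans (≤-reflexive ι1) (ι-mono 1≤B)
    mul1 : ∀ {a c} → 1# ≤ a → 1# ≤ c → 1# ≤ a * c
    mul1 h h' = ≤-resp (*-identityˡ 1#) refl (*-mono 0≤1 0≤1 h h')
    0≤rest : 0# ≤ rest
    0≤rest = +-nonneg (+-nonneg (+-nonneg (+-nonneg (b³ ⋆ 0≤b ⋆ 0≤x) (b³ ⋆ (0≤x ⋆ 0≤x))) (0≤b ⋆ 0≤b ⋆ x³)) (0≤b ⋆ (x³ ⋆ 0≤x))) (x³ ⋆ (0≤x ⋆ 0≤x))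
      where
      b³ : 0# ≤ cube b
      b³ = 0≤b ⋆ 0≤b ⋆ 0≤b
      x³ : 0# ≤ cube x
      x³ = 0≤x ⋆ 0≤x ⋆ 0≤x
    1≤y : 1# ≤ y
    1≤y = ≤-resp (+-identityʳ 1#) refl (+-mono (mul1 (mul1 (mul1 1≤b 1≤b) 1≤b) (mul1 1≤b 1≤b)) 0≤rest)
    factor : cube b * cube b - cube x * cube x ≈ y * (b - x)
    factor = solve 2 (λ b x → (b :* b :* b) :* (b :* b :* b) :- (x :* x :* x) :* (x :* x :* x) :=
      ((b :* b :* b) :* (b :* b) :+ ((b :* b :* b) :* b :* x :+ (b :* b :* b) :* (x :* x) :+ b :* b :* (x :* x :* x) :+ b :* ((x :* x :* x) :* x) :+ (x :* x :* x) :* (x :* x))) :* (b :- x)) refl b x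

  module GapBounds (a u₀ : K) (a≢0 : ¬ a ≡ 𝟘) (h N m : ℕ) (1≤h : 1 ℕ.≤ h) (1≤N : 1 ℕ.≤ N)
    (gap : ∀ x → x ↑ t ≡ 𝟏 → (h ℕ.≤ toℕ ((a ⊗ x) ⊝ u₀)) × (toℕ ((a ⊗ x) ⊝ u₀) ℕ.+ h ℕ.≤ p))
    (large : 2 ℕ.* (m ℕ.* N ℕ.+ 1) ℕ.* (p ℕ.* p) ℕ.^ m ℕ.≤ (2 ℕ.* (h ℕ.* h)) ℕ.^ m ℕ.* (N ℕ.^ m ℕ.* N ℕ.^ m))
    (L : ℕ) (L≡ : m ℕ.* N ℕ.+ 1 ≡ L) (L<p : L ℕ.< p) where

    c : Fin L → K
    c k = [ suc (toℕ k) ] ⊗ a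

    c≢0 : ∀ k → ¬ c k ≡ 𝟘
    c≢0 k = *-≢0 ([]≢0 (suc (toℕ k)) (s≤s z≤n) (ℕₚ.≤-<-trans (Fₚ.toℕ<n k) L<p)) a≢0

    t²≤ : ι (t ℕ.* t) ≤ ι (8 ℕ.* L) * mass L c c≢0
    t²≤ = ≤-trans (≤-reflexive (trans (ι-* t t) (sym (*-cong τ≈ τ≈)))) (≡.subst (λ L → τ * τ ≤ ι (8 ℕ.* L) * ∑ {L} (λ k → S² ([ suc (toℕ k) ] ⊗ a))) L≡ (Gap.conclusion a u₀ h N m 1≤h 1≤N gap large))

    uniform : ∀ B → (∀ k → S² (c k) ≤ ι B) → t ℕ.* t ℕ.≤ 8 ℕ.* L ℕ.* (L ℕ.* B)
    uniform B bound = reflect (≤-trans t²≤ (≤-trans (*-monoˡ (ι (8 ℕ.* L)) (ι-nonneg (8 ℕ.* L)) (≤-trans (∑-mono bound) (≤-reflexive (trans (sym (ι-∑ {L} (λ _ → B))) (reflexive (cong ι (NatSums.∑-const L B))))))) (≤-reflexive (sym (ι-* (8 ℕ.* L) (L ℕ.* B))))))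

    pólya-vinogradov : t ℕ.* t ℕ.≤ 8 ℕ.* L ℕ.* (L ℕ.* p)
    pólya-vinogradov = uniform p (λ k → cancel⁺ t (ℕ.>-nonZero⁻¹ t) (≤-resp (*-congʳ τ≈) (trans (*-comm _ _) (*-congʳ τ≈)) (τS²≤pτ (c k) (c≢0 k))))

    individual : ∀ B → 1 ℕ.≤ B → (∀ k → energy₁ ℕ.* (p ℕ.* (p ℕ.* energy 1 (λ _ → c k) (λ _ → c≢0 k))) ℕ.≤ (B ℕ.* B ℕ.* B) ℕ.* (B ℕ.* B ℕ.* B)) → t ℕ.* t ℕ.≤ 8 ℕ.* L ℕ.* (L ℕ.* B)
    individual B 1≤B bound = uniform B (λ k → ≤-trans (≤-reflexive (sym (one k))) (sixth-root B 1≤B (mass-nonneg 1 (λ _ → c k) (λ _ → c≢0 k))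
        (≤-trans (moment 1 (λ _ → c k) (λ _ → c≢0 k)) (≤-trans (ι-mono (bound k)) (≤-reflexive (trans (ι-* (B ℕ.* B ℕ.* B) (B ℕ.* B ℕ.* B)) (*-cong (sym (cube-ι B)) (sym (cube-ι B)))))))))
      where
      one : ∀ k → mass 1 (λ _ → c k) (λ _ → c≢0 k) ≈ S² (c k)
      one k = trans (∑-suc _) (trans (+-congˡ (∑-zero _)) (+-identityʳ _))

    -- The sixth power of the gap inequality, with all j = 1, ..., L kept together in one weight;
    -- both sides are numerals, so it descends to ℕ.
    collective : (t ℕ.* t ℕ.* (t ℕ.* t) ℕ.* (t ℕ.* t)) ℕ.* (t ℕ.* t ℕ.* (t ℕ.* t) ℕ.* (t ℕ.* t)) ℕ.≤
      ((8 ℕ.* L) ℕ.* (8 ℕ.* L) ℕ.* (8 ℕ.* L)) ℕ.* ((8 ℕ.* L) ℕ.* (8 ℕ.* L) ℕ.* (8 ℕ.* L)) ℕ.* (energy₁ ℕ.* (p ℕ.* (p ℕ.* energy L c c≢0)))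
    collective = reflect (≤-resp (lem (t ℕ.* t)) refl (≤-trans (sq-mono cube-nn (*-mono (*-nonneg nn nn) nn (sq-mono nn t²≤) t²≤))
        (≤-resp (solve 2 (λ l m → ((l :* l :* l) :* (l :* l :* l)) :* ((m :* m :* m) :* (m :* m :* m)) := ((l :* m) :* (l :* m) :* (l :* m)) :* ((l :* m) :* (l :* m) :* (l :* m))) refl (ι (8 ℕ.* L)) M)
          (trans (*-congʳ (lem (8 ℕ.* L))) (sym (ι-* (cube₂ (8 ℕ.* L)) _)))
          (*-monoˡ (cube (ι (8 ℕ.* L)) * cube (ι (8 ℕ.* L))) (sq-nonneg _) (moment L c c≢0)))))
      where
      M = mass L c c≢0
      cube₂ : ℕ → ℕ
      cube₂ k = (k ℕ.* k ℕ.* k) ℕ.* (k ℕ.* k ℕ.* k)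
      lem : ∀ k → cube (ι k) * cube (ι k) ≈ ι (cube₂ k)
      lem k = trans (*-cong (cube-ι k) (cube-ι k)) (sym (ι-* (k ℕ.* k ℕ.* k) (k ℕ.* k ℕ.* k)))
      nn : 0# ≤ ι (t ℕ.* t)
      nn = ι-nonneg (t ℕ.* t)
      cube-nn : 0# ≤ cube (ι (t ℕ.* t))
      cube-nn = *-nonneg (*-nonneg nn nn) nn

-- Comparison of exponents

module _ where
 open import Data.Nat
 open import Data.Nat.Primality using (Prime)
 open import Data.Nat.Divisibility using (_∣_)
 open import Relation.Nullary using (¬_)
 open import Relation.Binary.PropositionalEquality using (_≡_)
 open OrderedRings using (OrderedRing)
 open Arithmetic using (c₁₂₈; c₆₉₁₂)
 module PowerBounds (ℓ : ℕ) (256≤ℓ : 256 ≤ ℓ) (128≤ : c₁₂₈ ≤ ℓ) (6912≤ : 1 + 64 * c₆₉₁₂ ≤ ℓ) where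
  open import Data.Nat.Properties
  open import Data.Empty using (⊥)
  open import Data.Bool using () renaming (T to True)
  open import Data.Unit using (tt)
  open import Data.Fin using (toℕ)
  open import Data.Product using (_×_)
  open import Data.Sum using (_⊎_; inj₁; inj₂)
  open import Relation.Binary.PropositionalEquality using (refl; sym; trans; cong; cong₂; subst)
  open Arithmetic using (sq-cancel)
  open import Data.Nat.Solver using (module +-*-Solver)
  open +-*-Solver using (solve; _:=_; _:*_)

  instance
    ℓ≢0 : NonZero ℓ
    ℓ≢0 = >-nonZero (≤-trans (s≤s z≤n) 256≤ℓ)

  -- Opaque: unfolding ℓ ^ 48000 would never end.
  abstract
    pw : ℕ → ℕ
    pw n = ℓ ^ n

    pw-def : ∀ n → pw n ≡ ℓ ^ n
    pw-def n = refl

  pw-+ : ∀ a b → pw a * pw b ≡ pw (a + b)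
  pw-+ a b = trans (cong₂ _*_ (pw-def a) (pw-def b)) (trans (sym (^-distribˡ-+-* ℓ a b)) (sym (pw-def (a + b))))

  pw-^ : ∀ a n → pw a ^ n ≡ pw (n * a)
  pw-^ a n = trans (cong (_^ n) (pw-def a)) (trans (trans (^-*-assoc ℓ a n) (cong (ℓ ^_) (*-comm a n))) (sym (pw-def (n * a))))

  pw-1 : pw 1 ≡ ℓ
  pw-1 = trans (pw-def 1) (*-identityʳ ℓ)

  pw-mono : ∀ {a b} → a ≤ b → pw a ≤ pw b
  pw-mono {a} {b} h = subst (_≤ pw b) (sym (pw-def a)) (subst (ℓ ^ a ≤_) (sym (pw-def b)) (^-monoʳ-≤ ℓ h))

  pw-≤ : ∀ a b {_ : True (a ≤ᵇ b)} → pw a ≤ pw b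
  pw-≤ a b {h} = pw-mono (≤ᵇ⇒≤ a b h)

  pw-cancel : ∀ {a b} → pw a ≤ pw b → a ≤ b
  pw-cancel {a} {b} h = ≮⇒≥ (λ b<a → <-irrefl refl (<-≤-trans (^-monoʳ-< ℓ (≤-trans (s≤s (s≤s z≤n)) 256≤ℓ) b<a) (subst (_≤ ℓ ^ b) (pw-def a) (subst (pw a ≤_) (pw-def b) h))))

  absurd : ∀ a b {_ : True (b <ᵇ a)} → ¬ pw a ≤ pw b
  absurd a b {h} l = <-irrefl refl (<-≤-trans (<ᵇ⇒< b a h) (pw-cancel l))

  1≤pw : ∀ n → 1 ≤ pw n
  1≤pw n = subst (1 ≤_) (sym (pw-def n)) (m^n>0 ℓ n)

  constant : ∀ k {_ : True (k ≤ᵇ 256)} → k ≤ pw 1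
  constant k {h} = subst (k ≤_) (sym pw-1) (≤-trans (≤ᵇ⇒≤ k 256 h) 256≤ℓ)

  infixl 7 _⋆_ _✶_
  _⋆_ : ∀ {x y a b} → x ≤ pw a → y ≤ pw b → x * y ≤ pw (a + b)
  _⋆_ {a = a} {b} h h' = ≤-trans (*-mono-≤ h h') (≤-reflexive (pw-+ a b))

  _✶_ : ∀ {x y a b} → pw a ≤ x → pw b ≤ y → pw (a + b) ≤ x * y
  _✶_ {a = a} {b} h h' = ≤-trans (≤-reflexive (sym (pw-+ a b))) (*-mono-≤ h h')

  -- In this order of the arguments no numeral is unified with a sum of unknown exponents.
  via : ∀ {x y z} → y ≤ z → x ≤ y → x ≤ z
  via l l' = ≤-trans l' l

  pw≤ : ∀ k → pw k ≤ pw k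
  pw≤ k = ≤-refl

  128≤ℓ : c₁₂₈ ≤ pw 1
  128≤ℓ = ≤-trans 128≤ (≤-reflexive (sym pw-1))

  shuffle : ∀ c t l x → c * (t * l * x) ≡ t * (c * l * x)
  shuffle = solve 4 (λ c t l x → c :* (t :* l :* x) := t :* (c :* l :* x)) refl

  cancel-t : ∀ a L t x → a * (L * (t * x)) ≡ a * (L * x) * t
  cancel-t = solve 4 (λ a L t x → a :* (L :* (t :* x)) := a :* (L :* x) :* t) refl

  collect : ∀ T s C p → (T * s * C) * (p * (p * (T * s * C))) ≡ (T * T) * (s * C * s * C * p * p)
  collect = solve 4 (λ T s C p → (T :* s :* C) :* (p :* (p :* (T :* s :* C))) := (T :* T) :* (s :* C :* s :* C :* p :* p)) refl

  sixth : ∀ t x → ((t * t * t) * (t * t * t)) * ((x * x * x) * (x * x * x)) ≡ ((t * x) * (t * x) * (t * x)) * ((t * x) * (t * x) * (t * x))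
  sixth = solve 2 (λ t x → ((t :* t :* t) :* (t :* t :* t)) :* ((x :* x :* x) :* (x :* x :* x)) := ((t :* x) :* (t :* x) :* (t :* x)) :* ((t :* x) :* (t :* x) :* (t :* x))) refl

  twelfth : ∀ t → ((t * t * t) * (t * t * t)) * ((t * t * t) * (t * t * t)) ≡ (t * t * (t * t) * (t * t)) * (t * t * (t * t) * (t * t))
  twelfth = solve 1 (λ t → ((t :* t :* t) :* (t :* t :* t)) :* ((t :* t :* t) :* (t :* t :* t)) := (t :* t :* (t :* t) :* (t :* t)) :* (t :* t :* (t :* t) :* (t :* t))) refl

  collect′ : ∀ l s T C p X → l * (T * s * C * (p * (p * (T * X * C)))) ≡ (T * T) * (l * s * C * p * p * X * C)
  collect′ = solve 6 (λ l s T C p X → l :* (T :* s :* C :* (p :* (p :* (T :* X :* C)))) := (T :* T) :* (l :* s :* C :* p :* p :* X :* C)) refl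

  large-power : ∀ m p h N q k A B C → q ≤ pw k → p * p ≤ pw A → pw B ≤ h * h → pw C ≤ N → m * A + k ≤ m * B + (m * C + m * C) →
    q * (p * p) ^ m ≤ (2 * (h * h)) ^ m * (N ^ m * N ^ m)
  large-power m p h N q k A B C q≤ p≤ h≥ N≥ exponents = begin
    q * (p * p) ^ m   ≡⟨ *-comm q _ ⟩
    (p * p) ^ m * q   ≤⟨ ≤-trans (^-monoˡ-≤ m p≤) (≤-reflexive (pw-^ A m)) ⋆ q≤ ⟩
    pw (m * A + k)    ≤⟨ pw-mono exponents ⟩
    pw (m * B + (m * C + m * C))   ≤⟨ power h² ✶ (power N≥ ✶ power N≥) ⟩
    (2 * (h * h)) ^ m * (N ^ m * N ^ m) ∎
    where
    open ≤-Reasoning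
    power : ∀ {x a} → pw a ≤ x → pw (m * a) ≤ x ^ m
    power {x} {a} l = ≤-trans (≤-reflexive (sym (pw-^ a m))) (^-monoˡ-≤ m l)
    h² : pw B ≤ 2 * (h * h)
    h² = ≤-trans h≥ (m≤n*m (h * h) 2)

  module _ (p : ℕ) (pr : Prime p) (p≥ : pw 48000 ≤ p) (p≤ : p ≤ pw 48001) (2^ℓ> : pw 192004 < 2 ^ ℓ)
    (τ≤ℓ : ∀ n → 1 ≤ n → n ≤ p * p → Divisors.τ n ≤ ℓ)
    (O : OrderedRing) (trig : FourierAnalysis.Trig p pr O)
    (t : ℕ) .{{_ : NonZero t}} (t∣p-1 : t ∣ p ∸ 1) (p≤t² : p ≤ t * t)
    (m : ℕ) (m≡250 : m ≡ 250) where

    open PrimeField p pr using (K) renaming (_*_ to _⊗_; _-_ to _⊝_; 0# to 𝟘; 1# to 𝟏; _^_ to _↑_)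
    open Energies p pr t using (energy; energy₁; energy₁≤; energy-bound)
    open Moments p pr O trig t t∣p-1 using (module GapBounds)

    N : ℕ
    -- As p/h ≤ ℓ^4302, this leaves N h/p ≥ ℓ^10. Each kernel factor then gains ℓ^20 on the coset,
    -- and m = 250 factors gain ℓ^5000, more than 2L ≤ ℓ^4314.
    N = pw 4312

    t≥ : pw 24000 ≤ t
    t≥ = sq-cancel (≤-trans (≤-reflexive (pw-+ 24000 24000)) (≤-trans p≥ p≤t²))

    CJ≤ : 1 + 64 * c₆₉₁₂ * (ℓ * ℓ * ℓ * ℓ) ≤ pw 5
    CJ≤ = ≤-trans (+-monoˡ-≤ _ (*-mono-≤ (*-mono-≤ (*-mono-≤ (>-nonZero⁻¹ ℓ) (>-nonZero⁻¹ ℓ)) (>-nonZero⁻¹ ℓ)) (>-nonZero⁻¹ ℓ)))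
      (≤-trans (≤-trans 6912≤ ℓ≤ ⋆ (ℓ≤ ⋆ ℓ≤ ⋆ ℓ≤ ⋆ ℓ≤)) (pw≤ 5))
      where
      ℓ≤ : ℓ ≤ pw 1
      ℓ≤ = ≤-reflexive (sym pw-1)

    abstract
      L : ℕ
      L = m * N + 1

      L≡ : m * N + 1 ≡ L
      L≡ = refl

    L≤ : L ≤ pw 4313
    L≤ = begin
      L                ≡⟨ sym L≡ ⟩
      m * N + 1        ≤⟨ +-monoʳ-≤ (m * N) (1≤pw 4312) ⟩
      m * N + N        ≡⟨ +-comm (m * N) N ⟩
      suc m * N        ≤⟨ ≤-trans (subst (λ k → suc k ≤ pw 1) (sym m≡250) (constant 251) ⋆ pw≤ 4312) (pw≤ 4313) ⟩
      pw 4313          ∎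
      where open ≤-Reasoning

    L<p : L < p
    L<p = <-≤-trans (≤-<-trans L≤ (≰⇒> (absurd 4314 4313))) (≤-trans (pw-≤ 4314 48000) p≥)

    large : ∀ h → pw 43699 ≤ h → 2 * (m * N + 1) * (p * p) ^ m ≤ (2 * (h * h)) ^ m * (N ^ m * N ^ m)
    large h h≥ = large-power m p h N (2 * (m * N + 1)) 4314 96002 87398 4312 (≤-trans (constant 2 ⋆ ≤-trans (≤-reflexive L≡) L≤) (pw≤ 4314)) (≤-trans (p≤ ⋆ p≤) (pw≤ 96002)) (via (h≥ ✶ h≥) (pw≤ 87398)) (pw≤ 4312)
      (subst (λ m → m * 96002 + 4314 ≤ m * 87398 + (m * 4312 + m * 4312)) (sym m≡250) (≤ᵇ⇒≤ (250 * 96002 + 4314) (250 * 87398 + (250 * 4312 + 250 * 4312)) tt))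

    -- The limit 28790 lies just below 28800, the exponent of p^(3/5), where 16 n t⁴ ≤ p³ fails for
    -- n about t.
    small-energy : t ≤ pw 28790 → (c : K) (c≢0 : ¬ c ≡ 𝟘) → energy 1 (λ _ → c) (λ _ → c≢0) ≤ (t * t * t) * pw 2 * pw 5
    small-energy t≤ c c≢0 = energy-bound 1 (λ _ → c) (λ _ → c≢0) (pw 1) (pw 1) (pw 2) (pw 5) ℓ
        (≤-trans (CosetWeights.W₂≤n⁴ p pr t 1 (λ _ → c) (λ _ → c≢0)) (constant 8)) (constant 4) (≤-reflexive (pw-+ 1 1)) CJ≤ h₁ h₂ h₃
      where
      open ≤-Reasoning
      h₁ : c₁₂₈ * (t * pw 1 * pw 1) ≤ t * t
      h₁ = begin
        c₁₂₈ * (t * pw 1 * pw 1)   ≡⟨ shuffle c₁₂₈ t (pw 1) (pw 1) ⟩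
        t * (c₁₂₈ * pw 1 * pw 1)   ≤⟨ *-monoʳ-≤ t (≤-trans (128≤ℓ ⋆ pw≤ 1 ⋆ pw≤ 1) (≤-trans (pw-≤ 3 24000) t≥)) ⟩
        t * t ∎
      h₂ : 16 * (t * pw 1 * pw 1) * (t * t * t * t) ≤ p * p * p
      h₂ = ≤-trans (constant 16 ⋆ (t≤ ⋆ pw≤ 1 ⋆ pw≤ 1) ⋆ (t≤ ⋆ t≤ ⋆ t≤ ⋆ t≤)) (via (p≥ ✶ p≥ ✶ p≥) (pw-≤ 143953 144000))
      h₃ : t * pw 1 < 2 ^ ℓ
      h₃ = ≤-<-trans (≤-trans (t≤ ⋆ pw≤ 1) (pw-≤ 28791 192004)) 2^ℓ>

    module _ (a u₀ : K) (a≢0 : ¬ a ≡ 𝟘) (h : ℕ) (h≥ : pw 43699 ≤ h)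
      (gap : ∀ x → x ↑ t ≡ 𝟏 → (h ≤ toℕ ((a ⊗ x) ⊝ u₀)) × (toℕ ((a ⊗ x) ⊝ u₀) + h ≤ p)) where

      open GapBounds a u₀ a≢0 h N m (≤-trans (1≤pw 43699) h≥) (1≤pw 4312) gap (large h h≥) L L≡ L<p using (c; c≢0; pólya-vinogradov; individual; collective)

      -- With |S|² ≤ p the gap inequality gives t² ≤ 8 L² p, about ℓ^56628.
      large-t : ¬ pw 28790 ≤ t
      large-t l = absurd 57580 56628 (via (≤-trans (≤-trans pólya-vinogradov (constant 8 ⋆ L≤ ⋆ (L≤ ⋆ p≤))) (pw≤ 56628)) (via (l ✶ l) (pw≤ 57580)))

      -- Each frequency alone satisfies |S|² ≤ t ℓ^16003, and the gap inequality becomes t ≤ 8 L²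
      -- ℓ^16003, about ℓ^24630.
      middle-t : t ≤ pw 28790 → ¬ pw 24768 ≤ t * 2
      middle-t t≤ l = absurd 24768 24631 (≤-trans l (≤-trans (≤-trans (*-monoˡ-≤ 2 t≤′) (constant 8 ⋆ L≤ ⋆ (L≤ ⋆ pw≤ 16003) ⋆ constant 2)) (pw≤ 24631)))
        where
        open ≤-Reasoning
        -- The sixth root of p² times logarithmic factors: 6 times 16003 is 96018, just above 2
        -- times 48001 plus 14.
        x = pw 16003
        B = t * x
        T³ = t * t * t
        E = T³ * pw 2 * pw 5
        bound : ∀ k → energy₁ * (p * (p * energy 1 (λ _ → c k) (λ _ → c≢0 k))) ≤ (B * B * B) * (B * B * B)
        bound k = begin
          energy₁ * (p * (p * energy 1 (λ _ → c k) (λ _ → c≢0 k)))   ≤⟨ *-mono-≤ (≤-trans energy₁≤ (small-energy t≤ 𝟏 (PrimeField.1≢0 p pr))) (*-monoʳ-≤ p (*-monoʳ-≤ p (small-energy t≤ (c k) (c≢0 k)))) ⟩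
          E * (p * (p * E))   ≡⟨ collect T³ (pw 2) (pw 5) p ⟩
          (T³ * T³) * (pw 2 * pw 5 * pw 2 * pw 5 * p * p)   ≤⟨ *-monoʳ-≤ (T³ * T³) (≤-trans (pw≤ 2 ⋆ pw≤ 5 ⋆ pw≤ 2 ⋆ pw≤ 5 ⋆ p≤ ⋆ p≤) (pw-≤ 96016 96018)) ⟩
          (T³ * T³) * pw 96018   ≤⟨ *-monoʳ-≤ (T³ * T³) (via (pw≤ 16003 ✶ pw≤ 16003 ✶ pw≤ 16003 ✶ (pw≤ 16003 ✶ pw≤ 16003 ✶ pw≤ 16003)) (pw≤ 96018)) ⟩
          (T³ * T³) * ((x * x * x) * (x * x * x))   ≡⟨ sixth t x ⟩
          (B * B * B) * (B * B * B) ∎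
        t≤′ : t ≤ 8 * L * (L * x)
        t≤′ = *-cancelʳ-≤ t (8 * L * (L * x)) t (≤-trans (individual B (*-mono-≤ (>-nonZero⁻¹ t) (1≤pw 16003)) bound) (≤-reflexive (cancel-t (8 * L) L t x)))

      -- After t⁶ is cancelled, t⁶ ≥ p³ has to be compared with L⁶ p² W₂². The lower end of the
      -- range of t enters on the left, the upper end through W₂ on the right.
      small-t : ¬ t * 2 ≤ pw 24768
      small-t r≤ = absurd 144000 143546 (≤-trans (via (t≥ ✶ t≥ ✶ t≥ ✶ (t≥ ✶ t≥ ✶ t≥)) (pw≤ 144000)) (*-cancelˡ-≤ (T³ * T³) {{T≢0}} (begin
          (T³ * T³) * (T³ * T³)   ≡⟨ twelfth t ⟩
          (t * t * (t * t) * (t * t)) * (t * t * (t * t) * (t * t))   ≤⟨ collective ⟩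
          l⁶ * (energy₁ * (p * (p * energy L c c≢0)))   ≤⟨ *-monoʳ-≤ l⁶ (*-mono-≤ (≤-trans energy₁≤ (small-energy t≤28790 𝟏 (PrimeField.1≢0 p pr))) (*-monoʳ-≤ p (*-monoʳ-≤ p energy-L))) ⟩
          l⁶ * (T³ * pw 2 * pw 5 * (p * (p * (T³ * pw 21648 * pw 5))))   ≡⟨ collect′ l⁶ (pw 2) T³ (pw 5) p (pw 21648) ⟩
          (T³ * T³) * (l⁶ * pw 2 * pw 5 * p * p * pw 21648 * pw 5)   ≤⟨ *-monoʳ-≤ (T³ * T³) (≤-trans ((l≤ ⋆ l≤ ⋆ l≤ ⋆ (l≤ ⋆ l≤ ⋆ l≤)) ⋆ pw≤ 2 ⋆ pw≤ 5 ⋆ p≤ ⋆ p≤ ⋆ pw≤ 21648 ⋆ pw≤ 5) (pw≤ 143546)) ⟩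
          (T³ * T³) * pw 143546 ∎)))
        where
        open ≤-Reasoning
        T³ = t * t * t
        1≤t = >-nonZero⁻¹ t
        T≢0 : NonZero (T³ * T³)
        T≢0 = >-nonZero (*-mono-≤ (*-mono-≤ (*-mono-≤ 1≤t 1≤t) 1≤t) (*-mono-≤ (*-mono-≤ 1≤t 1≤t) 1≤t))
        l⁶ = (8 * L) * (8 * L) * (8 * L) * ((8 * L) * (8 * L) * (8 * L))
        l≤ : 8 * L ≤ pw 4314
        l≤ = ≤-trans (constant 8 ⋆ L≤) (pw≤ 4314)
        t≤r : t ≤ pw 24768
        t≤r = ≤-trans (m≤m*n t 2) r≤
        t≤28790 : t ≤ pw 28790
        t≤28790 = ≤-trans t≤r (pw-≤ 24768 28790)
        -- E = e³ and d₀ = ℓ^18192 solve r = d₀ E and r d₀² = E² p for r at its upper limit: 24768 =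
        -- 18192 + 6576 and 61152 = 13152 + 48000.
        e = pw 2192
        E≥ : pw 6576 ≤ e * e * e
        E≥ = via (pw≤ 2192 ✶ pw≤ 2192 ✶ pw≤ 2192) (pw≤ 6576)
        L⁶≤ : (L * L) * (L * L) * (L * L) ≤ pw 25878
        L⁶≤ = ≤-trans ((L≤ ⋆ L≤) ⋆ (L≤ ⋆ L≤) ⋆ (L≤ ⋆ L≤)) (pw≤ 25878)
        below : ∀ {x} k → suc k ≤ 48000 → x ≤ pw k → x < p
        below k k< x≤ = <-≤-trans (≤-<-trans x≤ (≰⇒> (λ l → <-irrefl refl (pw-cancel {suc k} {k} l)))) (≤-trans (pw-mono k<) p≥)
        module I = IntervalWeights p pr t L L<p a a≢0 ℓ (>-nonZero⁻¹ ℓ) τ≤ℓ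
        W₂≤X : I.W₂ ≤ pw 10824
        W₂≤X = ≤-trans (I.multiplicative-energy (pw 18192) e (1≤pw 2192)
            (below 36384 (≤ᵇ⇒≤ 36385 48000 tt) (≤-trans (pw≤ 18192 ⋆ pw≤ 18192) (pw≤ 36384)))
            (below 25878 (≤ᵇ⇒≤ 25879 48000 tt) L⁶≤)
            (via (pw≤ 18192 ✶ E≥) r≤)
            (≤-trans (≤-trans (r≤ ⋆ (pw≤ 18192 ⋆ pw≤ 18192)) (pw≤ 61152)) (via (E≥ ✶ E≥ ✶ p≥) (pw≤ 61152)))
            (≤-trans (r≤ ⋆ L⁶≤) (via (E≥ ✶ p≥) (pw-≤ 50646 54576)))
            (≤-trans (r≤ ⋆ constant 2) (via ((E≥ ✶ E≥) ✶ (E≥ ✶ E≥)) (pw-≤ 24769 26304))))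
          (≤-trans (constant 16 ⋆ (ℓ≤ ⋆ ℓ≤ ⋆ ℓ≤ ⋆ ℓ≤ ⋆ ℓ≤) ⋆ pw≤ 2192 ⋆ (L≤ ⋆ L≤)) (pw≤ 10824))
          where
          ℓ≤ : ℓ ≤ pw 1
          ℓ≤ = ≤-reflexive (sym pw-1)
        L2≤ : L * 2 ≤ pw 4314
        L2≤ = ≤-trans (L≤ ⋆ constant 2) (pw≤ 4314)
        h₁ : c₁₂₈ * (t * pw 8628 * pw 10824) ≤ t * t
        h₁ = begin
          c₁₂₈ * (t * pw 8628 * pw 10824)   ≡⟨ shuffle c₁₂₈ t (pw 8628) (pw 10824) ⟩
          t * (c₁₂₈ * pw 8628 * pw 10824)   ≤⟨ *-monoʳ-≤ t (≤-trans (128≤ℓ ⋆ pw≤ 8628 ⋆ pw≤ 10824) (≤-trans (pw-≤ 19453 24000) t≥)) ⟩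
          t * t ∎
        h₂ : 16 * (t * pw 8628 * pw 10824) * (t * t * t * t) ≤ p * p * p
        h₂ = ≤-trans (constant 16 ⋆ (t≤r ⋆ pw≤ 8628 ⋆ pw≤ 10824) ⋆ (t≤r ⋆ t≤r ⋆ t≤r ⋆ t≤r)) (via (p≥ ✶ p≥ ✶ p≥) (pw-≤ 143293 144000))
        h₃ : t * pw 8628 < 2 ^ ℓ
        h₃ = ≤-<-trans (≤-trans (t≤r ⋆ pw≤ 8628) (pw-≤ 33396 192004)) 2^ℓ>
        energy-L : energy L c c≢0 ≤ T³ * pw 21648 * pw 5
        energy-L = energy-bound L c c≢0 (pw 10824) (pw 8628) (pw 21648) (pw 5) ℓ W₂≤X (≤-trans (L2≤ ⋆ L2≤) (pw≤ 8628)) (≤-trans (pw≤ 10824 ⋆ pw≤ 10824) (pw≤ 21648)) CJ≤ h₁ h₂ h₃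

      contradictory : ⊥
      contradictory = by-size (≤-total (pw 28790) t) (≤-total (t * 2) (pw 24768))
        where
        by-size : pw 28790 ≤ t ⊎ t ≤ pw 28790 → t * 2 ≤ pw 24768 ⊎ pw 24768 ≤ t * 2 → ⊥
        by-size (inj₁ l) _ = large-t l
        by-size (inj₂ _) (inj₁ l) = small-t l
        by-size (inj₂ l) (inj₂ l') = middle-t l l'

-- From gaps of integers to the field, and the choice of the scale

open import Defs
open import Data.Nat
open import Data.Nat.Properties
open import Data.Nat.DivMod using (m<n⇒m%n≡m)
open import Data.Nat.Divisibility using (_∣_; ∣-refl)
open import Data.Nat.Primality using (Prime)
open import Data.Fin using (toℕ)
import Data.Fin.Properties as Fₚ
import Data.Rational.Properties as ℚₚ
open import Data.Product using (Σ; _,_; _×_; proj₁; proj₂)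
open import Data.Empty using (⊥; ⊥-elim)
open import Relation.Nullary using (¬_; Dec; yes; no; contradiction)
open import Relation.Binary.PropositionalEquality using (_≡_; refl; sym; trans; cong; subst)
open Arithmetic using (c₁₂₈; c₆₉₁₂; integer-root)
open Divisors using (τ; divisor-bound; polynomial≤exponential)
open Rationals using (ℚ-ordered; ℚ-inverse)
open BoundedSequences ℚ-ordered ℚₚ.≤-total using (Seq-ordered)

module Translation (p : ℕ) (pr : Prime p) where

  open PrimeField p pr using (K; [_]; p-nonZero; []-toℕ; []-*; []-+; []-inj; []-^; []-1; toℕ≢0; 1<p; 1≢0; 0^; ∣⇒[]≡0; solveK; _:=_; _:+_; _:-_)
    renaming (_+_ to _⊕_; _*_ to _⊗_; _-_ to _⊝_; 0# to 𝟘; 1# to 𝟏; _^_ to _↑_; +-identityʳ to ⊕-identityʳ)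

  in-coset : ∀ t .{{_ : NonZero t}} a y (x : K) → x ↑ t ≡ 𝟏 → [ a ] ⊗ x ≡ [ y ] → InCoset p t a y
  in-coset t a y x xᵗ≡1 e = toℕ x , (toℕ≢0 x x≢0 , Fₚ.toℕ<n x , trans ([]-inj power) (m<n⇒m%n≡m 1<p)) , []-inj (trans ([]-* a (toℕ x)) (trans (cong ([ a ] ⊗_) ([]-toℕ x)) e))
    where
    x≢0 : ¬ x ≡ 𝟘
    x≢0 refl = 1≢0 (trans (sym xᵗ≡1) (0^ t (>-nonZero⁻¹ t)))
    power : [ toℕ x ^ t ] ≡ [ 1 ]
    power = trans ([]-^ (toℕ x) t) (trans (cong (_↑ t) ([]-toℕ x)) (trans xᵗ≡1 (sym []-1)))

  -- The distance y is measured from the centre u + h. If y < h, then a x is u + (h + y); if y > p -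
  -- h, it is u + (y + h - p). Both indices lie between 1 and 2h ≤ H.
  centred-gap : ∀ t .{{_ : NonZero t}} a u H h → 1 ≤ h → h + h ≤ H → IsGap p t a u H → ∀ x → x ↑ t ≡ 𝟏 →
    (h ≤ toℕ (([ a ] ⊗ x) ⊝ [ u + h ])) × (toℕ (([ a ] ⊗ x) ⊝ [ u + h ]) + h ≤ p)
  centred-gap t a u H h 1≤h 2h≤H isGap x xᵗ≡1 =
      ≮⇒≥ (λ y<h → isGap (h + y) (≤-trans 1≤h (m≤m+n h y)) (≤-trans (+-monoʳ-≤ h (<⇒≤ y<h)) 2h≤H) (in-coset t a (u + (h + y)) x xᵗ≡1 (trans ax (cong [_] (+-assoc u h y)))))
    , ≮⇒≥ (λ p<y+h → beyond (y + h ∸ p) (m<n⇒0<n∸m p<y+h) (trans (+-comm p _) (m∸n+n≡m (<⇒≤ p<y+h))))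
    where
    y = toℕ (([ a ] ⊗ x) ⊝ [ u + h ])
    ax : [ a ] ⊗ x ≡ [ u + h + y ]
    ax = trans (lem ([ a ] ⊗ x) [ u + h ]) (trans (cong ([ u + h ] ⊕_) (sym ([]-toℕ _))) (sym ([]-+ (u + h) y)))
      where
      lem : ∀ z v → z ≡ v ⊕ (z ⊝ v)
      lem = solveK 2 (λ z v → z := v :+ (z :- v)) refl
    beyond : ∀ j → 1 ≤ j → p + j ≡ y + h → ⊥
    beyond j 1≤j e = isGap j 1≤j j≤H (in-coset t a (u + j) x xᵗ≡1 (trans ax (trans (cong [_] shift) (trans ([]-+ (u + j) p) (trans (cong ([ u + j ] ⊕_) (∣⇒[]≡0 p ∣-refl)) (⊕-identityʳ _))))))
      where
      shift : u + h + y ≡ u + j + p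
      shift = trans (+-assoc u h y) (trans (cong (u +_) (trans (+-comm h y) (trans (sym e) (+-comm p j)))) (sym (+-assoc u j p)))
      j≤H : j ≤ H
      j≤H = ≤-trans (+-cancelˡ-≤ p j h (≤-trans (≤-reflexive e) (+-monoˡ-≤ h (<⇒≤ (Fₚ.toℕ<n (([ a ] ⊗ x) ⊝ [ u + h ])))))) (≤-trans (m≤m+n h h) 2h≤H)

^-cancelˡ-≤ : ∀ {a b} k → a ^ suc k ≤ b ^ suc k → a ≤ b
^-cancelˡ-≤ {a} {b} k l = ≮⇒≥ (λ b<a → <-irrefl refl (<-≤-trans (^-monoˡ-< (suc k) b<a) l))

-- ℓ is the integer part of the κ-th root of p. Rounding costs one more power of ℓ: (ℓ + 1)^κ ≤ 2^κ
-- ℓ^κ, and 2^κ ≤ ℓ₀ ≤ ℓ.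
root-scale : ∀ κ .{{_ : NonZero κ}} ℓ₀ p → ℓ₀ ^ κ ≤ p → 2 ^ κ ≤ ℓ₀ → Σ ℕ λ ℓ → (ℓ₀ ≤ ℓ) × (ℓ ^ κ ≤ p) × (p ≤ ℓ ^ suc κ)
root-scale κ ℓ₀ p h 2≤ = go (integer-root κ p)
  where
  go : (Σ ℕ λ r → (r ^ κ ≤ p) × (p < suc r ^ κ)) → Σ ℕ λ ℓ → (ℓ₀ ≤ ℓ) × (ℓ ^ κ ≤ p) × (p ≤ ℓ ^ suc κ)
  go (ℓ , lo , hi) = ℓ , ℓ₀≤ℓ , lo , (begin
    p              ≤⟨ <⇒≤ hi ⟩
    suc ℓ ^ κ      ≤⟨ ^-monoˡ-≤ κ (≤-trans (+-monoˡ-≤ ℓ 1≤ℓ) (≤-reflexive (cong (ℓ +_) (sym (+-identityʳ ℓ))))) ⟩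
    (2 * ℓ) ^ κ    ≡⟨ Divisors.^-distribʳ-* κ 2 ℓ ⟩
    2 ^ κ * ℓ ^ κ  ≤⟨ *-monoˡ-≤ (ℓ ^ κ) (≤-trans 2≤ ℓ₀≤ℓ) ⟩
    ℓ * ℓ ^ κ      ∎)
    where
    open ≤-Reasoning
    ℓ₀≤ℓ : ℓ₀ ≤ ℓ
    ℓ₀≤ℓ = ≮⇒≥ (λ ℓ<ℓ₀ → <-irrefl refl (≤-<-trans (≤-trans (^-monoˡ-≤ κ ℓ<ℓ₀) h) hi))
    1≤ℓ : 1 ≤ ℓ
    1≤ℓ = ≤-trans (m^n>0 2 κ) (≤-trans 2≤ ℓ₀≤ℓ)

-- The bound (ℓ + 1)^(k+1) ≤ (k+1)^(k+1) 2^ℓ has one spare power of ℓ, which absorbs the constant.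
power<exponential : ∀ k ℓ → 1 ≤ ℓ → suc k ^ suc k ≤ ℓ → ℓ ^ k < 2 ^ ℓ
power<exponential k ℓ 1≤ℓ h = *-cancelˡ-< ℓ (ℓ ^ k) (2 ^ ℓ) (<-≤-trans (^-monoˡ-< (suc k) (n<1+n ℓ)) (≤-trans (polynomial≤exponential (suc k) ℓ) (*-monoˡ-≤ (2 ^ ℓ) h)))

-- The exponent k + 1 in the divisor bound leaves τ(n)^(k+1) ≤ C n ≤ ℓ ℓ^k.
few-divisors : ∀ k C → (∀ n → 1 ≤ n → τ n ^ suc k ≤ C * n) → ∀ ℓ q → C ≤ ℓ → q ≤ ℓ ^ k → ∀ n → 1 ≤ n → n ≤ q → τ n ≤ ℓ
few-divisors k C bound ℓ q C≤ℓ q≤ n 1≤n n≤q = ^-cancelˡ-≤ k (≤-trans (bound n 1≤n) (*-mono-≤ C≤ℓ (≤-trans n≤q q≤)))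

half-≥ : ∀ {n H} → n + n ≤ H → n ≤ ⌊ H /2⌋
half-≥ {n} l = ≤-trans (≤-reflexive (n≡⌊n+n/2⌋ n)) (⌊n/2⌋-mono l)

half-≤ : ∀ H → ⌊ H /2⌋ + ⌊ H /2⌋ ≤ H
half-≤ H = ≤-trans (+-monoʳ-≤ ⌊ H /2⌋ (⌊n/2⌋≤⌈n/2⌉ H)) (≤-reflexive (⌊n/2⌋+⌈n/2⌉≡n H))

-- The numerals enter only through equations, so that none of the huge powers is ever evaluated.
module Bound (κ k₁ k₂ m α β : ℕ) (κ≡ : κ ≡ 48000) (k₁≡ : k₁ ≡ 192004) (k₂≡ : k₂ ≡ 96002) (m≡ : m ≡ 250) (αβ≡ : β * 43700 ≡ α * 48000)
  .{{_ : NonZero κ}} where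

  C : ℕ
  C = proj₁ (divisor-bound (suc k₂))

  -- A sum in place of a maximum. In order: small numerals, the two Stepanov constants, the rounding
  -- loss 2^κ, the threshold from which 2^ℓ exceeds the power k₁ of ℓ, and the constant of the
  -- divisor bound.
  ℓ₀ : ℕ
  ℓ₀ = 256 + (c₁₂₈ + ((1 + 64 * c₆₉₁₂) + (2 ^ κ + (suc k₁ ^ suc k₁ + C))))

  p₀ : ℕ
  p₀ = ℓ₀ ^ κ

  gap-bound : ∀ p → Prime p → .{{_ : NonZero p}} → p₀ ≤ p → ∀ t → t ∣ p ∸ 1 → p ≤ t * t → ∀ a u H → 1 ≤ a → a < p → IsGap p t a u H → H ^ β ≤ p ^ α
  gap-bound p pr p₀≤p t t∣p-1 p≤t² a u H 1≤a a<p isGap = decide (root-scale κ ℓ₀ p p₀≤p (≤-trans (m≤m+n (2 ^ κ) _) (≤-trans (m≤n+m _ (1 + 64 * c₆₉₁₂)) (≤-trans (m≤n+m _ c₁₂₈) (m≤n+m _ 256))))) (H ^ β ≤? p ^ α)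
    where
    decide : (Σ ℕ λ ℓ → (ℓ₀ ≤ ℓ) × (ℓ ^ κ ≤ p) × (p ≤ ℓ ^ suc κ)) → Dec (H ^ β ≤ p ^ α) → H ^ β ≤ p ^ α
    decide _ (yes l) = l
    decide (ℓ , ℓ₀≤ℓ , lo , hi) (no ¬l) = ⊥-elim (small ¬l)
      where
      r₁ : c₁₂₈ + ((1 + 64 * c₆₉₁₂) + (2 ^ κ + (suc k₁ ^ suc k₁ + C))) ≤ ℓ
      r₁ = ≤-trans (m≤n+m _ 256) ℓ₀≤ℓ
      r₂ : (1 + 64 * c₆₉₁₂) + (2 ^ κ + (suc k₁ ^ suc k₁ + C)) ≤ ℓ
      r₂ = ≤-trans (m≤n+m _ c₁₂₈) r₁
      r₃ : suc k₁ ^ suc k₁ + C ≤ ℓ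
      r₃ = ≤-trans (m≤n+m _ (2 ^ κ)) (≤-trans (m≤n+m _ (1 + 64 * c₆₉₁₂)) r₂)
      256≤ℓ : 256 ≤ ℓ
      256≤ℓ = ≤-trans (m≤m+n 256 _) ℓ₀≤ℓ
      1≤ℓ : 1 ≤ ℓ
      1≤ℓ = ≤-trans (s≤s z≤n) 256≤ℓ
      open PowerBounds ℓ 256≤ℓ (≤-trans (m≤m+n c₁₂₈ _) r₁) (≤-trans (m≤m+n (1 + 64 * c₆₉₁₂) _) r₂)
      p≥ : pw 48000 ≤ p
      p≥ = subst (λ k → pw k ≤ p) κ≡ (≤-trans (≤-reflexive (pw-def κ)) lo)
      p≤ : p ≤ pw 48001
      p≤ = subst (λ k → p ≤ pw (suc k)) κ≡ (≤-trans hi (≤-reflexive (sym (pw-def (suc κ)))))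
      2^ℓ> : pw 192004 < 2 ^ ℓ
      2^ℓ> = subst (λ k → pw k < 2 ^ ℓ) k₁≡ (≤-<-trans (≤-reflexive (pw-def k₁)) (power<exponential k₁ ℓ 1≤ℓ (≤-trans (m≤m+n _ C) r₃)))
      τ≤ℓ : ∀ n → 1 ≤ n → n ≤ p * p → τ n ≤ ℓ
      τ≤ℓ = few-divisors k₂ C (proj₂ (divisor-bound (suc k₂))) ℓ (p * p) (≤-trans (m≤n+m C _) r₃) (≤-trans (subst (λ k → p * p ≤ pw k) (sym k₂≡) (≤-trans (p≤ ⋆ p≤) (pw≤ 96002))) (≤-reflexive (pw-def k₂)))
      256≤p : 256 ≤ p
      256≤p = ≤-trans (constant 256) (≤-trans (pw-≤ 1 48000) p≥)
      instance
        t≢0 : NonZero t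
        t≢0 = ≢-nonZero λ { refl → contradiction (≤-trans 256≤p p≤t²) λ () }
      small : ¬ H ^ β ≤ p ^ α → ⊥
      small ¬l = contradictory p pr p≥ p≤ 2^ℓ> τ≤ℓ Seq-ordered (Trigonometry.trig ℚ-ordered ℚₚ.≤-total ℚₚ._≤?_ ℚ-inverse p pr (≤-trans (s≤s (s≤s (s≤s z≤n))) 256≤p))
          t t∣p-1 p≤t² m m≡ [ a ] [ u + h ] ([]≢0 a 1≤a a<p) h h≥ (Translation.centred-gap p pr t a u H h (≤-trans (1≤pw 43699) h≥) (half-≤ H) isGap)
        where
        open PrimeField p pr using ([_]; []≢0)
        h = ⌊ H /2⌋
        -- Otherwise H^β ≤ ℓ^(43700 β) = ℓ^(48000 α) ≤ p^α. Halving H then costs at most one power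
        -- of ℓ, whence 43699.
        H> : pw 43700 < H
        H> = ≰⇒> λ H≤ → ¬l (≤-trans (^-monoˡ-≤ β H≤) (≤-trans (≤-reflexive (trans (pw-^ 43700 β) (trans (cong pw αβ≡) (sym (pw-^ 48000 α))))) (^-monoˡ-≤ α p≥)))
        h≥ : pw 43699 ≤ h
        h≥ = half-≥ (≤-trans (≤-reflexive (cong (pw 43699 +_) (sym (+-identityʳ _)))) (≤-trans (≤-trans (constant 2 ⋆ pw≤ 43699) (pw≤ 43700)) (<⇒≤ H>)))

-- Real exponents are cleared of denominators: ε = e/d, and both sides are raised to the power β d.
raise : ∀ α β e d H p .{{_ : NonZero p}} → H ^ β ≤ p ^ α → H ^ (β * d) ≤ p ^ (α * d + β * e)
raise α β e d H p h = begin
  H ^ (β * d)            ≡⟨ sym (^-*-assoc H β d) ⟩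
  (H ^ β) ^ d            ≤⟨ ^-monoˡ-≤ d h ⟩
  (p ^ α) ^ d            ≡⟨ ^-*-assoc p α d ⟩
  p ^ (α * d)            ≤⟨ ^-monoʳ-≤ p (m≤m+n (α * d) (β * e)) ⟩
  p ^ (α * d + β * e)    ∎
  where open ≤-Reasoning

theorem21 : (e d : ℕ) → 1 ≤ e → 1 ≤ d →
    Σ ℕ (λ p₀ → (p : ℕ) → .{{_ : NonZero p}} → Prime p → p₀ ≤ p →
      (t : ℕ) → t ∣ p ∸ 1 → p ≤ t * t →
      (a u H : ℕ) → 1 ≤ a → a < p → u < p → IsGap p t a u H →
      H ^ (480 * d) ≤ p ^ (437 * d + 480 * e))
theorem21 e d _ _ = p₀ , λ p pr p₀≤p t t∣p-1 p≤t² a u H 1≤a a<p _ isGap → raise 437 480 e d H p (gap-bound p pr p₀≤p t t∣p-1 p≤t² a u H 1≤a a<p isGap)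
  where open Bound 48000 192004 96002 250 437 480 refl refl refl refl refl
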